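{- Let $\mathcal{A}^{\mathrm{bd}}$ be a cluster algebra of type $D$ with boundary frozen variables (the cluster algebra of a once-punctured polygon with one frozen variable per boundary segment). Then the Newton polytope of any cluster variable, written as a Laurent polynomial in the cluster and frozen variables of an arbitrary seed, is saturated.
   Context: A once-punctured polygon is a convex polygon whose marked points are its vertices together with one interior point (the puncture). Following Fomin–Shapiro–Thurston, the cluster variables of the associated type $D$ cluster algebra are indexed by tagged arcs (ordinary arcs between distinct marked points, tagged plain, plus radii — arcs from a vertex to the puncture — tagged notched), seeds $\Sigma_T$ are indexed by tagged triangulations $T$ (maximal sets of pairwise compatible tagged arcs), and with boundary frozen variables the seed $\Sigma_T$ consists of the cluster variables $x_\tau$, $\tau\in T$, together with frozen variables $x_\zeta$, one for each boundary segment $\zeta$, the extended exchange matrix being the one attached to $T$ by Fomin–Shapiro–Thurston. For a Laurent polynomial, its support is the set of exponent vectors with nonzero coefficient, its Newton polytope is the convex hull of the support, and the Newton polytope is saturated if every lattice point in it lies in the support. -}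

module Defs where

open import Data.Bool.Base using (Bool; true; false; _∧_; _∨_; not; if_then_else_)
open import Data.Nat.Base as ℕ using (ℕ; zero; suc; _∸_; _<ᵇ_; _≤ᵇ_; _≡ᵇ_)
open import Data.Fin.Base using (Fin; toℕ) renaming (zero to Fz; suc to Fs)
open import Data.Integer.Base as ℤ using (ℤ; +_; -[1+_])
open import Data.Integer.Properties using () renaming (_≟_ to _≟ℤ_)
open import Data.Rational.Base as ℚ using (ℚ; 0ℚ; 1ℚ)
open import Data.List.Base as List using (List; []; _∷_; map; concatMap; _++_; foldr)
open import Data.List.Relation.Unary.All using (All)
open import Data.Product.Base using (_×_; _,_; proj₁; ∃-syntax; Σ-syntax)
open import Relation.Nullary.Decidable.Core using (⌊_⌋)
open import Relation.Nullary.Negation.Core using (¬_)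
open import Relation.Binary.PropositionalEquality.Core using (_≡_; _≢_)

allF : ∀ {m} → (Fin m → Bool) → Bool
allF {zero}  f = true
allF {suc m} f = f Fz ∧ allF (λ i → f (Fs i))

anyF : ∀ {m} → (Fin m → Bool) → Bool
anyF {zero}  f = false
anyF {suc m} f = f Fz ∨ anyF (λ i → f (Fs i))

sumF : ∀ {m} → (Fin m → ℤ) → ℤ
sumF {zero}  f = + 0
sumF {suc m} f = f Fz ℤ.+ sumF (λ i → f (Fs i))

finEq : ∀ {m} → Fin m → Fin m → Bool
finEq a b = toℕ a ≡ᵇ toℕ b

allFinL : ∀ m → List (Fin m)
allFinL m = List.allFin m

-- The once-punctured n-gon.
-- Vertices: Fin n, numbered counterclockwise.  Boundary segment s : Fin n
-- joins vertex s and vertex s+1 (mod n).  The puncture is interior.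

dist : ∀ {n} → Fin n → Fin n → ℕ
dist {n} a b = if toℕ a ≤ᵇ toℕ b then toℕ b ∸ toℕ a else n ℕ.+ toℕ b ∸ toℕ a

data Tag : Set where
  plain notched : Tag

tagEq : Tag → Tag → Bool
tagEq plain   plain   = true
tagEq notched notched = true
tagEq _       _       = false

-- Tagged arcs.
--  * arc i k : the (plain) arc between the distinct vertices i and
--    j = i + (k+2) (mod n) such that the region cut off by it which does NOT
--    contain the puncture is the polygon with vertices i, i+1, …, j
--    (counterclockwise); equivalently it cuts off the k+2 boundary
--    segments i, i+1, …, i+k+1.  Every ordinary arc between distinct
--    marked points which are vertices is exactly one of these
--    (ccw length 1 would be a boundary segment).
--  * rad t i : the radius from vertex i to the puncture, with tag t.
data TArc (n : ℕ) : Set where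
  arc : Fin n → Fin (n ∸ 2) → TArc n
  rad : Tag → Fin n → TArc n

-- variables: cluster variables (tagged arcs) and frozen variables
-- (boundary segments)
data Var (n : ℕ) : Set where
  cl : TArc n → Var n
  bd : Fin n → Var n

tarcEq : ∀ {n} → TArc n → TArc n → Bool
tarcEq (arc i k) (arc j l) = finEq i j ∧ finEq k l
tarcEq (rad t i) (rad s j) = tagEq t s ∧ finEq i j
tarcEq _ _ = false

varEq : ∀ {n} → Var n → Var n → Bool
varEq (cl a) (cl b) = tarcEq a b
varEq (bd s) (bd t) = finEq s t
varEq _ _ = false

allTArc : ∀ n → List (TArc n)
allTArc n = concatMap (λ i → map (arc i) (allFinL (n ∸ 2))) (allFinL n)
            ++ map (rad plain) (allFinL n) ++ map (rad notched) (allFinL n)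

allVar : ∀ n → List (Var n)
allVar n = map cl (allTArc n) ++ map bd (allFinL n)

segIn : ∀ {n} → Fin n → Fin (n ∸ 2) → Fin n → Bool
segIn i k s = dist i s <ᵇ (toℕ k ℕ.+ 2)

vtxInside : ∀ {n} → Fin n → Fin (n ∸ 2) → Fin n → Bool
vtxInside i k v = (0 <ᵇ dist i v) ∧ (dist i v <ᵇ (toℕ k ℕ.+ 2))

-- Plain arcs are compatible iff they do not cross, i.e. the regions
-- they cut off (away from the puncture) are nested or have disjoint
-- interiors; an arc and a radius are compatible iff the radius does not
-- start strictly inside the region cut off by the arc; two radii are
-- compatible iff they have the same tag or the same endpoint.
compatible : ∀ {n} → TArc n → TArc n → Bool
compatible (arc i k) (arc j l) =
  allF (λ s → not (segIn i k s) ∨ segIn j l s)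
  ∨ allF (λ s → not (segIn j l s) ∨ segIn i k s)
  ∨ allF (λ s → not (segIn i k s ∧ segIn j l s))
compatible (arc i k) (rad t v) = not (vtxInside i k v)
compatible (rad t v) (arc i k) = not (vtxInside i k v)
compatible (rad t a) (rad s b) = tagEq t s ∨ finEq a b

-- Tagged triangulation: maximal set of pairwise compatible tagged arcs
-- (compatibility is reflexive, so maximality is the condition below).
record TaggedTriangulation (n : ℕ) : Set where
  field
    mem      : TArc n → Bool
    pairwise : ∀ x y → mem x ≡ true → mem y ≡ true → compatible x y ≡ true
    maximal  : ∀ x → (∀ y → mem y ≡ true → compatible x y ≡ true) → mem x ≡ true
open TaggedTriangulation public

Flip : ∀ {n} → TaggedTriangulation n → TArc n → TaggedTriangulation n → TArc n → Set
Flip T τ T' τ' =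
  mem T τ ≡ true × mem T' τ' ≡ true × mem T τ' ≡ false × mem T' τ ≡ false
  × (∀ γ → tarcEq γ τ ≡ false → tarcEq γ τ' ≡ false → mem T γ ≡ mem T' γ)

-- The extended exchange matrix B(T) of Fomin–Shapiro–Thurston
-- (rows: T ∪ boundary segments, columns: T), up to the global sign
-- convention (irrelevant for exchange relations).
-- B(T) = B(T°) for the ideal triangulation T°: if all radii are notched,
-- change them to plain; if T has a plain and a notched radius at vertex i,
-- the notched one becomes the loop ℓ at i enclosing the plain radius
-- (self-folded triangle).  b_xy = Σ_Δ b^Δ_{π x, π y} over the
-- non-self-folded triangles Δ, where π(radius in self-folded triangle) = ℓ,
-- and b^Δ = +1/-1 for consecutive sides in ccw / cw order.

-- side of a triangle joining distinct vertices a, b going ccw from a to b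
-- without passing the puncture: boundary segment or arc.
isS : ∀ {n} → Fin n → Fin n → Var n → Bool
isS a b (bd s) = finEq s a ∧ (dist a b ≡ᵇ 1)
isS a b (cl (arc i k)) = finEq i a ∧ ((toℕ k ℕ.+ 2) ≡ᵇ dist a b)
isS a b (cl (rad _ _)) = false

isR : ∀ {n} → Tag → Fin n → Var n → Bool
isR t a (cl (rad s b)) = tagEq t s ∧ finEq a b
isR t a _ = false

sideIn : ∀ {n} → TaggedTriangulation n → Fin n → Fin n → Bool
sideIn T a b = (dist a b ≡ᵇ 1) ∨ anyF (λ k → ((toℕ k ℕ.+ 2) ≡ᵇ dist a b) ∧ mem T (arc a k))

ind : Bool → ℤ
ind true  = + 1
ind false = + 0

-- contribution of a triangle with sides P₁, P₂, P₃ in ccw cyclic order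
triB : ∀ {n} → (Var n → Bool) → (Var n → Bool) → (Var n → Bool) → Var n → Var n → ℤ
triB P₁ P₂ P₃ x y =
  (ind (P₁ x ∧ P₂ y) ℤ.+ ind (P₂ x ∧ P₃ y) ℤ.+ ind (P₃ x ∧ P₁ y))
  ℤ.- (ind (P₂ x ∧ P₁ y) ℤ.+ ind (P₃ x ∧ P₂ y) ℤ.+ ind (P₁ x ∧ P₃ y))

-- π: a plain radius paired with a notched radius at the same vertex is the
-- folded side of a self-folded triangle, identified with the loop (notched)
piT : ∀ {n} → TaggedTriangulation n → Var n → Var n
piT T (cl (rad plain i)) = if mem T (rad notched i) then cl (rad notched i) else cl (rad plain i)
piT T v = v

bMat : ∀ {n} → TaggedTriangulation n → Var n → Var n → ℤ
bMat T x y =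
  -- triangles with three polygon vertices a, b, c (ccw), puncture beyond
  -- the side from a to c
  sumF (λ a → sumF (λ b → sumF (λ c →
    if (0 <ᵇ dist a b) ∧ (dist a b <ᵇ dist a c) ∧ sideIn T a b ∧ sideIn T b c ∧ sideIn T a c
    then triB (isS a b) (isS b c) (isS a c) px py else + 0)))
  -- triangles with vertices puncture, a, c (radii of equal tag at a ≠ c)
  ℤ.+ sumF (λ a → sumF (λ c →
    (if mem T (rad plain a) ∧ mem T (rad plain c) ∧ not (finEq a c) ∧ sideIn T a c
     then triB (isR plain a) (isS a c) (isR plain c) px py else + 0)
    ℤ.+ (if mem T (rad notched a) ∧ mem T (rad notched c) ∧ not (finEq a c) ∧ sideIn T a c
     then triB (isR notched a) (isS a c) (isR notched c) px py else + 0)))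
  -- triangle with sides arc i→j, arc j→i and the loop ℓ at i
  ℤ.+ sumF (λ i → sumF (λ j →
    if mem T (rad plain i) ∧ mem T (rad notched i) ∧ not (finEq i j) ∧ sideIn T i j ∧ sideIn T j i
    then triB (isS i j) (isS j i) (isR notched i) px py else + 0))
  where
  px = piT T x
  py = piT T y

inSeed : ∀ {n} → TaggedTriangulation n → Var n → Bool
inSeed T (cl γ) = mem T γ
inSeed T (bd s) = true

-- Laurent polynomials with integer coefficients in the variables Var n.
-- A Laurent polynomial is a finite formal sum (list) of terms c·x^e;
-- two are equal (≈L) iff all coefficients agree.

allL : ∀ {A : Set} → (A → Bool) → List A → Bool
allL f = foldr (λ a b → f a ∧ b) true

Exp : ℕ → Set
Exp n = Var n → ℤ

LP : ℕ → Set
LP n = List (ℤ × Exp n)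

eqExp : ∀ {n} → Exp n → Exp n → Bool
eqExp {n} e e' = allL (λ v → ⌊ e v ≟ℤ e' v ⌋) (allVar n)

coeff : ∀ {n} → LP n → Exp n → ℤ
coeff p e = foldr (λ t acc → (if eqExp (proj₁' t) e then proj₀ t else + 0) ℤ.+ acc) (+ 0) p
  where
  proj₀ : _ → ℤ
  proj₀ (c , _) = c
  proj₁' : _ → _
  proj₁' (_ , e') = e'

_≈L_ : ∀ {n} → LP n → LP n → Set
p ≈L q = ∀ e → coeff p e ≡ coeff q e

_+L_ : ∀ {n} → LP n → LP n → LP n
p +L q = p ++ q

_*L_ : ∀ {n} → LP n → LP n → LP n
p *L q = concatMap (λ { (c , e) → map (λ { (c' , e') → (c ℤ.* c' , λ v → e v ℤ.+ e' v) }) q }) p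

oneL : ∀ {n} → LP n
oneL = (+ 1 , λ _ → + 0) ∷ []

powL : ∀ {n} → LP n → ℕ → LP n
powL p zero    = oneL
powL p (suc k) = p *L powL p k

prodL : ∀ {n} → List (LP n) → LP n
prodL = foldr _*L_ oneL

varL : ∀ {n} → Var n → LP n
varL v = (+ 1 , λ w → ind (varEq v w)) ∷ []

posPart negPart : ℤ → ℕ
posPart (+ k)      = k
posPart -[1+ k ]   = 0
negPart (+ k)      = 0
negPart -[1+ k ]   = suc k

-- Cluster variables expanded in the seed Σ_T.
-- F γ is the Laurent expansion of x_γ in the cluster and frozen variables
-- of Σ_T: F τ = x_τ for τ ∈ T, and F satisfies every exchange relation
--   x_τ x_τ' = Π_{b_στ > 0} x_σ^{b_στ} + Π_{b_στ < 0} x_σ^{-b_στ}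
-- (σ ∈ T₁ ∪ boundary, b = B(T₁)) for every flip of tagged triangulations.
-- By the Laurent phenomenon and connectivity of the flip graph there is
-- exactly one such F (up to ≈L).

valL : ∀ {n} → (TArc n → LP n) → Var n → LP n
valL F (cl γ) = F γ
valL F (bd s) = varL (bd s)

exchL : ∀ {n} → TaggedTriangulation n → TArc n → (TArc n → LP n) → LP n
exchL {n} T τ F =
  prodL (map (λ σ → if inSeed T σ then powL (valL F σ) (posPart (bMat T σ (cl τ))) else oneL) (allVar n))
  +L prodL (map (λ σ → if inSeed T σ then powL (valL F σ) (negPart (bMat T σ (cl τ))) else oneL) (allVar n))

ClusterExpansion : ∀ {n} → TaggedTriangulation n → (TArc n → LP n) → Set
ClusterExpansion {n} T F =
  (∀ τ → mem T τ ≡ true → F τ ≈L varL (cl τ))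
  × (∀ T₁ τ₁ T₂ τ₂ → Flip T₁ τ₁ T₂ τ₂ → (F τ₁ *L F τ₂) ≈L exchL T₁ τ₁ F)

Support : ∀ {n} → LP n → Exp n → Set
Support p e = coeff p e ≢ + 0

sumℚ : List ℚ → ℚ
sumℚ = foldr ℚ._+_ 0ℚ

toℚ : ℤ → ℚ
toℚ z = z ℚ./ 1

InNewtonPolytope : ∀ {n} → LP n → (Var n → ℚ) → Set
InNewtonPolytope {n} p u =
  Σ[ cs ∈ List (ℚ × Exp n) ] (All (λ { (l , e) → (0ℚ ℚ.≤ l) × Support p e }) cs
          × sumℚ (map (λ { (l , e) → l }) cs) ≡ 1ℚ
          × (∀ v → sumℚ (map (λ { (l , e) → l ℚ.* toℚ (e v) }) cs) ≡ u v))

Saturated : ∀ {n} → LP n → Set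
Saturated p = ∀ (u : Exp _) → InNewtonPolytope p (λ v → toℚ (u v)) → Support p u

{-# OPTIONS --safe #-}
module Submission where

-- Fix a radius of T at a vertex a, with tag t. Write R v for the radius with tag t at v and N v for the one with the
-- other tag, and uv for the arc or boundary segment from u counterclockwise to v. The only flips needed are those of R b
-- in a triangulation with radii at a, b, c and sides ab, bc; they give
--   R b · ac = ab · R c + bc · R a,   and, when c = a,   R b · N a = ab + ba,
-- and since Laurent polynomials form a domain, the Ptolemy relations follow from these.
--
-- Cut open along the radius at a, T becomes a triangulation of a polygon with vertices 0, …, n (both 0 and n are a) and
-- n + 1 (the puncture), that is, a binary tree. Going up the tree from a vertex v, each diagonal crossed gives a tag,
-- 0 or 1 according to the endpoint chosen, and an expansion is a sum of monomials whose exponents are affine in the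
-- tags; the tags satisfy inequalities y ≤ y' and are recovered, over the integers, from exponents of variables that
-- occur once. So a lattice point that is an average of exponents has integral averaged tags, satisfying the same
-- inequalities, hence is an exponent.
--
-- For N v and for arcs around the puncture, take as base the last radius before v. Two walks then use the same
-- diagonals and only the sum z ∈ {0, 1, 2} of their tags is seen. The terms at the triangle at the puncture next to the
-- base require, moreover, that the walks can be chosen with y_v ≤ y_w, which excludes only some sums with z constantly
-- equal to 1. If an average of sums has z constantly equal to 1, the inequalities force z to be constant for each of
-- them, so the condition passes to the first common diagonal, where it is linear: 2 y_v ≤ z ≤ 2 y_w.

open import Defs
open import Algebra.Bundles using (CommutativeSemiring)
import Algebra.Properties.AbelianGroup
import Algebra.Solver.Ring.NaturalCoefficients.Default as NatSolver
open import Algebra.Structures using (IsCommutativeSemiring)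
import Algebra.Structures.Biased as Biased
open import Data.Bool.Base as Bool using (Bool; true; false; _∧_; _∨_; not; if_then_else_)
import Data.Bool.Properties as Boolₚ
open import Data.Empty using (⊥; ⊥-elim)
open import Data.Fin.Base using (Fin; toℕ; fromℕ<) renaming (zero to Fz; suc to Fs)
import Data.Fin.Properties as Finₚ
open import Data.Integer.Base as ℤ using (ℤ; +_; -[1+_])
import Data.Integer.Properties as ℤₚ
import Data.Integer.Tactic.RingSolver as ℤS
open import Data.List.Base as List using (List; []; _∷_; map; _++_; concatMap; foldr)
open import Data.List.Membership.Propositional using (_∈_)
open import Data.List.Membership.Propositional.Properties
open import Data.List.Properties using (map-++)
open import Data.List.Relation.Unary.All as All using (All; []; _∷_)
import Data.List.Relation.Unary.All.Properties as Allₚ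
import Data.List.Relation.Unary.AllPairs as AllPairs
open import Data.List.Relation.Unary.Any using (Any; here; there)
open import Data.List.Relation.Unary.Unique.Propositional using (Unique)
import Data.List.Relation.Unary.Unique.Propositional.Properties as Uniqueₚ
open import Data.Nat.Base as ℕ using (ℕ; zero; suc; _≤_; _<_; _∸_; _<ᵇ_; _≤ᵇ_; _≡ᵇ_)
open import Data.Nat.DivMod using (_%_; m%n<n; m<n⇒m%n≡m; [m+n]%n≡m%n; %-distribˡ-+; m%n%n≡m%n)
import Data.Nat.Properties as ℕₚ
open import Data.Product.Base using (_×_; _,_; proj₁; proj₂; ∃-syntax; Σ-syntax)
open import Data.Rational.Base as ℚ using (ℚ; 0ℚ)
import Data.Rational.Properties as ℚₚ
open import Data.Rational.Solver using (module +-*-Solver)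
import Data.Rational.Unnormalised.Base as ℚᵘ
import Data.Rational.Unnormalised.Properties as ℚᵘₚ
open import Data.Sum.Base using (_⊎_; inj₁; inj₂)
open import Data.Unit.Base using (⊤; tt)
open import Relation.Binary.Definitions using (tri<; tri≈; tri>)
open import Relation.Binary.PropositionalEquality using (_≡_; _≢_; refl; sym; trans; cong; cong₂; subst; subst₂; module ≡-Reasoning)
import Relation.Binary.Reasoning.Setoid
open import Relation.Nullary using (¬_; yes; no; Dec; ¬?)

-- Every expansion rests on one substitution. At a triangle with vertices a, b, c, a family `Φ` that
-- satisfies the Ptolemy relations has `Φ b = (ab/ac) Φ c + (bc/ac) Φ a`: a walk standing at b moves
-- to c or to a, and its tag records which. At each triangle one side has as its exponent the new
-- tag, with coefficient 1, plus an affine function of earlier tags; so integral exponents give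
-- integral tags one after the other. This needs a variable that occurs in one label only, and
-- cutting along the base destroys that for the base itself: its variable occurs in the chords from
-- 0 and from n to the puncture and in the chord from 0 to n, which stands for the loop at a and has
-- the product of the two radii at a as its value. Tags are therefore read off at the other chords
-- (`Reg`). For an arc that runs around the puncture, two walks cross the same diagonals, and their
-- separate averaged tags need not be integers even if the averaged sum is. The sum 1 has two
-- readings, (0, 1) and (1, 0), and the product formula for such an arc omits one of them in part of
-- its terms; this is the reason for the flag carried by `Q`.

private
  module ℤG = Algebra.Properties.AbelianGroup ℤₚ.+-0-abelianGroup

-- Laurent polynomials

∈-allTArc : ∀ {n} (γ : TArc n) → γ ∈ allTArc n
∈-allTArc {n} (arc i k) = ∈-++⁺ˡ (∈-concatMap⁺ (λ i → map (arc i) (allFinL (n ℕ.∸ 2))) (lemma (∈-allFin i)))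
  where
  lemma : ∀ {xs} → i ∈ xs → Any (λ j → arc i k ∈ map (arc j) (allFinL (n ℕ.∸ 2))) xs
  lemma (here refl) = here (∈-map⁺ (arc i) (∈-allFin k))
  lemma (there p) = there (lemma p)
∈-allTArc {n} (rad plain i) = ∈-++⁺ʳ (concatMap (λ i → map (arc i) (allFinL (n ℕ.∸ 2))) (allFinL n)) (∈-++⁺ˡ (∈-map⁺ (rad plain) (∈-allFin i)))
∈-allTArc {n} (rad notched i) = ∈-++⁺ʳ (concatMap (λ i → map (arc i) (allFinL (n ℕ.∸ 2))) (allFinL n)) (∈-++⁺ʳ (map (rad plain) (allFinL n)) (∈-map⁺ (rad notched) (∈-allFin i)))

∈-allVar : ∀ {n} (v : Var n) → v ∈ allVar n
∈-allVar {n} (cl γ) = ∈-++⁺ˡ (∈-map⁺ cl (∈-allTArc γ))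
∈-allVar {n} (bd s) = ∈-++⁺ʳ (map cl (allTArc n)) (∈-map⁺ bd (∈-allFin s))

module _ {n : ℕ} where

  infix 4 _≐_
  infixl 6 _⊞_ _⊟_
  infixl 7 _·_

  _≐_ : Exp n → Exp n → Set
  e ≐ f = ∀ v → e v ≡ f v

  _⊞_ _⊟_ : Exp n → Exp n → Exp n
  (e ⊞ f) v = e v ℤ.+ f v
  (e ⊟ f) v = e v ℤ.- f v

  _·_ : ℤ → Exp n → Exp n
  (c · e) v = c ℤ.* e v

  0ᵉ : Exp n
  0ᵉ _ = + 0

  eqExp-sound : ∀ e f → eqExp e f ≡ true → e ≐ f
  eqExp-sound e f h v = go (allVar n) h (∈-allVar v)
    where
    go : ∀ vs → allL (λ v → Relation.Nullary.⌊ e v ℤₚ.≟ f v ⌋) vs ≡ true → v ∈ vs → e v ≡ f v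
    go (w ∷ vs) h m with e w ℤₚ.≟ f w
    go (w ∷ vs) h (here refl) | yes q = q
    go (w ∷ vs) h (there m) | yes q = go vs h m

  eqExp-complete : ∀ e f → e ≐ f → eqExp e f ≡ true
  eqExp-complete e f h = go (allVar n)
    where
    go : ∀ vs → allL (λ v → Relation.Nullary.⌊ e v ℤₚ.≟ f v ⌋) vs ≡ true
    go [] = refl
    go (w ∷ vs) with e w ℤₚ.≟ f w
    ... | yes q = go vs
    ... | no q = ⊥-elim (q (h w))

  _≐?_ : ∀ e f → Dec (e ≐ f)
  e ≐? f with eqExp e f in eq
  ... | true  = yes (eqExp-sound e f eq)
  ... | false = no λ h → case-⊥ (trans (sym eq) (eqExp-complete e f h))
    where
    case-⊥ : false ≡ true → ⊥
    case-⊥ ()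

  δ : Exp n → Exp n → ℤ
  δ e f = ind (eqExp f e)

  δ-yes : ∀ e f → f ≐ e → δ e f ≡ + 1
  δ-yes e f h rewrite eqExp-complete f e h = refl

  δ-no : ∀ e f → ¬ (f ≐ e) → δ e f ≡ + 0
  δ-no e f h with eqExp f e in eq
  ... | true  = ⊥-elim (h (eqExp-sound f e eq))
  ... | false = refl

  δ-resp : ∀ {e f e' f'} → (f ≐ e → f' ≐ e') → (f' ≐ e' → f ≐ e) → δ e f ≡ δ e' f'
  δ-resp {e} {f} {e'} {f'} to from with f ≐? e
  ... | yes p = trans (δ-yes e f p) (sym (δ-yes e' f' (to p)))
  ... | no ¬p = trans (δ-no e f ¬p) (sym (δ-no e' f' λ q → ¬p (from q)))

  -- The linear extension of φ from monomials to Laurent polynomials.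
  ev : LP n → (Exp n → ℤ) → ℤ
  ev [] φ = + 0
  ev ((c , e) ∷ p) φ = c ℤ.* φ e ℤ.+ ev p φ

  coeff≡ev : ∀ p e → coeff p e ≡ ev p (δ e)
  coeff≡ev [] e = refl
  coeff≡ev ((c , f) ∷ p) e = cong₂ ℤ._+_ (lemma (eqExp f e)) (coeff≡ev p e)
    where
    lemma : ∀ b → (if b then c else + 0) ≡ c ℤ.* ind b
    lemma true  = sym (ℤₚ.*-identityʳ c)
    lemma false = sym (ℤₚ.*-zeroʳ c)

  Resp : (Exp n → ℤ) → Set
  Resp φ = ∀ e f → e ≐ f → φ e ≡ φ f

  δ-Resp : ∀ e → Resp (δ e)
  δ-Resp e f g h = δ-resp {e} {f} {e} {g} (λ p v → trans (sym (h v)) (p v)) (λ p v → trans (h v) (p v))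

  ev-cong : ∀ p {φ ψ} → (∀ e → φ e ≡ ψ e) → ev p φ ≡ ev p ψ
  ev-cong [] h = refl
  ev-cong ((c , e) ∷ p) h = cong₂ (λ a b → c ℤ.* a ℤ.+ b) (h e) (ev-cong p h)

  ev-++ : ∀ p q φ → ev (p ++ q) φ ≡ ev p φ ℤ.+ ev q φ
  ev-++ [] q φ = sym (ℤₚ.+-identityˡ _)
  ev-++ ((c , e) ∷ p) q φ = trans (cong (ℤ._+_ (c ℤ.* φ e)) (ev-++ p q φ)) (sym (ℤₚ.+-assoc (c ℤ.* φ e) _ _))

  ev-+ : ∀ p φ ψ → ev p (λ e → φ e ℤ.+ ψ e) ≡ ev p φ ℤ.+ ev p ψ
  ev-+ [] φ ψ = refl
  ev-+ ((c , e) ∷ p) φ ψ rewrite ev-+ p φ ψ = lemma c (φ e) (ψ e) (ev p φ) (ev p ψ)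
    where
    lemma : ∀ c a b x y → c ℤ.* (a ℤ.+ b) ℤ.+ (x ℤ.+ y) ≡ c ℤ.* a ℤ.+ x ℤ.+ (c ℤ.* b ℤ.+ y)
    lemma = ℤS.solve-∀

  ev-* : ∀ p d φ → ev p (λ e → d ℤ.* φ e) ≡ d ℤ.* ev p φ
  ev-* [] d φ = sym (ℤₚ.*-zeroʳ d)
  ev-* ((c , e) ∷ p) d φ rewrite ev-* p d φ = lemma c d (φ e) (ev p φ)
    where
    lemma : ∀ c d a x → c ℤ.* (d ℤ.* a) ℤ.+ d ℤ.* x ≡ d ℤ.* (c ℤ.* a ℤ.+ x)
    lemma = ℤS.solve-∀

  ev-zero : ∀ p → ev p (λ _ → + 0) ≡ + 0
  ev-zero [] = refl
  ev-zero ((c , e) ∷ p) rewrite ev-zero p | ℤₚ.*-zeroʳ c = refl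

  ev-swap : ∀ p q (ψ : Exp n → Exp n → ℤ) → ev p (λ e → ev q (ψ e)) ≡ ev q (λ f → ev p (λ e → ψ e f))
  ev-swap [] q ψ = sym (ev-zero q)
  ev-swap ((c , e) ∷ p) q ψ = trans (cong₂ ℤ._+_ (sym (ev-* q c (ψ e))) (ev-swap p q ψ))
    (sym (ev-+ q (λ f → c ℤ.* ψ e f) (λ f → ev p (λ e → ψ e f))))

  ev-*L : ∀ p q φ → ev (p *L q) φ ≡ ev p (λ e → ev q (λ f → φ (e ⊞ f)))
  ev-*L [] q φ = refl
  ev-*L ((c , e) ∷ p) q φ = trans (ev-++ (map _ q) _ φ) (cong₂ ℤ._+_ (shift _ (λ _ _ → refl) q) (ev-*L p q φ))
    where
    shift : ∀ g → (∀ c' e' → g (c' , e') ≡ (c ℤ.* c' , e ⊞ e')) → ∀ q →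
            ev (map g q) φ ≡ c ℤ.* ev q (λ f → φ (e ⊞ f))
    shift g h [] = sym (ℤₚ.*-zeroʳ c)
    shift g h ((c' , e') ∷ q) rewrite h c' e' | shift g h q = lemma c c' (φ (e ⊞ e')) _
      where
      lemma : ∀ c c' a x → c ℤ.* c' ℤ.* a ℤ.+ c ℤ.* x ≡ c ℤ.* (c' ℤ.* a ℤ.+ x)
      lemma = ℤS.solve-∀

  infix 4 _≈_ _≋_
  -- _≈L_ as a record, so that the two sides can be inferred.
  record _≈_ (p q : LP n) : Set where
    constructor mk≈
    field un≈ : p ≈L q
  open _≈_ public

  -- Tests against all functionals that respect `_≐_`. Ring identities hold in this stronger form by
  -- manipulating sums, and specialising to `δ` gives the equality of coefficients.
  _≋_ : LP n → LP n → Set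
  p ≋ q = ∀ φ → Resp φ → ev p φ ≡ ev q φ

  ≋⇒≈ : ∀ {p q} → p ≋ q → p ≈ q
  ≋⇒≈ {p} {q} h = mk≈ λ e → trans (coeff≡ev p e) (trans (h (δ e) (δ-Resp e)) (sym (coeff≡ev q e)))

  ≈-refl : ∀ {p} → p ≈ p
  ≈-refl = mk≈ λ _ → refl

  ≈-sym : ∀ {p q} → p ≈ q → q ≈ p
  ≈-sym h = mk≈ λ e → sym (un≈ h e)

  ≈-trans : ∀ {p q r} → p ≈ q → q ≈ r → p ≈ r
  ≈-trans h k = mk≈ λ e → trans (un≈ h e) (un≈ k e)

  coeff-++ : ∀ p q e → coeff (p ++ q) e ≡ coeff p e ℤ.+ coeff q e
  coeff-++ p q e rewrite coeff≡ev (p ++ q) e | coeff≡ev p e | coeff≡ev q e = ev-++ p q (δ e)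

  -- `_≈_` compares coefficients only, and not lists of terms. With the sum running over the terms
  -- of `q`, the left factor enters through its coefficients alone, which is what makes `*-congʳ`
  -- immediate.
  coeff-*L : ∀ p q e → coeff (p *L q) e ≡ ev q (λ g → coeff p (e ⊟ g))
  coeff-*L p q e = begin
    coeff (p *L q) e                            ≡⟨ coeff≡ev (p *L q) e ⟩
    ev (p *L q) (δ e)                           ≡⟨ ev-*L p q (δ e) ⟩
    ev p (λ f → ev q (λ g → δ e (f ⊞ g)))       ≡⟨ ev-swap p q _ ⟩
    ev q (λ g → ev p (λ f → δ e (f ⊞ g)))       ≡⟨ ev-cong q (λ g → ev-cong p (λ f →
                                                     δ-resp {e} {f ⊞ g} {e ⊟ g} {f} (λ h v → to (h v)) (λ h v → from (h v)))) ⟩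
    ev q (λ g → ev p (δ (e ⊟ g)))               ≡⟨ ev-cong q (λ g → sym (coeff≡ev p (e ⊟ g))) ⟩
    ev q (λ g → coeff p (e ⊟ g))                ∎
    where
    open ≡-Reasoning
    lemma₁ : ∀ f g → f ≡ f ℤ.+ g ℤ.- g
    lemma₁ = ℤS.solve-∀
    lemma₂ : ∀ e g → e ℤ.- g ℤ.+ g ≡ e
    lemma₂ = ℤS.solve-∀
    to : ∀ {f g e} → f ℤ.+ g ≡ e → f ≡ e ℤ.- g
    to {f} {g} refl = lemma₁ f g
    from : ∀ {f g e} → f ≡ e ℤ.- g → f ℤ.+ g ≡ e
    from {f} {g} {e} refl = lemma₂ e g

  +-cong : ∀ {p p' q q'} → p ≈ p' → q ≈ q' → (p +L q) ≈ (p' +L q')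
  +-cong {p} {p'} {q} {q'} h k = mk≈ λ e → trans (coeff-++ p q e) (trans (cong₂ ℤ._+_ (un≈ h e) (un≈ k e)) (sym (coeff-++ p' q' e)))

  *-comm : ∀ p q → (p *L q) ≈ (q *L p)
  *-comm p q = ≋⇒≈ λ φ r → trans (ev-*L p q φ) (trans (ev-swap p q _)
    (trans (ev-cong q λ g → ev-cong p λ f → r _ _ λ v → ℤₚ.+-comm (f v) (g v)) (sym (ev-*L q p φ))))

  *-congʳ : ∀ {p p'} q → p ≈ p' → (p *L q) ≈ (p' *L q)
  *-congʳ {p} {p'} q h = mk≈ λ e → trans (coeff-*L p q e) (trans (ev-cong q λ g → un≈ h (e ⊟ g)) (sym (coeff-*L p' q e)))

  *-cong : ∀ {p p' q q'} → p ≈ p' → q ≈ q' → (p *L q) ≈ (p' *L q')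
  *-cong {p} {p'} {q} {q'} h k = ≈-trans (*-congʳ q h) (≈-trans (*-comm p' q) (≈-trans (*-congʳ p' k) (*-comm q' p')))

  LP-isCommutativeSemiring : IsCommutativeSemiring _≈_ _+L_ _*L_ [] oneL
  LP-isCommutativeSemiring = Biased.isCommutativeSemiringˡ record
    { +-isCommutativeMonoid = record
      { isMonoid = record
        { isSemigroup = record
          { isMagma = record { isEquivalence = record { refl = ≈-refl ; sym = ≈-sym ; trans = ≈-trans } ; ∙-cong = +-cong }
          ; assoc = λ p q r → ≋⇒≈ λ φ _ → trans (ev-++ (p ++ q) r φ) (trans (cong (ℤ._+ ev r φ) (ev-++ p q φ))
              (trans (ℤₚ.+-assoc (ev p φ) _ _) (trans (cong (ℤ._+_ (ev p φ)) (sym (ev-++ q r φ))) (sym (ev-++ p (q ++ r) φ))))) }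
        ; identity = (λ p → ≈-refl) , (λ p → ≋⇒≈ λ φ _ → trans (ev-++ p [] φ) (ℤₚ.+-identityʳ _)) }
      ; comm = λ p q → ≋⇒≈ λ φ _ → trans (ev-++ p q φ) (trans (ℤₚ.+-comm (ev p φ) _) (sym (ev-++ q p φ))) }
    ; *-isCommutativeMonoid = record
      { isMonoid = record
        { isSemigroup = record
          { isMagma = record { isEquivalence = record { refl = ≈-refl ; sym = ≈-sym ; trans = ≈-trans } ; ∙-cong = *-cong }
          ; assoc = λ p q r → ≋⇒≈ λ φ R → trans (ev-*L (p *L q) r φ) (trans (ev-*L p q _)
              (trans (ev-cong p λ e → trans (ev-cong q λ f → ev-cong r λ g → R _ _ λ v → ℤₚ.+-assoc (e v) (f v) (g v)) (sym (ev-*L q r _)))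
                     (sym (ev-*L p (q *L r) φ)))) }
        ; identity = *-identityˡ , (λ p → ≈-trans (*-comm p oneL) (*-identityˡ p)) }
      ; comm = *-comm }
    ; distribʳ = λ p q r → ≋⇒≈ λ φ _ → trans (ev-*L (q ++ r) p φ) (trans (ev-++ q r _)
        (trans (cong₂ ℤ._+_ (sym (ev-*L q p φ)) (sym (ev-*L r p φ))) (sym (ev-++ (q *L p) (r *L p) φ))))
    ; zeroˡ = λ p → ≈-refl
    }
    where
    *-identityˡ : ∀ p → (oneL *L p) ≈ p
    *-identityˡ p = ≋⇒≈ λ φ R → trans (ev-*L oneL p φ) (trans (ℤₚ.+-identityʳ _) (trans (ℤₚ.*-identityˡ _)
      (ev-cong p λ e → R _ _ λ v → ℤₚ.+-identityˡ (e v))))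

module _ {n : ℕ} where

  mono : List (Exp n) → LP n
  mono = map (λ e → + 1 , e)

  x^ : Exp n → LP n
  x^ e = mono (e ∷ [])

  ev-mono-⊞ : ∀ es fs φ → ev (mono (List.cartesianProductWith _⊞_ es fs)) φ ≡ ev (mono es) (λ e → ev (mono fs) (λ f → φ (e ⊞ f)))
  ev-mono-⊞ [] fs φ = refl
  ev-mono-⊞ (e ∷ es) fs φ = trans (cong (λ l → ev l φ) (map-++ _ (map (e ⊞_) fs) _))
    (trans (ev-++ (mono (map (e ⊞_) fs)) _ φ) (cong₂ ℤ._+_ (trans (shift fs) (sym (ℤₚ.*-identityˡ _))) (ev-mono-⊞ es fs φ)))
    where
    shift : ∀ fs → ev (mono (map (e ⊞_) fs)) φ ≡ ev (mono fs) (λ f → φ (e ⊞ f))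
    shift [] = refl
    shift (f ∷ fs) = cong (ℤ._+_ (+ 1 ℤ.* φ (e ⊞ f))) (shift fs)

  mono-* : ∀ es fs → (mono es *L mono fs) ≈ mono (List.cartesianProductWith _⊞_ es fs)
  mono-* es fs = ≋⇒≈ λ φ _ → trans (ev-*L (mono es) (mono fs) φ) (sym (ev-mono-⊞ es fs φ))

  x^-* : ∀ e f → (x^ e *L x^ f) ≈ x^ (e ⊞ f)
  x^-* e f = mono-* (e ∷ []) (f ∷ [])

  x^-cong : ∀ {e f} → e ≐ f → x^ e ≈ x^ f
  x^-cong {e} {f} h = ≋⇒≈ λ φ r → cong (λ a → + 1 ℤ.* a ℤ.+ + 0) (r e f h)

  coeff-resp : ∀ (p : LP n) (e f : Exp n) → e ≐ f → coeff p e ≡ coeff p f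
  coeff-resp p e f h = trans (coeff≡ev p e) (trans (ev-cong p λ g → δ-resp {e = e} {f = g} {e' = f} {f' = g} (λ q v → trans (q v) (h v)) (λ q v → trans (q v) (sym (h v)))) (sym (coeff≡ev p f)))

  -- The lexicographic order on exponents makes Laurent polynomials cancellative.

  Lex : List (Var n) → Exp n → Exp n → Set
  Lex [] e f = ⊥
  Lex (v ∷ vs) e f = e v ℤ.< f v ⊎ (e v ≡ f v × Lex vs e f)

  _≺_ : Exp n → Exp n → Set
  _≺_ = Lex (allVar n)

  Lex-trans : ∀ vs {e f g} → Lex vs e f → Lex vs f g → Lex vs e g
  Lex-trans (v ∷ vs) (inj₁ p) (inj₁ q) = inj₁ (ℤₚ.<-trans p q)
  Lex-trans (v ∷ vs) {e} (inj₁ p) (inj₂ (q , _)) = inj₁ (subst (e v ℤ.<_) q p)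
  Lex-trans (v ∷ vs) {e} {f} {g} (inj₂ (p , _)) (inj₁ q) = inj₁ (subst (ℤ._< g v) (sym p) q)
  Lex-trans (v ∷ vs) (inj₂ (p , p')) (inj₂ (q , q')) = inj₂ (trans p q , Lex-trans vs p' q')

  Lex-irrefl : ∀ vs {e f} → e ≐ f → ¬ Lex vs e f
  Lex-irrefl (v ∷ vs) h (inj₁ p) = ℤₚ.<-irrefl (h v) p
  Lex-irrefl (v ∷ vs) h (inj₂ (_ , p)) = Lex-irrefl vs h p

  <-diff : ∀ {a b c d} → b ℤ.- a ≡ d ℤ.- c → a ℤ.< b → c ℤ.< d
  <-diff {a} {b} {c} {d} h p = subst₂ ℤ._<_ (lemma a c) (trans (lemma₂ a b c) (trans (cong (ℤ._+ c) h) (lemma₃ c d))) (ℤₚ.+-monoˡ-< (c ℤ.- a) p)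
    where
    lemma : ∀ a c → a ℤ.+ (c ℤ.- a) ≡ c
    lemma = ℤS.solve-∀
    lemma₂ : ∀ a b c → b ℤ.+ (c ℤ.- a) ≡ b ℤ.- a ℤ.+ c
    lemma₂ = ℤS.solve-∀
    lemma₃ : ∀ c d → d ℤ.- c ℤ.+ c ≡ d
    lemma₃ = ℤS.solve-∀

  -- The order depends only on the difference of the exponents, hence is invariant under
  -- translation; leading monomials are multiplicative for this reason.
  Lex-diff : ∀ vs {e f e' f'} → (f ⊟ e) ≐ (f' ⊟ e') → Lex vs e f → Lex vs e' f'
  Lex-diff (v ∷ vs) {e} {f} {e'} {f'} h (inj₁ p) = inj₁ (<-diff (h v) p)
  Lex-diff (v ∷ vs) {e} {f} {e'} {f'} h (inj₂ (p , q)) = inj₂ (sym (ℤₚ.i-j≡0⇒i≡j (f' v) (e' v) (trans (sym (h v)) (ℤₚ.i≡j⇒i-j≡0 (sym p)))) , Lex-diff vs h q)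

  Lex-tri : ∀ vs e f → Lex vs e f ⊎ Lex vs f e ⊎ (∀ {v} → v ∈ vs → e v ≡ f v)
  Lex-tri [] e f = inj₂ (inj₂ λ ())
  Lex-tri (v ∷ vs) e f with ℤₚ.<-cmp (e v) (f v)
  ... | tri< a _ _ = inj₁ (inj₁ a)
  ... | tri> _ _ c = inj₂ (inj₁ (inj₁ c))
  ... | tri≈ _ b _ with Lex-tri vs e f
  ...   | inj₁ p = inj₁ (inj₂ (b , p))
  ...   | inj₂ (inj₁ p) = inj₂ (inj₁ (inj₂ (sym b , p)))
  ...   | inj₂ (inj₂ p) = inj₂ (inj₂ λ { (here refl) → b ; (there m) → p m })

  ≺-max : ∀ e es → ∃[ m ] (m ∈ e ∷ es × (∀ {m'} → m' ∈ e ∷ es → m' ≐ m ⊎ m' ≺ m))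
  ≺-max e [] = e , here refl , λ { (here refl) → inj₁ λ _ → refl }
  ≺-max e (f ∷ es) with ≺-max f es
  ... | m , m∈ , mx with Lex-tri (allVar n) e m
  ...   | inj₁ p = m , there m∈ , λ { (here refl) → inj₂ p ; (there q) → mx q }
  ...   | inj₂ (inj₁ p) = e , here refl , λ { (here refl) → inj₁ λ _ → refl ; (there q) → inj₂ (below (mx q)) }
    where
    below : ∀ {m'} → m' ≐ m ⊎ m' ≺ m → m' ≺ e
    below (inj₁ h) = Lex-diff (allVar n) (λ v → cong (λ a → e v ℤ.- a) (sym (h v))) p
    below (inj₂ h) = Lex-trans (allVar n) h p
  ...   | inj₂ (inj₂ p) = m , there m∈ , λ { (here refl) → inj₁ (λ v → p (∈-allVar v)) ; (there q) → mx q }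

  exps : LP n → List (Exp n)
  exps = map proj₂

  coeff≢0⇒∈ : ∀ p e → coeff p e ≢ + 0 → Σ[ f ∈ Exp n ] (f ∈ exps p × f ≐ e)
  coeff≢0⇒∈ [] e h = ⊥-elim (h refl)
  coeff≢0⇒∈ ((c , f) ∷ p) e h with eqExp f e in eq
  ... | true = f , here refl , eqExp-sound f e eq
  ... | false with coeff≢0⇒∈ p e (λ q → h (trans (ℤₚ.+-identityˡ _) q))
  ...   | g , g∈ , q = g , there g∈ , q

  ev-mono-mult : ∀ φ c es → (∀ {m} → m ∈ es → φ m ≡ c ⊎ φ m ≡ + 0) → ∃[ k ] ev (mono es) φ ≡ + k ℤ.* c
  ev-mono-mult φ c [] h = 0 , sym (ℤₚ.*-zeroˡ c)
  ev-mono-mult φ c (m ∷ es) h with ev-mono-mult φ c es (λ q → h (there q)) | h (here refl)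
  ... | k , eq | inj₁ p = suc k , trans (cong₂ (λ a b → + 1 ℤ.* a ℤ.+ b) p eq) (lemma (+ k) c)
    where
    lemma : ∀ k c → + 1 ℤ.* c ℤ.+ k ℤ.* c ≡ (+ 1 ℤ.+ k) ℤ.* c
    lemma = ℤS.solve-∀
  ... | k , eq | inj₂ p = k , trans (cong₂ (λ a b → + 1 ℤ.* a ℤ.+ b) p eq) (ℤₚ.+-identityˡ _)

  -- The list may repeat its leading exponent, so the leading coefficient is a positive count and
  -- not necessarily 1. A positive multiple is enough for `+suc*≡0`.
  ev-mono-mult⁺ : ∀ φ c es → (∀ {m} → m ∈ es → φ m ≡ c ⊎ φ m ≡ + 0) → ∀ {m} → m ∈ es → φ m ≡ c →
                  ∃[ k ] ev (mono es) φ ≡ + suc k ℤ.* c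
  ev-mono-mult⁺ φ c (m ∷ es) h (here refl) p with ev-mono-mult φ c es (λ q → h (there q))
  ... | k , eq = k , trans (cong₂ (λ a b → + 1 ℤ.* a ℤ.+ b) p eq) (lemma (+ k) c)
    where
    lemma : ∀ k c → + 1 ℤ.* c ℤ.+ k ℤ.* c ≡ (+ 1 ℤ.+ k) ℤ.* c
    lemma = ℤS.solve-∀
  ev-mono-mult⁺ φ c (m ∷ es) h (there m∈) p with ev-mono-mult⁺ φ c es (λ q → h (there q)) m∈ p | h (here refl)
  ... | k , eq | inj₁ q = suc k , trans (cong₂ (λ a b → + 1 ℤ.* a ℤ.+ b) q eq) (lemma (+ k) c)
    where
    lemma : ∀ k c → + 1 ℤ.* c ℤ.+ (+ 1 ℤ.+ k) ℤ.* c ≡ (+ 1 ℤ.+ (+ 1 ℤ.+ k)) ℤ.* c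
    lemma = ℤS.solve-∀
  ... | k , eq | inj₂ q = k , trans (cong₂ (λ a b → + 1 ℤ.* a ℤ.+ b) q eq) (ℤₚ.+-identityˡ _)

  +suc*≡0 : ∀ k c → + suc k ℤ.* c ≡ + 0 → c ≡ + 0
  +suc*≡0 k c h with ℤₚ.i*j≡0⇒i≡0∨j≡0 (+ suc k) h
  ... | inj₂ q = q

  -- The product of the two leading monomials cannot cancel.
  mono-*-zero : ∀ r m₀ es → (r *L mono (m₀ ∷ es)) ≈ [] → ∀ e → coeff r e ≡ + 0
  mono-*-zero r m₀ es h e with coeff r e ℤₚ.≟ + 0
  ... | yes q = q
  ... | no ¬q = ⊥-elim (go nz nz-sound nz-complete (coeff≢0⇒∈ r e ¬q))
    where
    dec : (f : Exp n) → Dec (coeff r f ≢ + 0)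
    dec f = ¬? (coeff r f ℤₚ.≟ + 0)
    -- Listed terms of `r` can cancel one another, so the maximum has to be taken over the exponents
    -- whose coefficient is really nonzero.
    nz : List (Exp n)
    nz = List.filter dec (exps r)
    nz-sound : ∀ {f : Exp n} → f ∈ nz → coeff r f ≢ + 0
    nz-sound q = proj₂ (∈-filter⁻ dec {xs = exps r} q)
    nz-complete : ∀ {f : Exp n} → f ∈ exps r → coeff r f ≢ + 0 → f ∈ nz
    nz-complete q ne = ∈-filter⁺ dec q ne
    go : ∀ nz → (∀ {f : Exp n} → f ∈ nz → coeff r f ≢ + 0) → (∀ {f : Exp n} → f ∈ exps r → coeff r f ≢ + 0 → f ∈ nz) →
         Σ[ f ∈ Exp n ] (f ∈ exps r × f ≐ e) → ⊥
    go [] s c (f , f∈ , fe) with c {f} f∈ (λ q → ¬q (trans (coeff-resp r e f (λ v → sym (fe v))) q))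
    ... | ()
    go (f₁ ∷ fs) s c _ with ≺-max f₁ fs | ≺-max m₀ es
    ... | f₀ , f₀∈ , fmax | m , m∈ , mmax = s f₀∈ (+suc*≡0 (proj₁ count) _ (trans (sym (proj₂ count)) total))
      where
      total : ev (mono (m₀ ∷ es)) (λ g → coeff r (f₀ ⊞ m ⊟ g)) ≡ + 0
      total = trans (sym (coeff-*L r (mono (m₀ ∷ es)) (f₀ ⊞ m))) (un≈ h (f₀ ⊞ m))
      lemma₁ : ∀ a b → a ≡ a ℤ.+ b ℤ.- b
      lemma₁ = ℤS.solve-∀
      lemma₂ : ∀ a m g → m ℤ.- g ≡ (a ℤ.+ m ℤ.- g) ℤ.- a
      lemma₂ = ℤS.solve-∀
      same : ∀ {g} → g ≐ m → coeff r (f₀ ⊞ m ⊟ g) ≡ coeff r f₀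
      same {g} q = coeff-resp r (f₀ ⊞ m ⊟ g) f₀ λ v → sym (trans (lemma₁ (f₀ v) (m v)) (cong (λ a → f₀ v ℤ.+ m v ℤ.- a) (sym (q v))))
      value : ∀ {g} → g ∈ m₀ ∷ es → coeff r (f₀ ⊞ m ⊟ g) ≡ coeff r f₀ ⊎ coeff r (f₀ ⊞ m ⊟ g) ≡ + 0
      value {g} q with mmax q
      ... | inj₁ p = inj₁ (same p)
      ... | inj₂ p with coeff r (f₀ ⊞ m ⊟ g) ℤₚ.≟ + 0
      ...   | yes z = inj₂ z
      ...   | no ¬z = ⊥-elim absurd
        where
        -- A `g` below `m` that contributed would put `f₀ ⊞ m ⊟ g`, which is above `f₀`, into the
        -- support of `r`.
        big : f₀ ≺ (f₀ ⊞ m ⊟ g)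
        big = Lex-diff (allVar n) (λ v → lemma₂ (f₀ v) (m v) (g v)) p
        absurd : ⊥
        absurd = let (f , f∈ , fe) = coeff≢0⇒∈ r (f₀ ⊞ m ⊟ g) ¬z in
          contra f fe (fmax {f} (c {f} f∈ (λ q → ¬z (trans (coeff-resp r (f₀ ⊞ m ⊟ g) f (λ v → sym (fe v))) q))))
          where
          contra : ∀ (f : Exp n) → f ≐ (f₀ ⊞ m ⊟ g) → f ≐ f₀ ⊎ f ≺ f₀ → ⊥
          contra f fe (inj₁ h) = Lex-irrefl (allVar n) (λ v → trans (sym (h v)) (fe v)) big
          contra f fe (inj₂ h) = Lex-irrefl (allVar n) fe (Lex-trans (allVar n) h big)
      count = ev-mono-mult⁺ _ (coeff r f₀) (m₀ ∷ es) value m∈ (same λ _ → refl)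

  negL : LP n → LP n
  negL = map λ t → ℤ.- proj₁ t , proj₂ t

  ev-neg : ∀ p φ → ev (negL p) φ ≡ ℤ.- ev p φ
  ev-neg [] φ = refl
  ev-neg ((c , e) ∷ p) φ rewrite ev-neg p φ = lemma c (φ e) (ev p φ)
    where
    lemma : ∀ c a x → ℤ.- c ℤ.* a ℤ.+ ℤ.- x ≡ ℤ.- (c ℤ.* a ℤ.+ x)
    lemma = ℤS.solve-∀

  -- Only nonempty sums of monomials ever have to be cancelled, so `mono-*-zero` applied to the
  -- difference of `p` and `q` replaces the general statement that Laurent polynomials form a
  -- domain.
  mono-cancel : ∀ m₀ es p q → (p *L mono (m₀ ∷ es)) ≈ (q *L mono (m₀ ∷ es)) → p ≈ q
  mono-cancel m₀ es p q h = mk≈ λ e → ℤₚ.i-j≡0⇒i≡j _ _ (trans (sym (diff e)) (mono-*-zero (p ++ negL q) m₀ es zero-product e))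
    where
    M = mono (m₀ ∷ es)
    diff : ∀ e → coeff (p ++ negL q) e ≡ coeff p e ℤ.- coeff q e
    diff e rewrite coeff≡ev (p ++ negL q) e | coeff≡ev p e | coeff≡ev q e =
      trans (ev-++ p (negL q) _) (cong (ℤ._+_ (ev p (δ e))) (ev-neg q _))
    zero-product : ((p ++ negL q) *L M) ≈ []
    zero-product = mk≈ λ e → trans (coeff≡ev ((p ++ negL q) *L M) e) (trans (ev-*L (p ++ negL q) M _) (trans (ev-++ p (negL q) _)
      (trans (cong₂ ℤ._+_ (sym (ev-*L p M _)) (trans (ev-neg q _) (cong ℤ.-_ (sym (ev-*L q M _)))))
      (ℤₚ.i≡j⇒i-j≡0 (trans (sym (coeff≡ev (p *L M) e)) (trans (un≈ h e) (coeff≡ev (q *L M) e)))))))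

-- Opaque copies of the ring operations, so that their arguments can be inferred.
opaque
  infixl 7 _⊗_
  infixl 6 _⊕_

  _⊗_ _⊕_ : ∀ {n} → LP n → LP n → LP n
  _⊗_ = _*L_
  _⊕_ = _+L_

  0ᴸ 1ᴸ : ∀ {n} → LP n
  0ᴸ = []
  1ᴸ = oneL

  𝕩 : ∀ {n} → Exp n → LP n
  𝕩 e = x^ e

  ⊗-def : ∀ {n} (p q : LP n) → p ⊗ q ≡ p *L q
  ⊗-def p q = refl

  ⊕-def : ∀ {n} (p q : LP n) → p ⊕ q ≡ p +L q
  ⊕-def p q = refl

  0ᴸ-def : ∀ {n} → 0ᴸ {n} ≡ []
  0ᴸ-def = refl

  1ᴸ-def : ∀ {n} → 1ᴸ {n} ≡ oneL
  1ᴸ-def = refl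

  𝕩-def : ∀ {n} (e : Exp n) → 𝕩 e ≡ mono (e ∷ [])
  𝕩-def e = refl

  ⊕-⊗-isCommutativeSemiring : ∀ {n} → IsCommutativeSemiring (_≈_ {n}) _⊕_ _⊗_ 0ᴸ 1ᴸ
  ⊕-⊗-isCommutativeSemiring = LP-isCommutativeSemiring

  𝕩-⊗ : ∀ {n} (e f : Exp n) → 𝕩 e ⊗ 𝕩 f ≈ 𝕩 (e ⊞ f)
  𝕩-⊗ e f = x^-* e f

  𝕩-cong : ∀ {n} {e f : Exp n} → e ≐ f → 𝕩 e ≈ 𝕩 f
  𝕩-cong = x^-cong

  𝕩-0ᵉ : ∀ {n} → 𝕩 0ᵉ ≈ 1ᴸ {n}
  𝕩-0ᵉ = ≈-refl

  mono-⊕ : ∀ {n} (es fs : List (Exp n)) → mono es ⊕ mono fs ≈ mono (es ++ fs)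
  mono-⊕ es fs = subst (λ l → (mono es +L mono fs) ≈ l) (sym (map-++ _ es fs)) ≈-refl

  mono-⊗ : ∀ {n} (es fs : List (Exp n)) → mono es ⊗ mono fs ≈ mono (List.cartesianProductWith _⊞_ es fs)
  mono-⊗ = mono-*

  mono-⊗-cancel : ∀ {n} m₀ es (p q : LP n) → p ⊗ mono (m₀ ∷ es) ≈ q ⊗ mono (m₀ ∷ es) → p ≈ q
  mono-⊗-cancel = mono-cancel

LP-semiring : ℕ → CommutativeSemiring _ _
LP-semiring n = record { isCommutativeSemiring = ⊕-⊗-isCommutativeSemiring {n} }

-- Sums of monomials and their sets of exponents

module _ {n : ℕ} where
  module LPₛ = CommutativeSemiring (LP-semiring n)
  module ≈-Reasoning = Relation.Binary.Reasoning.Setoid LPₛ.setoid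

  -- p is a sum of monomials (with coefficients +1, possibly repeated) whose exponents are described by X.
  record Rep (p : LP n) (X : Exp n → Set) : Set where
    constructor mkRep
    field
      terms    : List (Exp n)
      expand   : p ≈ mono terms
      sound    : ∀ {e : Exp n} → e ∈ terms → X e
      complete : ∀ {e : Exp n} → X e → Σ[ f ∈ Exp n ] (f ∈ terms × f ≐ e)
      resp     : ∀ {e f : Exp n} → e ≐ f → X e → X f

  Rep-≈ : ∀ {p q X} → p ≈ q → Rep q X → Rep p X
  Rep-≈ h (mkRep es eq s c r) = mkRep es (≈-trans h eq) s c r

  Rep-⇔ : ∀ {p X} (Y : Exp n → Set) → Rep p X → (∀ e → X e → Y e) → (∀ e → Y e → X e) → Rep p Y
  Rep-⇔ Y (mkRep es eq s c r) to from = mkRep es eq (λ m → to _ (s m)) (λ y → c (from _ y)) (λ {e} {f} h y → to f (r h (from e y)))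

  Rep-0ᴸ : Rep 0ᴸ (λ _ → ⊥)
  Rep-0ᴸ = mkRep [] (subst (_≈ []) (sym 0ᴸ-def) ≈-refl) (λ ()) (λ ()) (λ _ ())

  Rep-𝕩 : ∀ e → Rep (𝕩 e) (_≐ e)
  Rep-𝕩 e = mkRep (e ∷ []) (subst (_≈ mono (e ∷ [])) (sym (𝕩-def e)) ≈-refl) (λ { (here refl) _ → refl }) (λ h → e , here refl , λ v → sym (h v)) (λ h k v → trans (sym (h v)) (k v))

  Rep-+ : ∀ {p q X Y} → Rep p X → Rep q Y → Rep (p ⊕ q) (λ e → X e ⊎ Y e)
  Rep-+ {p} {q} {X} {Y} (mkRep es eq s c r) (mkRep es' eq' s' c' r') = mkRep (es ++ es')
    (≈-trans (LPₛ.+-cong eq eq') (mono-⊕ es es'))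
    (λ m → sound (∈-++⁻ es m)) complete
    (λ { h (inj₁ x) → inj₁ (r h x) ; h (inj₂ y) → inj₂ (r' h y) })
    where
    sound : ∀ {e : Exp n} → e ∈ es ⊎ e ∈ es' → X e ⊎ Y e
    sound (inj₁ m) = inj₁ (s m)
    sound (inj₂ m) = inj₂ (s' m)
    complete : ∀ {e : Exp n} → X e ⊎ Y e → Σ[ f ∈ Exp n ] (f ∈ es ++ es' × f ≐ e)
    complete (inj₁ x) = let (f , m , h) = c x in f , ∈-++⁺ˡ m , h
    complete (inj₂ y) = let (f , m , h) = c' y in f , ∈-++⁺ʳ es m , h

  _+ˢ_ : (Exp n → Set) → (Exp n → Set) → Exp n → Set
  (X +ˢ Y) e = Σ[ f ∈ Exp n ] Σ[ g ∈ Exp n ] (X f × Y g × e ≐ (f ⊞ g))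

  Rep-* : ∀ {p q X Y} → Rep p X → Rep q Y → Rep (p ⊗ q) (X +ˢ Y)
  Rep-* {p} {q} {X} {Y} (mkRep es eq s c r) (mkRep es' eq' s' c' r') = mkRep (List.cartesianProductWith _⊞_ es es')
    (≈-trans (LPₛ.*-cong eq eq') (mono-⊗ es es')) sound complete
    (λ h (f , g , x , y , k) → f , g , x , y , λ v → trans (sym (h v)) (k v))
    where
    sound : ∀ {e : Exp n} → e ∈ List.cartesianProductWith _⊞_ es es' → (X +ˢ Y) e
    sound m = let (f , g , f∈ , g∈ , h) = ∈-cartesianProductWith⁻ _⊞_ es es' m in f , g , s f∈ , s' g∈ , λ v → cong (λ e → e v) h
    complete : ∀ {e : Exp n} → (X +ˢ Y) e → Σ[ f ∈ Exp n ] (f ∈ List.cartesianProductWith _⊞_ es es' × f ≐ e)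
    complete (f , g , x , y , h) = let (f' , m , k) = c x ; (g' , m' , k') = c' y in
      f' ⊞ g' , ∈-cartesianProductWith⁺ _⊞_ m m' , λ v → trans (cong₂ ℤ._+_ (k v) (k' v)) (sym (h v))

  𝕩-inverse : ∀ m p → 𝕩 (0ᵉ ⊟ m) ⊗ (𝕩 m ⊗ p) ≈ p
  𝕩-inverse m p = begin
    𝕩 (0ᵉ ⊟ m) ⊗ (𝕩 m ⊗ p)   ≈⟨ LPₛ.*-assoc _ _ p ⟨
    𝕩 (0ᵉ ⊟ m) ⊗ 𝕩 m ⊗ p     ≈⟨ LPₛ.*-congʳ (𝕩-⊗ (0ᵉ ⊟ m) m) ⟩
    𝕩 (0ᵉ ⊟ m ⊞ m) ⊗ p       ≈⟨ LPₛ.*-congʳ (≈-trans (𝕩-cong λ v → lemma (m v)) 𝕩-0ᵉ) ⟩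
    1ᴸ ⊗ p                   ≈⟨ LPₛ.*-identityˡ p ⟩
    p                        ∎
    where
    open ≈-Reasoning
    lemma : ∀ a → + 0 ℤ.- a ℤ.+ a ≡ + 0
    lemma = ℤS.solve-∀

  -- The divisions carried out on explicit expansions are all by monomials, namely by labels of
  -- chords of the triangulation; they only translate the exponents.
  Rep-÷ : ∀ m {p q X} → 𝕩 m ⊗ p ≈ q → Rep q X → Rep p (λ e → X (e ⊞ m))
  Rep-÷ m {p} {q} {X} h R = Rep-⇔ (λ e → X (e ⊞ m))
    (Rep-≈ (≈-trans (≈-sym (𝕩-inverse m p)) (LPₛ.*-congˡ h)) (Rep-* (Rep-𝕩 (0ᵉ ⊟ m)) R))
    (λ e (f , g , hf , x , k) → Rep.resp R (λ v → sym (trans (cong (ℤ._+ m v) (trans (k v) (cong (ℤ._+ g v) (hf v)))) (lemma (m v) (g v)))) x)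
    (λ e x → 0ᵉ ⊟ m , e ⊞ m , (λ _ → refl) , x , λ v → lemma₂ (m v) (e v))
    where
    lemma : ∀ m g → + 0 ℤ.- m ℤ.+ g ℤ.+ m ≡ g
    lemma = ℤS.solve-∀
    lemma₂ : ∀ m e → e ≡ + 0 ℤ.- m ℤ.+ (e ℤ.+ m)
    lemma₂ = ℤS.solve-∀

  Pos : LP n → Set
  Pos p = Σ[ m ∈ Exp n ] Σ[ es ∈ List (Exp n) ] p ≈ mono (m ∷ es)

  Rep⇒Pos : ∀ {p X} → Rep p X → ∀ {e} → X e → Pos p
  Rep⇒Pos {p} (mkRep es eq s c r) x = go es eq (proj₁ (proj₂ (c x)))
    where
    go : ∀ es → p ≈ mono es → ∀ {f : Exp n} → f ∈ es → Pos p
    go (m ∷ es) h _ = m , es , h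

  Pos-cancelʳ : ∀ {p q r} → Pos r → p ⊗ r ≈ q ⊗ r → p ≈ q
  Pos-cancelʳ {p} {q} {r} (m , es , eq) h = mono-⊗-cancel m es p q
    (≈-trans (LPₛ.*-congˡ (≈-sym eq)) (≈-trans h (LPₛ.*-congˡ eq)))

  coeff-mono : ∀ (es : List (Exp n)) (e : Exp n) → ∃[ k ] coeff (mono es) e ≡ + k
  coeff-mono [] e = 0 , refl
  coeff-mono (f ∷ es) e with coeff-mono es e | eqExp f e
  ... | k , h | true  = suc k , cong (ℤ._+_ (+ 1)) h
  ... | k , h | false = k , cong (ℤ._+_ (+ 0)) h

  -- With all coefficients +1 a repetition can only increase a coefficient, so the support is
  -- exactly the set of listed exponents.
  coeff-mono-∈ : ∀ es (e f : Exp n) → f ∈ es → f ≐ e → coeff (mono es) e ≢ + 0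
  coeff-mono-∈ (g ∷ es) e f m h q = head (eqExp g e) refl m q
    where
    1+k≢0 : ∀ {x} → (∃[ k ] x ≡ + k) → + 1 ℤ.+ x ≢ + 0
    1+k≢0 (k , refl) ()
    head : ∀ b → eqExp g e ≡ b → f ∈ g ∷ es → (if b then + 1 else + 0) ℤ.+ coeff (mono es) e ≢ + 0
    head true _ _ q = 1+k≢0 (coeff-mono es e) q
    head false r (here refl) q with trans (sym r) (eqExp-complete f e h)
    ... | ()
    head false r (there m) q = coeff-mono-∈ es e f m h (trans (sym (ℤₚ.+-identityˡ (coeff (mono es) e))) q)

  Rep-Support : ∀ {p X} → Rep p X → ∀ e → Support p e → X e
  Rep-Support {p} (mkRep es eq s c r) e h with coeff≢0⇒∈ (mono es) e (λ q → h (trans (un≈ eq e) q))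
  ... | f , f∈ , k = r k (s (un f∈))
    where
    un : ∀ {es} {f : Exp n} → f ∈ exps (mono es) → f ∈ es
    un {e ∷ es} (here h) = here h
    un {e ∷ es} (there h) = there (un h)

  Support-Rep : ∀ {p X} → Rep p X → ∀ e → X e → Support p e
  Support-Rep {p} (mkRep es eq s c r) e x h with c x
  ... | f , f∈ , k = coeff-mono-∈ es e f f∈ k (trans (sym (un≈ eq e)) h)

-- Saturation, with a convex combination having rational weights replaced by an average of a finite family with repetitions.

record Avg {N} (g : Fin N → ℤ) (m : ℤ) : Set where
  constructor mkAvg
  field unAvg : sumF g ≡ + N ℤ.* m
open Avg public

Sat : ∀ {n} → (Exp n → Set) → Set
Sat {n} X = ∀ N (es : Fin (suc N) → Exp n) (u : Exp n) → (∀ i → X (es i)) → (∀ v → Avg (λ i → es i v) (u v)) → X u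

fromℚᵘ-+ : ∀ p q → ℚ.fromℚᵘ (p ℚᵘ.+ q) ≡ ℚ.fromℚᵘ p ℚ.+ ℚ.fromℚᵘ q
fromℚᵘ-+ p q = ℚₚ.toℚᵘ-injective (ℚᵘₚ.≃-trans (ℚₚ.toℚᵘ-fromℚᵘ _) (ℚᵘₚ.≃-sym (ℚᵘₚ.≃-trans (ℚₚ.toℚᵘ-homo-+ (ℚ.fromℚᵘ p) (ℚ.fromℚᵘ q))
  (ℚᵘₚ.+-cong (ℚₚ.toℚᵘ-fromℚᵘ p) (ℚₚ.toℚᵘ-fromℚᵘ q)))))

fromℚᵘ-* : ∀ p q → ℚ.fromℚᵘ (p ℚᵘ.* q) ≡ ℚ.fromℚᵘ p ℚ.* ℚ.fromℚᵘ q
fromℚᵘ-* p q = ℚₚ.toℚᵘ-injective (ℚᵘₚ.≃-trans (ℚₚ.toℚᵘ-fromℚᵘ _) (ℚᵘₚ.≃-sym (ℚᵘₚ.≃-trans (ℚₚ.toℚᵘ-homo-* (ℚ.fromℚᵘ p) (ℚ.fromℚᵘ q))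
  (ℚᵘₚ.*-cong (ℚₚ.toℚᵘ-fromℚᵘ p) (ℚₚ.toℚᵘ-fromℚᵘ q)))))

toℚ-+ : ∀ a b → toℚ (a ℤ.+ b) ≡ toℚ a ℚ.+ toℚ b
toℚ-+ a b = trans (ℚₚ.fromℚᵘ-cong {ℚᵘ.mkℚᵘ (a ℤ.+ b) 0} {ℚᵘ.mkℚᵘ a 0 ℚᵘ.+ ℚᵘ.mkℚᵘ b 0} (ℚᵘ.*≡* (lemma a b))) (fromℚᵘ-+ (ℚᵘ.mkℚᵘ a 0) (ℚᵘ.mkℚᵘ b 0))
  where
  lemma : ∀ a b → (a ℤ.+ b) ℤ.* + 1 ≡ (a ℤ.* + 1 ℤ.+ b ℤ.* + 1) ℤ.* + 1
  lemma = ℤS.solve-∀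

toℚ-* : ∀ a b → toℚ (a ℤ.* b) ≡ toℚ a ℚ.* toℚ b
toℚ-* a b = fromℚᵘ-* (ℚᵘ.mkℚᵘ a 0) (ℚᵘ.mkℚᵘ b 0)

toℚ-injective : ∀ {a b} → toℚ a ≡ toℚ b → a ≡ b
toℚ-injective {a} {b} h with ℚₚ.fromℚᵘ-injective {ℚᵘ.mkℚᵘ a 0} {ℚᵘ.mkℚᵘ b 0} h
... | ℚᵘ.*≡* q = trans (sym (ℤₚ.*-identityʳ a)) (trans q (ℤₚ.*-identityʳ b))

numerator-den : ∀ l → l ℚ.* toℚ (ℚ.↧ l) ≡ toℚ (ℚ.↥ l)
numerator-den l@(ℚ.mkℚ a d _) = trans (cong (ℚ._* toℚ (+ suc d)) (sym (ℚₚ.fromℚᵘ-toℚᵘ l)))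
  (trans (sym (fromℚᵘ-* (ℚᵘ.mkℚᵘ a d) (ℚᵘ.mkℚᵘ (+ suc d) 0))) (ℚₚ.fromℚᵘ-cong {ℚᵘ.mkℚᵘ a d ℚᵘ.* ℚᵘ.mkℚᵘ (+ suc d) 0} {ℚᵘ.mkℚᵘ a 0} (ℚᵘ.*≡* lemma)))
  where
  lemma : (a ℤ.* + suc d) ℤ.* + 1 ≡ a ℤ.* + (suc d ℕ.* 1)
  lemma rewrite ℕₚ.*-identityʳ d = ℤₚ.*-identityʳ _

module _ {n : ℕ} where

  sumL : List (Exp n) → (Exp n → ℤ) → ℤ
  sumL [] g = + 0
  sumL (e ∷ es) g = g e ℤ.+ sumL es g

  sumL-++ : ∀ es fs g → sumL (es ++ fs) g ≡ sumL es g ℤ.+ sumL fs g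
  sumL-++ [] fs g = sym (ℤₚ.+-identityˡ _)
  sumL-++ (e ∷ es) fs g = trans (cong (ℤ._+_ (g e)) (sumL-++ es fs g)) (sym (ℤₚ.+-assoc (g e) _ _))

  copies : ℕ → List (Exp n) → List (Exp n)
  copies zero es = []
  copies (suc k) es = es ++ copies k es

  sumL-copies : ∀ k es g → sumL (copies k es) g ≡ + k ℤ.* sumL es g
  sumL-copies zero es g = sym (ℤₚ.*-zeroˡ (sumL es g))
  sumL-copies (suc k) es g = trans (sumL-++ es (copies k es) g) (trans (cong (ℤ._+_ (sumL es g)) (sumL-copies k es g)) (lemma (+ k) (sumL es g)))
    where
    lemma : ∀ k s → s ℤ.+ k ℤ.* s ≡ (+ 1 ℤ.+ k) ℤ.* s
    lemma = ℤS.solve-∀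

  All-copies : ∀ {X : Exp n → Set} k es → All X es → All X (copies k es)
  All-copies zero es h = []
  All-copies (suc k) es h = Allₚ.++⁺ h (All-copies k es h)

  weights : List (ℚ × Exp n) → (Exp n → ℤ) → ℚ
  weights cs g = sumℚ (map (λ t → proj₁ t ℚ.* toℚ (g (proj₂ t))) cs)

  -- A weight `a / suc d` turns into `suc D ℕ.* a` copies of its exponent next to `suc d` copies of
  -- the list found for the rest. The equation is stated for every `g` because two kinds are needed:
  -- the constant 1 gives the length of the list, and evaluation at a variable gives the
  -- coordinates.
  clear-denominators : ∀ {X : Exp n → Set} cs → All (λ t → 0ℚ ℚ.≤ proj₁ t × X (proj₂ t)) cs →
    Σ[ D ∈ ℕ ] Σ[ es ∈ List (Exp n) ] (All X es × (∀ g → toℚ (sumL es g) ≡ toℚ (+ suc D) ℚ.* weights cs g))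
  clear-denominators [] [] = 0 , [] , [] , λ g → refl
  clear-denominators ((l , e) ∷ cs) ((l≥0 , x) ∷ xs) with clear-denominators cs xs | l in leq
  ... | D , es , h , eq | ℚ.mkℚ -[1+ a ] d c with l≥0
  ...   | ℚ.*≤* ()
  clear-denominators {X} ((l , e) ∷ cs) ((l≥0 , x) ∷ xs) | D , es , h , eq | q@(ℚ.mkℚ (+ a) d c) =
    -- The predecessor, by computation, of the new common denominator `suc D ℕ.* suc d`.
    d ℕ.+ D ℕ.* suc d , copies (suc D ℕ.* a) (e ∷ []) ++ copies (suc d) es ,
    Allₚ.++⁺ (All-copies (suc D ℕ.* a) _ (x ∷ [])) (All-copies (suc d) es h) , total
    where
    open +-*-Solver
    total : ∀ g → toℚ (sumL (copies (suc D ℕ.* a) (e ∷ []) ++ copies (suc d) es) g) ≡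
            toℚ (+ (suc D ℕ.* suc d)) ℚ.* (q ℚ.* toℚ (g e) ℚ.+ weights cs g)
    total g = begin
      toℚ (sumL (copies (suc D ℕ.* a) (e ∷ []) ++ copies (suc d) es) g)
        ≡⟨ cong toℚ (sumL-++ (copies (suc D ℕ.* a) (e ∷ [])) _ g) ⟩
      toℚ (sumL (copies (suc D ℕ.* a) (e ∷ [])) g ℤ.+ sumL (copies (suc d) es) g)
        ≡⟨ cong₂ (λ s t → toℚ (s ℤ.+ t)) (trans (sumL-copies (suc D ℕ.* a) (e ∷ []) g) (cong₂ ℤ._*_ (ℤₚ.pos-* (suc D) a) (ℤₚ.+-identityʳ (g e)))) (sumL-copies (suc d) es g) ⟩
      toℚ (+ suc D ℤ.* + a ℤ.* g e ℤ.+ + suc d ℤ.* sumL es g)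
        ≡⟨ trans (toℚ-+ (+ suc D ℤ.* + a ℤ.* g e) _) (cong₂ ℚ._+_ (trans (toℚ-* (+ suc D ℤ.* + a) (g e)) (cong (ℚ._* toℚ (g e)) (toℚ-* (+ suc D) (+ a)))) (toℚ-* (+ suc d) (sumL es g))) ⟩
      toℚ (+ suc D) ℚ.* toℚ (+ a) ℚ.* toℚ (g e) ℚ.+ toℚ (+ suc d) ℚ.* toℚ (sumL es g)
        ≡⟨ cong₂ (λ s t → toℚ (+ suc D) ℚ.* s ℚ.* toℚ (g e) ℚ.+ toℚ (+ suc d) ℚ.* t) (sym (numerator-den q)) (eq g) ⟩
      toℚ (+ suc D) ℚ.* (q ℚ.* toℚ (+ suc d)) ℚ.* toℚ (g e) ℚ.+ toℚ (+ suc d) ℚ.* (toℚ (+ suc D) ℚ.* weights cs g)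
        ≡⟨ solve 5 (λ D q d g w → D :* (q :* d) :* g :+ d :* (D :* w) := (D :* d) :* (q :* g :+ w)) refl (toℚ (+ suc D)) q (toℚ (+ suc d)) (toℚ (g e)) (weights cs g) ⟩
      (toℚ (+ suc D) ℚ.* toℚ (+ suc d)) ℚ.* (q ℚ.* toℚ (g e) ℚ.+ weights cs g)
        ≡⟨ cong (ℚ._* (q ℚ.* toℚ (g e) ℚ.+ weights cs g)) (trans (sym (toℚ-* (+ suc D) (+ suc d))) (cong toℚ (sym (ℤₚ.pos-* (suc D) (suc d))))) ⟩
      toℚ (+ (suc D ℕ.* suc d)) ℚ.* (q ℚ.* toℚ (g e) ℚ.+ weights cs g) ∎
      where open ≡-Reasoning

  sumF-lookup : ∀ es (g : Exp n → ℤ) → sumF (λ i → g (List.lookup es i)) ≡ sumL es g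
  sumF-lookup [] g = refl
  sumF-lookup (e ∷ es) g = cong (ℤ._+_ (g e)) (sumF-lookup es g)

  sumL-1 : ∀ es → sumL es (λ _ → + 1) ≡ + List.length es
  sumL-1 [] = refl
  sumL-1 (e ∷ es) = cong (ℤ._+_ (+ 1)) (sumL-1 es)

  Sat⇒Saturated : ∀ {p : LP n} {X} → Rep p X → Sat X → Saturated p
  Sat⇒Saturated {p} {X} R sat u (cs , all , total , eq) =
    go (clear-denominators {X} cs (All.map (λ { {l , e} (l≥0 , s) → l≥0 , Rep-Support R e s }) all))
    where
    weight-sum : ∀ cs → weights cs (λ _ → + 1) ≡ sumℚ (map (λ { (l , e) → l }) cs)
    weight-sum [] = refl
    weight-sum ((l , e) ∷ cs) = cong₂ ℚ._+_ (ℚₚ.*-identityʳ l) (weight-sum cs)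
    weight-coord : ∀ v cs → weights cs (λ e → e v) ≡ sumℚ (map (λ { (l , e) → l ℚ.* toℚ (e v) }) cs)
    weight-coord v [] = refl
    weight-coord v ((l , e) ∷ cs) = cong (ℚ._+_ (l ℚ.* toℚ (e v))) (weight-coord v cs)
    go : Σ[ D ∈ ℕ ] Σ[ es ∈ List (Exp n) ] (All X es × (∀ g → toℚ (sumL es g) ≡ toℚ (+ suc D) ℚ.* weights cs g)) → Support p u
    go (D , es , xs , h) = done es xs (λ v → trans (sum-coord v) (cong (ℤ._* u v) (sym len))) len
      where
      -- The weights add up to 1, so the number of copies is the common denominator; in particular
      -- the list is not empty.
      len : + List.length es ≡ + suc D
      len = trans (sym (sumL-1 es)) (toℚ-injective (trans (h (λ _ → + 1)) (trans (cong (toℚ (+ suc D) ℚ.*_) (trans (weight-sum cs) total)) (ℚₚ.*-identityʳ _))))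
      sum-coord : ∀ v → sumL es (λ e → e v) ≡ + suc D ℤ.* u v
      sum-coord v = toℚ-injective (trans (h (λ e → e v)) (trans (cong (toℚ (+ suc D) ℚ.*_) (trans (weight-coord v cs) (eq v))) (sym (toℚ-* (+ suc D) (u v)))))
      done : ∀ es → All X es → (∀ v → sumL es (λ e → e v) ≡ + List.length es ℤ.* u v) → + List.length es ≡ + suc D → Support p u
      done (e ∷ es) xs k _ = Support-Rep R u (sat (List.length es) (List.lookup (e ∷ es)) u (λ i → All.lookup xs (∈-lookup i)) (λ v → mkAvg (trans (sumF-lookup (e ∷ es) (λ e → e v)) (k v))))

-- Averages of integer families

sumF-cong : ∀ {m} {f g : Fin m → ℤ} → (∀ i → f i ≡ g i) → sumF f ≡ sumF g
sumF-cong {zero} h = refl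
sumF-cong {suc m} h = cong₂ ℤ._+_ (h Fz) (sumF-cong (λ i → h (Fs i)))

module _ {N : ℕ} where

  Avg-cong : ∀ {f g : Fin N → ℤ} {m} → (∀ i → f i ≡ g i) → Avg g m → Avg f m
  Avg-cong h a = mkAvg (trans (sumF-cong h) (unAvg a))

  Avg-const : ∀ c → Avg {N} (λ _ → c) c
  Avg-const c = mkAvg (go N)
    where
    lemma : ∀ c n → c ℤ.+ n ℤ.* c ≡ (+ 1 ℤ.+ n) ℤ.* c
    lemma = ℤS.solve-∀
    go : ∀ m → sumF {m} (λ _ → c) ≡ + m ℤ.* c
    go zero = sym (ℤₚ.*-zeroˡ c)
    go (suc m) = trans (cong (ℤ._+_ c) (go m)) (lemma c (+ m))

  Avg-+ : ∀ {f g : Fin N → ℤ} {a b} → Avg f a → Avg g b → Avg (λ i → f i ℤ.+ g i) (a ℤ.+ b)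
  Avg-+ {f} {g} {a} {b} (mkAvg p) (mkAvg q) = mkAvg (trans (go f g) (trans (cong₂ ℤ._+_ p q) (sym (ℤₚ.*-distribˡ-+ (+ N) a b))))
    where
    lemma : ∀ a b c d → a ℤ.+ b ℤ.+ (c ℤ.+ d) ≡ a ℤ.+ c ℤ.+ (b ℤ.+ d)
    lemma = ℤS.solve-∀
    go : ∀ {m} (f g : Fin m → ℤ) → sumF (λ i → f i ℤ.+ g i) ≡ sumF f ℤ.+ sumF g
    go {zero} f g = refl
    go {suc m} f g = trans (cong (ℤ._+_ (f Fz ℤ.+ g Fz)) (go (λ i → f (Fs i)) (λ i → g (Fs i)))) (lemma (f Fz) (g Fz) _ _)

  Avg-*c : ∀ {f : Fin N → ℤ} {a} c → Avg f a → Avg (λ i → f i ℤ.* c) (a ℤ.* c)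
  Avg-*c {f} {a} c (mkAvg p) = mkAvg (trans (go f) (trans (cong (ℤ._* c) p) (ℤₚ.*-assoc (+ N) a c)))
    where
    go : ∀ {m} (f : Fin m → ℤ) → sumF (λ i → f i ℤ.* c) ≡ sumF f ℤ.* c
    go {zero} f = sym (ℤₚ.*-zeroˡ c)
    go {suc m} f = trans (cong (ℤ._+_ (f Fz ℤ.* c)) (go (λ i → f (Fs i)))) (sym (ℤₚ.*-distribʳ-+ c (f Fz) _))

  Avg-neg : ∀ {f : Fin N → ℤ} {a} → Avg f a → Avg (λ i → ℤ.- f i) (ℤ.- a)
  Avg-neg {f} {a} p = mkAvg (trans (sumF-cong (λ i → lemma (f i))) (trans (unAvg (Avg-*c (ℤ.- + 1) p)) (cong (ℤ._*_ (+ N)) (sym (lemma a)))))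
    where
    lemma : ∀ a → ℤ.- a ≡ a ℤ.* ℤ.- + 1
    lemma = ℤS.solve-∀

  Avg-sub : ∀ {f g : Fin N → ℤ} {a b} → Avg f a → Avg g b → Avg (λ i → f i ℤ.- g i) (a ℤ.- b)
  Avg-sub p q = Avg-+ p (Avg-neg q)

sumF-≤ : ∀ {m} {f g : Fin m → ℤ} → (∀ i → f i ℤ.≤ g i) → sumF f ℤ.≤ sumF g
sumF-≤ {zero} h = ℤₚ.≤-refl
sumF-≤ {suc m} h = ℤₚ.+-mono-≤ (h Fz) (sumF-≤ (λ i → h (Fs i)))

sumF-≤-≡ : ∀ {m} {f g : Fin m → ℤ} → (∀ i → f i ℤ.≤ g i) → sumF f ≡ sumF g → ∀ i → f i ≡ g i
sumF-≤-≡ {suc m} {f} {g} h eq i with f Fz ℤₚ.≟ g Fz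
... | no ¬p = ⊥-elim (ℤₚ.<-irrefl eq (ℤₚ.+-mono-<-≤ (ℤₚ.≤∧≢⇒< (h Fz) ¬p) (sumF-≤ (λ i → h (Fs i)))))
sumF-≤-≡ {suc m} {f} {g} h eq Fz | yes p = p
sumF-≤-≡ {suc m} {f} {g} h eq (Fs i) | yes p =
  sumF-≤-≡ (λ i → h (Fs i)) (ℤG.∙-cancelˡ (f Fz) _ _ (trans eq (cong (ℤ._+ sumF (λ i → g (Fs i))) (sym p)))) i

module _ {M : ℕ} where

  Avg-≤ : ∀ {f g : Fin (suc M) → ℤ} {a b} → Avg f a → Avg g b → (∀ i → f i ℤ.≤ g i) → a ℤ.≤ b
  Avg-≤ {a = a} {b} (mkAvg p) (mkAvg q) h = ℤₚ.*-cancelˡ-≤-pos a b (+ suc M) (subst₂ ℤ._≤_ p q (sumF-≤ h))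

  -- Rigidity: this is the passage from an average back to its members. Applied with a constant
  -- bound, it says that a bounded quantity whose average is extremal is constant.
  Avg-≡ : ∀ {f g : Fin (suc M) → ℤ} {a} → Avg f a → Avg g a → (∀ i → f i ℤ.≤ g i) → ∀ i → f i ≡ g i
  Avg-≡ (mkAvg p) (mkAvg q) h = sumF-≤-≡ h (trans p (sym q))

  Avg-unique : ∀ {f : Fin (suc M) → ℤ} {a b} → Avg f a → Avg f b → a ≡ b
  Avg-unique {a = a} {b} (mkAvg p) (mkAvg q) = ℤₚ.*-cancelˡ-≡ (+ suc M) a b (trans (sym p) q)

≤-by : ∀ {a b d} → + 0 ℤ.≤ d → a ℤ.+ d ≡ b → a ℤ.≤ b
≤-by {a} {b} {d} p refl = subst (ℤ._≤ a ℤ.+ d) (ℤₚ.+-identityʳ a) (ℤₚ.+-monoʳ-≤ a p)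

01-cases : ∀ {y} → + 0 ℤ.≤ y → y ℤ.≤ + 1 → y ≡ + 0 ⊎ y ≡ + 1
01-cases {+ 0} _ _ = inj₁ refl
01-cases {+ 1} _ _ = inj₂ refl
01-cases {+ suc (suc _)} _ (ℤ.+≤+ (ℕ.s≤s ()))

012-cases : ∀ {y} → + 0 ℤ.≤ y → y ℤ.≤ + 2 → y ≡ + 0 ⊎ y ≡ + 1 ⊎ y ≡ + 2
012-cases {+ 0} _ _ = inj₁ refl
012-cases {+ 1} _ _ = inj₂ (inj₁ refl)
012-cases {+ 2} _ _ = inj₂ (inj₂ refl)
012-cases {+ suc (suc (suc _))} _ (ℤ.+≤+ (ℕ.s≤s (ℕ.s≤s ())))

-- Triangulations of the polygon with vertices a, …, c, as binary trees

data Tree : ℕ → ℕ → Set where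
  leaf : ∀ {a} → Tree a (suc a)
  node : ∀ {a b c} → Tree a b → Tree b c → Tree a c

Tree-< : ∀ {a c} → Tree a c → a < c
Tree-< leaf = ℕₚ.≤-refl
Tree-< (node l r) = ℕₚ.<-trans (Tree-< l) (Tree-< r)

data Loc : ∀ {a c} → Tree a c → Set where
  atL atR : ∀ {a c} {t : Tree a c} → Loc t
  inL : ∀ {a b c} {l : Tree a b} {r : Tree b c} → Loc l → Loc (node l r)
  inR : ∀ {a b c} {l : Tree a b} {r : Tree b c} → Loc r → Loc (node l r)

pos : ∀ {a c} {t : Tree a c} → Loc t → ℕ
pos {a} atL = a
pos {_} {c} atR = c
pos (inL x) = pos x
pos (inR x) = pos x

-- A pair of vertices; split locates the two in the two subpolygons cut off by a triangle.
data Loc2 : ∀ {a c} → Tree a c → Set where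
  ends : ∀ {a c} {t : Tree a c} → Loc2 t
  inL : ∀ {a b c} {l : Tree a b} {r : Tree b c} → Loc2 l → Loc2 (node l r)
  inR : ∀ {a b c} {l : Tree a b} {r : Tree b c} → Loc2 r → Loc2 (node l r)
  split : ∀ {a b c} {l : Tree a b} {r : Tree b c} → Loc l → Loc r → Loc2 (node l r)

fst2 snd2 : ∀ {a c} {t : Tree a c} → Loc2 t → Loc t
fst2 ends = atL
fst2 (inL q) = inL (fst2 q)
fst2 (inR q) = inR (fst2 q)
fst2 (split x y) = inL x
snd2 ends = atR
snd2 (inL q) = inL (snd2 q)
snd2 (inR q) = inR (snd2 q)
snd2 (split x y) = inR y

locate : ∀ {a c} (t : Tree a c) v → a ≤ v → v ≤ c → Σ[ x ∈ Loc t ] pos x ≡ v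
locate {a} {c} t v a≤v v≤c with a ℕₚ.≟ v | v ℕₚ.≟ c
... | yes refl | _ = atL , refl
... | no _ | yes refl = atR , refl
locate leaf v a≤v v≤c | no p | no q = ⊥-elim (q (ℕₚ.≤-antisym v≤c (ℕₚ.≤∧≢⇒< a≤v p)))
locate (node {b = b} l r) v a≤v v≤c | no p | no q with ℕₚ.≤-total v b
... | inj₁ v≤b = let (x , h) = locate l v a≤v v≤b in inL x , h
... | inj₂ b≤v = let (x , h) = locate r v b≤v v≤c in inR x , h

locate2 : ∀ {a c} (t : Tree a c) v w → a ≤ v → v < w → w ≤ c → Σ[ q ∈ Loc2 t ] (pos (fst2 q) ≡ v × pos (snd2 q) ≡ w)
locate2 leaf v w a≤v v<w w≤c = ends , ℕₚ.≤-antisym a≤v (ℕ.s≤s⁻¹ (ℕₚ.≤-trans v<w w≤c)) , ℕₚ.≤-antisym (ℕₚ.≤-trans (ℕ.s≤s a≤v) v<w) w≤c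
locate2 {a} {c} (node {b = b} l r) v w a≤v v<w w≤c with ℕₚ.≤-total w b | ℕₚ.≤-total b v | a ℕₚ.≟ v | w ℕₚ.≟ c
... | inj₁ w≤b | _ | _ | _ = let (q , h) = locate2 l v w a≤v v<w w≤b in inL q , h
... | inj₂ _ | inj₁ b≤v | _ | _ = let (q , h) = locate2 r v w b≤v v<w w≤c in inR q , h
... | inj₂ _ | inj₂ _ | yes refl | yes refl = ends , refl , refl
... | inj₂ b≤w | inj₂ v≤b | _ | _ = let (x , h) = locate l v a≤v v≤b ; (y , k) = locate r w b≤w w≤c in split x y , h , k

-- Exponents of expansions in a triangulated polygon whose vertices are 0, …, n + 1.
-- ℓ p q is the exponent of the side or diagonal pq; for "regular" ones it is a variable
-- var p q that occurs in no other label.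

Reg : ℕ → ℕ → ℕ → Set
Reg n p q = p < q × q ≤ n × q < p ℕ.+ n

-- The side `ac` itself is left out, because its exponent is not yet final inside the polygon.
Under : ℕ → ℕ → ℕ → ℕ → Set
Under a c p q = a ≤ p × q ≤ c × (a < p ⊎ q < c)

module Expansion {n : ℕ} (ℓ : ℕ → ℕ → Exp n) (var : ℕ → ℕ → Var n)
  (ℓ-self : ∀ p q → Reg n p q → ℓ p q (var p q) ≡ + 1)
  (ℓ-other : ∀ p q → Reg n p q → ∀ p' q' → p' < q' → q' ≤ suc n → ¬ (p' ≡ p × q' ≡ q) → ℓ p' q' (var p q) ≡ + 0)
  where

  -- The arguments are a tag, the exponent of the side `ac`, and the exponent of everything inside.
  -- The power of `ac` is kept apart because the triangle on the other side of `ac` still changes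
  -- it.
  Tagged : Set₁
  Tagged = ℤ → ℤ → Exp n → Set

  -- Comes from substituting `(ab/ac) Φ c + (bc/ac) Φ a` for `Φ b`. Of the `z` factors at b, `z'` go
  -- to c with `ab/ac` and `z - z'` go to a with `bc/ac`; those at a stay. The number of factors is
  -- left open, so that one walk and a pair of walks share this step.
  record StepL (Low : Tagged) (a b c : ℕ) (z' ρ' : ℤ) (e' : Exp n) : Set where
    constructor mkL
    field
      z ρ : ℤ
      e   : Exp n
      low : Low z ρ e
      lo  : + 0 ℤ.≤ z'
      hi  : z' ℤ.≤ z
      ρ≡  : ρ' ≡ ℤ.- z
      e≐  : ∀ v → e' v ≡ e v ℤ.+ (ρ ℤ.+ z') ℤ.* ℓ a b v ℤ.+ (z ℤ.- z') ℤ.* ℓ b c v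

  -- In the right subpolygon tag 1 means c, so `k` factors with total tag `z` leave `k - z` of them
  -- at b, and the tag can only grow. `k` is 1 for one walk and 2 for a pair.
  record StepR (k : ℤ) (Low : Tagged) (a b c : ℕ) (z' ρ' : ℤ) (e' : Exp n) : Set where
    constructor mkR
    field
      z ρ : ℤ
      e   : Exp n
      low : Low z ρ e
      lo  : z ℤ.≤ z'
      hi  : z' ℤ.≤ k
      ρ≡  : ρ' ≡ z ℤ.- k
      e≐  : ∀ v → e' v ≡ e v ℤ.+ (ρ ℤ.+ k ℤ.- z') ℤ.* ℓ b c v ℤ.+ (z' ℤ.- z) ℤ.* ℓ a b v

  -- The vector of a vertex v of the polygon a … c is Σ x^(e + ρ·ac) (a if y = 0, c if y = 1) over (y, ρ, e) in Z.
  Z : ∀ {a c} {t : Tree a c} → Loc t → Tagged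
  Z atL y ρ e = y ≡ + 0 × ρ ≡ + 0 × e ≐ 0ᵉ
  Z atR y ρ e = y ≡ + 1 × ρ ≡ + 0 × e ≐ 0ᵉ
  Z (inL {a} {b} {c} x) = StepL (Z x) a b c
  Z (inR {a} {b} {c} x) = StepR (+ 1) (Z x) a b c

  -- The triangle where two walks meet. `y₁` chooses between a and b, `y₂` between b and c, so
  -- `1 + y₁ - y₂` factors stand at b and are distributed over a and c. The bounds on `z'` express
  -- that a factor already at c, or already at a, stays there.
  record Join (Low₁ Low₂ : Tagged) (a b c : ℕ) (Cond : ℤ → ℤ → ℤ → Set) (z' ρ' : ℤ) (e' : Exp n) : Set where
    constructor mkJ
    field
      y₁ ρ₁ : ℤ
      e₁    : Exp n
      low₁  : Low₁ y₁ ρ₁ e₁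
      y₂ ρ₂ : ℤ
      e₂    : Exp n
      low₂  : Low₂ y₂ ρ₂ e₂
      lo    : y₂ ℤ.≤ z'
      hi    : z' ℤ.≤ + 1 ℤ.+ y₁
      cond  : Cond y₁ y₂ z'
      ρ≡    : ρ' ≡ y₂ ℤ.- + 1 ℤ.- y₁
      e≐    : ∀ v → e' v ≡ e₁ v ℤ.+ e₂ v ℤ.+ (ρ₁ ℤ.+ z' ℤ.- y₂) ℤ.* ℓ a b v ℤ.+ (ρ₂ ℤ.+ + 1 ℤ.+ y₁ ℤ.- z') ℤ.* ℓ b c v

  -- The tags beyond the triangle satisfy `y_w ≤ y₁` and `y₂ ≤ y_v` and have sum `z`, so `y_v ≤ y_w`
  -- gives `2 y₂ ≤ z ≤ 2 y₁`. Conversely, for `z` equal to 0, 1, 2 these bounds leave room for the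
  -- tags (0, 0), (1, 0), (1, 1) of w and v.
  Good : Bool → ℤ → ℤ → ℤ → Set
  Good b y₁ y₂ z = b ≡ true → y₂ ℤ.+ y₂ ℤ.≤ z × z ℤ.≤ y₁ ℤ.+ y₁

  -- Sums of one element of Z for each of two vertices w < v; the flag true restricts
  -- to the sums that can be written with tags y_v ≤ y_w.
  Q : Bool → ∀ {a c} {t : Tree a c} → Loc2 t → Tagged
  -- The vertices w and v are a and c, with tags 0 and 1: the forbidden order.
  Q b ends z ρ e = b ≡ false × z ≡ + 1 × ρ ≡ + 0 × e ≐ 0ᵉ
  -- If the new sum is 0 or 2, the two new tags are equal whatever happened below. If it is 1, they
  -- have to be (1, 0), and this requires that the sum below could be ordered as well.
  Q b (inL {a} {b₁} {c} q) z ρ e = Σ[ b' ∈ Bool ] (StepL (Q b' q) a b₁ c z ρ e × (b ≡ true → b' ≡ true ⊎ z ≢ + 1))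
  Q b (inR {a} {b₁} {c} q) z ρ e = Σ[ b' ∈ Bool ] (StepR (+ 2) (Q b' q) a b₁ c z ρ e × (b ≡ true → b' ≡ true ⊎ z ≢ + 1))
  Q b (split {a} {b₁} {c} x y) = Join (Z x) (Z y) a b₁ c (Good b)

  record AvgOf {M} (z ρ : Fin (suc M) → ℤ) (e : Fin (suc M) → Exp n) (R : Tagged) : Set where
    constructor mkA
    field
      z̄ ρ̄ : ℤ
      ē   : Exp n
      rel : R z̄ ρ̄ ē
      avz : Avg z z̄
      avρ : Avg ρ ρ̄
      ave : ∀ v → Avg (λ i → e i v) (ē v)

  -- R is closed under averages as soon as these are integral at the labels strictly inside the polygon a … c.
  Averages : ℕ → ℕ → Tagged → Set
  Averages a c R = ∀ {M} (z ρ : Fin (suc M) → ℤ) (e : Fin (suc M) → Exp n) → (∀ i → R (z i) (ρ i) (e i)) →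
    (∀ p q → Reg n p q → Under a c p q → ∃[ m ] Avg (λ i → e i (var p q)) m) → AvgOf z ρ e R

  Supported : ℕ → ℕ → Tagged → Set
  Supported a c R = ∀ {z ρ e} → R z ρ e → ∀ p q → Reg n p q → ¬ Under a c p q → e (var p q) ≡ + 0

  module Node {a b c : ℕ} (a<b : a < b) (b<c : b < c) (c≤ : c ≤ suc n) where

    UnderL : ∀ {p q} → Under a b p q → Under a c p q
    UnderL (h , k , _) = h , ℕₚ.≤-trans k (ℕₚ.<⇒≤ b<c) , inj₂ (ℕₚ.≤-<-trans k b<c)

    UnderR : ∀ {p q} → Under b c p q → Under a c p q
    UnderR (h , k , _) = ℕₚ.≤-trans (ℕₚ.<⇒≤ a<b) h , k , inj₁ (ℕₚ.<-≤-trans a<b h)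

    UnderLR : ∀ {p q} → Reg n p q → Under a b p q → ¬ Under b c p q
    UnderLR (p<q , _) (_ , h , _) (k , _) = ℕₚ.<-irrefl refl (ℕₚ.<-≤-trans p<q (ℕₚ.≤-trans h k))

    ab∉ : ¬ Under a b a b
    ab∉ (_ , _ , inj₁ h) = ℕₚ.<-irrefl refl h
    ab∉ (_ , _ , inj₂ h) = ℕₚ.<-irrefl refl h

    ab∉R : ¬ Under b c a b
    ab∉R (h , _) = ℕₚ.<-irrefl refl (ℕₚ.<-≤-trans a<b h)

    ℓab≡0 : ∀ {p q} → Reg n p q → ¬ Under a c p q → ℓ a b (var p q) ≡ + 0
    ℓab≡0 reg h = ℓ-other _ _ reg a b a<b (ℕₚ.≤-trans (ℕₚ.<⇒≤ b<c) c≤) λ { (refl , refl) → h (ℕₚ.≤-refl , ℕₚ.<⇒≤ b<c , inj₂ b<c) }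

    ℓbc≡0 : ∀ {p q} → Reg n p q → ¬ Under a c p q → ℓ b c (var p q) ≡ + 0
    ℓbc≡0 reg h = ℓ-other _ _ reg b c b<c c≤ λ { (refl , refl) → h (ℕₚ.<⇒≤ a<b , ℕₚ.≤-refl , inj₁ a<b) }

    ℓab≡0ˡ : ∀ {p q} → Reg n p q → Under a b p q → ℓ a b (var p q) ≡ + 0
    ℓab≡0ˡ reg h = ℓ-other _ _ reg a b a<b (ℕₚ.≤-trans (ℕₚ.<⇒≤ b<c) c≤) λ { (refl , refl) → ab∉ h }

    ℓbc≡0ˡ : ∀ {p q} → Reg n p q → Under a b p q → ℓ b c (var p q) ≡ + 0
    ℓbc≡0ˡ (p<q , reg) (_ , h , _) = ℓ-other _ _ (p<q , reg) b c b<c c≤ λ { (refl , refl) → ℕₚ.<-irrefl refl (ℕₚ.<-≤-trans p<q h) }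

    ℓab≡0ʳ : ∀ {p q} → Reg n p q → Under b c p q → ℓ a b (var p q) ≡ + 0
    ℓab≡0ʳ (p<q , reg) (h , _) = ℓ-other _ _ (p<q , reg) a b a<b (ℕₚ.≤-trans (ℕₚ.<⇒≤ b<c) c≤) λ { (refl , refl) → ℕₚ.<-irrefl refl (ℕₚ.≤-<-trans h a<b) }

    ℓbc≡0ʳ : ∀ {p q} → Reg n p q → Under b c p q → ℓ b c (var p q) ≡ + 0
    ℓbc≡0ʳ reg (_ , _ , h) = ℓ-other _ _ reg b c b<c c≤ λ { (refl , refl) → irr h }
      where
      irr : b < b ⊎ c < c → ⊥
      irr (inj₁ h) = ℕₚ.<-irrefl refl h
      irr (inj₂ h) = ℕₚ.<-irrefl refl h

    ℓbc-ab≡0 : Reg n a b → ℓ b c (var a b) ≡ + 0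
    ℓbc-ab≡0 reg = ℓ-other _ _ reg b c b<c c≤ λ { (refl , _) → ℕₚ.<-irrefl refl a<b }

    vanish : ∀ A B {e x y} → e ≡ + 0 → x ≡ + 0 → y ≡ + 0 → e ℤ.+ A ℤ.* x ℤ.+ B ℤ.* y ≡ + 0
    vanish A B refl refl refl rewrite ℤₚ.*-zeroʳ A | ℤₚ.*-zeroʳ B = refl

    keep : ∀ A B {e x y} → x ≡ + 0 → y ≡ + 0 → e ℤ.+ A ℤ.* x ℤ.+ B ℤ.* y ≡ e
    keep A B {e} refl refl rewrite ℤₚ.*-zeroʳ A | ℤₚ.*-zeroʳ B = trans (ℤₚ.+-identityʳ _) (ℤₚ.+-identityʳ e)

    StepL-supported : ∀ {Low} → Supported a b Low → Supported a c (StepL Low a b c)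
    StepL-supported sup {z'} s p q reg h = trans (StepL.e≐ s (var p q))
      (vanish (StepL.ρ s ℤ.+ z') (StepL.z s ℤ.- z') (sup (StepL.low s) p q reg (λ u → h (UnderL u))) (ℓab≡0 reg h) (ℓbc≡0 reg h))

    StepR-supported : ∀ {k Low} → Supported b c Low → Supported a c (StepR k Low a b c)
    StepR-supported {k} sup {z'} s p q reg h = trans (StepR.e≐ s (var p q))
      (vanish (StepR.ρ s ℤ.+ k ℤ.- z') (z' ℤ.- StepR.z s) (sup (StepR.low s) p q reg (λ u → h (UnderR u))) (ℓbc≡0 reg h) (ℓab≡0 reg h))

    Join-supported : ∀ {Low₁ Low₂ : Tagged} {C} → Supported a b Low₁ → Supported b c Low₂ → Supported a c (Join Low₁ Low₂ a b c C)
    Join-supported s₁ s₂ {z'} s p q reg h = trans (Join.e≐ s (var p q))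
      (vanish (Join.ρ₁ s ℤ.+ z' ℤ.- Join.y₂ s) (Join.ρ₂ s ℤ.+ + 1 ℤ.+ Join.y₁ s ℤ.- z') (cong₂ ℤ._+_ (s₁ (Join.low₁ s) p q reg (λ u → h (UnderL u))) (s₂ (Join.low₂ s) p q reg (λ u → h (UnderR u)))) (ℓab≡0 reg h) (ℓbc≡0 reg h))

    module _ {M} {z' ρ' : Fin (suc M) → ℤ} {e' : Fin (suc M) → Exp n} where

      -- The exponent of ab in e' is ρ + z', and ρ has an integral average.
      StepL-avg : ∀ {Low : Fin (suc M) → Tagged} {Low̄ : Tagged} → (s : ∀ i → StepL (Low i) a b c (z' i) (ρ' i) (e' i)) → Reg n a b →
        (∀ i → StepL.e (s i) (var a b) ≡ + 0) → ∃[ m ] Avg (λ i → e' i (var a b)) m →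
        AvgOf (λ i → StepL.z (s i)) (λ i → StepL.ρ (s i)) (λ i → StepL.e (s i)) Low̄ →
        AvgOf z' ρ' e' (StepL Low̄ a b c)
      StepL-avg s reg e≡0 (m , avm) (mkA z̄ ρ̄ ē rel avz avρ ave) = mkA (m ℤ.- ρ̄) (ℤ.- z̄)
        (λ v → ē v ℤ.+ (ρ̄ ℤ.+ (m ℤ.- ρ̄)) ℤ.* ℓ a b v ℤ.+ (z̄ ℤ.- (m ℤ.- ρ̄)) ℤ.* ℓ b c v)
        (mkL z̄ ρ̄ ē rel (Avg-≤ (Avg-const (+ 0)) avz' (λ i → StepL.lo (s i))) (Avg-≤ avz' avz (λ i → StepL.hi (s i))) refl (λ _ → refl))
        avz' (Avg-cong (λ i → StepL.ρ≡ (s i)) (Avg-neg avz))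
        (λ v → Avg-cong (λ i → StepL.e≐ (s i) v) (Avg-+ (Avg-+ (ave v) (Avg-*c (ℓ a b v) (Avg-+ avρ avz'))) (Avg-*c (ℓ b c v) (Avg-sub avz avz'))))
        where
        coord : ∀ i → z' i ≡ e' i (var a b) ℤ.- StepL.ρ (s i)
        coord i = sym (trans (cong (ℤ._- StepL.ρ (s i)) (trans (StepL.e≐ (s i) (var a b)) (trans
          (cong₂ (λ x y → StepL.e (s i) (var a b) ℤ.+ (StepL.ρ (s i) ℤ.+ z' i) ℤ.* x ℤ.+ (StepL.z (s i) ℤ.- z' i) ℤ.* y) (ℓ-self a b reg) (ℓbc-ab≡0 reg))
          (cong (λ x → x ℤ.+ (StepL.ρ (s i) ℤ.+ z' i) ℤ.* + 1 ℤ.+ (StepL.z (s i) ℤ.- z' i) ℤ.* + 0) (e≡0 i)))))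
          (lemma (StepL.ρ (s i)) (z' i) (StepL.z (s i))))
          where
          lemma : ∀ ρ z' z → + 0 ℤ.+ (ρ ℤ.+ z') ℤ.* + 1 ℤ.+ (z ℤ.- z') ℤ.* + 0 ℤ.- ρ ≡ z'
          lemma = ℤS.solve-∀
        avz' : Avg z' (m ℤ.- ρ̄)
        avz' = Avg-cong coord (Avg-sub avm avρ)

      -- The tag is again read off at `ab`, where the exponent is `z' - z`, although the diagonal
      -- crossed is `bc`: the latter may end at the puncture and then is not regular.
      StepR-avg : ∀ {k} {Low : Fin (suc M) → Tagged} {Low̄ : Tagged} → (s : ∀ i → StepR k (Low i) a b c (z' i) (ρ' i) (e' i)) → Reg n a b →
        (∀ i → StepR.e (s i) (var a b) ≡ + 0) → ∃[ m ] Avg (λ i → e' i (var a b)) m →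
        AvgOf (λ i → StepR.z (s i)) (λ i → StepR.ρ (s i)) (λ i → StepR.e (s i)) Low̄ →
        AvgOf z' ρ' e' (StepR k Low̄ a b c)
      StepR-avg {k} s reg e≡0 (m , avm) (mkA z̄ ρ̄ ē rel avz avρ ave) = mkA (m ℤ.+ z̄) (z̄ ℤ.- k)
        (λ v → ē v ℤ.+ (ρ̄ ℤ.+ k ℤ.- (m ℤ.+ z̄)) ℤ.* ℓ b c v ℤ.+ (m ℤ.+ z̄ ℤ.- z̄) ℤ.* ℓ a b v)
        (mkR z̄ ρ̄ ē rel (Avg-≤ avz avz' (λ i → StepR.lo (s i))) (Avg-≤ avz' (Avg-const k) (λ i → StepR.hi (s i))) refl (λ _ → refl))
        avz' (Avg-cong (λ i → StepR.ρ≡ (s i)) (Avg-sub avz (Avg-const k)))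
        (λ v → Avg-cong (λ i → StepR.e≐ (s i) v) (Avg-+ (Avg-+ (ave v) (Avg-*c (ℓ b c v) (Avg-sub (Avg-+ avρ (Avg-const k)) avz'))) (Avg-*c (ℓ a b v) (Avg-sub avz' avz))))
        where
        coord : ∀ i → z' i ≡ e' i (var a b) ℤ.+ StepR.z (s i)
        coord i = sym (trans (cong (ℤ._+ StepR.z (s i)) (trans (StepR.e≐ (s i) (var a b)) (trans
          (cong₂ (λ x y → StepR.e (s i) (var a b) ℤ.+ (StepR.ρ (s i) ℤ.+ k ℤ.- z' i) ℤ.* y ℤ.+ (z' i ℤ.- StepR.z (s i)) ℤ.* x) (ℓ-self a b reg) (ℓbc-ab≡0 reg))
          (cong (λ x → x ℤ.+ (StepR.ρ (s i) ℤ.+ k ℤ.- z' i) ℤ.* + 0 ℤ.+ (z' i ℤ.- StepR.z (s i)) ℤ.* + 1) (e≡0 i)))))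
          (lemma (StepR.ρ (s i) ℤ.+ k ℤ.- z' i) (z' i) (StepR.z (s i))))
          where
          lemma : ∀ A z' z → + 0 ℤ.+ A ℤ.* + 0 ℤ.+ (z' ℤ.- z) ℤ.* + 1 ℤ.+ z ≡ z'
          lemma = ℤS.solve-∀
        avz' : Avg z' (m ℤ.+ z̄)
        avz' = Avg-cong coord (Avg-+ avm avz)

      StepL-low : ∀ {Low : Fin (suc M) → Tagged} → (s : ∀ i → StepL (Low i) a b c (z' i) (ρ' i) (e' i)) →
        (∀ p q → Reg n p q → Under a c p q → ∃[ m ] Avg (λ i → e' i (var p q)) m) →
        (∀ p q → Reg n p q → Under a b p q → ∃[ m ] Avg (λ i → StepL.e (s i) (var p q)) m)
      StepL-low s h p q reg u = let (m , av) = h p q reg (UnderL u) in m ,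
        Avg-cong (λ i → sym (trans (StepL.e≐ (s i) (var p q)) (keep (StepL.ρ (s i) ℤ.+ z' i) (StepL.z (s i) ℤ.- z' i) (ℓab≡0ˡ reg u) (ℓbc≡0ˡ reg u)))) av

      StepR-low : ∀ {k} {Low : Fin (suc M) → Tagged} → (s : ∀ i → StepR k (Low i) a b c (z' i) (ρ' i) (e' i)) →
        (∀ p q → Reg n p q → Under a c p q → ∃[ m ] Avg (λ i → e' i (var p q)) m) →
        (∀ p q → Reg n p q → Under b c p q → ∃[ m ] Avg (λ i → StepR.e (s i) (var p q)) m)
      StepR-low {k} s h p q reg u = let (m , av) = h p q reg (UnderR u) in m ,
        Avg-cong (λ i → sym (trans (StepR.e≐ (s i) (var p q)) (keep (StepR.ρ (s i) ℤ.+ k ℤ.- z' i) (z' i ℤ.- StepR.z (s i)) (ℓbc≡0ʳ reg u) (ℓab≡0ʳ reg u)))) av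

  -- Among the polygons that occur this excludes only the whole one, from 0 to n + 1. There the side
  -- `ab` of the top triangle can be the loop from 0 to n; in all others it is regular (`regAB`).
  Inner : ℕ → ℕ → Set
  Inner a c = c ≤ suc n × (0 < a ⊎ c ≤ n)

  module InnerNode {a b c : ℕ} (a<b : a < b) (b<c : b < c) (inn : Inner a c) where
    open Node a<b b<c (proj₁ inn) public

    b≤n : b ≤ n
    b≤n = ℕ.s≤s⁻¹ (ℕₚ.≤-trans b<c (proj₁ inn))

    innerL : Inner a b
    innerL = ℕₚ.m≤n⇒m≤1+n b≤n , inj₂ b≤n

    innerR : Inner b c
    innerR = proj₁ inn , inj₁ (ℕₚ.≤-<-trans ℕ.z≤n a<b)

    regAB : Reg n a b
    regAB = a<b , b≤n , go (proj₂ inn)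
      where
      go : 0 < a ⊎ c ≤ n → b < a ℕ.+ n
      go (inj₁ h) = ℕₚ.≤-<-trans b≤n (ℕₚ.m<n+m n h)
      go (inj₂ h) = ℕₚ.<-≤-trans b<c (ℕₚ.≤-trans h (ℕₚ.m≤n+m n a))

    underAB : Under a c a b
    underAB = ℕₚ.≤-refl , ℕₚ.<⇒≤ b<c , inj₂ b<c

  Z-supported : ∀ {a c} {t : Tree a c} (x : Loc t) → c ≤ suc n → Supported a c (Z x)
  Z-supported atL c≤ (_ , _ , h) p q reg _ = h _
  Z-supported atR c≤ (_ , _ , h) p q reg _ = h _
  Z-supported (inL {l = l} {r} x) c≤ = Node.StepL-supported (Tree-< l) (Tree-< r) c≤ (Z-supported x (ℕₚ.≤-trans (ℕₚ.<⇒≤ (Tree-< r)) c≤))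
  Z-supported (inR {l = l} {r} x) c≤ = Node.StepR-supported (Tree-< l) (Tree-< r) c≤ (Z-supported x c≤)

  Z-averages : ∀ {a c} {t : Tree a c} (x : Loc t) → Inner a c → Averages a c (Z x)
  Z-averages atL inn z ρ e h _ = mkA (+ 0) (+ 0) 0ᵉ (refl , refl , λ _ → refl)
    (Avg-cong (λ i → proj₁ (h i)) (Avg-const (+ 0))) (Avg-cong (λ i → proj₁ (proj₂ (h i))) (Avg-const (+ 0))) (λ v → Avg-cong (λ i → proj₂ (proj₂ (h i)) v) (Avg-const (+ 0)))
  Z-averages atR inn z ρ e h _ = mkA (+ 1) (+ 0) 0ᵉ (refl , refl , λ _ → refl)
    (Avg-cong (λ i → proj₁ (h i)) (Avg-const (+ 1))) (Avg-cong (λ i → proj₁ (proj₂ (h i))) (Avg-const (+ 0))) (λ v → Avg-cong (λ i → proj₂ (proj₂ (h i)) v) (Avg-const (+ 0)))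
  Z-averages (inL {l = l} {r} x) inn z ρ e h int =
    (StepL-avg {Low = λ _ → Z x} h regAB (λ i → Z-supported x (proj₁ innerL) (StepL.low (h i)) _ _ regAB ab∉) (int _ _ regAB underAB)
      (Z-averages x innerL (λ i → StepL.z (h i)) (λ i → StepL.ρ (h i)) (λ i → StepL.e (h i)) (λ i → StepL.low (h i)) (StepL-low {Low = λ _ → Z x} h int)))
    where open InnerNode (Tree-< l) (Tree-< r) inn
  Z-averages (inR {l = l} {r} x) inn z ρ e h int =
    (StepR-avg {Low = λ _ → Z x} h regAB (λ i → Z-supported x (proj₁ innerR) (StepR.low (h i)) _ _ regAB ab∉R) (int _ _ regAB underAB)
      (Z-averages x innerR (λ i → StepR.z (h i)) (λ i → StepR.ρ (h i)) (λ i → StepR.e (h i)) (λ i → StepR.low (h i)) (StepR-low {Low = λ _ → Z x} h int)))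
    where open InnerNode (Tree-< l) (Tree-< r) inn

  Z-bounds : ∀ {a c} {t : Tree a c} (x : Loc t) {y ρ e} → Z x y ρ e → + 0 ℤ.≤ y × y ℤ.≤ + 1
  Z-bounds atL (refl , _) = ℤ.+≤+ ℕ.z≤n , ℤ.+≤+ ℕ.z≤n
  Z-bounds atR (refl , _) = ℤ.+≤+ ℕ.z≤n , ℤ.+≤+ (ℕ.s≤s ℕ.z≤n)
  Z-bounds (inL x) s = StepL.lo s , ℤₚ.≤-trans (StepL.hi s) (proj₂ (Z-bounds x (StepL.low s)))
  Z-bounds (inR x) s = ℤₚ.≤-trans (proj₁ (Z-bounds x (StepR.low s))) (StepR.lo s) , StepR.hi s

  Q-bounds : ∀ {b a c} {t : Tree a c} (q : Loc2 t) {z ρ e} → Q b q z ρ e → + 0 ℤ.≤ z × z ℤ.≤ + 2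
  Q-bounds ends (_ , refl , _) = ℤ.+≤+ ℕ.z≤n , ℤ.+≤+ (ℕ.s≤s ℕ.z≤n)
  Q-bounds (inL q) (_ , s , _) = StepL.lo s , ℤₚ.≤-trans (StepL.hi s) (proj₂ (Q-bounds q (StepL.low s)))
  Q-bounds (inR q) (_ , s , _) = ℤₚ.≤-trans (proj₁ (Q-bounds q (StepR.low s))) (StepR.lo s) , StepR.hi s
  Q-bounds (split x y) s = ℤₚ.≤-trans (proj₁ (Z-bounds y (Join.low₂ s))) (Join.lo s) ,
    ℤₚ.≤-trans (Join.hi s) (ℤₚ.+-monoʳ-≤ (+ 1) (proj₂ (Z-bounds x (Join.low₁ s))))

  Q-supported : ∀ b {a c} {t : Tree a c} (q : Loc2 t) → c ≤ suc n → Supported a c (Q b q)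
  Q-supported b ends c≤ (_ , _ , _ , h) p p' reg _ = h _
  Q-supported b (inL {l = l} {r} q) c≤ (b' , s , _) = Node.StepL-supported (Tree-< l) (Tree-< r) c≤ (Q-supported b' q (ℕₚ.≤-trans (ℕₚ.<⇒≤ (Tree-< r)) c≤)) s
  Q-supported b (inR {l = l} {r} q) c≤ (b' , s , _) = Node.StepR-supported (Tree-< l) (Tree-< r) c≤ (Q-supported b' q c≤) s
  Q-supported b (split {l = l} {r} x y) c≤ = Node.Join-supported (Tree-< l) (Tree-< r) c≤ (Z-supported x (ℕₚ.≤-trans (ℕₚ.<⇒≤ (Tree-< r)) c≤)) (Z-supported y c≤)

  Q-relax : ∀ b {a c} {t : Tree a c} (q : Loc2 t) {z ρ e} → Q b q z ρ e → Q false q z ρ e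
  Q-relax b ends (_ , h) = refl , h
  Q-relax b (inL q) (b' , s , _) = b' , s , λ ()
  Q-relax b (inR q) (b' , s , _) = b' , s , λ ()
  Q-relax b (split x y) (mkJ y₁ ρ₁ e₁ low₁ y₂ ρ₂ e₂ low₂ lo hi _ ρ≡ e≐) = mkJ y₁ ρ₁ e₁ low₁ y₂ ρ₂ e₂ low₂ lo hi (λ ()) ρ≡ e≐

  -- Two tags with sum 0 or 2 are equal, hence ordered.
  Q-good : ∀ {a c} {t : Tree a c} (q : Loc2 t) {z ρ e} → Q false q z ρ e → z ≢ + 1 → Q true q z ρ e
  Q-good ends (_ , h , _) z≢1 = ⊥-elim (z≢1 h)
  Q-good (inL q) (b' , s , _) z≢1 = b' , s , λ _ → inj₂ z≢1
  Q-good (inR q) (b' , s , _) z≢1 = b' , s , λ _ → inj₂ z≢1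
  Q-good (split x y) s@(mkJ y₁ ρ₁ e₁ low₁ y₂ ρ₂ e₂ low₂ lo hi _ ρ≡ e≐) z≢1 = mkJ y₁ ρ₁ e₁ low₁ y₂ ρ₂ e₂ low₂ lo hi
    (λ _ → good (012-cases (proj₁ (Q-bounds (split x y) s)) (proj₂ (Q-bounds (split x y) s)))
      (01-cases (proj₁ (Z-bounds x low₁)) (proj₂ (Z-bounds x low₁))) (01-cases (proj₁ (Z-bounds y low₂)) (proj₂ (Z-bounds y low₂))) lo hi z≢1) ρ≡ e≐
    where
    good : ∀ {z y₁ y₂} → z ≡ + 0 ⊎ z ≡ + 1 ⊎ z ≡ + 2 → y₁ ≡ + 0 ⊎ y₁ ≡ + 1 → y₂ ≡ + 0 ⊎ y₂ ≡ + 1 →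
           y₂ ℤ.≤ z → z ℤ.≤ + 1 ℤ.+ y₁ → z ≢ + 1 → y₂ ℤ.+ y₂ ℤ.≤ z × z ℤ.≤ y₁ ℤ.+ y₁
    good (inj₁ refl) (inj₁ refl) (inj₁ refl) _ _ _ = ℤₚ.≤-refl , ℤₚ.≤-refl
    good (inj₁ refl) (inj₂ refl) (inj₁ refl) _ _ _ = ℤₚ.≤-refl , ℤ.+≤+ ℕ.z≤n
    good (inj₁ refl) _ (inj₂ refl) (ℤ.+≤+ ()) _ _
    good (inj₂ (inj₁ refl)) _ _ _ _ z≢1 = ⊥-elim (z≢1 refl)
    good (inj₂ (inj₂ refl)) (inj₁ refl) _ _ (ℤ.+≤+ (ℕ.s≤s ())) _
    good (inj₂ (inj₂ refl)) (inj₂ refl) (inj₁ refl) _ _ _ = ℤ.+≤+ ℕ.z≤n , ℤₚ.≤-refl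
    good (inj₂ (inj₂ refl)) (inj₂ refl) (inj₂ refl) _ _ _ = ℤₚ.≤-refl , ℤₚ.≤-refl

  -- Even if all members carry the flag, their flags one step below may differ, so there is no
  -- single relation to average there. The average below is first taken with the flag dropped, and
  -- the flag is then recovered from the averaged sums.
  Q-averages : ∀ b {a c} {t : Tree a c} (q : Loc2 t) → Inner a c → Averages a c (Q b q)
  Q-averages b ends inn z ρ e h _ = mkA (+ 1) (+ 0) 0ᵉ (proj₁ (h Fz) , refl , refl , λ _ → refl)
    (Avg-cong (λ i → proj₁ (proj₂ (h i))) (Avg-const (+ 1))) (Avg-cong (λ i → proj₁ (proj₂ (proj₂ (h i)))) (Avg-const (+ 0)))
    (λ v → Avg-cong (λ i → proj₂ (proj₂ (proj₂ (h i))) v) (Avg-const (+ 0)))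
  Q-averages b (split {a} {b₁} {c} {l} {r} x y) inn z ρ e h int =
    mkA z̄ (y̅₂ ℤ.- + 1 ℤ.- y̅₁) _
      (mkJ y̅₁ ρ̅₁ _ rel₁ y̅₂ ρ̅₂ _ rel₂ (Avg-≤ av₂ avz (λ i → Join.lo (h i))) (Avg-≤ avz (Avg-+ (Avg-const (+ 1)) av₁) (λ i → Join.hi (h i)))
        (λ g → Avg-≤ (Avg-+ av₂ av₂) avz (λ i → proj₁ (Join.cond (h i) g)) , Avg-≤ avz (Avg-+ av₁ av₁) (λ i → proj₂ (Join.cond (h i) g)))
        refl (λ _ → refl))
      avz (Avg-cong (λ i → Join.ρ≡ (h i)) (Avg-sub (Avg-sub av₂ (Avg-const (+ 1))) av₁))
      (λ v → Avg-cong (λ i → Join.e≐ (h i) v) (Avg-+ (Avg-+ (Avg-+ (ave₁ v) (ave₂ v)) (Avg-*c (ℓ a b₁ v) (Avg-sub (Avg-+ avρ₁ avz) av₂)))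
        (Avg-*c (ℓ b₁ c v) (Avg-sub (Avg-+ (Avg-+ avρ₂ (Avg-const (+ 1))) av₁) avz))))
    where
    open InnerNode (Tree-< l) (Tree-< r) inn
    A B : Fin _ → ℤ
    A i = Join.ρ₁ (h i) ℤ.+ z i ℤ.- Join.y₂ (h i)
    B i = Join.ρ₂ (h i) ℤ.+ + 1 ℤ.+ Join.y₁ (h i) ℤ.- z i
    int₁ : ∀ p q → Reg n p q → Under a b₁ p q → ∃[ m ] Avg (λ i → Join.e₁ (h i) (var p q)) m
    int₁ p q reg u = let (m , av) = int p q reg (UnderL u) in m , Avg-cong (λ i → sym (trans (Join.e≐ (h i) (var p q))
      (trans (keep (A i) (B i) (ℓab≡0ˡ reg u) (ℓbc≡0ˡ reg u)) (trans (cong (ℤ._+_ (Join.e₁ (h i) (var p q))) (Z-supported y (proj₁ inn) (Join.low₂ (h i)) p q reg (UnderLR reg u))) (ℤₚ.+-identityʳ _))))) av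
    int₂ : ∀ p q → Reg n p q → Under b₁ c p q → ∃[ m ] Avg (λ i → Join.e₂ (h i) (var p q)) m
    int₂ p q reg u = let (m , av) = int p q reg (UnderR u) in m , Avg-cong (λ i → sym (trans (Join.e≐ (h i) (var p q))
      (trans (keep (A i) (B i) (ℓab≡0ʳ reg u) (ℓbc≡0ʳ reg u)) (trans (cong (ℤ._+ (Join.e₂ (h i) (var p q))) (Z-supported x (proj₁ innerL) (Join.low₁ (h i)) p q reg (λ u' → UnderLR reg u' u))) (ℤₚ.+-identityˡ _))))) av
    open AvgOf (Z-averages x innerL (λ i → Join.y₁ (h i)) (λ i → Join.ρ₁ (h i)) (λ i → Join.e₁ (h i)) (λ i → Join.low₁ (h i)) int₁)
      renaming (z̄ to y̅₁; ρ̄ to ρ̅₁; ē to e̅₁; rel to rel₁; avz to av₁; avρ to avρ₁; ave to ave₁)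
    open AvgOf (Z-averages y innerR (λ i → Join.y₂ (h i)) (λ i → Join.ρ₂ (h i)) (λ i → Join.e₂ (h i)) (λ i → Join.low₂ (h i)) int₂)
      renaming (z̄ to y̅₂; ρ̄ to ρ̅₂; ē to e̅₂; rel to rel₂; avz to av₂; avρ to avρ₂; ave to ave₂)
    m = proj₁ (int a b₁ regAB underAB)
    -- Solved from the exponent `ρ₁ + z - y₂` of the side `a b₁`.
    z̄ = m ℤ.- ρ̅₁ ℤ.+ y̅₂
    avz : Avg z z̄
    avz = Avg-cong coord (Avg-+ (Avg-sub (proj₂ (int a b₁ regAB underAB)) avρ₁) av₂)
      where
      lemma : ∀ ρ z y B → (+ 0 ℤ.+ + 0 ℤ.+ (ρ ℤ.+ z ℤ.- y) ℤ.* + 1 ℤ.+ B ℤ.* + 0) ℤ.- ρ ℤ.+ y ≡ z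
      lemma = ℤS.solve-∀
      coord : ∀ i → z i ≡ e i (var a b₁) ℤ.- Join.ρ₁ (h i) ℤ.+ Join.y₂ (h i)
      coord i = sym (trans (cong (λ x → x ℤ.- Join.ρ₁ (h i) ℤ.+ Join.y₂ (h i)) (trans (Join.e≐ (h i) (var a b₁))
        (trans (cong₂ (λ s t → s ℤ.+ t ℤ.+ A i ℤ.* ℓ a b₁ (var a b₁) ℤ.+ B i ℤ.* ℓ b₁ c (var a b₁))
                 (Z-supported x (proj₁ innerL) (Join.low₁ (h i)) a b₁ regAB ab∉) (Z-supported y (proj₁ inn) (Join.low₂ (h i)) a b₁ regAB ab∉R))
               (cong₂ (λ s t → + 0 ℤ.+ + 0 ℤ.+ A i ℤ.* s ℤ.+ B i ℤ.* t) (ℓ-self a b₁ regAB) (ℓbc-ab≡0 regAB)))))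
        (lemma (Join.ρ₁ (h i)) (z i) (Join.y₂ (h i)) (B i)))
  Q-averages b (inL {a} {b₁} {c} {l} {r} q) inn z ρ e h int = result b refl
    where
    open InnerNode (Tree-< l) (Tree-< r) inn
    b' : Fin _ → Bool
    b' i = proj₁ (h i)
    s : ∀ i → StepL (Q (b' i) q) a b₁ c (z i) (ρ i) (e i)
    s i = proj₁ (proj₂ (h i))
    e≡0 = λ i → Q-supported (b' i) q (proj₁ innerL) (StepL.low (s i)) _ _ regAB ab∉
    lower : ∀ b″ → (∀ i → Q b″ q (StepL.z (s i)) (StepL.ρ (s i)) (StepL.e (s i))) → AvgOf (λ i → StepL.z (s i)) (λ i → StepL.ρ (s i)) (λ i → StepL.e (s i)) (Q b″ q)
    lower b″ k = Q-averages b″ q innerL _ _ _ k (StepL-low {Low = λ i → Q (b' i) q} s int)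
    α₀ = lower false (λ i → Q-relax (b' i) q (StepL.low (s i)))
    step : ∀ {b″} → AvgOf (λ i → StepL.z (s i)) (λ i → StepL.ρ (s i)) (λ i → StepL.e (s i)) (Q b″ q) → AvgOf z ρ e (StepL (Q b″ q) a b₁ c)
    step {b″} α = StepL-avg {Low = λ i → Q (b' i) q} {Low̄ = Q b″ q} s regAB e≡0 (int _ _ regAB underAB) α
    wrap : ∀ {b b″} (α : AvgOf z ρ e (StepL (Q b″ q) a b₁ c)) → (b ≡ true → b″ ≡ true ⊎ AvgOf.z̄ α ≢ + 1) → AvgOf z ρ e (Q b (inL {r = r} q))
    wrap {b} {b″} (mkA z̄ ρ̄ ē rel av₁ av₂ av₃) c = mkA z̄ ρ̄ ē (b″ , rel , c) av₁ av₂ av₃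
    result : ∀ b₀ → b ≡ b₀ → AvgOf z ρ e (Q b₀ (inL {r = r} q))
    result false _ = wrap (step α₀) (λ ())
    result true refl with AvgOf.z̄ (step α₀) ℤₚ.≟ + 1
    ... | no z'≢1 = wrap (step α₀) (λ _ → inj₂ z'≢1)
    ... | yes z'≡1 with AvgOf.z̄ α₀ ℤₚ.≟ + 1
    ...   | no z≢1 = wrap (step (mkA (AvgOf.z̄ α₀) (AvgOf.ρ̄ α₀) (AvgOf.ē α₀) (Q-good q (AvgOf.rel α₀) z≢1) (AvgOf.avz α₀) (AvgOf.avρ α₀) (AvgOf.ave α₀))) (λ _ → inj₁ refl)
    -- Both averaged sums are 1 and the sum never grows in this step, so it is unchanged in every
    -- member. A member that escapes through `z ≢ 1` above then also has a sum different from 1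
    -- below and satisfies the condition there; hence all members do, and the average below can be
    -- taken with the flag.
    ...   | yes z≡1 = wrap (step (lower true (λ i → good i (proj₂ (proj₂ (h i)) refl)))) (λ _ → inj₁ refl)
      where
      same : ∀ i → z i ≡ StepL.z (s i)
      same = Avg-≡ (subst (Avg z) z'≡1 (AvgOf.avz (step α₀))) (subst (Avg (λ i → StepL.z (s i))) z≡1 (AvgOf.avz α₀)) (λ i → StepL.hi (s i))
      good : ∀ i → b' i ≡ true ⊎ z i ≢ + 1 → Q true q (StepL.z (s i)) (StepL.ρ (s i)) (StepL.e (s i))
      good i (inj₁ g) = subst (λ β → Q β q (StepL.z (s i)) (StepL.ρ (s i)) (StepL.e (s i))) g (StepL.low (s i))
      good i (inj₂ g) = Q-good q (Q-relax (b' i) q (StepL.low (s i))) (λ p → g (trans (same i) p))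
  Q-averages b (inR {a} {b₁} {c} {l} {r} q) inn z ρ e h int = result b refl
    where
    open InnerNode (Tree-< l) (Tree-< r) inn
    b' : Fin _ → Bool
    b' i = proj₁ (h i)
    s : ∀ i → StepR (+ 2) (Q (b' i) q) a b₁ c (z i) (ρ i) (e i)
    s i = proj₁ (proj₂ (h i))
    e≡0 = λ i → Q-supported (b' i) q (proj₁ innerR) (StepR.low (s i)) _ _ regAB ab∉R
    lower : ∀ b″ → (∀ i → Q b″ q (StepR.z (s i)) (StepR.ρ (s i)) (StepR.e (s i))) → AvgOf (λ i → StepR.z (s i)) (λ i → StepR.ρ (s i)) (λ i → StepR.e (s i)) (Q b″ q)
    lower b″ k = Q-averages b″ q innerR _ _ _ k (StepR-low {Low = λ i → Q (b' i) q} s int)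
    α₀ = lower false (λ i → Q-relax (b' i) q (StepR.low (s i)))
    step : ∀ {b″} → AvgOf (λ i → StepR.z (s i)) (λ i → StepR.ρ (s i)) (λ i → StepR.e (s i)) (Q b″ q) → AvgOf z ρ e (StepR (+ 2) (Q b″ q) a b₁ c)
    step {b″} α = StepR-avg {Low = λ i → Q (b' i) q} {Low̄ = Q b″ q} s regAB e≡0 (int _ _ regAB underAB) α
    wrap : ∀ {b b″} (α : AvgOf z ρ e (StepR (+ 2) (Q b″ q) a b₁ c)) → (b ≡ true → b″ ≡ true ⊎ AvgOf.z̄ α ≢ + 1) → AvgOf z ρ e (Q b (inR {l = l} q))
    wrap {b} {b″} (mkA z̄ ρ̄ ē rel av₁ av₂ av₃) c = mkA z̄ ρ̄ ē (b″ , rel , c) av₁ av₂ av₃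
    result : ∀ b₀ → b ≡ b₀ → AvgOf z ρ e (Q b₀ (inR {l = l} q))
    result false _ = wrap (step α₀) (λ ())
    result true refl with AvgOf.z̄ (step α₀) ℤₚ.≟ + 1
    ... | no z'≢1 = wrap (step α₀) (λ _ → inj₂ z'≢1)
    ... | yes z'≡1 with AvgOf.z̄ α₀ ℤₚ.≟ + 1
    ...   | no z≢1 = wrap (step (mkA (AvgOf.z̄ α₀) (AvgOf.ρ̄ α₀) (AvgOf.ē α₀) (Q-good q (AvgOf.rel α₀) z≢1) (AvgOf.avz α₀) (AvgOf.avρ α₀) (AvgOf.ave α₀))) (λ _ → inj₁ refl)
    ...   | yes z≡1 = wrap (step (lower true (λ i → good i (proj₂ (proj₂ (h i)) refl)))) (λ _ → inj₁ refl)
      where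
      same : ∀ i → StepR.z (s i) ≡ z i
      same = Avg-≡ (subst (Avg (λ i → StepR.z (s i))) z≡1 (AvgOf.avz α₀)) (subst (Avg z) z'≡1 (AvgOf.avz (step α₀))) (λ i → StepR.lo (s i))
      good : ∀ i → b' i ≡ true ⊎ z i ≢ + 1 → Q true q (StepR.z (s i)) (StepR.ρ (s i)) (StepR.e (s i))
      good i (inj₁ g) = subst (λ β → Q β q (StepR.z (s i)) (StepR.ρ (s i)) (StepR.e (s i))) g (StepR.low (s i))
      good i (inj₂ g) = Q-good q (Q-relax (b' i) q (StepR.low (s i))) (λ p → g (trans (sym (same i)) p))

  -- The tags choose one of a, b and one of b, c. The choice (1, 0) would give the degenerate chord
  -- from b to b, of value 0, whence `y₁≤y₂`; the other three give `ab`, `ac`, `bc`, whose exponents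
  -- `1 - y₂`, `y₂ - y₁`, `y₁` are affine in the tags.
  record Triangle (Low₁ Low₂ : Tagged) (a b c : ℕ) (e : Exp n) : Set where
    constructor mkT
    field
      y₁ ρ₁ : ℤ
      e₁    : Exp n
      low₁  : Low₁ y₁ ρ₁ e₁
      y₂ ρ₂ : ℤ
      e₂    : Exp n
      low₂  : Low₂ y₂ ρ₂ e₂
      y₁≤y₂ : y₁ ℤ.≤ y₂
      e≐    : ∀ v → e v ≡ e₁ v ℤ.+ e₂ v ℤ.+ (ρ₁ ℤ.+ + 1 ℤ.- y₂) ℤ.* ℓ a b v ℤ.+ (ρ₂ ℤ.+ y₁) ℤ.* ℓ b c v ℤ.+ (y₂ ℤ.- y₁) ℤ.* ℓ a c v

  -- The exponents of the expansion of a diagonal.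
  𝒳 : ∀ {a c} {t : Tree a c} → Loc2 t → Exp n → Set
  𝒳 (ends {a} {c}) e = e ≐ ℓ a c
  𝒳 (inL q) = 𝒳 q
  𝒳 (inR q) = 𝒳 q
  𝒳 (split {a} {b} {c} x y) = Triangle (Z x) (Z y) a b c

  𝒳-supported : ∀ {a c} {t : Tree a c} (q : Loc2 t) → c ≤ suc n → ∀ {e} → 𝒳 q e → ∀ p p' → Reg n p p' → ¬ (a ≤ p × p' ≤ c) → e (var p p') ≡ + 0
  𝒳-supported (ends {a} {c} {t}) c≤ h p p' reg out = trans (h _) (ℓ-other p p' reg a c (Tree-< t) c≤ λ { (refl , refl) → out (ℕₚ.≤-refl , ℕₚ.≤-refl) })
  𝒳-supported (inL {r = r} q) c≤ h p p' reg out = 𝒳-supported q (ℕₚ.≤-trans (ℕₚ.<⇒≤ (Tree-< r)) c≤) h p p' reg (λ (u , v) → out (u , ℕₚ.≤-trans v (ℕₚ.<⇒≤ (Tree-< r))))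
  𝒳-supported (inR {l = l} q) c≤ h p p' reg out = 𝒳-supported q c≤ h p p' reg (λ (u , v) → out (ℕₚ.≤-trans (ℕₚ.<⇒≤ (Tree-< l)) u , v))
  𝒳-supported (split {a} {b} {c} {l} {r} x y) c≤ s p p' reg out = trans (Triangle.e≐ s (var p p'))
    (trans (cong₂ ℤ._+_ (vanish A B (cong₂ ℤ._+_ (Z-supported x (ℕₚ.≤-trans (ℕₚ.<⇒≤ (Tree-< r)) c≤) (Triangle.low₁ s) p p' reg (λ u → out′ (UnderL u)))
        (Z-supported y c≤ (Triangle.low₂ s) p p' reg (λ u → out′ (UnderR u)))) (ℓab≡0 reg out′) (ℓbc≡0 reg out′))
      (cong (ℤ._*_ C) (ℓ-other p p' reg a c (ℕₚ.<-trans (Tree-< l) (Tree-< r)) c≤ λ { (refl , refl) → out (ℕₚ.≤-refl , ℕₚ.≤-refl) })))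
      (trans (ℤₚ.+-identityˡ (C ℤ.* + 0)) (ℤₚ.*-zeroʳ C)))
    where
    open Node (Tree-< l) (Tree-< r) c≤
    open Triangle s
    A = ρ₁ ℤ.+ + 1 ℤ.- y₂
    B = ρ₂ ℤ.+ y₁
    C = y₂ ℤ.- y₁
    out′ : ¬ Under a c p p'
    out′ (u , v , _) = out (u , v)

  -- The top triangle introduces no tag of its own, so its sides need not be regular. Everything is
  -- determined by its two subpolygons, which are `Inner` even when `a … c` is the whole polygon.
  𝒳-sat : ∀ {a c} {t : Tree a c} (q : Loc2 t) → c ≤ suc n → Sat (𝒳 q)
  𝒳-sat (ends {a} {c}) c≤ N es u h av v = Avg-unique (av v) (Avg-cong (λ i → h i v) (Avg-const (ℓ a c v)))
  𝒳-sat (inL {r = r} q) c≤ = 𝒳-sat q (ℕₚ.≤-trans (ℕₚ.<⇒≤ (Tree-< r)) c≤)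
  𝒳-sat (inR q) c≤ = 𝒳-sat q c≤
  𝒳-sat (split {a} {b} {c} {l} {r} x y) c≤ N es u h av =
    mkT y̅₁ ρ̅₁ e̅₁ rel₁ y̅₂ ρ̅₂ e̅₂ rel₂ (Avg-≤ av₁ av₂ (λ i → Triangle.y₁≤y₂ (h i)))
      (λ v → Avg-unique (av v) (Avg-cong (λ i → Triangle.e≐ (h i) v) (Avg-+ (Avg-+ (Avg-+ (Avg-+ (ave₁ v) (ave₂ v)) (Avg-*c (ℓ a b v) (Avg-sub (Avg-+ avρ₁ (Avg-const (+ 1))) av₂)))
        (Avg-*c (ℓ b c v) (Avg-+ avρ₂ av₁))) (Avg-*c (ℓ a c v) (Avg-sub av₂ av₁)))))
    where
    open Node (Tree-< l) (Tree-< r) c≤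
    b≤n : b ≤ n
    b≤n = ℕ.s≤s⁻¹ (ℕₚ.≤-trans (Tree-< r) c≤)
    A B C : Fin _ → ℤ
    A i = Triangle.ρ₁ (h i) ℤ.+ + 1 ℤ.- Triangle.y₂ (h i)
    B i = Triangle.ρ₂ (h i) ℤ.+ Triangle.y₁ (h i)
    C i = Triangle.y₂ (h i) ℤ.- Triangle.y₁ (h i)
    ℓac≡0 : ∀ {p q} → Reg n p q → Under a c p q → ℓ a c (var p q) ≡ + 0
    ℓac≡0 reg (_ , _ , k) = ℓ-other _ _ reg a c (ℕₚ.<-trans (Tree-< l) (Tree-< r)) c≤ λ { (refl , refl) → irr k }
      where
      irr : a < a ⊎ c < c → ⊥
      irr (inj₁ h) = ℕₚ.<-irrefl refl h
      irr (inj₂ h) = ℕₚ.<-irrefl refl h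
    keep₃ : ∀ C {s x} → x ≡ + 0 → s ℤ.+ C ℤ.* x ≡ s
    keep₃ C {s} refl = trans (cong (ℤ._+_ s) (ℤₚ.*-zeroʳ C)) (ℤₚ.+-identityʳ s)
    int₁ : ∀ p q → Reg n p q → Under a b p q → ∃[ m ] Avg (λ i → Triangle.e₁ (h i) (var p q)) m
    int₁ p q reg k = u (var p q) , Avg-cong (λ i → sym (trans (Triangle.e≐ (h i) (var p q))
      (trans (keep₃ (C i) (ℓac≡0 reg (UnderL k))) (trans (keep (A i) (B i) (ℓab≡0ˡ reg k) (ℓbc≡0ˡ reg k))
      (trans (cong (ℤ._+_ (Triangle.e₁ (h i) (var p q))) (Z-supported y c≤ (Triangle.low₂ (h i)) p q reg (UnderLR reg k))) (ℤₚ.+-identityʳ _)))))) (av (var p q))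
    int₂ : ∀ p q → Reg n p q → Under b c p q → ∃[ m ] Avg (λ i → Triangle.e₂ (h i) (var p q)) m
    int₂ p q reg k = u (var p q) , Avg-cong (λ i → sym (trans (Triangle.e≐ (h i) (var p q))
      (trans (keep₃ (C i) (ℓac≡0 reg (UnderR k))) (trans (keep (A i) (B i) (ℓab≡0ʳ reg k) (ℓbc≡0ʳ reg k))
      (trans (cong (ℤ._+ (Triangle.e₂ (h i) (var p q))) (Z-supported x (ℕₚ.m≤n⇒m≤1+n b≤n) (Triangle.low₁ (h i)) p q reg (λ k' → UnderLR reg k' k))) (ℤₚ.+-identityˡ _)))))) (av (var p q))
    open AvgOf (Z-averages x (ℕₚ.m≤n⇒m≤1+n b≤n , inj₂ b≤n) (λ i → Triangle.y₁ (h i)) (λ i → Triangle.ρ₁ (h i)) (λ i → Triangle.e₁ (h i)) (λ i → Triangle.low₁ (h i)) int₁)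
      renaming (z̄ to y̅₁; ρ̄ to ρ̅₁; ē to e̅₁; rel to rel₁; avz to av₁; avρ to avρ₁; ave to ave₁)
    open AvgOf (Z-averages y (c≤ , inj₁ (ℕₚ.≤-<-trans ℕ.z≤n (Tree-< l))) (λ i → Triangle.y₂ (h i)) (λ i → Triangle.ρ₂ (h i)) (λ i → Triangle.e₂ (h i)) (λ i → Triangle.low₂ (h i)) int₂)
      renaming (z̄ to y̅₂; ρ̄ to ρ̅₂; ē to e̅₂; rel to rel₂; avz to av₂; avρ to avρ₂; ave to ave₂)

  -- Exponents of (Σ over the tagged set of x^(e + ρ·0q) R₀^(k-z) R_q^z) · (h / (R₀ R_q)) where h is either
  -- the label of 0q, for tagged exponents in 𝒢, or an exponent in G, for those in 𝒜.
  module Around (q : ℕ) (0<q : 0 < q) (q≤n : q ≤ n) (k : ℤ) (𝒢 𝒜 : Tagged) (G : Exp n → Set) where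

    S R₀ R₁ : Exp n
    S = ℓ 0 q
    R₀ = ℓ 0 (suc n)
    R₁ = ℓ q (suc n)

    Shape : Tagged → (Exp n → Set) → Exp n → Set
    Shape 𝒯 H e = Σ[ z ∈ ℤ ] Σ[ ρ ∈ ℤ ] Σ[ f ∈ Exp n ] Σ[ h ∈ Exp n ] (𝒯 z ρ f × H h ×
      (∀ v → e v ≡ f v ℤ.+ ρ ℤ.* S v ℤ.+ (k ℤ.- z) ℤ.* R₀ v ℤ.+ z ℤ.* R₁ v ℤ.+ h v ℤ.- R₀ v ℤ.- R₁ v))

    𝒲 : Exp n → Set
    𝒲 e = Shape 𝒢 (_≐ S) e ⊎ Shape 𝒜 G e

    -- The exponent of the side 0q is `ρ` plus 1 for the first summand of `𝒲` and plus 0 for the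
    -- second. As `ρ` has an integral average, so has this 0 or 1; then by rigidity all members come
    -- from the same summand, and each summand is averaged by itself.
    Around-Sat : Averages 0 q 𝒢 → Averages 0 q 𝒜 → Supported 0 q 𝒢 → Supported 0 q 𝒜 → Sat G →
      (∀ {g} → G g → ∀ p p' → Reg n p p' → p' ≤ q → g (var p p') ≡ + 0) → (q ≡ n → ∀ {g} → ¬ G g) →
      (∀ {z ρ e} → 𝒢 z ρ e → 𝒜 z ρ e) → Sat 𝒲
    Around-Sat av𝒢 av𝒜 sup𝒢 sup𝒜 satG G≡0 G-empty 𝒢⊆𝒜 N es u hs av = result
      where
      ℓ0q≡0 : ∀ p p' → Reg n p p' → Under 0 q p p' → S (var p p') ≡ + 0
      ℓ0q≡0 p p' reg (_ , _ , o) = ℓ-other p p' reg 0 q 0<q (ℕₚ.m≤n⇒m≤1+n q≤n) λ { (refl , refl) → irr o }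
        where
        irr : 0 < 0 ⊎ q < q → ⊥
        irr (inj₂ h) = ℕₚ.<-irrefl refl h
      R≡0 : ∀ r → r < suc n → ∀ p p' → Reg n p p' → ℓ r (suc n) (var p p') ≡ + 0
      R≡0 r r< p p' reg = ℓ-other p p' reg r (suc n) r< ℕₚ.≤-refl λ { (refl , refl) → ℕₚ.<-irrefl refl (proj₁ (proj₂ reg)) }
      R₀≡0 = R≡0 0 (ℕ.s≤s ℕ.z≤n)
      R₁≡0 = R≡0 q (ℕ.s≤s q≤n)
      lemma : ∀ {f ρ S A R₀ B R₁ h} → R₀ ≡ + 0 → R₁ ≡ + 0 → f ℤ.+ ρ ℤ.* S ℤ.+ A ℤ.* R₀ ℤ.+ B ℤ.* R₁ ℤ.+ h ℤ.- R₀ ℤ.- R₁ ≡ f ℤ.+ ρ ℤ.* S ℤ.+ h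
      lemma {f} {ρ} {S} {A} {_} {B} {_} {h} refl refl = solve f (ρ ℤ.* S) A B h
        where
        solve : ∀ f s A B h → f ℤ.+ s ℤ.+ A ℤ.* + 0 ℤ.+ B ℤ.* + 0 ℤ.+ h ℤ.- + 0 ℤ.- + 0 ≡ f ℤ.+ s ℤ.+ h
        solve = ℤS.solve-∀
      inside : ∀ {𝒯 H} → (∀ {h} → H h → ∀ p p' → Reg n p p' → Under 0 q p p' → h (var p p') ≡ + 0) →
        (ks : ∀ i → Shape 𝒯 H (es i)) → ∀ p p' → Reg n p p' → Under 0 q p p' → ∃[ m ] Avg (λ i → proj₁ (proj₂ (proj₂ (ks i))) (var p p')) m
      inside H≡0 ks p p' reg un = u (var p p') , Avg-cong (λ i → sym (val i)) (av (var p p'))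
        where
        simp : ∀ f ρ → f ℤ.+ ρ ℤ.* + 0 ℤ.+ + 0 ≡ f
        simp = ℤS.solve-∀
        val : ∀ i → es i (var p p') ≡ proj₁ (proj₂ (proj₂ (ks i))) (var p p')
        val i = let (z , ρ , f , h , _ , Hh , eq) = ks i in
          trans (eq (var p p')) (trans (lemma {f (var p p')} {ρ} {S (var p p')} {k ℤ.- z} {B = z} {h = h (var p p')} (R₀≡0 p p' reg) (R₁≡0 p p' reg))
          (trans (cong₂ (λ s t → f (var p p') ℤ.+ ρ ℤ.* s ℤ.+ t) (ℓ0q≡0 p p' reg un) (H≡0 Hh p p' reg un)) (simp (f (var p p')) ρ)))
      S≡0 : ∀ {h : Exp n} → h ≐ S → ∀ p p' → Reg n p p' → Under 0 q p p' → h (var p p') ≡ + 0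
      S≡0 h p p' reg un = trans (h _) (ℓ0q≡0 p p' reg un)
      G≡0′ : ∀ {h : Exp n} → G h → ∀ p p' → Reg n p p' → Under 0 q p p' → h (var p p') ≡ + 0
      G≡0′ h p p' reg un = G≡0 h p p' reg (proj₁ (proj₂ un))
      all-S : (∀ i → Shape 𝒢 (_≐ S) (es i)) → 𝒲 u
      all-S ks = inj₁ (z̄ , ρ̄ , ē , S , rel , (λ _ → refl) , λ v → Avg-unique (av v) (Avg-cong (λ i → proj₂ (proj₂ (proj₂ (proj₂ (proj₂ (proj₂ (ks i)))))) v)
        (Avg-sub (Avg-sub (Avg-+ (Avg-+ (Avg-+ (Avg-+ (ave v) (Avg-*c (S v) avρ)) (Avg-*c (R₀ v) (Avg-sub (Avg-const k) avz))) (Avg-*c (R₁ v) avz))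
          (Avg-cong (λ i → proj₁ (proj₂ (proj₂ (proj₂ (proj₂ (proj₂ (ks i)))))) v) (Avg-const (S v)))) (Avg-const (R₀ v))) (Avg-const (R₁ v)))))
        where open AvgOf (av𝒢 _ _ _ (λ i → proj₁ (proj₂ (proj₂ (proj₂ (proj₂ (ks i)))))) (inside S≡0 ks))
      all-G : (∀ i → Shape 𝒜 G (es i)) → 𝒲 u
      all-G ks = inj₂ (z̄ , ρ̄ , ē , ḡ , rel , satG N (λ i → proj₁ (proj₂ (proj₂ (proj₂ (ks i))))) ḡ (λ i → proj₁ (proj₂ (proj₂ (proj₂ (proj₂ (proj₂ (ks i))))))) avg ,
        λ v → solve₁ (u v) (T̄ v) (R₀ v) (R₁ v))
        where
        open AvgOf (av𝒜 _ _ _ (λ i → proj₁ (proj₂ (proj₂ (proj₂ (proj₂ (ks i)))))) (inside G≡0′ ks))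
        T : Fin _ → Exp n
        T i v = let (z , ρ , f , _) = ks i in f v ℤ.+ ρ ℤ.* S v ℤ.+ (k ℤ.- z) ℤ.* R₀ v ℤ.+ z ℤ.* R₁ v
        T̄ ḡ : Exp n
        T̄ v = ē v ℤ.+ ρ̄ ℤ.* S v ℤ.+ (k ℤ.- z̄) ℤ.* R₀ v ℤ.+ z̄ ℤ.* R₁ v
        ḡ v = u v ℤ.- T̄ v ℤ.+ R₀ v ℤ.+ R₁ v
        solve₁ : ∀ u T a b → u ≡ T ℤ.+ (u ℤ.- T ℤ.+ a ℤ.+ b) ℤ.- a ℤ.- b
        solve₁ = ℤS.solve-∀
        solve₂ : ∀ T g a b → g ≡ T ℤ.+ g ℤ.- a ℤ.- b ℤ.- T ℤ.+ a ℤ.+ b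
        solve₂ = ℤS.solve-∀
        avg : ∀ v → Avg (λ i → proj₁ (proj₂ (proj₂ (proj₂ (ks i)))) v) (ḡ v)
        avg v = Avg-cong (λ i → let (_ , _ , _ , g , _ , _ , eq) = ks i in
                  trans (solve₂ (T i v) (g v) (R₀ v) (R₁ v)) (cong (λ x → x ℤ.- T i v ℤ.+ R₀ v ℤ.+ R₁ v) (sym (eq v))))
          (Avg-+ (Avg-+ (Avg-sub (av v) (Avg-+ (Avg-+ (Avg-+ (ave v) (Avg-*c (S v) avρ)) (Avg-*c (R₀ v) (Avg-sub (Avg-const k) avz))) (Avg-*c (R₁ v) avz))) (Avg-const (R₀ v))) (Avg-const (R₁ v)))
      κ : ∀ {e} → 𝒲 e → ℤ
      κ (inj₁ _) = + 1
      κ (inj₂ _) = + 0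
      κ₁ : ∀ {e} (w : 𝒲 e) → κ w ≡ + 1 → Shape 𝒢 (_≐ S) e
      κ₁ (inj₁ s) _ = s
      κ₀ : ∀ {e} (w : 𝒲 e) → κ w ≡ + 0 → Shape 𝒜 G e
      κ₀ (inj₂ s) _ = s
      κ-bounds : ∀ {e} (w : 𝒲 e) → + 0 ℤ.≤ κ w × κ w ℤ.≤ + 1
      κ-bounds (inj₁ _) = ℤ.+≤+ ℕ.z≤n , ℤₚ.≤-refl
      κ-bounds (inj₂ _) = ℤₚ.≤-refl , ℤ.+≤+ ℕ.z≤n
      H : Exp n → Set
      H h = h ≐ S ⊎ G h
      merge : ∀ {e} → 𝒲 e → Shape 𝒜 H e
      merge (inj₁ (z , ρ , f , h , g , s , eq)) = z , ρ , f , h , 𝒢⊆𝒜 g , inj₁ s , eq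
      merge (inj₂ (z , ρ , f , h , a , s , eq)) = z , ρ , f , h , a , inj₂ s , eq
      H≡0 : ∀ {h : Exp n} → H h → ∀ p p' → Reg n p p' → Under 0 q p p' → h (var p p') ≡ + 0
      H≡0 (inj₁ h) = S≡0 h
      H≡0 (inj₂ h) = G≡0′ h
      result : 𝒲 u
      result with q ℕₚ.≟ n
      -- Here 0q is the loop, which is not regular, and the two summands could not be told apart;
      -- but in this case `G` is empty.
      ... | yes q≡n = all-S (λ i → only (hs i))
        where
        only : ∀ {e} → 𝒲 e → Shape 𝒢 (_≐ S) e
        only (inj₁ s) = s
        only (inj₂ (_ , _ , _ , _ , _ , g , _)) = ⊥-elim (G-empty q≡n g)
      ... | no q≢n = decide (01-cases (Avg-≤ (Avg-const (+ 0)) avκ (λ i → proj₁ (κ-bounds (hs i)))) (Avg-≤ avκ (Avg-const (+ 1)) (λ i → proj₂ (κ-bounds (hs i)))))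
        where
        reg : Reg n 0 q
        reg = 0<q , q≤n , ℕₚ.≤∧≢⇒< q≤n q≢n
        out : ¬ Under 0 q 0 q
        out (_ , _ , inj₂ h) = ℕₚ.<-irrefl refl h
        open AvgOf (av𝒜 _ _ _ (λ i → proj₁ (proj₂ (proj₂ (proj₂ (proj₂ (merge (hs i))))))) (inside H≡0 (λ i → merge (hs i))))
        simp : ∀ ρ κ → + 0 ℤ.+ ρ ℤ.* + 1 ℤ.+ κ ℤ.- ρ ≡ κ
        simp = ℤS.solve-∀
        coord : ∀ {e} (w : 𝒲 e) → κ w ≡ e (var 0 q) ℤ.- proj₁ (proj₂ (merge w))
        coord (inj₁ (z , ρ , f , h , g , s , eq)) = sym (trans (cong (ℤ._- ρ) (trans (eq (var 0 q)) (trans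
          (lemma {f (var 0 q)} {ρ} {S (var 0 q)} {k ℤ.- z} {B = z} {h = h (var 0 q)} (R₀≡0 0 q reg) (R₁≡0 0 q reg))
          (trans (cong (λ x → f (var 0 q) ℤ.+ ρ ℤ.* S (var 0 q) ℤ.+ x) (s _)) (cong₂ (λ x y → x ℤ.+ ρ ℤ.* y ℤ.+ y) (sup𝒢 g 0 q reg out) (ℓ-self 0 q reg)))))) (simp ρ (+ 1)))
        coord (inj₂ (z , ρ , f , h , a , s , eq)) = sym (trans (cong (ℤ._- ρ) (trans (eq (var 0 q)) (trans
          (lemma {f (var 0 q)} {ρ} {S (var 0 q)} {k ℤ.- z} {B = z} {h = h (var 0 q)} (R₀≡0 0 q reg) (R₁≡0 0 q reg))
          (trans (cong (λ x → f (var 0 q) ℤ.+ ρ ℤ.* S (var 0 q) ℤ.+ x) (G≡0 s 0 q reg ℕₚ.≤-refl)) (cong₂ (λ x y → x ℤ.+ ρ ℤ.* y ℤ.+ + 0) (sup𝒜 a 0 q reg out) (ℓ-self 0 q reg)))))) (simp ρ (+ 0)))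
        avκ : Avg (λ i → κ (hs i)) (u (var 0 q) ℤ.- ρ̄)
        avκ = Avg-cong (λ i → coord (hs i)) (Avg-sub (av (var 0 q)) avρ)
        decide : u (var 0 q) ℤ.- ρ̄ ≡ + 0 ⊎ u (var 0 q) ℤ.- ρ̄ ≡ + 1 → 𝒲 u
        decide (inj₁ K≡0) = all-G (λ i → κ₀ (hs i) (sym (Avg-≡ (Avg-const (+ 0)) (subst (Avg _) K≡0 avκ) (λ i → proj₁ (κ-bounds (hs i))) i)))
        decide (inj₂ K≡1) = all-S (λ i → κ₁ (hs i) (Avg-≡ (subst (Avg _) K≡1 avκ) (Avg-const (+ 1)) (λ i → proj₂ (κ-bounds (hs i))) i))

  -- Pairs of tags and their sums

  choose↓ : ∀ {y₁ y₂ z'} → + 0 ℤ.≤ y₁ × y₁ ℤ.≤ + 1 → + 0 ℤ.≤ y₂ × y₂ ℤ.≤ + 1 → + 0 ℤ.≤ z' → z' ℤ.≤ y₁ ℤ.+ y₂ →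
    y₂ ℤ.≤ y₁ ⊎ z' ≢ + 1 →
    Σ[ y₁' ∈ ℤ ] Σ[ y₂' ∈ ℤ ] ((+ 0 ℤ.≤ y₁' × y₁' ℤ.≤ y₁) × (+ 0 ℤ.≤ y₂' × y₂' ℤ.≤ y₂) × y₁' ℤ.+ y₂' ≡ z' × y₂' ℤ.≤ y₁')
  choose↓ {y₁} {y₂} (a , b) (c , d) 0≤z z≤ ord with 01-cases a b | 01-cases c d | 012-cases 0≤z (ℤₚ.≤-trans z≤ (ℤₚ.+-mono-≤ b d))
  ... | _ | _ | inj₁ refl = + 0 , + 0 , (ℤₚ.≤-refl , a) , (ℤₚ.≤-refl , c) , refl , ℤₚ.≤-refl
  ... | inj₂ refl | _ | inj₂ (inj₁ refl) = + 1 , + 0 , (a , ℤₚ.≤-refl) , (ℤₚ.≤-refl , c) , refl , a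
  ... | inj₁ refl | inj₂ refl | inj₂ (inj₁ refl) with ord
  ...   | inj₁ (ℤ.+≤+ ())
  ...   | inj₂ z≢1 = ⊥-elim (z≢1 refl)
  choose↓ (a , b) (c , d) 0≤z (ℤ.+≤+ ()) ord | inj₁ refl | inj₁ refl | inj₂ (inj₁ refl)
  choose↓ (a , b) (c , d) 0≤z (ℤ.+≤+ ()) ord | inj₁ refl | inj₁ refl | inj₂ (inj₂ refl)
  choose↓ (a , b) (c , d) 0≤z (ℤ.+≤+ (ℕ.s≤s ())) ord | inj₁ refl | inj₂ refl | inj₂ (inj₂ refl)
  choose↓ (a , b) (c , d) 0≤z (ℤ.+≤+ (ℕ.s≤s ())) ord | inj₂ refl | inj₁ refl | inj₂ (inj₂ refl)
  choose↓ (a , b) (c , d) 0≤z z≤ ord | inj₂ refl | inj₂ refl | inj₂ (inj₂ refl) = + 1 , + 1 , (a , ℤₚ.≤-refl) , (c , ℤₚ.≤-refl) , refl , ℤₚ.≤-refl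

  -- The counterpart of `choose↓` for steps that raise tags. In both, the sums 0 and 2 are realised
  -- by equal tags and the sum 1 by (1, 0). The order of the old tags provides the room for the
  -- latter: it forces `y₁` to be 1 when tags go down, and `y₂` to be 0 when they go up.
  choose↑ : ∀ {y₁ y₂ z'} → + 0 ℤ.≤ y₁ × y₁ ℤ.≤ + 1 → + 0 ℤ.≤ y₂ × y₂ ℤ.≤ + 1 → y₁ ℤ.+ y₂ ℤ.≤ z' → z' ℤ.≤ + 2 →
    y₂ ℤ.≤ y₁ ⊎ z' ≢ + 1 →
    Σ[ y₁' ∈ ℤ ] Σ[ y₂' ∈ ℤ ] ((y₁ ℤ.≤ y₁' × y₁' ℤ.≤ + 1) × (y₂ ℤ.≤ y₂' × y₂' ℤ.≤ + 1) × y₁' ℤ.+ y₂' ≡ z' × y₂' ℤ.≤ y₁')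
  choose↑ {y₁} {y₂} (a , b) (c , d) z≥ z≤2 ord with 01-cases a b | 01-cases c d | 012-cases (ℤₚ.≤-trans (ℤₚ.+-mono-≤ a c) z≥) z≤2
  ... | _ | _ | inj₂ (inj₂ refl) = + 1 , + 1 , (b , ℤₚ.≤-refl) , (d , ℤₚ.≤-refl) , refl , ℤₚ.≤-refl
  ... | _ | inj₁ refl | inj₂ (inj₁ refl) = + 1 , + 0 , (b , ℤₚ.≤-refl) , (ℤₚ.≤-refl , d) , refl , ℤ.+≤+ ℕ.z≤n
  ... | inj₁ refl | inj₂ refl | inj₂ (inj₁ refl) with ord
  ...   | inj₁ (ℤ.+≤+ ())
  ...   | inj₂ z≢1 = ⊥-elim (z≢1 refl)
  choose↑ (a , b) (c , d) (ℤ.+≤+ (ℕ.s≤s ())) z≤2 ord | inj₂ refl | inj₂ refl | inj₂ (inj₁ refl)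
  choose↑ (a , b) (c , d) z≥ z≤2 ord | inj₁ refl | inj₁ refl | inj₁ refl = + 0 , + 0 , (ℤₚ.≤-refl , b) , (ℤₚ.≤-refl , d) , refl , ℤₚ.≤-refl
  choose↑ (a , b) (c , d) (ℤ.+≤+ ()) z≤2 ord | inj₁ refl | inj₂ refl | inj₁ refl
  choose↑ (a , b) (c , d) (ℤ.+≤+ ()) z≤2 ord | inj₂ refl | inj₁ refl | inj₁ refl
  choose↑ (a , b) (c , d) (ℤ.+≤+ ()) z≤2 ord | inj₂ refl | inj₂ refl | inj₁ refl

  01-gap : ∀ {y₁ y₂} → + 0 ℤ.≤ y₁ × y₁ ℤ.≤ + 1 → + 0 ℤ.≤ y₂ × y₂ ℤ.≤ + 1 → ¬ y₂ ℤ.≤ y₁ → y₁ ≡ + 0 × y₂ ≡ + 1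
  01-gap (a , b) (c , d) h with 01-cases a b | 01-cases c d
  ... | inj₁ refl | inj₁ refl = ⊥-elim (h ℤₚ.≤-refl)
  ... | inj₁ refl | inj₂ refl = refl , refl
  ... | inj₂ refl | inj₁ refl = ⊥-elim (h (ℤ.+≤+ ℕ.z≤n))
  ... | inj₂ refl | inj₂ refl = ⊥-elim (h ℤₚ.≤-refl)

  -- Ordered tags may arise from unordered ones in the step before. Since tags only go down, or only
  -- go up, the new tags are then equal, which is the escape `z ≢ 1` in `Q`.
  Z⇒Q : ∀ b {a c} {t : Tree a c} (q : Loc2 t) {y₁ ρ₁ e₁ y₂ ρ₂ e₂ e} → Z (fst2 q) y₁ ρ₁ e₁ → Z (snd2 q) y₂ ρ₂ e₂ →
    (b ≡ true → y₂ ℤ.≤ y₁) → e ≐ (e₁ ⊞ e₂) → Q b q (y₁ ℤ.+ y₂) (ρ₁ ℤ.+ ρ₂) e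
  Z⇒Q true ends (refl , _) (refl , _) o _ with o refl
  ... | ℤ.+≤+ ()
  Z⇒Q false ends (refl , refl , h) (refl , refl , k) _ g = refl , refl , refl , λ v → trans (g v) (cong₂ ℤ._+_ (h v) (k v))
  Z⇒Q b (inL {a} {b₁} {c} {l} {r} q) {y₁'} {ρ₁'} {_} {y₂'} {ρ₂'} {_} {e'} (mkL y₁ ρ₁ e₁ low₁ lo₁ hi₁ refl h₁) (mkL y₂ ρ₂ e₂ low₂ lo₂ hi₂ refl h₂) o g = result b o
    where
    solve : ∀ e₁ e₂ ρ₁ ρ₂ y₁ y₂ y₁' y₂' s t → e₁ ℤ.+ (ρ₁ ℤ.+ y₁') ℤ.* s ℤ.+ (y₁ ℤ.- y₁') ℤ.* t ℤ.+ (e₂ ℤ.+ (ρ₂ ℤ.+ y₂') ℤ.* s ℤ.+ (y₂ ℤ.- y₂') ℤ.* t) ≡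
      e₁ ℤ.+ e₂ ℤ.+ (ρ₁ ℤ.+ ρ₂ ℤ.+ (y₁' ℤ.+ y₂')) ℤ.* s ℤ.+ (y₁ ℤ.+ y₂ ℤ.- (y₁' ℤ.+ y₂')) ℤ.* t
    solve = ℤS.solve-∀
    step : ∀ b' → (b' ≡ true → y₂ ℤ.≤ y₁) → StepL (Q b' q) a b₁ c (y₁' ℤ.+ y₂') (ℤ.- y₁ ℤ.+ ℤ.- y₂) e'
    step b' o' = mkL (y₁ ℤ.+ y₂) (ρ₁ ℤ.+ ρ₂) (e₁ ⊞ e₂) (Z⇒Q b' q low₁ low₂ o' (λ _ → refl)) (ℤₚ.+-mono-≤ lo₁ lo₂) (ℤₚ.+-mono-≤ hi₁ hi₂)
      (sym (ℤₚ.neg-distrib-+ y₁ y₂)) (λ v → trans (g v) (trans (cong₂ ℤ._+_ (h₁ v) (h₂ v)) (solve (e₁ v) (e₂ v) ρ₁ ρ₂ y₁ y₂ y₁' y₂' (ℓ a b₁ v) (ℓ b₁ c v))))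
    result : ∀ b → (b ≡ true → y₂' ℤ.≤ y₁') → Q b (inL {r = r} q) (y₁' ℤ.+ y₂') (ℤ.- y₁ ℤ.+ ℤ.- y₂) e'
    result false _ = false , step false (λ ()) , λ ()
    result true o with y₂ ℤₚ.≤? y₁
    ... | yes p = true , step true (λ _ → p) , λ _ → inj₁ refl
    ... | no ¬p = false , step false (λ ()) , λ _ → inj₂ λ eq → absurd (trans (sym eq) (cong₂ ℤ._+_ y₁'≡0 y₂'≡0))
      where
      absurd : + 1 ≡ + 0 → ⊥
      absurd ()
      gap = 01-gap (Z-bounds (fst2 q) low₁) (Z-bounds (snd2 q) low₂) ¬p
      y₁'≡0 : y₁' ≡ + 0
      y₁'≡0 = ℤₚ.≤-antisym (subst (y₁' ℤ.≤_) (proj₁ gap) hi₁) lo₁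
      y₂'≡0 : y₂' ≡ + 0
      y₂'≡0 = ℤₚ.≤-antisym (subst (y₂' ℤ.≤_) y₁'≡0 (o refl)) lo₂
  Z⇒Q b (inR {a} {b₁} {c} {l} {r} q) {y₁'} {ρ₁'} {_} {y₂'} {ρ₂'} {_} {e'} (mkR y₁ ρ₁ e₁ low₁ lo₁ hi₁ refl h₁) (mkR y₂ ρ₂ e₂ low₂ lo₂ hi₂ refl h₂) o g = result b o
    where
    solve : ∀ e₁ e₂ ρ₁ ρ₂ y₁ y₂ y₁' y₂' s t → e₁ ℤ.+ (ρ₁ ℤ.+ + 1 ℤ.- y₁') ℤ.* s ℤ.+ (y₁' ℤ.- y₁) ℤ.* t ℤ.+ (e₂ ℤ.+ (ρ₂ ℤ.+ + 1 ℤ.- y₂') ℤ.* s ℤ.+ (y₂' ℤ.- y₂) ℤ.* t) ≡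
      e₁ ℤ.+ e₂ ℤ.+ (ρ₁ ℤ.+ ρ₂ ℤ.+ + 2 ℤ.- (y₁' ℤ.+ y₂')) ℤ.* s ℤ.+ (y₁' ℤ.+ y₂' ℤ.- (y₁ ℤ.+ y₂)) ℤ.* t
    solve = ℤS.solve-∀
    solve′ : ∀ y₁ y₂ → y₁ ℤ.- + 1 ℤ.+ (y₂ ℤ.- + 1) ≡ y₁ ℤ.+ y₂ ℤ.- + 2
    solve′ = ℤS.solve-∀
    step : ∀ b' → (b' ≡ true → y₂ ℤ.≤ y₁) → StepR (+ 2) (Q b' q) a b₁ c (y₁' ℤ.+ y₂') (y₁ ℤ.- + 1 ℤ.+ (y₂ ℤ.- + 1)) e'
    step b' o' = mkR (y₁ ℤ.+ y₂) (ρ₁ ℤ.+ ρ₂) (e₁ ⊞ e₂) (Z⇒Q b' q low₁ low₂ o' (λ _ → refl)) (ℤₚ.+-mono-≤ lo₁ lo₂) (ℤₚ.+-mono-≤ hi₁ hi₂)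
      (solve′ y₁ y₂) (λ v → trans (g v) (trans (cong₂ ℤ._+_ (h₁ v) (h₂ v)) (solve (e₁ v) (e₂ v) ρ₁ ρ₂ y₁ y₂ y₁' y₂' (ℓ b₁ c v) (ℓ a b₁ v))))
    result : ∀ b → (b ≡ true → y₂' ℤ.≤ y₁') → Q b (inR {l = l} q) (y₁' ℤ.+ y₂') (y₁ ℤ.- + 1 ℤ.+ (y₂ ℤ.- + 1)) e'
    result false _ = false , step false (λ ()) , λ ()
    result true o with y₂ ℤₚ.≤? y₁
    ... | yes p = true , step true (λ _ → p) , λ _ → inj₁ refl
    ... | no ¬p = false , step false (λ ()) , λ _ → inj₂ λ eq → absurd (trans (sym eq) (cong₂ ℤ._+_ y₁'≡1 y₂'≡1))
      where
      absurd : + 1 ≡ + 2 → ⊥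
      absurd ()
      gap = 01-gap (Z-bounds (fst2 q) low₁) (Z-bounds (snd2 q) low₂) ¬p
      y₂'≡1 : y₂' ≡ + 1
      y₂'≡1 = ℤₚ.≤-antisym hi₂ (subst (ℤ._≤ y₂') (proj₂ gap) lo₂)
      y₁'≡1 : y₁' ≡ + 1
      y₁'≡1 = ℤₚ.≤-antisym hi₁ (subst (ℤ._≤ y₁') y₂'≡1 (o refl))
  Z⇒Q b (split {a} {b₁} {c} x y) {y₁'} {ρ₁'} {_} {y₂'} {ρ₂'} (mkL y₁ ρ₁ e₁ low₁ lo₁ hi₁ refl h₁) (mkR y₂ ρ₂ e₂ low₂ lo₂ hi₂ refl h₂) o g =
    mkJ y₁ ρ₁ e₁ low₁ y₂ ρ₂ e₂ low₂
      (ℤₚ.≤-trans lo₂ (≤-by lo₁ (ℤₚ.+-comm y₂' y₁')))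
      (subst (y₁' ℤ.+ y₂' ℤ.≤_) (ℤₚ.+-comm y₁ (+ 1)) (ℤₚ.+-mono-≤ hi₁ hi₂))
      (λ t → ℤₚ.≤-trans (ℤₚ.+-mono-≤ lo₂ lo₂) (ℤₚ.+-monoˡ-≤ y₂' (o t)) , ℤₚ.≤-trans (ℤₚ.+-monoʳ-≤ y₁' (o t)) (ℤₚ.+-mono-≤ hi₁ hi₁))
      (solve′ y₁ y₂)
      (λ v → trans (g v) (trans (cong₂ ℤ._+_ (h₁ v) (h₂ v)) (solve (e₁ v) (e₂ v) ρ₁ ρ₂ y₁ y₂ y₁' y₂' (ℓ a b₁ v) (ℓ b₁ c v))))
    where
    solve : ∀ e₁ e₂ ρ₁ ρ₂ y₁ y₂ y₁' y₂' s t → e₁ ℤ.+ (ρ₁ ℤ.+ y₁') ℤ.* s ℤ.+ (y₁ ℤ.- y₁') ℤ.* t ℤ.+ (e₂ ℤ.+ (ρ₂ ℤ.+ + 1 ℤ.- y₂') ℤ.* t ℤ.+ (y₂' ℤ.- y₂) ℤ.* s) ≡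
      e₁ ℤ.+ e₂ ℤ.+ (ρ₁ ℤ.+ (y₁' ℤ.+ y₂') ℤ.- y₂) ℤ.* s ℤ.+ (ρ₂ ℤ.+ + 1 ℤ.+ y₁ ℤ.- (y₁' ℤ.+ y₂')) ℤ.* t
    solve = ℤS.solve-∀
    solve′ : ∀ y₁ y₂ → ℤ.- y₁ ℤ.+ (y₂ ℤ.- + 1) ≡ y₂ ℤ.- + 1 ℤ.- y₁
    solve′ = ℤS.solve-∀

  -- Without the flag the opposite order is imposed. It can always be attained, starting from the
  -- tags 0 and 1 at `ends`, and it lets `choose↓` and `choose↑`, which need some order, be applied
  -- with the two walks exchanged.
  record Pair (b : Bool) {a c} {t : Tree a c} (q : Loc2 t) (z ρ : ℤ) (e : Exp n) : Set where
    constructor mkP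
    field
      y₁ ρ₁ : ℤ
      e₁    : Exp n
      low₁  : Z (fst2 q) y₁ ρ₁ e₁
      y₂ ρ₂ : ℤ
      e₂    : Exp n
      low₂  : Z (snd2 q) y₂ ρ₂ e₂
      z≡    : y₁ ℤ.+ y₂ ≡ z
      ρ≡    : ρ₁ ℤ.+ ρ₂ ≡ ρ
      e≐    : e ≐ (e₁ ⊞ e₂)
      ord   : if b then y₂ ℤ.≤ y₁ else y₁ ℤ.≤ y₂

  Q⇒Z : ∀ b {a c} {t : Tree a c} (q : Loc2 t) {z ρ e} → Q b q z ρ e → Pair b q z ρ e
  Q⇒Z b ends (refl , refl , refl , h) = mkP (+ 0) (+ 0) 0ᵉ (refl , refl , λ _ → refl) (+ 1) (+ 0) 0ᵉ (refl , refl , λ _ → refl) refl refl h (ℤ.+≤+ ℕ.z≤n)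
  Q⇒Z b (inL {a} {b₁} {c} {l} {r} q) {z'} {ρ'} {e'} (b' , mkL z ρ e low lo hi ρ≡ h , cond) = result b cond
    where
    build : ∀ b {b″} (P : Pair b″ q z ρ e) y₁' y₂' → + 0 ℤ.≤ y₁' × y₁' ℤ.≤ Pair.y₁ P → + 0 ℤ.≤ y₂' × y₂' ℤ.≤ Pair.y₂ P → y₁' ℤ.+ y₂' ≡ z' →
      (if b then y₂' ℤ.≤ y₁' else y₁' ℤ.≤ y₂') → Pair b (inL {r = r} q) z' ρ' e'
    build b (mkP y₁ ρ₁ e₁ low₁ y₂ ρ₂ e₂ low₂ refl refl g _) y₁' y₂' (l₁ , u₁) (l₂ , u₂) refl o =
      mkP y₁' (ℤ.- y₁) _ (mkL y₁ ρ₁ e₁ low₁ l₁ u₁ refl (λ _ → refl)) y₂' (ℤ.- y₂) _ (mkL y₂ ρ₂ e₂ low₂ l₂ u₂ refl (λ _ → refl)) refl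
        (trans (sym (ℤₚ.neg-distrib-+ y₁ y₂)) (sym ρ≡))
        (λ v → trans (h v) (trans (cong (λ x → x ℤ.+ (ρ₁ ℤ.+ ρ₂ ℤ.+ (y₁' ℤ.+ y₂')) ℤ.* ℓ a b₁ v ℤ.+ (y₁ ℤ.+ y₂ ℤ.- (y₁' ℤ.+ y₂')) ℤ.* ℓ b₁ c v) (g v))
          (solve (e₁ v) (e₂ v) ρ₁ ρ₂ y₁ y₂ y₁' y₂' (ℓ a b₁ v) (ℓ b₁ c v)))) o
      where
      solve : ∀ e₁ e₂ ρ₁ ρ₂ y₁ y₂ y₁' y₂' s t → e₁ ℤ.+ e₂ ℤ.+ (ρ₁ ℤ.+ ρ₂ ℤ.+ (y₁' ℤ.+ y₂')) ℤ.* s ℤ.+ (y₁ ℤ.+ y₂ ℤ.- (y₁' ℤ.+ y₂')) ℤ.* t ≡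
        e₁ ℤ.+ (ρ₁ ℤ.+ y₁') ℤ.* s ℤ.+ (y₁ ℤ.- y₁') ℤ.* t ℤ.+ (e₂ ℤ.+ (ρ₂ ℤ.+ y₂') ℤ.* s ℤ.+ (y₂ ℤ.- y₂') ℤ.* t)
      solve = ℤS.solve-∀
    result : ∀ b → (b ≡ true → b' ≡ true ⊎ z' ≢ + 1) → Pair b (inL {r = r} q) z' ρ' e'
    result false _ = let P = Q⇒Z false q (Q-relax b' q low)
                         (y₂' , y₁' , k₂ , k₁ , s , o) = choose↓ (Z-bounds (snd2 q) (Pair.low₂ P)) (Z-bounds (fst2 q) (Pair.low₁ P)) lo
                           (subst (z' ℤ.≤_) (trans (sym (Pair.z≡ P)) (ℤₚ.+-comm (Pair.y₁ P) (Pair.y₂ P))) hi) (inj₁ (Pair.ord P))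
                     in build false P y₁' y₂' k₁ k₂ (trans (ℤₚ.+-comm y₁' y₂') s) o
    result true cond = let P = Q⇒Z b' q low
                           (y₁' , y₂' , k₁ , k₂ , s , o) = choose↓ (Z-bounds (fst2 q) (Pair.low₁ P)) (Z-bounds (snd2 q) (Pair.low₂ P)) lo
                             (subst (z' ℤ.≤_) (sym (Pair.z≡ P)) hi) (ordered b' (Pair.ord P) (cond refl))
                       in build true P y₁' y₂' k₁ k₂ s o
      where
      ordered : ∀ b' {y₁ y₂} → (if b' then y₂ ℤ.≤ y₁ else y₁ ℤ.≤ y₂) → b' ≡ true ⊎ z' ≢ + 1 → y₂ ℤ.≤ y₁ ⊎ z' ≢ + 1
      ordered true o _ = inj₁ o
      ordered false o (inj₂ k) = inj₂ k
  Q⇒Z b (inR {a} {b₁} {c} {l} {r} q) {z'} {ρ'} {e'} (b' , mkR z ρ e low lo hi ρ≡ h , cond) = result b cond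
    where
    build : ∀ b {b″} (P : Pair b″ q z ρ e) y₁' y₂' → Pair.y₁ P ℤ.≤ y₁' × y₁' ℤ.≤ + 1 → Pair.y₂ P ℤ.≤ y₂' × y₂' ℤ.≤ + 1 → y₁' ℤ.+ y₂' ≡ z' →
      (if b then y₂' ℤ.≤ y₁' else y₁' ℤ.≤ y₂') → Pair b (inR {l = l} q) z' ρ' e'
    build b (mkP y₁ ρ₁ e₁ low₁ y₂ ρ₂ e₂ low₂ refl refl g _) y₁' y₂' (l₁ , u₁) (l₂ , u₂) refl o =
      mkP y₁' (y₁ ℤ.- + 1) _ (mkR y₁ ρ₁ e₁ low₁ l₁ u₁ refl (λ _ → refl)) y₂' (y₂ ℤ.- + 1) _ (mkR y₂ ρ₂ e₂ low₂ l₂ u₂ refl (λ _ → refl)) refl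
        (trans (solve′ y₁ y₂) (sym ρ≡))
        (λ v → trans (h v) (trans (cong (λ x → x ℤ.+ (ρ₁ ℤ.+ ρ₂ ℤ.+ + 2 ℤ.- (y₁' ℤ.+ y₂')) ℤ.* ℓ b₁ c v ℤ.+ (y₁' ℤ.+ y₂' ℤ.- (y₁ ℤ.+ y₂)) ℤ.* ℓ a b₁ v) (g v))
          (solve (e₁ v) (e₂ v) ρ₁ ρ₂ y₁ y₂ y₁' y₂' (ℓ b₁ c v) (ℓ a b₁ v)))) o
      where
      solve : ∀ e₁ e₂ ρ₁ ρ₂ y₁ y₂ y₁' y₂' s t → e₁ ℤ.+ e₂ ℤ.+ (ρ₁ ℤ.+ ρ₂ ℤ.+ + 2 ℤ.- (y₁' ℤ.+ y₂')) ℤ.* s ℤ.+ (y₁' ℤ.+ y₂' ℤ.- (y₁ ℤ.+ y₂)) ℤ.* t ≡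
        e₁ ℤ.+ (ρ₁ ℤ.+ + 1 ℤ.- y₁') ℤ.* s ℤ.+ (y₁' ℤ.- y₁) ℤ.* t ℤ.+ (e₂ ℤ.+ (ρ₂ ℤ.+ + 1 ℤ.- y₂') ℤ.* s ℤ.+ (y₂' ℤ.- y₂) ℤ.* t)
      solve = ℤS.solve-∀
      solve′ : ∀ y₁ y₂ → y₁ ℤ.- + 1 ℤ.+ (y₂ ℤ.- + 1) ≡ y₁ ℤ.+ y₂ ℤ.- + 2
      solve′ = ℤS.solve-∀
    result : ∀ b → (b ≡ true → b' ≡ true ⊎ z' ≢ + 1) → Pair b (inR {l = l} q) z' ρ' e'
    result false _ = let P = Q⇒Z false q (Q-relax b' q low)
                         (y₂' , y₁' , k₂ , k₁ , s , o) = choose↑ (Z-bounds (snd2 q) (Pair.low₂ P)) (Z-bounds (fst2 q) (Pair.low₁ P))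
                           (subst (ℤ._≤ z') (trans (sym (Pair.z≡ P)) (ℤₚ.+-comm (Pair.y₁ P) (Pair.y₂ P))) lo) hi (inj₁ (Pair.ord P))
                     in build false P y₁' y₂' k₁ k₂ (trans (ℤₚ.+-comm y₁' y₂') s) o
    result true cond = let P = Q⇒Z b' q low
                           (y₁' , y₂' , k₁ , k₂ , s , o) = choose↑ (Z-bounds (fst2 q) (Pair.low₁ P)) (Z-bounds (snd2 q) (Pair.low₂ P))
                             (subst (ℤ._≤ z') (sym (Pair.z≡ P)) lo) hi (ordered b' (Pair.ord P) (cond refl))
                       in build true P y₁' y₂' k₁ k₂ s o
      where
      ordered : ∀ b' {y₁ y₂} → (if b' then y₂ ℤ.≤ y₁ else y₁ ℤ.≤ y₂) → b' ≡ true ⊎ z' ≢ + 1 → y₂ ℤ.≤ y₁ ⊎ z' ≢ + 1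
      ordered true o _ = inj₁ o
      ordered false o (inj₂ k) = inj₂ k
  Q⇒Z b (split {a} {b₁} {c} x y) {z'} {ρ'} {e'} s@(mkJ y₁ ρ₁ e₁ low₁ y₂ ρ₂ e₂ low₂ lo hi cond refl h) =
    result b cond (012-cases (proj₁ (Q-bounds (split x y) s)) (proj₂ (Q-bounds (split x y) s)))
      (01-cases (proj₁ (Z-bounds x low₁)) (proj₂ (Z-bounds x low₁))) (01-cases (proj₁ (Z-bounds y low₂)) (proj₂ (Z-bounds y low₂)))
    where
    build : ∀ b y₁' y₂' → + 0 ℤ.≤ y₁' → y₁' ℤ.≤ y₁ → y₂ ℤ.≤ y₂' → y₂' ℤ.≤ + 1 → y₁' ℤ.+ y₂' ≡ z' → (if b then y₂' ℤ.≤ y₁' else y₁' ℤ.≤ y₂') → Pair b (split x y) z' ρ' e'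
    build b y₁' y₂' l₁ u₁ l₂ u₂ refl o = mkP y₁' (ℤ.- y₁) _ (mkL y₁ ρ₁ e₁ low₁ l₁ u₁ refl (λ _ → refl)) y₂' (y₂ ℤ.- + 1) _ (mkR y₂ ρ₂ e₂ low₂ l₂ u₂ refl (λ _ → refl)) refl
      (solve′ y₁ y₂) (λ v → trans (h v) (solve (e₁ v) (e₂ v) ρ₁ ρ₂ y₁ y₂ y₁' y₂' (ℓ a b₁ v) (ℓ b₁ c v))) o
      where
      solve : ∀ e₁ e₂ ρ₁ ρ₂ y₁ y₂ y₁' y₂' s t →
        e₁ ℤ.+ e₂ ℤ.+ (ρ₁ ℤ.+ (y₁' ℤ.+ y₂') ℤ.- y₂) ℤ.* s ℤ.+ (ρ₂ ℤ.+ + 1 ℤ.+ y₁ ℤ.- (y₁' ℤ.+ y₂')) ℤ.* t ≡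
        e₁ ℤ.+ (ρ₁ ℤ.+ y₁') ℤ.* s ℤ.+ (y₁ ℤ.- y₁') ℤ.* t ℤ.+ (e₂ ℤ.+ (ρ₂ ℤ.+ + 1 ℤ.- y₂') ℤ.* t ℤ.+ (y₂' ℤ.- y₂) ℤ.* s)
      solve = ℤS.solve-∀
      solve′ : ∀ y₁ y₂ → ℤ.- y₁ ℤ.+ (y₂ ℤ.- + 1) ≡ y₂ ℤ.- + 1 ℤ.- y₁
      solve′ = ℤS.solve-∀
    0≤1 : + 0 ℤ.≤ + 1
    0≤1 = ℤ.+≤+ ℕ.z≤n
    result : ∀ b → Good b y₁ y₂ z' → z' ≡ + 0 ⊎ z' ≡ + 1 ⊎ z' ≡ + 2 → y₁ ≡ + 0 ⊎ y₁ ≡ + 1 → y₂ ≡ + 0 ⊎ y₂ ≡ + 1 → Pair b (split x y) z' ρ' e'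
    result b g (inj₁ refl) _ _ = build b (+ 0) (+ 0) ℤₚ.≤-refl (proj₁ (Z-bounds x low₁)) lo 0≤1 refl (refl-ord b)
      where
      refl-ord : ∀ b → if b then + 0 ℤ.≤ + 0 else + 0 ℤ.≤ + 0
      refl-ord true = ℤₚ.≤-refl
      refl-ord false = ℤₚ.≤-refl
    result false g (inj₂ (inj₁ refl)) _ _ = build false (+ 0) (+ 1) ℤₚ.≤-refl (proj₁ (Z-bounds x low₁)) (proj₂ (Z-bounds y low₂)) ℤₚ.≤-refl refl 0≤1
    result true g (inj₂ (inj₁ refl)) (inj₂ refl) (inj₁ refl) = build true (+ 1) (+ 0) 0≤1 ℤₚ.≤-refl ℤₚ.≤-refl 0≤1 refl 0≤1
    result true g (inj₂ (inj₁ refl)) (inj₁ refl) _ with proj₂ (g refl)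
    ... | ℤ.+≤+ ()
    result true g (inj₂ (inj₁ refl)) _ (inj₂ refl) with proj₁ (g refl)
    ... | ℤ.+≤+ (ℕ.s≤s ())
    result b g (inj₂ (inj₂ refl)) (inj₂ refl) _ = build b (+ 1) (+ 1) 0≤1 ℤₚ.≤-refl (proj₂ (Z-bounds y low₂)) ℤₚ.≤-refl refl (refl-ord b)
      where
      refl-ord : ∀ b → if b then + 1 ℤ.≤ + 1 else + 1 ℤ.≤ + 1
      refl-ord true = ℤₚ.≤-refl
      refl-ord false = ℤₚ.≤-refl
    result b g (inj₂ (inj₂ refl)) (inj₁ refl) _ = ⊥-elim (2≰1 hi)
      where
      2≰1 : ¬ + 2 ℤ.≤ + 1
      2≰1 (ℤ.+≤+ (ℕ.s≤s ()))

-- The Ptolemy relations and the expansions they give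

module Ptolemy {n : ℕ} (ℓ : ℕ → ℕ → Exp n) (var : ℕ → ℕ → Var n)
  (ℓ-self : ∀ p q → Reg n p q → ℓ p q (var p q) ≡ + 1)
  (ℓ-other : ∀ p q → Reg n p q → ∀ p' q' → p' < q' → q' ≤ suc n → ¬ (p' ≡ p × q' ≡ q) → ℓ p' q' (var p q) ≡ + 0)
  (Λ : ℕ → ℕ → LP n) (Λ-refl : ∀ a → Λ a a ≈ 0ᴸ)
  (ptolemy-R : ∀ a b c → a < b → b < c → c ≤ n → Λ b (suc n) ⊗ Λ a c ≈ Λ a b ⊗ Λ c (suc n) ⊕ Λ b c ⊗ Λ a (suc n))
  where
  open Expansion ℓ var ℓ-self ℓ-other
  module Rλ = CommutativeSemiring (LP-semiring n)
  open NatSolver (LP-semiring n) using (solve; _:=_; _:*_; _:+_)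

  R : ℕ → LP n
  R v = Λ v (suc n)

  Labelled : ∀ {a c} → Tree a c → Set
  Labelled {a} {c} leaf = Λ a c ≈ 𝕩 (ℓ a c)
  Labelled {a} {c} (node l r) = Λ a c ≈ 𝕩 (ℓ a c) × Labelled l × Labelled r

  label : ∀ {a c} (t : Tree a c) → Labelled t → Λ a c ≈ 𝕩 (ℓ a c)
  label leaf h = h
  label (node l r) h = proj₁ h

  -- Keeps a description of the exponents, unlike `Pos`, because the induction divides by labels.
  Positive : LP n → Set₁
  Positive p = Σ[ X ∈ (Exp n → Set) ] (Rep p X × Σ[ e ∈ Exp n ] X e)

  Positive⇒Pos : ∀ {p} → Positive p → Pos p
  Positive⇒Pos (X , rep , e , x) = Rep⇒Pos rep x

  Positive-𝕩 : ∀ {p e} → p ≈ 𝕩 e → Positive p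
  Positive-𝕩 {e = e} h = _ , Rep-≈ h (Rep-𝕩 e) , e , λ _ → refl

  -- Uses only the relation with the puncture. The general Ptolemy relation is not yet available at
  -- this stage: it is obtained by cancelling radii, which presupposes that these are positive.
  Positive-apex : ∀ {a b c} → a < b → b < c → c ≤ n → Λ a c ≈ 𝕩 (ℓ a c) → Λ a b ≈ 𝕩 (ℓ a b) → Λ b c ≈ 𝕩 (ℓ b c) →
    Positive (R a) → Positive (R c) → Positive (R b)
  Positive-apex {a} {b} {c} a<b b<c c≤n ac ab bc (X , Ra , e , x) (Y , Rc , f , y) =
    _ , Rep-÷ (ℓ a c) relation (Rep-+ (Rep-* (Rep-𝕩 (ℓ a b)) Rc) (Rep-* (Rep-𝕩 (ℓ b c)) Ra)) , ℓ a b ⊞ f ⊟ ℓ a c ,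
    inj₁ (ℓ a b , f , (λ _ → refl) , y , λ v → cancel (ℓ a b v ℤ.+ f v) (ℓ a c v))
    where
    cancel : ∀ x y → x ℤ.- y ℤ.+ y ≡ x
    cancel = ℤS.solve-∀
    relation : 𝕩 (ℓ a c) ⊗ R b ≈ 𝕩 (ℓ a b) ⊗ R c ⊕ 𝕩 (ℓ b c) ⊗ R a
    relation = ≈-trans (Rλ.*-congʳ (≈-sym ac)) (≈-trans (Rλ.*-comm (Λ a c) (R b))
      (≈-trans (ptolemy-R a b c a<b b<c c≤n) (Rλ.+-cong (Rλ.*-congʳ ab) (Rλ.*-congʳ bc))))

  Positive-region : ∀ {a c} (t : Tree a c) → Labelled t → c ≤ n → Positive (R a) → Positive (R c) → ∀ v → a ≤ v → v ≤ c → Positive (R v)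
  Positive-region leaf h c≤n pa pc v a≤v v≤c with ℕₚ.m≤n⇒m<n∨m≡n a≤v
  ... | inj₂ refl = pa
  ... | inj₁ a<v with ℕₚ.≤-antisym a<v v≤c
  ...   | refl = pc
  Positive-region (node {b = b} l r) (ac , hl , hr) c≤n pa pc v a≤v v≤c with ℕₚ.≤-total v b
  ... | inj₁ v≤b = Positive-region l hl (ℕₚ.≤-trans (ℕₚ.<⇒≤ (Tree-< r)) c≤n) pa (Positive-apex (Tree-< l) (Tree-< r) c≤n ac (label l hl) (label r hr) pa pc) v a≤v v≤b
  ... | inj₂ b≤v = Positive-region r hr c≤n (Positive-apex (Tree-< l) (Tree-< r) c≤n ac (label l hl) (label r hr) pa pc) pc v b≤v v≤c

  -- The triangles at the puncture form the right spine of the tree, and each left subtree along it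
  -- lies between two consecutive radii of the triangulation, whose values are labels.
  Positive-R : ∀ {a c} (t : Tree a c) → Labelled t → c ≡ suc n → ∀ v → a ≤ v → v ≤ n → Positive (R v)
  Positive-R leaf h refl v a≤v v≤n with ℕₚ.≤-antisym a≤v v≤n
  ... | refl = Positive-𝕩 h
  Positive-R (node {b = b} l r) (ac , hl , hr) refl v a≤v v≤n with ℕₚ.≤-total v b
  ... | inj₁ v≤b = Positive-region l hl (ℕ.s≤s⁻¹ (Tree-< r)) (Positive-𝕩 ac) (Positive-𝕩 (label r hr)) v a≤v v≤b
  ... | inj₂ b≤v = Positive-R r hr refl v b≤v v≤n

  module _ (pos-R : ∀ v → v ≤ n → Pos (R v)) where

    -- Follows from the relations with the puncture after multiplication by R b and R c.
    ptolemy-< : ∀ a b c d → a < b → b < c → c < d → d ≤ n → Λ a c ⊗ Λ b d ≈ Λ a b ⊗ Λ c d ⊕ Λ a d ⊗ Λ b c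
    ptolemy-< a b c d a<b b<c c<d d≤n = Pos-cancelʳ (pos-R b b≤n) (Pos-cancelʳ (pos-R c c≤n) (begin
      Λ a c ⊗ Λ b d ⊗ R b ⊗ R c
        ≈⟨ solve 4 (λ ac bd rb rc → ac :* bd :* rb :* rc := (rb :* ac) :* (rc :* bd)) ≈-refl (Λ a c) (Λ b d) (R b) (R c) ⟩
      (R b ⊗ Λ a c) ⊗ (R c ⊗ Λ b d)
        ≈⟨ Rλ.*-cong abc (ptolemy-R b c d b<c c<d d≤n) ⟩
      (Λ a b ⊗ R c ⊕ Λ b c ⊗ R a) ⊗ (Λ b c ⊗ R d ⊕ Λ c d ⊗ R b)
        ≈⟨ solve 7 (λ ab bc cd ra rb rc rd → (ab :* rc :+ bc :* ra) :* (bc :* rd :+ cd :* rb) :=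
             ab :* cd :* (rb :* rc) :+ bc :* ((ab :* rc :+ bc :* ra) :* rd :+ cd :* ra :* rb)) ≈-refl (Λ a b) (Λ b c) (Λ c d) (R a) (R b) (R c) (R d) ⟩
      Λ a b ⊗ Λ c d ⊗ (R b ⊗ R c) ⊕ Λ b c ⊗ ((Λ a b ⊗ R c ⊕ Λ b c ⊗ R a) ⊗ R d ⊕ Λ c d ⊗ R a ⊗ R b)
        ≈⟨ Rλ.+-congˡ (Rλ.*-congˡ (Rλ.+-congʳ (Rλ.*-congʳ abc))) ⟨
      Λ a b ⊗ Λ c d ⊗ (R b ⊗ R c) ⊕ Λ b c ⊗ (R b ⊗ Λ a c ⊗ R d ⊕ Λ c d ⊗ R a ⊗ R b)
        ≈⟨ solve 8 (λ ab bc cd ac ra rb rc rd → ab :* cd :* (rb :* rc) :+ bc :* (rb :* ac :* rd :+ cd :* ra :* rb) :=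
             ab :* cd :* (rb :* rc) :+ bc :* rb :* (ac :* rd :+ cd :* ra)) ≈-refl (Λ a b) (Λ b c) (Λ c d) (Λ a c) (R a) (R b) (R c) (R d) ⟩
      Λ a b ⊗ Λ c d ⊗ (R b ⊗ R c) ⊕ Λ b c ⊗ R b ⊗ (Λ a c ⊗ R d ⊕ Λ c d ⊗ R a)
        ≈⟨ Rλ.+-congˡ (Rλ.*-congˡ (ptolemy-R a c d (ℕₚ.<-trans a<b b<c) c<d d≤n)) ⟨
      Λ a b ⊗ Λ c d ⊗ (R b ⊗ R c) ⊕ Λ b c ⊗ R b ⊗ (R c ⊗ Λ a d)
        ≈⟨ solve 6 (λ ab bc cd ad rb rc → ab :* cd :* (rb :* rc) :+ bc :* rb :* (rc :* ad) := (ab :* cd :+ ad :* bc) :* rb :* rc) ≈-refl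
             (Λ a b) (Λ b c) (Λ c d) (Λ a d) (R b) (R c) ⟩
      (Λ a b ⊗ Λ c d ⊕ Λ a d ⊗ Λ b c) ⊗ R b ⊗ R c ∎))
      where
      open ≈-Reasoning
      c≤n : c ≤ n
      c≤n = ℕₚ.≤-trans (ℕₚ.<⇒≤ c<d) d≤n
      b≤n : b ≤ n
      b≤n = ℕₚ.≤-trans (ℕₚ.<⇒≤ b<c) c≤n
      abc : R b ⊗ Λ a c ≈ Λ a b ⊗ R c ⊕ Λ b c ⊗ R a
      abc = ptolemy-R a b c a<b b<c c≤n

    -- The cases of coinciding vertices reduce to `Λ-refl`. They allow the outer vertex in `linearˡ`
    -- and `linearʳ` to be an end of the polygon.
    ptolemy : ∀ a b c d → a ≤ b → b ≤ c → c ≤ d → d ≤ suc n → Λ a c ⊗ Λ b d ≈ Λ a b ⊗ Λ c d ⊕ Λ a d ⊗ Λ b c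
    ptolemy a b c d a≤b b≤c c≤d d≤ with ℕₚ.m≤n⇒m<n∨m≡n a≤b | ℕₚ.m≤n⇒m<n∨m≡n b≤c | ℕₚ.m≤n⇒m<n∨m≡n c≤d | ℕₚ.m≤n⇒m<n∨m≡n d≤
    ... | inj₂ refl | _ | _ | _ = ≈-trans (Rλ.*-comm _ _) (≈-sym (≈-trans (Rλ.+-congʳ (≈-trans (Rλ.*-congʳ (Λ-refl a)) (Rλ.zeroˡ _))) (Rλ.+-identityˡ _)))
    ... | inj₁ _ | inj₂ refl | _ | _ = ≈-sym (≈-trans (Rλ.+-congˡ (≈-trans (Rλ.*-congˡ (Λ-refl b)) (Rλ.zeroʳ _))) (Rλ.+-identityʳ _))
    ... | inj₁ _ | inj₁ _ | inj₂ refl | _ = ≈-sym (≈-trans (Rλ.+-congʳ (≈-trans (Rλ.*-congˡ (Λ-refl c)) (Rλ.zeroʳ _))) (Rλ.+-identityˡ _))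
    ... | inj₁ a<b | inj₁ b<c | inj₁ c<d | inj₁ d<1+n = ptolemy-< a b c d a<b b<c c<d (ℕ.s≤s⁻¹ d<1+n)
    ... | inj₁ a<b | inj₁ b<c | inj₁ c<d | inj₂ refl = ≈-trans (Rλ.*-comm _ _) (≈-trans (ptolemy-R a b c a<b b<c (ℕ.s≤s⁻¹ c<d)) (Rλ.+-congˡ (Rλ.*-comm _ _)))

    Linear : (ℕ → LP n) → ∀ {a c} → Tree a c → Set
    Linear Φ leaf = ⊤
    Linear Φ {a} {c} (node {b = b} l r) = 𝕩 (ℓ a c) ⊗ Φ b ≈ 𝕩 (ℓ a b) ⊗ Φ c ⊕ 𝕩 (ℓ b c) ⊗ Φ a × Linear Φ l × Linear Φ r

    linearˡ : ∀ {a c} (t : Tree a c) → Labelled t → ∀ w → c ≤ w → w ≤ suc n → Linear (λ u → Λ u w) t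
    linearˡ leaf h w c≤w w≤ = tt
    linearˡ {a} {c} (node {b = b} l r) (ac , hl , hr) w c≤w w≤ =
      ≈-trans (Rλ.*-congʳ (≈-sym ac)) (≈-trans (ptolemy a b c w (ℕₚ.<⇒≤ (Tree-< l)) (ℕₚ.<⇒≤ (Tree-< r)) c≤w w≤)
        (Rλ.+-cong (Rλ.*-congʳ (label l hl)) (≈-trans (Rλ.*-comm _ _) (Rλ.*-congʳ (label r hr))))) ,
      linearˡ l hl w (ℕₚ.≤-trans (ℕₚ.<⇒≤ (Tree-< r)) c≤w) w≤ , linearˡ r hr w c≤w w≤

    linearʳ : ∀ {a c} (t : Tree a c) → Labelled t → ∀ w → w ≤ a → c ≤ suc n → Linear (λ u → Λ w u) t
    linearʳ leaf h w w≤a c≤ = tt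
    linearʳ {a} {c} (node {b = b} l r) (ac , hl , hr) w w≤a c≤ =
      ≈-trans (Rλ.*-congʳ (≈-sym ac)) (≈-trans (Rλ.*-comm _ _) (≈-trans (ptolemy w a b c w≤a (ℕₚ.<⇒≤ (Tree-< l)) (ℕₚ.<⇒≤ (Tree-< r)) c≤)
        (≈-trans (Rλ.+-comm _ _) (Rλ.+-cong (≈-trans (Rλ.*-comm _ _) (Rλ.*-congʳ (label l hl))) (≈-trans (Rλ.*-comm _ _) (Rλ.*-congʳ (label r hr))))))) ,
      linearʳ l hl w w≤a (ℕₚ.≤-trans (ℕₚ.<⇒≤ (Tree-< r)) c≤) , linearʳ r hr w (ℕₚ.≤-trans w≤a (ℕₚ.<⇒≤ (Tree-< l))) c≤

    Zᵉ : ∀ {a c} {t : Tree a c} → Loc t → ℤ → Exp n → Set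
    Zᵉ {a} {c} x y e = Σ[ ρ ∈ ℤ ] Σ[ f ∈ Exp n ] (Z x y ρ f × (∀ v → e v ≡ f v ℤ.+ ρ ℤ.* ℓ a c v))

    -- `M₀` and `M₁` are the same for all `Φ`, so one pair of coefficients expands the chords from a
    -- vertex to every point outside its polygon, the puncture included. This is what allows
    -- products of several such expansions to be compared.
    record Coordinates {a c} {t : Tree a c} (x : Loc t) : Set where
      field
        M₀ M₁ : LP n
        combine : ∀ Φ → Linear Φ t → Φ (pos x) ≈ M₀ ⊗ Φ a ⊕ M₁ ⊗ Φ c
        rep₀ : Rep M₀ (Zᵉ x (+ 0))
        rep₁ : Rep M₁ (Zᵉ x (+ 1))

    apex : ∀ (Φ : ℕ → LP n) {a b c} → 𝕩 (ℓ a c) ⊗ Φ b ≈ 𝕩 (ℓ a b) ⊗ Φ c ⊕ 𝕩 (ℓ b c) ⊗ Φ a →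
           Φ b ≈ 𝕩 (ℓ a b ⊟ ℓ a c) ⊗ Φ c ⊕ 𝕩 (ℓ b c ⊟ ℓ a c) ⊗ Φ a
    apex Φ {a} {b} {c} h = begin
      Φ b ≈⟨ 𝕩-inverse (ℓ a c) (Φ b) ⟨
      𝕩 (0ᵉ ⊟ ℓ a c) ⊗ (𝕩 (ℓ a c) ⊗ Φ b) ≈⟨ Rλ.*-congˡ h ⟩
      𝕩 (0ᵉ ⊟ ℓ a c) ⊗ (𝕩 (ℓ a b) ⊗ Φ c ⊕ 𝕩 (ℓ b c) ⊗ Φ a)
        ≈⟨ solve 5 (λ i x y p q → i :* (x :* p :+ y :* q) := (i :* x) :* p :+ (i :* y) :* q) ≈-refl (𝕩 (0ᵉ ⊟ ℓ a c)) (𝕩 (ℓ a b)) (𝕩 (ℓ b c)) (Φ c) (Φ a) ⟩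
      (𝕩 (0ᵉ ⊟ ℓ a c) ⊗ 𝕩 (ℓ a b)) ⊗ Φ c ⊕ (𝕩 (0ᵉ ⊟ ℓ a c) ⊗ 𝕩 (ℓ b c)) ⊗ Φ a
        ≈⟨ Rλ.+-cong (Rλ.*-congʳ (≈-trans (𝕩-⊗ _ _) (𝕩-cong λ v → lemma (ℓ a c v) (ℓ a b v)))) (Rλ.*-congʳ (≈-trans (𝕩-⊗ _ _) (𝕩-cong λ v → lemma (ℓ a c v) (ℓ b c v)))) ⟩
      𝕩 (ℓ a b ⊟ ℓ a c) ⊗ Φ c ⊕ 𝕩 (ℓ b c ⊟ ℓ a c) ⊗ Φ a ∎
      where
      open ≈-Reasoning
      lemma : ∀ x y → + 0 ℤ.- x ℤ.+ y ≡ y ℤ.- x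
      lemma = ℤS.solve-∀

    Rep-1ᴸ : Rep {n} 1ᴸ (_≐ 0ᵉ)
    Rep-1ᴸ = Rep-≈ (≈-sym 𝕩-0ᵉ) (Rep-𝕩 0ᵉ)

    coordinates : ∀ {a c} {t : Tree a c} (x : Loc t) → Coordinates x
    coordinates {a} {c} atL = record { M₀ = 1ᴸ ; M₁ = 0ᴸ
      ; combine = λ Φ _ → ≈-sym (≈-trans (Rλ.+-cong (Rλ.*-identityˡ _) (Rλ.zeroˡ _)) (Rλ.+-identityʳ _))
      ; rep₀ = Rep-⇔ _ Rep-1ᴸ (λ e h → + 0 , 0ᵉ , (refl , refl , λ _ → refl) , λ v → trans (h v) refl)
          (λ { e (.(+ 0) , f , (refl , refl , k) , h) v → trans (h v) (trans (ℤₚ.+-identityʳ (f v)) (k v)) })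
      ; rep₁ = Rep-⇔ _ Rep-0ᴸ (λ _ ()) (λ { e (_ , _ , (() , _) , _) }) }
    coordinates {a} {c} atR = record { M₀ = 0ᴸ ; M₁ = 1ᴸ
      ; combine = λ Φ _ → ≈-sym (≈-trans (Rλ.+-cong (Rλ.zeroˡ _) (Rλ.*-identityˡ _)) (Rλ.+-identityˡ _))
      ; rep₁ = Rep-⇔ _ Rep-1ᴸ (λ e h → + 0 , 0ᵉ , (refl , refl , λ _ → refl) , λ v → trans (h v) refl)
          (λ { e (.(+ 0) , f , (refl , refl , k) , h) v → trans (h v) (trans (ℤₚ.+-identityʳ (f v)) (k v)) })
      ; rep₀ = Rep-⇔ _ Rep-0ᴸ (λ _ ()) (λ { e (_ , _ , (() , _) , _) }) }
    coordinates (inL {a} {b} {c} {l} {r} x) = record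
      { M₀ = M₀ ⊕ M₁ ⊗ 𝕩 (ℓ b c ⊟ ℓ a c)
      ; M₁ = M₁ ⊗ 𝕩 (ℓ a b ⊟ ℓ a c)
      ; combine = λ { Φ (h , hl , hr) → ≈-trans (combine Φ hl) (≈-trans (Rλ.+-congˡ (Rλ.*-congˡ (apex Φ h)))
          (solve 6 (λ m₀ m₁ s t p q → m₀ :* p :+ m₁ :* (s :* q :+ t :* p) := (m₀ :+ m₁ :* t) :* p :+ (m₁ :* s) :* q) ≈-refl
            M₀ M₁ (𝕩 (ℓ a b ⊟ ℓ a c)) (𝕩 (ℓ b c ⊟ ℓ a c)) (Φ a) (Φ c))) }
      ; rep₀ = Rep-⇔ _ (Rep-+ rep₀ (Rep-* rep₁ (Rep-𝕩 _))) to₀ from₀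
      ; rep₁ = Rep-⇔ _ (Rep-* rep₁ (Rep-𝕩 _)) to₁ from₁ }
      where
      open Coordinates (coordinates x)
      0≤0 : + 0 ℤ.≤ + 0
      0≤0 = ℤₚ.≤-refl
      to₀ : ∀ e → Zᵉ x (+ 0) e ⊎ (Zᵉ x (+ 1) +ˢ (_≐ (ℓ b c ⊟ ℓ a c))) e → Zᵉ (inL {r = r} x) (+ 0) e
      to₀ e (inj₁ (ρ , f , z , h)) = + 0 , f′ , mkL (+ 0) ρ f z 0≤0 0≤0 refl (λ _ → refl) , λ v → trans (h v) (lemma (f v) ρ (ℓ a b v) (ℓ b c v) (ℓ a c v))
        where
        f′ : Exp n
        f′ v = f v ℤ.+ (ρ ℤ.+ + 0) ℤ.* ℓ a b v ℤ.+ (+ 0 ℤ.- + 0) ℤ.* ℓ b c v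
        lemma : ∀ f ρ s t u → f ℤ.+ ρ ℤ.* s ≡ f ℤ.+ (ρ ℤ.+ + 0) ℤ.* s ℤ.+ (+ 0 ℤ.- + 0) ℤ.* t ℤ.+ + 0 ℤ.* u
        lemma = ℤS.solve-∀
      to₀ e (inj₂ (g , g' , (ρ , f , z , h) , h' , k)) = ℤ.- + 1 , f′ , mkL (+ 1) ρ f z 0≤0 (ℤ.+≤+ ℕ.z≤n) refl (λ _ → refl) ,
        λ v → trans (k v) (trans (cong₂ ℤ._+_ (h v) (h' v)) (lemma (f v) ρ (ℓ a b v) (ℓ b c v) (ℓ a c v)))
        where
        f′ : Exp n
        f′ v = f v ℤ.+ (ρ ℤ.+ + 0) ℤ.* ℓ a b v ℤ.+ (+ 1 ℤ.- + 0) ℤ.* ℓ b c v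
        lemma : ∀ f ρ s t u → f ℤ.+ ρ ℤ.* s ℤ.+ (t ℤ.- u) ≡ f ℤ.+ (ρ ℤ.+ + 0) ℤ.* s ℤ.+ (+ 1 ℤ.- + 0) ℤ.* t ℤ.+ (ℤ.- + 1) ℤ.* u
        lemma = ℤS.solve-∀
      from₀ : ∀ e → Zᵉ (inL {r = r} x) (+ 0) e → Zᵉ x (+ 0) e ⊎ (Zᵉ x (+ 1) +ˢ (_≐ (ℓ b c ⊟ ℓ a c))) e
      from₀ e (ρ' , f' , mkL y ρ f z lo hi refl g , h) with 01-cases (proj₁ (Z-bounds x z)) (proj₂ (Z-bounds x z))
      ... | inj₁ refl = inj₁ (ρ , f , z , λ v → trans (h v) (trans (cong (λ s → s ℤ.+ ℤ.- + 0 ℤ.* ℓ a c v) (g v)) (lemma (f v) ρ (ℓ a b v) (ℓ b c v) (ℓ a c v))))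
        where
        lemma : ∀ f ρ s t u → f ℤ.+ (ρ ℤ.+ + 0) ℤ.* s ℤ.+ (+ 0 ℤ.- + 0) ℤ.* t ℤ.+ + 0 ℤ.* u ≡ f ℤ.+ ρ ℤ.* s
        lemma = ℤS.solve-∀
      ... | inj₂ refl = inj₂ (_ , ℓ b c ⊟ ℓ a c , (ρ , f , z , λ _ → refl) , (λ _ → refl) ,
        λ v → trans (h v) (trans (cong (λ s → s ℤ.+ (ℤ.- + 1) ℤ.* ℓ a c v) (g v)) (lemma (f v) ρ (ℓ a b v) (ℓ b c v) (ℓ a c v))))
        where
        lemma : ∀ f ρ s t u → f ℤ.+ (ρ ℤ.+ + 0) ℤ.* s ℤ.+ (+ 1 ℤ.- + 0) ℤ.* t ℤ.+ (ℤ.- + 1) ℤ.* u ≡ f ℤ.+ ρ ℤ.* s ℤ.+ (t ℤ.- u)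
        lemma = ℤS.solve-∀
      to₁ : ∀ e → (Zᵉ x (+ 1) +ˢ (_≐ (ℓ a b ⊟ ℓ a c))) e → Zᵉ (inL {r = r} x) (+ 1) e
      to₁ e (g , g' , (ρ , f , z , h) , h' , k) = ℤ.- + 1 , f′ , mkL (+ 1) ρ f z (ℤ.+≤+ ℕ.z≤n) ℤₚ.≤-refl refl (λ _ → refl) ,
        λ v → trans (k v) (trans (cong₂ ℤ._+_ (h v) (h' v)) (lemma (f v) ρ (ℓ a b v) (ℓ b c v) (ℓ a c v)))
        where
        f′ : Exp n
        f′ v = f v ℤ.+ (ρ ℤ.+ + 1) ℤ.* ℓ a b v ℤ.+ (+ 1 ℤ.- + 1) ℤ.* ℓ b c v
        lemma : ∀ f ρ s t u → f ℤ.+ ρ ℤ.* s ℤ.+ (s ℤ.- u) ≡ f ℤ.+ (ρ ℤ.+ + 1) ℤ.* s ℤ.+ (+ 1 ℤ.- + 1) ℤ.* t ℤ.+ (ℤ.- + 1) ℤ.* u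
        lemma = ℤS.solve-∀
      from₁ : ∀ e → Zᵉ (inL {r = r} x) (+ 1) e → (Zᵉ x (+ 1) +ˢ (_≐ (ℓ a b ⊟ ℓ a c))) e
      from₁ e (ρ' , f' , mkL y ρ f z lo hi refl g , h) with ℤₚ.≤-antisym (proj₂ (Z-bounds x z)) hi
      ... | refl = _ , ℓ a b ⊟ ℓ a c , (ρ , f , z , λ _ → refl) , (λ _ → refl) ,
        λ v → trans (h v) (trans (cong (λ s → s ℤ.+ (ℤ.- + 1) ℤ.* ℓ a c v) (g v)) (lemma (f v) ρ (ℓ a b v) (ℓ b c v) (ℓ a c v)))
        where
        lemma : ∀ f ρ s t u → f ℤ.+ (ρ ℤ.+ + 1) ℤ.* s ℤ.+ (+ 1 ℤ.- + 1) ℤ.* t ℤ.+ (ℤ.- + 1) ℤ.* u ≡ f ℤ.+ ρ ℤ.* s ℤ.+ (s ℤ.- u)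
        lemma = ℤS.solve-∀
    coordinates (inR {a} {b} {c} {l} {r} x) = record
      { M₀ = M₀ ⊗ 𝕩 (ℓ b c ⊟ ℓ a c)
      ; M₁ = M₁ ⊕ M₀ ⊗ 𝕩 (ℓ a b ⊟ ℓ a c)
      ; combine = λ { Φ (h , hl , hr) → ≈-trans (combine Φ hr) (≈-trans (Rλ.+-congʳ (Rλ.*-congˡ (apex Φ h)))
          (solve 6 (λ m₀ m₁ s t p q → m₀ :* (s :* q :+ t :* p) :+ m₁ :* q := (m₀ :* t) :* p :+ (m₁ :+ m₀ :* s) :* q) ≈-refl
            M₀ M₁ (𝕩 (ℓ a b ⊟ ℓ a c)) (𝕩 (ℓ b c ⊟ ℓ a c)) (Φ a) (Φ c))) }
      ; rep₁ = Rep-⇔ _ (Rep-+ rep₁ (Rep-* rep₀ (Rep-𝕩 _))) to₁ from₁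
      ; rep₀ = Rep-⇔ _ (Rep-* rep₀ (Rep-𝕩 _)) to₀ from₀ }
      where
      open Coordinates (coordinates x)
      0≤1 : + 0 ℤ.≤ + 1
      0≤1 = ℤ.+≤+ ℕ.z≤n
      to₁ : ∀ e → Zᵉ x (+ 1) e ⊎ (Zᵉ x (+ 0) +ˢ (_≐ (ℓ a b ⊟ ℓ a c))) e → Zᵉ (inR {l = l} x) (+ 1) e
      to₁ e (inj₁ (ρ , f , z , h)) = + 0 , f′ , mkR (+ 1) ρ f z ℤₚ.≤-refl ℤₚ.≤-refl refl (λ _ → refl) , λ v → trans (h v) (lemma (f v) ρ (ℓ b c v) (ℓ a b v) (ℓ a c v))
        where
        f′ : Exp n
        f′ v = f v ℤ.+ (ρ ℤ.+ + 1 ℤ.- + 1) ℤ.* ℓ b c v ℤ.+ (+ 1 ℤ.- + 1) ℤ.* ℓ a b v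
        lemma : ∀ f ρ s t u → f ℤ.+ ρ ℤ.* s ≡ f ℤ.+ (ρ ℤ.+ + 1 ℤ.- + 1) ℤ.* s ℤ.+ (+ 1 ℤ.- + 1) ℤ.* t ℤ.+ + 0 ℤ.* u
        lemma = ℤS.solve-∀
      to₁ e (inj₂ (g , g' , (ρ , f , z , h) , h' , k)) = ℤ.- + 1 , f′ , mkR (+ 0) ρ f z 0≤1 ℤₚ.≤-refl refl (λ _ → refl) ,
        λ v → trans (k v) (trans (cong₂ ℤ._+_ (h v) (h' v)) (lemma (f v) ρ (ℓ b c v) (ℓ a b v) (ℓ a c v)))
        where
        f′ : Exp n
        f′ v = f v ℤ.+ (ρ ℤ.+ + 1 ℤ.- + 1) ℤ.* ℓ b c v ℤ.+ (+ 1 ℤ.- + 0) ℤ.* ℓ a b v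
        lemma : ∀ f ρ s t u → f ℤ.+ ρ ℤ.* s ℤ.+ (t ℤ.- u) ≡ f ℤ.+ (ρ ℤ.+ + 1 ℤ.- + 1) ℤ.* s ℤ.+ (+ 1 ℤ.- + 0) ℤ.* t ℤ.+ (ℤ.- + 1) ℤ.* u
        lemma = ℤS.solve-∀
      from₁ : ∀ e → Zᵉ (inR {l = l} x) (+ 1) e → Zᵉ x (+ 1) e ⊎ (Zᵉ x (+ 0) +ˢ (_≐ (ℓ a b ⊟ ℓ a c))) e
      from₁ e (ρ' , f' , mkR y ρ f z lo hi refl g , h) with 01-cases (proj₁ (Z-bounds x z)) (proj₂ (Z-bounds x z))
      ... | inj₂ refl = inj₁ (ρ , f , z , λ v → trans (h v) (trans (cong (λ s → s ℤ.+ + 0 ℤ.* ℓ a c v) (g v)) (lemma (f v) ρ (ℓ b c v) (ℓ a b v) (ℓ a c v))))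
        where
        lemma : ∀ f ρ s t u → f ℤ.+ (ρ ℤ.+ + 1 ℤ.- + 1) ℤ.* s ℤ.+ (+ 1 ℤ.- + 1) ℤ.* t ℤ.+ + 0 ℤ.* u ≡ f ℤ.+ ρ ℤ.* s
        lemma = ℤS.solve-∀
      ... | inj₁ refl = inj₂ (_ , ℓ a b ⊟ ℓ a c , (ρ , f , z , λ _ → refl) , (λ _ → refl) ,
        λ v → trans (h v) (trans (cong (λ s → s ℤ.+ (ℤ.- + 1) ℤ.* ℓ a c v) (g v)) (lemma (f v) ρ (ℓ b c v) (ℓ a b v) (ℓ a c v))))
        where
        lemma : ∀ f ρ s t u → f ℤ.+ (ρ ℤ.+ + 1 ℤ.- + 1) ℤ.* s ℤ.+ (+ 1 ℤ.- + 0) ℤ.* t ℤ.+ (ℤ.- + 1) ℤ.* u ≡ f ℤ.+ ρ ℤ.* s ℤ.+ (t ℤ.- u)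
        lemma = ℤS.solve-∀
      to₀ : ∀ e → (Zᵉ x (+ 0) +ˢ (_≐ (ℓ b c ⊟ ℓ a c))) e → Zᵉ (inR {l = l} x) (+ 0) e
      to₀ e (g , g' , (ρ , f , z , h) , h' , k) = ℤ.- + 1 , f′ , mkR (+ 0) ρ f z ℤₚ.≤-refl 0≤1 refl (λ _ → refl) ,
        λ v → trans (k v) (trans (cong₂ ℤ._+_ (h v) (h' v)) (lemma (f v) ρ (ℓ b c v) (ℓ a b v) (ℓ a c v)))
        where
        f′ : Exp n
        f′ v = f v ℤ.+ (ρ ℤ.+ + 1 ℤ.- + 0) ℤ.* ℓ b c v ℤ.+ (+ 0 ℤ.- + 0) ℤ.* ℓ a b v
        lemma : ∀ f ρ s t u → f ℤ.+ ρ ℤ.* s ℤ.+ (s ℤ.- u) ≡ f ℤ.+ (ρ ℤ.+ + 1 ℤ.- + 0) ℤ.* s ℤ.+ (+ 0 ℤ.- + 0) ℤ.* t ℤ.+ (ℤ.- + 1) ℤ.* u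
        lemma = ℤS.solve-∀
      from₀ : ∀ e → Zᵉ (inR {l = l} x) (+ 0) e → (Zᵉ x (+ 0) +ˢ (_≐ (ℓ b c ⊟ ℓ a c))) e
      from₀ e (ρ' , f' , mkR y ρ f z lo hi refl g , h) with ℤₚ.≤-antisym lo (proj₁ (Z-bounds x z))
      ... | refl = _ , ℓ b c ⊟ ℓ a c , (ρ , f , z , λ _ → refl) , (λ _ → refl) ,
        λ v → trans (h v) (trans (cong (λ s → s ℤ.+ (ℤ.- + 1) ℤ.* ℓ a c v) (g v)) (lemma (f v) ρ (ℓ b c v) (ℓ a b v) (ℓ a c v)))
        where
        lemma : ∀ f ρ s t u → f ℤ.+ (ρ ℤ.+ + 1 ℤ.- + 0) ℤ.* s ℤ.+ (+ 0 ℤ.- + 0) ℤ.* t ℤ.+ (ℤ.- + 1) ℤ.* u ≡ f ℤ.+ ρ ℤ.* s ℤ.+ (s ℤ.- u)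
        lemma = ℤS.solve-∀

    pos-bounds : ∀ {a c} {t : Tree a c} (x : Loc t) → a ≤ pos x × pos x ≤ c
    pos-bounds {t = t} atL = ℕₚ.≤-refl , ℕₚ.<⇒≤ (Tree-< t)
    pos-bounds {t = t} atR = ℕₚ.<⇒≤ (Tree-< t) , ℕₚ.≤-refl
    pos-bounds (inL {r = r} x) = proj₁ (pos-bounds x) , ℕₚ.≤-trans (proj₂ (pos-bounds x)) (ℕₚ.<⇒≤ (Tree-< r))
    pos-bounds (inR {l = l} x) = ℕₚ.≤-trans (ℕₚ.<⇒≤ (Tree-< l)) (proj₁ (pos-bounds x)) , proj₂ (pos-bounds x)

    Rep-Λ : ∀ {a c} {t : Tree a c} (q : Loc2 t) → Labelled t → c ≤ suc n → Rep (Λ (pos (fst2 q)) (pos (snd2 q))) (𝒳 q)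
    Rep-Λ {a} {c} {t} ends h c≤ = Rep-≈ (label t h) (Rep-𝕩 (ℓ a c))
    Rep-Λ (inL {r = r} q) (_ , hl , _) c≤ = Rep-Λ q hl (ℕₚ.≤-trans (ℕₚ.<⇒≤ (Tree-< r)) c≤)
    Rep-Λ (inR q) (_ , _ , hr) c≤ = Rep-Λ q hr c≤
    Rep-Λ (split {a} {b} {c} {l} {r} x y) (ac , hl , hr) c≤ =
      Rep-⇔ _ (Rep-≈ expansion (Rep-+ (Rep-+ (Rep-* (Rep-* rep₀ rep₀′) (Rep-𝕩 (ℓ a b))) (Rep-* (Rep-* rep₀ rep₁′) (Rep-𝕩 (ℓ a c)))) (Rep-* (Rep-* rep₁ rep₁′) (Rep-𝕩 (ℓ b c)))))
        to from
      where
      open Coordinates (coordinates x)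
      open Coordinates (coordinates y) renaming (M₀ to N₀; M₁ to N₁; combine to combine′; rep₀ to rep₀′; rep₁ to rep₁′)
      v w : ℕ
      v = pos x
      w = pos y
      expansion : Λ v w ≈ M₀ ⊗ N₀ ⊗ 𝕩 (ℓ a b) ⊕ M₀ ⊗ N₁ ⊗ 𝕩 (ℓ a c) ⊕ M₁ ⊗ N₁ ⊗ 𝕩 (ℓ b c)
      expansion = begin
        Λ v w
          ≈⟨ combine (λ u → Λ u w) (linearˡ l hl w (proj₁ (pos-bounds y)) (ℕₚ.≤-trans (proj₂ (pos-bounds y)) c≤)) ⟩
        M₀ ⊗ Λ a w ⊕ M₁ ⊗ Λ b w
          ≈⟨ Rλ.+-cong (Rλ.*-congˡ (combine′ (λ u → Λ a u) (linearʳ r hr a (ℕₚ.<⇒≤ (Tree-< l)) c≤))) (Rλ.*-congˡ (combine′ (λ u → Λ b u) (linearʳ r hr b ℕₚ.≤-refl c≤))) ⟩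
        M₀ ⊗ (N₀ ⊗ Λ a b ⊕ N₁ ⊗ Λ a c) ⊕ M₁ ⊗ (N₀ ⊗ Λ b b ⊕ N₁ ⊗ Λ b c)
          ≈⟨ Rλ.+-cong (Rλ.*-congˡ (Rλ.+-cong (Rλ.*-congˡ (label l hl)) (Rλ.*-congˡ ac)))
               (Rλ.*-congˡ (≈-trans (Rλ.+-cong (≈-trans (Rλ.*-congˡ (Λ-refl b)) (Rλ.zeroʳ N₀)) (Rλ.*-congˡ (label r hr))) (Rλ.+-identityˡ _))) ⟩
        M₀ ⊗ (N₀ ⊗ 𝕩 (ℓ a b) ⊕ N₁ ⊗ 𝕩 (ℓ a c)) ⊕ M₁ ⊗ (N₁ ⊗ 𝕩 (ℓ b c))
          ≈⟨ solve 7 (λ m₀ m₁ n₀ n₁ s t u → m₀ :* (n₀ :* s :+ n₁ :* t) :+ m₁ :* (n₁ :* u) := m₀ :* n₀ :* s :+ m₀ :* n₁ :* t :+ m₁ :* n₁ :* u) ≈-refl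
               M₀ M₁ N₀ N₁ (𝕩 (ℓ a b)) (𝕩 (ℓ a c)) (𝕩 (ℓ b c)) ⟩
        M₀ ⊗ N₀ ⊗ 𝕩 (ℓ a b) ⊕ M₀ ⊗ N₁ ⊗ 𝕩 (ℓ a c) ⊕ M₁ ⊗ N₁ ⊗ 𝕩 (ℓ b c) ∎
        where open ≈-Reasoning
      Term : ℤ → ℤ → Exp n → Exp n → Set
      Term y₁ y₂ m e = ((Zᵉ x y₁ +ˢ Zᵉ y y₂) +ˢ (_≐ m)) e
      tri : ∀ {y₁ y₂ e} m → y₁ ℤ.≤ y₂ → (∀ v → m v ≡ (+ 1 ℤ.- y₂) ℤ.* ℓ a b v ℤ.+ y₁ ℤ.* ℓ b c v ℤ.+ (y₂ ℤ.- y₁) ℤ.* ℓ a c v) → Term y₁ y₂ m e → 𝒳 (split x y) e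
      tri {y₁} {y₂} m o hm (g , m' , (g₁ , g₂ , (ρ₁ , f₁ , z₁ , h₁) , (ρ₂ , f₂ , z₂ , h₂) , hg) , hm' , he) =
        mkT y₁ ρ₁ f₁ z₁ y₂ ρ₂ f₂ z₂ o (λ v → trans (he v) (trans (cong₂ ℤ._+_ (trans (hg v) (cong₂ ℤ._+_ (h₁ v) (h₂ v))) (trans (hm' v) (hm v)))
          (lemma (f₁ v) (f₂ v) ρ₁ ρ₂ y₁ y₂ (ℓ a b v) (ℓ b c v) (ℓ a c v))))
        where
        lemma : ∀ f₁ f₂ ρ₁ ρ₂ y₁ y₂ s t u → f₁ ℤ.+ ρ₁ ℤ.* s ℤ.+ (f₂ ℤ.+ ρ₂ ℤ.* t) ℤ.+ ((+ 1 ℤ.- y₂) ℤ.* s ℤ.+ y₁ ℤ.* t ℤ.+ (y₂ ℤ.- y₁) ℤ.* u) ≡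
          f₁ ℤ.+ f₂ ℤ.+ (ρ₁ ℤ.+ + 1 ℤ.- y₂) ℤ.* s ℤ.+ (ρ₂ ℤ.+ y₁) ℤ.* t ℤ.+ (y₂ ℤ.- y₁) ℤ.* u
        lemma = ℤS.solve-∀
      term : ∀ {y₁ y₂ e} m → (∀ v → (+ 1 ℤ.- y₂) ℤ.* ℓ a b v ℤ.+ y₁ ℤ.* ℓ b c v ℤ.+ (y₂ ℤ.- y₁) ℤ.* ℓ a c v ≡ m v) →
        (T : Triangle (Z x) (Z y) a b c e) → Triangle.y₁ T ≡ y₁ → Triangle.y₂ T ≡ y₂ → Term y₁ y₂ m e
      term m hm (mkT y₁ ρ₁ f₁ z₁ y₂ ρ₂ f₂ z₂ o h) refl refl = _ , m , (_ , _ , (ρ₁ , f₁ , z₁ , λ _ → refl) , (ρ₂ , f₂ , z₂ , λ _ → refl) , λ _ → refl) , (λ _ → refl) ,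
        λ v → trans (h v) (trans (lemma (f₁ v) (f₂ v) ρ₁ ρ₂ y₁ y₂ (ℓ a b v) (ℓ b c v) (ℓ a c v)) (cong (ℤ._+_ (f₁ v ℤ.+ ρ₁ ℤ.* ℓ a b v ℤ.+ (f₂ v ℤ.+ ρ₂ ℤ.* ℓ b c v))) (hm v)))
        where
        lemma : ∀ f₁ f₂ ρ₁ ρ₂ y₁ y₂ s t u → f₁ ℤ.+ f₂ ℤ.+ (ρ₁ ℤ.+ + 1 ℤ.- y₂) ℤ.* s ℤ.+ (ρ₂ ℤ.+ y₁) ℤ.* t ℤ.+ (y₂ ℤ.- y₁) ℤ.* u ≡
          f₁ ℤ.+ ρ₁ ℤ.* s ℤ.+ (f₂ ℤ.+ ρ₂ ℤ.* t) ℤ.+ ((+ 1 ℤ.- y₂) ℤ.* s ℤ.+ y₁ ℤ.* t ℤ.+ (y₂ ℤ.- y₁) ℤ.* u)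
        lemma = ℤS.solve-∀
      lab : ∀ s t u → + 1 ℤ.* s ℤ.+ + 0 ℤ.* t ℤ.+ + 0 ℤ.* u ≡ s
      lab = ℤS.solve-∀
      lac : ∀ s t u → + 0 ℤ.* s ℤ.+ + 0 ℤ.* t ℤ.+ + 1 ℤ.* u ≡ u
      lac = ℤS.solve-∀
      lbc : ∀ s t u → + 0 ℤ.* s ℤ.+ + 1 ℤ.* t ℤ.+ + 0 ℤ.* u ≡ t
      lbc = ℤS.solve-∀
      to : ∀ e → (Term (+ 0) (+ 0) (ℓ a b) e ⊎ Term (+ 0) (+ 1) (ℓ a c) e) ⊎ Term (+ 1) (+ 1) (ℓ b c) e → 𝒳 (split x y) e
      to e (inj₁ (inj₁ k)) = tri (ℓ a b) ℤₚ.≤-refl (λ v → sym (lab (ℓ a b v) (ℓ b c v) (ℓ a c v))) k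
      to e (inj₁ (inj₂ k)) = tri (ℓ a c) (ℤ.+≤+ ℕ.z≤n) (λ v → sym (lac (ℓ a b v) (ℓ b c v) (ℓ a c v))) k
      to e (inj₂ k) = tri (ℓ b c) ℤₚ.≤-refl (λ v → sym (lbc (ℓ a b v) (ℓ b c v) (ℓ a c v))) k
      from : ∀ e → 𝒳 (split x y) e → (Term (+ 0) (+ 0) (ℓ a b) e ⊎ Term (+ 0) (+ 1) (ℓ a c) e) ⊎ Term (+ 1) (+ 1) (ℓ b c) e
      from e T = cases (01-cases (proj₁ (Z-bounds x low₁)) (proj₂ (Z-bounds x low₁))) (01-cases (proj₁ (Z-bounds y low₂)) (proj₂ (Z-bounds y low₂)))
        where
        open Triangle T
        1≰0 : ¬ + 1 ℤ.≤ + 0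
        1≰0 (ℤ.+≤+ ())
        cases : y₁ ≡ + 0 ⊎ y₁ ≡ + 1 → y₂ ≡ + 0 ⊎ y₂ ≡ + 1 → _
        cases (inj₁ p) (inj₁ q) = inj₁ (inj₁ (term (ℓ a b) (λ v → lab (ℓ a b v) (ℓ b c v) (ℓ a c v)) T p q))
        cases (inj₁ p) (inj₂ q) = inj₁ (inj₂ (term (ℓ a c) (λ v → lac (ℓ a b v) (ℓ b c v) (ℓ a c v)) T p q))
        cases (inj₂ p) (inj₂ q) = inj₂ (term (ℓ b c) (λ v → lbc (ℓ a b v) (ℓ b c v) (ℓ a c v)) T p q)
        cases (inj₂ p) (inj₁ q) = ⊥-elim (1≰0 (subst₂ ℤ._≤_ p q y₁≤y₂))

    -- Notched radii and arcs around the puncture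

    module AroundPuncture {q : ℕ} (t₁ : Tree 0 q) (h₁ : Labelled t₁) (q≤n : q ≤ n) (R0 : R 0 ≈ 𝕩 (ℓ 0 (suc n))) (Rq : R q ≈ 𝕩 (ℓ q (suc n)))
      (Rn : R n ≈ R 0) (G : Exp n → Set) (repG : Rep (Λ q n) G) where

      S R₀ R₁ : Exp n
      S = ℓ 0 q
      R₀ = ℓ 0 (suc n)
      R₁ = ℓ q (suc n)

      q≤1+n : q ≤ suc n
      q≤1+n = ℕₚ.m≤n⇒m≤1+n q≤n

      -- The Ptolemy relation of 0, q, n and the puncture. Both ends of the loop are the same
      -- vertex, so both terms contain the radius `R 0`.
      Λ0n : R q ⊗ Λ 0 n ≈ 𝕩 S ⊗ R 0 ⊕ Λ q n ⊗ R 0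
      Λ0n = ≈-trans (Rλ.*-comm _ _) (≈-trans (ptolemy 0 q n (suc n) ℕ.z≤n q≤n (ℕₚ.n≤1+n n) ℕₚ.≤-refl)
        (Rλ.+-cong (Rλ.*-cong (label t₁ h₁) Rn) (Rλ.*-comm _ _)))

      Spread : Loc t₁ → Exp n → Set
      Spread x e = Σ[ y ∈ ℤ ] Σ[ ρ ∈ ℤ ] Σ[ f ∈ Exp n ] (Z x y ρ f × (∀ v → e v ≡ f v ℤ.+ ρ ℤ.* S v ℤ.+ (+ 1 ℤ.- y) ℤ.* R₀ v ℤ.+ y ℤ.* R₁ v))

      module _ (x : Loc t₁) where
        open Coordinates (coordinates x)

        R-expansion : R (pos x) ≈ M₀ ⊗ 𝕩 R₀ ⊕ M₁ ⊗ 𝕩 R₁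
        R-expansion = ≈-trans (combine R (linearˡ t₁ h₁ (suc n) q≤1+n ℕₚ.≤-refl)) (Rλ.+-cong (Rλ.*-congˡ R0) (Rλ.*-congˡ Rq))

        Rep-R : Rep (R (pos x)) (Spread x)
        Rep-R = Rep-⇔ _ (Rep-≈ R-expansion (Rep-+ (Rep-* rep₀ (Rep-𝕩 R₀)) (Rep-* rep₁ (Rep-𝕩 R₁)))) to from
          where
          l₀ : ∀ a b c → a ℤ.+ b ≡ a ℤ.+ + 1 ℤ.* b ℤ.+ + 0 ℤ.* c
          l₀ = ℤS.solve-∀
          l₁ : ∀ a b c → a ℤ.+ c ≡ a ℤ.+ + 0 ℤ.* b ℤ.+ + 1 ℤ.* c
          l₁ = ℤS.solve-∀
          to : ∀ e → (Zᵉ x (+ 0) +ˢ (_≐ R₀)) e ⊎ (Zᵉ x (+ 1) +ˢ (_≐ R₁)) e → Spread x e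
          to e (inj₁ (g , m , (ρ , f , z , h) , hm , k)) = + 0 , ρ , f , z , λ v → trans (k v) (trans (cong₂ ℤ._+_ (h v) (hm v)) (l₀ (f v ℤ.+ ρ ℤ.* S v) (R₀ v) (R₁ v)))
          to e (inj₂ (g , m , (ρ , f , z , h) , hm , k)) = + 1 , ρ , f , z , λ v → trans (k v) (trans (cong₂ ℤ._+_ (h v) (hm v)) (l₁ (f v ℤ.+ ρ ℤ.* S v) (R₀ v) (R₁ v)))
          from : ∀ e → Spread x e → (Zᵉ x (+ 0) +ˢ (_≐ R₀)) e ⊎ (Zᵉ x (+ 1) +ˢ (_≐ R₁)) e
          from e (y , ρ , f , z , h) with 01-cases (proj₁ (Z-bounds x z)) (proj₂ (Z-bounds x z))
          ... | inj₁ refl = inj₁ (_ , R₀ , (ρ , f , z , λ _ → refl) , (λ _ → refl) , λ v → trans (h v) (sym (l₀ (f v ℤ.+ ρ ℤ.* S v) (R₀ v) (R₁ v))))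
          ... | inj₂ refl = inj₂ (_ , R₁ , (ρ , f , z , λ _ → refl) , (λ _ → refl) , λ v → trans (h v) (sym (l₁ (f v ℤ.+ ρ ℤ.* S v) (R₀ v) (R₁ v))))

        Λ0v : Λ 0 (pos x) ≈ M₁ ⊗ 𝕩 S
        Λ0v = ≈-trans (combine (λ u → Λ 0 u) (linearʳ t₁ h₁ 0 ℕ.z≤n q≤1+n)) (≈-trans (Rλ.+-cong (≈-trans (Rλ.*-congˡ (Λ-refl 0)) (Rλ.zeroʳ _)) (Rλ.*-congˡ (label t₁ h₁))) (Rλ.+-identityˡ _))

        RqΛvn : R q ⊗ Λ (pos x) n ≈ M₀ ⊗ 𝕩 S ⊗ 𝕩 R₀ ⊕ Λ q n ⊗ R (pos x)
        RqΛvn = begin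
          R q ⊗ Λ (pos x) n
            ≈⟨ Rλ.*-congˡ (combine (λ u → Λ u n) (linearˡ t₁ h₁ n q≤n (ℕₚ.n≤1+n n))) ⟩
          R q ⊗ (M₀ ⊗ Λ 0 n ⊕ M₁ ⊗ Λ q n)
            ≈⟨ solve 5 (λ rq m₀ m₁ on qn → rq :* (m₀ :* on :+ m₁ :* qn) := m₀ :* (rq :* on) :+ m₁ :* rq :* qn) ≈-refl (R q) M₀ M₁ (Λ 0 n) (Λ q n) ⟩
          M₀ ⊗ (R q ⊗ Λ 0 n) ⊕ M₁ ⊗ R q ⊗ Λ q n
            ≈⟨ Rλ.+-congʳ (Rλ.*-congˡ Λ0n) ⟩
          M₀ ⊗ (𝕩 S ⊗ R 0 ⊕ Λ q n ⊗ R 0) ⊕ M₁ ⊗ R q ⊗ Λ q n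
            ≈⟨ Rλ.+-cong (Rλ.*-congˡ (Rλ.+-cong (Rλ.*-congˡ R0) (Rλ.*-congˡ R0))) (Rλ.*-congʳ (Rλ.*-congˡ Rq)) ⟩
          M₀ ⊗ (𝕩 S ⊗ 𝕩 R₀ ⊕ Λ q n ⊗ 𝕩 R₀) ⊕ M₁ ⊗ 𝕩 R₁ ⊗ Λ q n
            ≈⟨ solve 6 (λ m₀ m₁ s r₀ r₁ qn → m₀ :* (s :* r₀ :+ qn :* r₀) :+ m₁ :* r₁ :* qn := m₀ :* s :* r₀ :+ qn :* (m₀ :* r₀ :+ m₁ :* r₁)) ≈-refl M₀ M₁ (𝕩 S) (𝕩 R₀) (𝕩 R₁) (Λ q n) ⟩
          M₀ ⊗ 𝕩 S ⊗ 𝕩 R₀ ⊕ Λ q n ⊗ (M₀ ⊗ 𝕩 R₀ ⊕ M₁ ⊗ 𝕩 R₁)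
            ≈⟨ Rλ.+-congˡ (Rλ.*-congˡ R-expansion) ⟨
          M₀ ⊗ 𝕩 S ⊗ 𝕩 R₀ ⊕ Λ q n ⊗ R (pos x) ∎
          where open ≈-Reasoning

        -- The two radii at a vertex of this polygon have a quotient that does not depend on the
        -- vertex, namely `𝕩 S ⊕ Λ q n` divided by `𝕩 (R₀ ⊞ R₁)`. So the exponents are those of
        -- `R (pos x)`, shifted in one of two ways.
        Rep-notched : ∀ N → R 0 ⊗ N ≈ Λ (pos x) n ⊕ Λ 0 (pos x) → Rep N (Around.𝒲 q (Tree-< t₁) q≤n (+ 1) (Z x) (Z x) G)
        Rep-notched N h = Rep-⇔ _ (Rep-÷ (R₀ ⊞ R₁) relation (Rep-* Rep-R (Rep-+ (Rep-𝕩 S) repG))) to from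
          where
          open ≈-Reasoning
          relation : 𝕩 (R₀ ⊞ R₁) ⊗ N ≈ R (pos x) ⊗ (𝕩 S ⊕ Λ q n)
          relation = begin
            𝕩 (R₀ ⊞ R₁) ⊗ N ≈⟨ Rλ.*-congʳ (𝕩-⊗ R₀ R₁) ⟨
            𝕩 R₀ ⊗ 𝕩 R₁ ⊗ N ≈⟨ Rλ.*-congʳ (Rλ.*-cong R0 Rq) ⟨
            R 0 ⊗ R q ⊗ N ≈⟨ solve 3 (λ a b c → a :* b :* c := b :* (a :* c)) ≈-refl (R 0) (R q) N ⟩
            R q ⊗ (R 0 ⊗ N) ≈⟨ Rλ.*-congˡ h ⟩
            R q ⊗ (Λ (pos x) n ⊕ Λ 0 (pos x)) ≈⟨ Rλ.distribˡ _ _ _ ⟩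
            R q ⊗ Λ (pos x) n ⊕ R q ⊗ Λ 0 (pos x) ≈⟨ Rλ.+-cong RqΛvn (Rλ.*-cong Rq Λ0v) ⟩
            M₀ ⊗ 𝕩 S ⊗ 𝕩 R₀ ⊕ Λ q n ⊗ R (pos x) ⊕ 𝕩 R₁ ⊗ (M₁ ⊗ 𝕩 S)
              ≈⟨ solve 7 (λ m₀ m₁ s r₀ r₁ qn r → m₀ :* s :* r₀ :+ qn :* r :+ r₁ :* (m₁ :* s) := (m₀ :* r₀ :+ m₁ :* r₁) :* s :+ r :* qn) ≈-refl M₀ M₁ (𝕩 S) (𝕩 R₀) (𝕩 R₁) (Λ q n) (R (pos x)) ⟩
            (M₀ ⊗ 𝕩 R₀ ⊕ M₁ ⊗ 𝕩 R₁) ⊗ 𝕩 S ⊕ R (pos x) ⊗ Λ q n ≈⟨ Rλ.+-congʳ (Rλ.*-congʳ R-expansion) ⟨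
            R (pos x) ⊗ 𝕩 S ⊕ R (pos x) ⊗ Λ q n ≈⟨ Rλ.distribˡ _ _ _ ⟨
            R (pos x) ⊗ (𝕩 S ⊕ Λ q n) ∎
          open Around q (Tree-< t₁) q≤n (+ 1) (Z x) (Z x) G using (𝒲)
          cancel : ∀ e a b → e ≡ e ℤ.+ (a ℤ.+ b) ℤ.- a ℤ.- b
          cancel = ℤS.solve-∀
          cancel′ : ∀ t h a b → t ℤ.+ h ℤ.- a ℤ.- b ℤ.+ (a ℤ.+ b) ≡ t ℤ.+ h
          cancel′ = ℤS.solve-∀
          to : ∀ e → (Spread x +ˢ (λ f → f ≐ S ⊎ G f)) (e ⊞ (R₀ ⊞ R₁)) → 𝒲 e
          to e (g , h , (y , ρ , f , z , hg) , H , k) = result H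
            where
            eq : ∀ v → e v ≡ f v ℤ.+ ρ ℤ.* S v ℤ.+ (+ 1 ℤ.- y) ℤ.* R₀ v ℤ.+ y ℤ.* R₁ v ℤ.+ h v ℤ.- R₀ v ℤ.- R₁ v
            eq v = trans (cancel (e v) (R₀ v) (R₁ v)) (cong (λ s → s ℤ.- R₀ v ℤ.- R₁ v) (trans (k v) (cong (ℤ._+ h v) (hg v))))
            result : h ≐ S ⊎ G h → 𝒲 e
            result (inj₁ p) = inj₁ (y , ρ , f , h , z , p , eq)
            result (inj₂ p) = inj₂ (y , ρ , f , h , z , p , eq)
          from : ∀ e → 𝒲 e → (Spread x +ˢ (λ f → f ≐ S ⊎ G f)) (e ⊞ (R₀ ⊞ R₁))
          from e (inj₁ (y , ρ , f , h , z , p , eq)) = _ , h , (y , ρ , f , z , λ _ → refl) , inj₁ p ,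
            λ v → trans (cong (ℤ._+ (R₀ v ℤ.+ R₁ v)) (eq v)) (cancel′ (f v ℤ.+ ρ ℤ.* S v ℤ.+ (+ 1 ℤ.- y) ℤ.* R₀ v ℤ.+ y ℤ.* R₁ v) (h v) (R₀ v) (R₁ v))
          from e (inj₂ (y , ρ , f , h , z , p , eq)) = _ , h , (y , ρ , f , z , λ _ → refl) , inj₂ p ,
            λ v → trans (cong (ℤ._+ (R₀ v ℤ.+ R₁ v)) (eq v)) (cancel′ (f v ℤ.+ ρ ℤ.* S v ℤ.+ (+ 1 ℤ.- y) ℤ.* R₀ v ℤ.+ y ℤ.* R₁ v) (h v) (R₀ v) (R₁ v))

      module _ (p : Loc2 t₁) where
        open Coordinates (coordinates (fst2 p)) renaming (M₀ to N₀; M₁ to N₁; rep₀ to rep₀′; rep₁ to rep₁′)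
        open Coordinates (coordinates (snd2 p))
        open Around q (Tree-< t₁) q≤n (+ 2) (Q true p) (Q false p) G using (𝒲)

        w v : ℕ
        w = pos (fst2 p)
        v = pos (snd2 p)

        Both : Exp n → Set
        Both e = Σ[ z ∈ ℤ ] Σ[ ρ ∈ ℤ ] Σ[ f ∈ Exp n ] (Q true p z ρ f × (∀ v → e v ≡ f v ℤ.+ ρ ℤ.* S v ℤ.+ (+ 2 ℤ.- z) ℤ.* R₀ v ℤ.+ z ℤ.* R₁ v))

        -- In `R w ⊗ R v` each of the four products of coordinates occurs once. Here `N₀ ⊗ M₁`, with
        -- tag 0 for w and 1 for v, is absent, and `N₁ ⊗ M₀` occurs twice. This is the origin of the
        -- condition `y_v ≤ y_w`; the coefficient 2 does not affect the support.
        goodPart : LP n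
        goodPart = N₀ ⊗ M₀ ⊗ 𝕩 (R₀ ⊞ R₀) ⊕ (N₁ ⊗ M₀ ⊗ 𝕩 (R₀ ⊞ R₁) ⊕ N₁ ⊗ M₀ ⊗ 𝕩 (R₀ ⊞ R₁)) ⊕ N₁ ⊗ M₁ ⊗ 𝕩 (R₁ ⊞ R₁)

        Rep-goodPart : Rep goodPart Both
        Rep-goodPart = Rep-⇔ _ (Rep-+ (Rep-+ (Rep-* (Rep-* rep₀′ rep₀) (Rep-𝕩 _)) (Rep-+ (Rep-* (Rep-* rep₁′ rep₀) (Rep-𝕩 _)) (Rep-* (Rep-* rep₁′ rep₀) (Rep-𝕩 _)))) (Rep-* (Rep-* rep₁′ rep₁) (Rep-𝕩 _))) to from
          where
          Term : ℤ → ℤ → Exp n → Exp n → Set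
          Term y₁ y₂ m e = ((Zᵉ (fst2 p) y₁ +ˢ Zᵉ (snd2 p) y₂) +ˢ (_≐ m)) e
          both : ∀ {y₁ y₂ e} m → y₂ ℤ.≤ y₁ → (∀ v → m v ≡ (+ 2 ℤ.- (y₁ ℤ.+ y₂)) ℤ.* R₀ v ℤ.+ (y₁ ℤ.+ y₂) ℤ.* R₁ v) → Term y₁ y₂ m e → Both e
          both {y₁} {y₂} m o hm (g , m' , (g₁ , g₂ , (ρ₁ , f₁ , z₁ , k₁) , (ρ₂ , f₂ , z₂ , k₂) , hg) , hm' , he) =
            y₁ ℤ.+ y₂ , ρ₁ ℤ.+ ρ₂ , f₁ ⊞ f₂ , Z⇒Q true p z₁ z₂ (λ _ → o) (λ _ → refl) ,
            λ v → trans (he v) (trans (cong₂ ℤ._+_ (trans (hg v) (cong₂ ℤ._+_ (k₁ v) (k₂ v))) (trans (hm' v) (hm v))) (lemma (f₁ v) (f₂ v) ρ₁ ρ₂ (S v) ((+ 2 ℤ.- (y₁ ℤ.+ y₂)) ℤ.* R₀ v) ((y₁ ℤ.+ y₂) ℤ.* R₁ v)))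
            where
            lemma : ∀ f₁ f₂ ρ₁ ρ₂ s a b → f₁ ℤ.+ ρ₁ ℤ.* s ℤ.+ (f₂ ℤ.+ ρ₂ ℤ.* s) ℤ.+ (a ℤ.+ b) ≡ f₁ ℤ.+ f₂ ℤ.+ (ρ₁ ℤ.+ ρ₂) ℤ.* s ℤ.+ a ℤ.+ b
            lemma = ℤS.solve-∀
          m₀₀ : ∀ a b → a ℤ.+ a ≡ + 2 ℤ.* a ℤ.+ + 0 ℤ.* b
          m₀₀ = ℤS.solve-∀
          m₁₀ : ∀ a b → a ℤ.+ b ≡ + 1 ℤ.* a ℤ.+ + 1 ℤ.* b
          m₁₀ = ℤS.solve-∀
          m₁₁ : ∀ a b → b ℤ.+ b ≡ + 0 ℤ.* a ℤ.+ + 2 ℤ.* b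
          m₁₁ = ℤS.solve-∀
          T₀₀ T₁₀ T₁₁ : Exp n → Set
          T₀₀ = Term (+ 0) (+ 0) (R₀ ⊞ R₀)
          T₁₀ = Term (+ 1) (+ 0) (R₀ ⊞ R₁)
          T₁₁ = Term (+ 1) (+ 1) (R₁ ⊞ R₁)
          to : ∀ e → (T₀₀ e ⊎ (T₁₀ e ⊎ T₁₀ e)) ⊎ T₁₁ e → Both e
          to e (inj₁ (inj₁ t)) = both (R₀ ⊞ R₀) ℤₚ.≤-refl (λ v → m₀₀ (R₀ v) (R₁ v)) t
          to e (inj₁ (inj₂ (inj₁ t))) = both (R₀ ⊞ R₁) (ℤ.+≤+ ℕ.z≤n) (λ v → m₁₀ (R₀ v) (R₁ v)) t
          to e (inj₁ (inj₂ (inj₂ t))) = both (R₀ ⊞ R₁) (ℤ.+≤+ ℕ.z≤n) (λ v → m₁₀ (R₀ v) (R₁ v)) t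
          to e (inj₂ t) = both (R₁ ⊞ R₁) ℤₚ.≤-refl (λ v → m₁₁ (R₀ v) (R₁ v)) t
          from : ∀ e → Both e → (T₀₀ e ⊎ (T₁₀ e ⊎ T₁₀ e)) ⊎ T₁₁ e
          from e (z , ρ , f , qz , h) = cases (Q⇒Z true p qz)
            where
            term : ∀ {y₁ y₂} m → (∀ v → m v ≡ (+ 2 ℤ.- (y₁ ℤ.+ y₂)) ℤ.* R₀ v ℤ.+ (y₁ ℤ.+ y₂) ℤ.* R₁ v) → ∀ {ρ₁ f₁ ρ₂ f₂} →
              Z (fst2 p) y₁ ρ₁ f₁ → Z (snd2 p) y₂ ρ₂ f₂ → y₁ ℤ.+ y₂ ≡ z → ρ₁ ℤ.+ ρ₂ ≡ ρ → f ≐ (f₁ ⊞ f₂) → Term y₁ y₂ m e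
            term {y₁} {y₂} m hm {ρ₁} {f₁} {ρ₂} {f₂} z₁ z₂ refl refl k = _ , m , (_ , _ , (ρ₁ , f₁ , z₁ , λ _ → refl) , (ρ₂ , f₂ , z₂ , λ _ → refl) , λ _ → refl) , (λ _ → refl) ,
              λ v → trans (h v) (trans (cong (λ s → s ℤ.+ (ρ₁ ℤ.+ ρ₂) ℤ.* S v ℤ.+ (+ 2 ℤ.- (y₁ ℤ.+ y₂)) ℤ.* R₀ v ℤ.+ (y₁ ℤ.+ y₂) ℤ.* R₁ v) (k v))
                (trans (lemma (f₁ v) (f₂ v) ρ₁ ρ₂ (S v) ((+ 2 ℤ.- (y₁ ℤ.+ y₂)) ℤ.* R₀ v) ((y₁ ℤ.+ y₂) ℤ.* R₁ v)) (cong (ℤ._+_ (f₁ v ℤ.+ ρ₁ ℤ.* S v ℤ.+ (f₂ v ℤ.+ ρ₂ ℤ.* S v))) (sym (hm v)))))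
              where
              lemma : ∀ f₁ f₂ ρ₁ ρ₂ s a b → f₁ ℤ.+ f₂ ℤ.+ (ρ₁ ℤ.+ ρ₂) ℤ.* s ℤ.+ a ℤ.+ b ≡ f₁ ℤ.+ ρ₁ ℤ.* s ℤ.+ (f₂ ℤ.+ ρ₂ ℤ.* s) ℤ.+ (a ℤ.+ b)
              lemma = ℤS.solve-∀
            cases : Pair true p z ρ f → _
            cases (mkP y₁ ρ₁ f₁ z₁ y₂ ρ₂ f₂ z₂ z≡ ρ≡ k o)
              with 01-cases (proj₁ (Z-bounds (fst2 p) z₁)) (proj₂ (Z-bounds (fst2 p) z₁)) | 01-cases (proj₁ (Z-bounds (snd2 p) z₂)) (proj₂ (Z-bounds (snd2 p) z₂))
            ... | inj₁ refl | inj₁ refl = inj₁ (inj₁ (term (R₀ ⊞ R₀) (λ v → m₀₀ (R₀ v) (R₁ v)) z₁ z₂ z≡ ρ≡ k))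
            ... | inj₂ refl | inj₁ refl = inj₁ (inj₂ (inj₁ (term (R₀ ⊞ R₁) (λ v → m₁₀ (R₀ v) (R₁ v)) z₁ z₂ z≡ ρ≡ k)))
            ... | inj₂ refl | inj₂ refl = inj₂ (term (R₁ ⊞ R₁) (λ v → m₁₁ (R₀ v) (R₁ v)) z₁ z₂ z≡ ρ≡ k)
            ... | inj₁ refl | inj₂ refl with o
            ...   | ℤ.+≤+ ()

        Rep-wrap : ∀ W → R 0 ⊗ W ≈ Λ v n ⊗ R w ⊕ Λ 0 w ⊗ R v → Rep W 𝒲
        Rep-wrap W h = Rep-⇔ _ (Rep-÷ (R₀ ⊞ R₁) relation (Rep-+ (Rep-* Rep-goodPart (Rep-𝕩 S)) (Rep-* (Rep-* (Rep-R (fst2 p)) (Rep-R (snd2 p))) repG))) to from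
          where
          open ≈-Reasoning
          relation : 𝕩 (R₀ ⊞ R₁) ⊗ W ≈ goodPart ⊗ 𝕩 S ⊕ R w ⊗ R v ⊗ Λ q n
          relation = begin
            𝕩 (R₀ ⊞ R₁) ⊗ W ≈⟨ Rλ.*-congʳ (𝕩-⊗ R₀ R₁) ⟨
            𝕩 R₀ ⊗ 𝕩 R₁ ⊗ W ≈⟨ Rλ.*-congʳ (Rλ.*-cong R0 Rq) ⟨
            R 0 ⊗ R q ⊗ W ≈⟨ solve 3 (λ a b c → a :* b :* c := b :* (a :* c)) ≈-refl (R 0) (R q) W ⟩
            R q ⊗ (R 0 ⊗ W) ≈⟨ Rλ.*-congˡ h ⟩
            R q ⊗ (Λ v n ⊗ R w ⊕ Λ 0 w ⊗ R v) ≈⟨ solve 5 (λ rq vn rw ow rv → rq :* (vn :* rw :+ ow :* rv) := (rq :* vn) :* rw :+ ow :* rq :* rv) ≈-refl (R q) (Λ v n) (R w) (Λ 0 w) (R v) ⟩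
            (R q ⊗ Λ v n) ⊗ R w ⊕ Λ 0 w ⊗ R q ⊗ R v ≈⟨ Rλ.+-cong (Rλ.*-congʳ (RqΛvn (snd2 p))) (Rλ.*-congʳ (Rλ.*-cong (Λ0v (fst2 p)) Rq)) ⟩
            (M₀ ⊗ 𝕩 S ⊗ 𝕩 R₀ ⊕ Λ q n ⊗ R v) ⊗ R w ⊕ N₁ ⊗ 𝕩 S ⊗ 𝕩 R₁ ⊗ R v
              ≈⟨ solve 8 (λ m₀ n₁ s r₀ r₁ qn rv rw → (m₀ :* s :* r₀ :+ qn :* rv) :* rw :+ n₁ :* s :* r₁ :* rv := (m₀ :* r₀ :* rw :+ n₁ :* r₁ :* rv) :* s :+ rw :* rv :* qn) ≈-refl
                   M₀ N₁ (𝕩 S) (𝕩 R₀) (𝕩 R₁) (Λ q n) (R v) (R w) ⟩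
            (M₀ ⊗ 𝕩 R₀ ⊗ R w ⊕ N₁ ⊗ 𝕩 R₁ ⊗ R v) ⊗ 𝕩 S ⊕ R w ⊗ R v ⊗ Λ q n
              ≈⟨ Rλ.+-congʳ (Rλ.*-congʳ (Rλ.+-cong (Rλ.*-congˡ (R-expansion (fst2 p))) (Rλ.*-congˡ (R-expansion (snd2 p))))) ⟩
            (M₀ ⊗ 𝕩 R₀ ⊗ (N₀ ⊗ 𝕩 R₀ ⊕ N₁ ⊗ 𝕩 R₁) ⊕ N₁ ⊗ 𝕩 R₁ ⊗ (M₀ ⊗ 𝕩 R₀ ⊕ M₁ ⊗ 𝕩 R₁)) ⊗ 𝕩 S ⊕ R w ⊗ R v ⊗ Λ q n
              ≈⟨ Rλ.+-congʳ (Rλ.*-congʳ (solve 6 (λ m₀ m₁ n₀ n₁ r₀ r₁ → m₀ :* r₀ :* (n₀ :* r₀ :+ n₁ :* r₁) :+ n₁ :* r₁ :* (m₀ :* r₀ :+ m₁ :* r₁) :=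
                   n₀ :* m₀ :* (r₀ :* r₀) :+ (n₁ :* m₀ :* (r₀ :* r₁) :+ n₁ :* m₀ :* (r₀ :* r₁)) :+ n₁ :* m₁ :* (r₁ :* r₁)) ≈-refl M₀ M₁ N₀ N₁ (𝕩 R₀) (𝕩 R₁))) ⟩
            (N₀ ⊗ M₀ ⊗ (𝕩 R₀ ⊗ 𝕩 R₀) ⊕ (N₁ ⊗ M₀ ⊗ (𝕩 R₀ ⊗ 𝕩 R₁) ⊕ N₁ ⊗ M₀ ⊗ (𝕩 R₀ ⊗ 𝕩 R₁)) ⊕ N₁ ⊗ M₁ ⊗ (𝕩 R₁ ⊗ 𝕩 R₁)) ⊗ 𝕩 S ⊕ R w ⊗ R v ⊗ Λ q n
              ≈⟨ Rλ.+-congʳ (Rλ.*-congʳ (Rλ.+-cong (Rλ.+-cong (Rλ.*-congˡ (𝕩-⊗ R₀ R₀)) (Rλ.+-cong (Rλ.*-congˡ (𝕩-⊗ R₀ R₁)) (Rλ.*-congˡ (𝕩-⊗ R₀ R₁)))) (Rλ.*-congˡ (𝕩-⊗ R₁ R₁)))) ⟩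
            goodPart ⊗ 𝕩 S ⊕ R w ⊗ R v ⊗ Λ q n ∎
          cancel : ∀ e a b → e ≡ e ℤ.+ (a ℤ.+ b) ℤ.- a ℤ.- b
          cancel = ℤS.solve-∀
          cancel′ : ∀ t h a b → t ℤ.+ h ℤ.- a ℤ.- b ℤ.+ (a ℤ.+ b) ≡ t ℤ.+ h
          cancel′ = ℤS.solve-∀
          to : ∀ e → (Both +ˢ (_≐ S)) (e ⊞ (R₀ ⊞ R₁)) ⊎ ((Spread (fst2 p) +ˢ Spread (snd2 p)) +ˢ G) (e ⊞ (R₀ ⊞ R₁)) → 𝒲 e
          to e (inj₁ (g , s , (z , ρ , f , qz , hg) , hs , k)) = inj₁ (z , ρ , f , s , qz , hs ,
            λ v → trans (cancel (e v) (R₀ v) (R₁ v)) (cong (λ t → t ℤ.- R₀ v ℤ.- R₁ v) (trans (k v) (cong (ℤ._+ s v) (hg v)))))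
          to e (inj₂ (g , h , (g₁ , g₂ , (y₁ , ρ₁ , f₁ , z₁ , k₁) , (y₂ , ρ₂ , f₂ , z₂ , k₂) , hg) , Gh , k)) =
            inj₂ (y₁ ℤ.+ y₂ , ρ₁ ℤ.+ ρ₂ , f₁ ⊞ f₂ , h , Z⇒Q false p z₁ z₂ (λ ()) (λ _ → refl) , Gh ,
            λ v → trans (cancel (e v) (R₀ v) (R₁ v)) (cong (λ t → t ℤ.- R₀ v ℤ.- R₁ v) (trans (k v) (cong (ℤ._+ h v)
              (trans (hg v) (trans (cong₂ ℤ._+_ (k₁ v) (k₂ v)) (lemma (f₁ v) (f₂ v) ρ₁ ρ₂ y₁ y₂ (S v) (R₀ v) (R₁ v))))))))
            where
            lemma : ∀ f₁ f₂ ρ₁ ρ₂ y₁ y₂ s a b → f₁ ℤ.+ ρ₁ ℤ.* s ℤ.+ (+ 1 ℤ.- y₁) ℤ.* a ℤ.+ y₁ ℤ.* b ℤ.+ (f₂ ℤ.+ ρ₂ ℤ.* s ℤ.+ (+ 1 ℤ.- y₂) ℤ.* a ℤ.+ y₂ ℤ.* b) ≡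
              f₁ ℤ.+ f₂ ℤ.+ (ρ₁ ℤ.+ ρ₂) ℤ.* s ℤ.+ (+ 2 ℤ.- (y₁ ℤ.+ y₂)) ℤ.* a ℤ.+ (y₁ ℤ.+ y₂) ℤ.* b
            lemma = ℤS.solve-∀
          from : ∀ e → 𝒲 e → (Both +ˢ (_≐ S)) (e ⊞ (R₀ ⊞ R₁)) ⊎ ((Spread (fst2 p) +ˢ Spread (snd2 p)) +ˢ G) (e ⊞ (R₀ ⊞ R₁))
          from e (inj₁ (z , ρ , f , h , qz , hs , eq)) = inj₁ (_ , h , (z , ρ , f , qz , λ _ → refl) , hs ,
            λ v → trans (cong (ℤ._+ (R₀ v ℤ.+ R₁ v)) (eq v)) (cancel′ (f v ℤ.+ ρ ℤ.* S v ℤ.+ (+ 2 ℤ.- z) ℤ.* R₀ v ℤ.+ z ℤ.* R₁ v) (h v) (R₀ v) (R₁ v)))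
          from e (inj₂ (z , ρ , f , h , qz , Gh , eq)) = result (Q⇒Z false p qz)
            where
            lemma : ∀ f₁ f₂ ρ₁ ρ₂ y₁ y₂ s a b → f₁ ℤ.+ f₂ ℤ.+ (ρ₁ ℤ.+ ρ₂) ℤ.* s ℤ.+ (+ 2 ℤ.- (y₁ ℤ.+ y₂)) ℤ.* a ℤ.+ (y₁ ℤ.+ y₂) ℤ.* b ≡
              f₁ ℤ.+ ρ₁ ℤ.* s ℤ.+ (+ 1 ℤ.- y₁) ℤ.* a ℤ.+ y₁ ℤ.* b ℤ.+ (f₂ ℤ.+ ρ₂ ℤ.* s ℤ.+ (+ 1 ℤ.- y₂) ℤ.* a ℤ.+ y₂ ℤ.* b)
            lemma = ℤS.solve-∀
            result : Pair false p z ρ f → _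
            result (mkP y₁ ρ₁ f₁ z₁ y₂ ρ₂ f₂ z₂ refl refl kf _) = inj₂ (_ , h , (_ , _ , (y₁ , ρ₁ , f₁ , z₁ , λ _ → refl) , (y₂ , ρ₂ , f₂ , z₂ , λ _ → refl) , λ _ → refl) , Gh ,
              λ v → trans (cong (ℤ._+ (R₀ v ℤ.+ R₁ v)) (eq v)) (trans (cancel′ (f v ℤ.+ (ρ₁ ℤ.+ ρ₂) ℤ.* S v ℤ.+ (+ 2 ℤ.- (y₁ ℤ.+ y₂)) ℤ.* R₀ v ℤ.+ (y₁ ℤ.+ y₂) ℤ.* R₁ v) (h v) (R₀ v) (R₁ v)) (cong (ℤ._+ h v)
                (trans (cong (λ t → t ℤ.+ (ρ₁ ℤ.+ ρ₂) ℤ.* S v ℤ.+ (+ 2 ℤ.- (y₁ ℤ.+ y₂)) ℤ.* R₀ v ℤ.+ (y₁ ℤ.+ y₂) ℤ.* R₁ v) (kf v)) (lemma (f₁ v) (f₂ v) ρ₁ ρ₂ y₁ y₂ (S v) (R₀ v) (R₁ v))))))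

-- Booleans

true≢false : true ≢ false
true≢false ()

T⇒≡ : ∀ {b} → Bool.T b → b ≡ true
T⇒≡ {true} _ = refl

≡⇒T : ∀ {b} → b ≡ true → Bool.T b
≡⇒T refl = tt

¬true⇒false : ∀ {b} → ¬ b ≡ true → b ≡ false
¬true⇒false {true} h = ⊥-elim (h refl)
¬true⇒false {false} h = refl

∧-true : ∀ {a b} → a ∧ b ≡ true → a ≡ true × b ≡ true
∧-true {true} h = refl , h

∧-intro : ∀ {a b} → a ≡ true → b ≡ true → a ∧ b ≡ true
∧-intro refl h = h

∨-true : ∀ {a b} → a ∨ b ≡ true → a ≡ true ⊎ b ≡ true
∨-true {true} h = inj₁ refl
∨-true {false} h = inj₂ h

∨-introˡ : ∀ {a b} → a ≡ true → a ∨ b ≡ true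
∨-introˡ refl = refl

∨-introʳ : ∀ a {b} → b ≡ true → a ∨ b ≡ true
∨-introʳ a refl = Boolₚ.∨-zeroʳ a

not-true : ∀ {a} → not a ≡ true → ¬ a ≡ true
not-true {true} ()
not-true {false} _ ()

not-intro : ∀ {a} → ¬ a ≡ true → not a ≡ true
not-intro {true} h = ⊥-elim (h refl)
not-intro {false} h = refl

<ᵇ-intro : ∀ {m n} → m < n → (m <ᵇ n) ≡ true
<ᵇ-intro h = T⇒≡ (ℕₚ.<⇒<ᵇ h)

<ᵇ-elim : ∀ {m n} → (m <ᵇ n) ≡ true → m < n
<ᵇ-elim {m} {n} h = ℕₚ.<ᵇ⇒< m n (≡⇒T h)

≡ᵇ-intro : ∀ {m n} → m ≡ n → (m ≡ᵇ n) ≡ true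
≡ᵇ-intro {m} {n} h = T⇒≡ (ℕₚ.≡⇒≡ᵇ m n h)

≡ᵇ-elim : ∀ {m n} → (m ≡ᵇ n) ≡ true → m ≡ n
≡ᵇ-elim {m} {n} h = ℕₚ.≡ᵇ⇒≡ m n (≡⇒T h)

finEq-refl : ∀ {n} (a : Fin n) → finEq a a ≡ true
finEq-refl a = ≡ᵇ-intro {toℕ a} refl

finEq-elim : ∀ {n} {a b : Fin n} → finEq a b ≡ true → a ≡ b
finEq-elim h = Finₚ.toℕ-injective (≡ᵇ-elim h)

finEq-≢ : ∀ {n} {a b : Fin n} → a ≢ b → finEq a b ≡ false
finEq-≢ h = ¬true⇒false (λ k → h (finEq-elim k))

tagEq-refl : ∀ t → tagEq t t ≡ true
tagEq-refl plain = refl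
tagEq-refl notched = refl

tagEq-elim : ∀ {s t} → tagEq s t ≡ true → s ≡ t
tagEq-elim {plain} {plain} _ = refl
tagEq-elim {notched} {notched} _ = refl

opposite : Tag → Tag
opposite plain = notched
opposite notched = plain

opposite-≢ : ∀ t → opposite t ≢ t
opposite-≢ plain ()
opposite-≢ notched ()

≢⇒opposite : ∀ {s t} → s ≢ t → s ≡ opposite t
≢⇒opposite {plain} {plain} h = ⊥-elim (h refl)
≢⇒opposite {plain} {notched} h = refl
≢⇒opposite {notched} {plain} h = refl
≢⇒opposite {notched} {notched} h = ⊥-elim (h refl)

tarcEq-refl : ∀ {n} (x : TArc n) → tarcEq x x ≡ true
tarcEq-refl (arc i k) = ∧-intro (finEq-refl i) (finEq-refl k)
tarcEq-refl (rad t i) = ∧-intro (tagEq-refl t) (finEq-refl i)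

tarcEq-elim : ∀ {n} {x y : TArc n} → tarcEq x y ≡ true → x ≡ y
tarcEq-elim {x = arc i k} {arc j l} h = cong₂ arc (finEq-elim (proj₁ (∧-true h))) (finEq-elim (proj₂ (∧-true {finEq i j} h)))
tarcEq-elim {x = rad t i} {rad s j} h = cong₂ rad (tagEq-elim (proj₁ (∧-true h))) (finEq-elim (proj₂ (∧-true {tagEq t s} h)))
tarcEq-elim {x = arc _ _} {rad _ _} ()
tarcEq-elim {x = rad _ _} {arc _ _} ()

allF-elim : ∀ {m} {f : Fin m → Bool} → allF f ≡ true → ∀ i → f i ≡ true
allF-elim {suc m} {f} h Fz = proj₁ (∧-true h)
allF-elim {suc m} {f} h (Fs i) = allF-elim (proj₂ (∧-true {f Fz} h)) i

allF-intro : ∀ {m} {f : Fin m → Bool} → (∀ i → f i ≡ true) → allF f ≡ true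
allF-intro {zero} h = refl
allF-intro {suc m} h = ∧-intro (h Fz) (allF-intro (λ i → h (Fs i)))

allF-cong : ∀ {m} {f g : Fin m → Bool} → (∀ i → f i ≡ g i) → allF f ≡ allF g
allF-cong {zero} h = refl
allF-cong {suc m} h = cong₂ _∧_ (h Fz) (allF-cong (λ i → h (Fs i)))

anyF-elim : ∀ {m} {f : Fin m → Bool} → anyF f ≡ true → ∃[ i ] f i ≡ true
anyF-elim {suc m} {f} h with ∨-true {f Fz} h
... | inj₁ p = Fz , p
... | inj₂ p = let (i , q) = anyF-elim p in Fs i , q

anyF-intro : ∀ {m} {f : Fin m → Bool} i → f i ≡ true → anyF f ≡ true
anyF-intro Fz h = ∨-introˡ h
anyF-intro {f = f} (Fs i) h = ∨-introʳ (f Fz) (anyF-intro i h)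

-- Positions on the circle

module Circle {n : ℕ} (3≤n : 3 ≤ n) where

  instance
    n-nonZero : ℕ.NonZero n
    n-nonZero = ℕ.>-nonZero (ℕₚ.≤-trans (ℕ.s≤s ℕ.z≤n) 3≤n)

  0<n : 0 < n
  0<n = ℕₚ.≤-trans (ℕ.s≤s ℕ.z≤n) 3≤n

  infixl 6 _↻_
  _↻_ : Fin n → ℕ → Fin n
  u ↻ d = fromℕ< (m%n<n (toℕ u ℕ.+ d) n)

  toℕ-↻ : ∀ u d → toℕ (u ↻ d) ≡ (toℕ u ℕ.+ d) % n
  toℕ-↻ u d = Finₚ.toℕ-fromℕ< (m%n<n (toℕ u ℕ.+ d) n)

  ↻-↻ : ∀ u p q → (u ↻ p) ↻ q ≡ u ↻ (p ℕ.+ q)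
  ↻-↻ u p q = Finₚ.toℕ-injective (begin
    toℕ ((u ↻ p) ↻ q)                          ≡⟨ toℕ-↻ (u ↻ p) q ⟩
    (toℕ (u ↻ p) ℕ.+ q) % n                    ≡⟨ cong (λ x → (x ℕ.+ q) % n) (toℕ-↻ u p) ⟩
    ((toℕ u ℕ.+ p) % n ℕ.+ q) % n              ≡⟨ %-distribˡ-+ ((toℕ u ℕ.+ p) % n) q n ⟩
    ((toℕ u ℕ.+ p) % n % n ℕ.+ q % n) % n      ≡⟨ cong (λ x → (x ℕ.+ q % n) % n) (m%n%n≡m%n (toℕ u ℕ.+ p) n) ⟩
    ((toℕ u ℕ.+ p) % n ℕ.+ q % n) % n          ≡⟨ %-distribˡ-+ (toℕ u ℕ.+ p) q n ⟨
    (toℕ u ℕ.+ p ℕ.+ q) % n                    ≡⟨ cong (_% n) (ℕₚ.+-assoc (toℕ u) p q) ⟩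
    (toℕ u ℕ.+ (p ℕ.+ q)) % n                  ≡⟨ toℕ-↻ u (p ℕ.+ q) ⟨
    toℕ (u ↻ (p ℕ.+ q))                        ∎)
    where open ≡-Reasoning

  ↻-0 : ∀ u → u ↻ 0 ≡ u
  ↻-0 u = Finₚ.toℕ-injective (trans (toℕ-↻ u 0) (trans (cong (_% n) (ℕₚ.+-identityʳ (toℕ u))) (m<n⇒m%n≡m (Finₚ.toℕ<n u))))

  ↻-n : ∀ u → u ↻ n ≡ u
  ↻-n u = Finₚ.toℕ-injective (trans (toℕ-↻ u n) (trans ([m+n]%n≡m%n (toℕ u) n) (m<n⇒m%n≡m (Finₚ.toℕ<n u))))

  -- d is the distance from a to b, up to a full turn
  Turn : ℕ → ℕ → ℕ → Set
  Turn a d b = a ℕ.+ d ≡ b ⊎ a ℕ.+ d ≡ b ℕ.+ n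

  ↻-Turn : ∀ u d → d < n → Turn (toℕ u) d (toℕ (u ↻ d))
  ↻-Turn u d d<n with (toℕ u ℕ.+ d) ℕₚ.<? n
  ... | yes h = inj₁ (sym (trans (toℕ-↻ u d) (m<n⇒m%n≡m h)))
  ... | no h = inj₂ (trans (sym (ℕₚ.m∸n+n≡m n≤)) (cong (ℕ._+ n) (sym (begin
    toℕ (u ↻ d)                            ≡⟨ toℕ-↻ u d ⟩
    (toℕ u ℕ.+ d) % n                      ≡⟨ cong (_% n) (ℕₚ.m∸n+n≡m n≤) ⟨
    ((toℕ u ℕ.+ d ∸ n) ℕ.+ n) % n          ≡⟨ [m+n]%n≡m%n (toℕ u ℕ.+ d ∸ n) n ⟩
    (toℕ u ℕ.+ d ∸ n) % n                  ≡⟨ m<n⇒m%n≡m (ℕₚ.+-cancelʳ-< n _ n (subst (_< n ℕ.+ n) (sym (ℕₚ.m∸n+n≡m n≤)) (ℕₚ.+-mono-< (Finₚ.toℕ<n u) d<n))) ⟩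
    toℕ u ℕ.+ d ∸ n                        ∎))))
    where
    open ≡-Reasoning
    n≤ = ℕₚ.≮⇒≥ h

  dist-spec : ∀ (a b : Fin n) → dist a b < n × Turn (toℕ a) (dist a b) (toℕ b)
  dist-spec a b with toℕ a ≤ᵇ toℕ b in eq
  ... | true  = ℕₚ.≤-<-trans (ℕₚ.m∸n≤m (toℕ b) (toℕ a)) (Finₚ.toℕ<n b) , inj₁ (ℕₚ.m+[n∸m]≡n (ℕₚ.≤ᵇ⇒≤ (toℕ a) (toℕ b) (≡⇒T eq)))
  ... | false = ℕₚ.+-cancelˡ-< (toℕ a) _ n (subst (_< toℕ a ℕ.+ n) (sym total) (subst (toℕ b ℕ.+ n <_) refl (ℕₚ.+-monoˡ-< n b<a))) , inj₂ total
    where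
    b<a : toℕ b < toℕ a
    b<a = ℕₚ.≰⇒> λ h → true≢false (trans (sym (T⇒≡ (ℕₚ.≤⇒≤ᵇ h))) eq)
    total : toℕ a ℕ.+ (n ℕ.+ toℕ b ∸ toℕ a) ≡ toℕ b ℕ.+ n
    total = trans (ℕₚ.m+[n∸m]≡n (ℕₚ.≤-trans (ℕₚ.<⇒≤ (Finₚ.toℕ<n a)) (ℕₚ.m≤m+n n (toℕ b)))) (ℕₚ.+-comm n (toℕ b))

  dist<n : ∀ (a b : Fin n) → dist a b < n
  dist<n a b = proj₁ (dist-spec a b)

  Turn-unique : ∀ {a d d' b} → d < n → d' < n → Turn a d b → Turn a d' b → d ≡ d'
  Turn-unique {a} p q (inj₁ h) (inj₁ k) = ℕₚ.+-cancelˡ-≡ a _ _ (trans h (sym k))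
  Turn-unique {a} p q (inj₂ h) (inj₂ k) = ℕₚ.+-cancelˡ-≡ a _ _ (trans h (sym k))
  Turn-unique {a} {d} {d'} {b} p q (inj₁ h) (inj₂ k) = ⊥-elim (ℕₚ.<⇒≱ q (ℕₚ.≤-trans (ℕₚ.m≤n+m n d) (ℕₚ.≤-reflexive (ℕₚ.+-cancelˡ-≡ a _ _ (trans (sym (ℕₚ.+-assoc a d n)) (trans (cong (ℕ._+ n) h) (sym k)))))))
  Turn-unique {a} {d} {d'} {b} p q (inj₂ h) (inj₁ k) = sym (Turn-unique {a} q p (inj₁ k) (inj₂ h))

  Turn-end : ∀ {a d b b'} → b < n → b' < n → Turn a d b → Turn a d b' → b ≡ b'
  Turn-end p q (inj₁ h) (inj₁ k) = trans (sym h) k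
  Turn-end p q (inj₂ h) (inj₂ k) = ℕₚ.+-cancelʳ-≡ n _ _ (trans (sym h) k)
  Turn-end {b' = b'} p q (inj₁ h) (inj₂ k) = ⊥-elim (ℕₚ.<⇒≱ p (ℕₚ.≤-trans (ℕₚ.m≤n+m n b') (ℕₚ.≤-reflexive (trans (sym k) h))))
  Turn-end {b = b} p q (inj₂ h) (inj₁ k) = ⊥-elim (ℕₚ.<⇒≱ q (ℕₚ.≤-trans (ℕₚ.m≤n+m n b) (ℕₚ.≤-reflexive (trans (sym h) k))))

  dist-↻ : ∀ u d → d < n → dist u (u ↻ d) ≡ d
  dist-↻ u d d<n = Turn-unique (dist<n u (u ↻ d)) d<n (proj₂ (dist-spec u (u ↻ d))) (↻-Turn u d d<n)

  ↻-dist : ∀ u v → u ↻ dist u v ≡ v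
  ↻-dist u v = Finₚ.toℕ-injective (Turn-end {toℕ u} {dist u v} (Finₚ.toℕ<n (u ↻ dist u v)) (Finₚ.toℕ<n v) (↻-Turn u (dist u v) (dist<n u v)) (proj₂ (dist-spec u v)))

  ↻-injective : ∀ u p q → p < n → q < n → u ↻ p ≡ u ↻ q → p ≡ q
  ↻-injective u p q p<n q<n h = trans (sym (dist-↻ u p p<n)) (trans (cong (dist u) h) (dist-↻ u q q<n))

  dist-self : ∀ u → dist u u ≡ 0
  dist-self u = trans (cong (dist u) (sym (↻-0 u))) (dist-↻ u 0 0<n)

  dist≡0 : ∀ {u v} → dist u v ≡ 0 → u ≡ v
  dist≡0 {u} {v} h = trans (sym (↻-0 u)) (trans (cong (u ↻_) (sym h)) (↻-dist u v))

  dist-≤ : ∀ u p s → p ≤ dist u s → p ℕ.+ dist (u ↻ p) s ≡ dist u s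
  dist-≤ u p s p≤q = trans (cong (p ℕ.+_) (trans (cong (dist (u ↻ p)) (trans (sym (↻-dist u s)) (trans (cong (u ↻_) (sym (ℕₚ.m+[n∸m]≡n p≤q))) (sym (↻-↻ u p _))))) (dist-↻ (u ↻ p) _ (ℕₚ.≤-<-trans (ℕₚ.m∸n≤m (dist u s) p) (dist<n u s)))))
    (ℕₚ.m+[n∸m]≡n p≤q)

  dist-> : ∀ u p s → p < n → dist u s < p → p ℕ.+ dist (u ↻ p) s ≡ n ℕ.+ dist u s
  dist-> u p s p<n q<p = trans (cong (p ℕ.+_) (trans (cong (dist (u ↻ p)) s≡) (dist-↻ (u ↻ p) e e<n))) p+e
    where
    e = n ℕ.+ dist u s ∸ p
    p+e : p ℕ.+ e ≡ n ℕ.+ dist u s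
    p+e = ℕₚ.m+[n∸m]≡n (ℕₚ.≤-trans (ℕₚ.<⇒≤ p<n) (ℕₚ.m≤m+n n _))
    e<n : e < n
    e<n = ℕₚ.+-cancelˡ-< p e n (subst (_< p ℕ.+ n) (sym p+e) (subst (n ℕ.+ dist u s <_) (ℕₚ.+-comm n p) (ℕₚ.+-monoʳ-< n q<p)))
    s≡ : s ≡ (u ↻ p) ↻ e
    s≡ = sym (trans (↻-↻ u p e) (trans (cong (u ↻_) p+e) (trans (sym (↻-↻ u n _)) (trans (cong (_↻ dist u s) (↻-n u)) (↻-dist u s)))))

-- Compatibility, completion to a tagged triangulation, and flips

bool-ext : ∀ {a b} → (a ≡ true → b ≡ true) → (b ≡ true → a ≡ true) → a ≡ b
bool-ext {true} {true} f g = refl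
bool-ext {true} {false} f g = sym (f refl)
bool-ext {false} {true} f g = g refl
bool-ext {false} {false} f g = refl

finEq-sym : ∀ {n} (a b : Fin n) → finEq a b ≡ finEq b a
finEq-sym a b = bool-ext (λ h → subst (λ x → finEq x a ≡ true) (finEq-elim {a = a} {b} h) (finEq-refl a))
                         (λ h → subst (λ x → finEq x b ≡ true) (finEq-elim {a = b} {a} h) (finEq-refl b))

tagEq-sym : ∀ s t → tagEq s t ≡ tagEq t s
tagEq-sym plain plain = refl
tagEq-sym plain notched = refl
tagEq-sym notched plain = refl
tagEq-sym notched notched = refl

compatible-sym : ∀ {n} (x y : TArc n) → compatible x y ≡ compatible y x
compatible-sym (arc i k) (arc j l) = trans (cong (λ z → A ∨ B ∨ z) (allF-cong (λ s → cong not (Boolₚ.∧-comm (segIn i k s) (segIn j l s))))) (swap A B _)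
  where
  A = allF (λ s → not (segIn i k s) ∨ segIn j l s)
  B = allF (λ s → not (segIn j l s) ∨ segIn i k s)
  swap : ∀ a b c → a ∨ b ∨ c ≡ b ∨ a ∨ c
  swap true true c = refl
  swap true false c = refl
  swap false b c = refl
compatible-sym (arc _ _) (rad _ _) = refl
compatible-sym (rad _ _) (arc _ _) = refl
compatible-sym (rad s a) (rad t b) = cong₂ _∨_ (tagEq-sym s t) (finEq-sym a b)

compatible-refl : ∀ {n} (x : TArc n) → compatible x x ≡ true
compatible-refl (arc i k) = ∨-introˡ (allF-intro {f = λ s → not (segIn i k s) ∨ segIn i k s} (λ s → Boolₚ.∨-inverseˡ (segIn i k s)))
compatible-refl (rad t a) = ∨-introˡ (tagEq-refl t)

module _ {n : ℕ} where

  Pairwise : List (TArc n) → Set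
  Pairwise xs = ∀ {x y} → x ∈ xs → y ∈ xs → compatible x y ≡ true

  greedy : List (TArc n) → List (TArc n) → List (TArc n)
  greedy acc [] = acc
  greedy acc (x ∷ xs) with allL (compatible x) acc
  ... | true  = greedy (x ∷ acc) xs
  ... | false = greedy acc xs

  allL-elim : ∀ {f : TArc n → Bool} {xs} → allL f xs ≡ true → ∀ {x} → x ∈ xs → f x ≡ true
  allL-elim {f} {x ∷ xs} h (here refl) = proj₁ (∧-true h)
  allL-elim {f} {x ∷ xs} h (there m) = allL-elim (proj₂ (∧-true {f x} h)) m

  allL-intro : ∀ {f : TArc n → Bool} xs → (∀ {x} → x ∈ xs → f x ≡ true) → allL f xs ≡ true
  allL-intro [] h = refl
  allL-intro (x ∷ xs) h = ∧-intro (h (here refl)) (allL-intro xs (λ m → h (there m)))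

  greedy-⊇ : ∀ acc xs {x} → x ∈ acc → x ∈ greedy acc xs
  greedy-⊇ acc [] m = m
  greedy-⊇ acc (x ∷ xs) m with allL (compatible x) acc
  ... | true  = greedy-⊇ (x ∷ acc) xs (there m)
  ... | false = greedy-⊇ acc xs m

  greedy-pairwise : ∀ acc xs → Pairwise acc → Pairwise (greedy acc xs)
  greedy-pairwise acc [] h = h
  greedy-pairwise acc (x ∷ xs) h with allL (compatible x) acc in eq
  ... | false = greedy-pairwise acc xs h
  ... | true  = greedy-pairwise (x ∷ acc) xs λ
    { (here refl) (here refl) → compatible-refl x
    ; (here refl) (there m) → allL-elim eq m
    ; {y} (there m) (here refl) → trans (compatible-sym y x) (allL-elim eq m)
    ; (there m) (there m') → h m m' }

  greedy-maximal : ∀ acc xs {x} → x ∈ xs → (∀ {y} → y ∈ greedy acc xs → compatible x y ≡ true) → x ∈ greedy acc xs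
  greedy-maximal acc (x ∷ xs) (here refl) h with allL (compatible x) acc in eq
  ... | true  = greedy-⊇ (x ∷ acc) xs (here refl)
  ... | false = ⊥-elim (true≢false (trans (sym (allL-intro acc (λ m → h (greedy-⊇ acc xs m)))) eq))
  greedy-maximal acc (y ∷ xs) (there m) h with allL (compatible y) acc
  ... | true  = greedy-maximal (y ∷ acc) xs m h
  ... | false = greedy-maximal acc xs m h

  member : List (TArc n) → TArc n → Bool
  member [] x = false
  member (y ∷ xs) x = tarcEq x y ∨ member xs x

  member-elim : ∀ xs {x} → member xs x ≡ true → x ∈ xs
  member-elim (y ∷ xs) {x} h with ∨-true {tarcEq x y} h
  ... | inj₁ p = here (tarcEq-elim p)
  ... | inj₂ p = there (member-elim xs p)

  member-intro : ∀ {xs x} → x ∈ xs → member xs x ≡ true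
  member-intro {y ∷ xs} {x} (here refl) = ∨-introˡ (tarcEq-refl x)
  member-intro {y ∷ xs} {x} (there m) = ∨-introʳ (tarcEq x y) (member-intro m)

  -- Exchange relations are given only for flips of whole triangulations, so each local
  -- configuration has to be completed to one.
  complete : (Y : List (TArc n)) → Pairwise Y → Σ[ T ∈ TaggedTriangulation n ] (∀ {x} → x ∈ Y → mem T x ≡ true)
  complete Y pw = record
    { mem = member G
    ; pairwise = λ x y p q → greedy-pairwise Y (allTArc n) pw (member-elim G p) (member-elim G q)
    ; maximal = λ x h → member-intro (greedy-maximal Y (allTArc n) (∈-allTArc x) (λ m → h _ (member-intro m)))
    } , λ m → member-intro (greedy-⊇ Y (allTArc n) m)
    where
    G = greedy Y (allTArc n)

  -- The last hypothesis concerns arcs incompatible with `τ` only: one that is compatible with `τ`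
  -- and with the rest of `T` already lies in `T` by maximality.
  replace : (T : TaggedTriangulation n) (τ τ' : TArc n) → mem T τ ≡ true → compatible τ τ' ≡ false →
    (∀ x → mem T x ≡ true → x ≢ τ → compatible x τ' ≡ true) →
    (∀ x → (∀ y → mem T y ≡ true → y ≢ τ → compatible x y ≡ true) → compatible x τ' ≡ true → compatible x τ ≡ false → x ≡ τ') →
    Σ[ T' ∈ TaggedTriangulation n ] Flip T τ T' τ'
  replace T τ τ' τ∈T τ-τ' old new = T' , τ∈T , τ'∈T' , τ'∉T , τ∉T' , same
    where
    mem' : TArc n → Bool
    mem' x = if tarcEq x τ' then true else if tarcEq x τ then false else mem T x
    τ≢τ' : τ ≢ τ'
    τ≢τ' refl = true≢false (trans (sym (compatible-refl τ)) τ-τ')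
    mem'-elim : ∀ x → mem' x ≡ true → x ≡ τ' ⊎ (mem T x ≡ true × x ≢ τ)
    mem'-elim x h with tarcEq x τ' in eq'
    ... | true = inj₁ (tarcEq-elim eq')
    ... | false with tarcEq x τ in eq
    mem'-elim x () | false | true
    ...   | false = inj₂ (h , λ { refl → true≢false (trans (sym (tarcEq-refl x)) eq) })
    mem'-new : ∀ x → x ≡ τ' → mem' x ≡ true
    mem'-new x refl rewrite tarcEq-refl x = refl
    mem'-old : ∀ x → mem T x ≡ true → x ≢ τ → mem' x ≡ true
    mem'-old x h ne with tarcEq x τ'
    ... | true = refl
    ... | false with tarcEq x τ in eq
    ...   | true = ⊥-elim (ne (tarcEq-elim eq))
    ...   | false = h
    T' : TaggedTriangulation n
    T' = record
      { mem = mem'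
      ; pairwise = λ x y p q → pw x y (mem'-elim x p) (mem'-elim y q)
      ; maximal = mx
      }
      where
      pw : ∀ x y → x ≡ τ' ⊎ (mem T x ≡ true × x ≢ τ) → y ≡ τ' ⊎ (mem T y ≡ true × y ≢ τ) → compatible x y ≡ true
      pw x y (inj₁ refl) (inj₁ refl) = compatible-refl x
      pw x y (inj₁ refl) (inj₂ (h , ne)) = trans (compatible-sym x y) (old y h ne)
      pw x y (inj₂ (h , ne)) (inj₁ refl) = old x h ne
      pw x y (inj₂ (h , _)) (inj₂ (k , _)) = pairwise T x y h k
      mx : ∀ x → (∀ y → mem' y ≡ true → compatible x y ≡ true) → mem' x ≡ true
      mx x h with compatible x τ in eq
      ... | false = mem'-new x (new x (λ y p ne → h y (mem'-old y p ne)) (h τ' (mem'-new τ' refl)) eq)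
      ... | true = mem'-old x (maximal T x all) (λ { refl → true≢false (trans (sym (h τ' (mem'-new τ' refl))) τ-τ') })
        where
        all : ∀ y → mem T y ≡ true → compatible x y ≡ true
        all y p with tarcEq y τ in eq'
        ... | true = subst (λ z → compatible x z ≡ true) (sym (tarcEq-elim eq')) eq
        ... | false = h y (mem'-old y p (λ { refl → true≢false (trans (sym (tarcEq-refl y)) eq') }))
    τ'∈T' : mem' τ' ≡ true
    τ'∈T' = mem'-new τ' refl
    τ'∉T : mem T τ' ≡ false
    τ'∉T = ¬true⇒false λ h → true≢false (trans (sym (pairwise T τ τ' τ∈T h)) τ-τ')
    τ∉T' : mem' τ ≡ false
    τ∉T' = ¬true⇒false λ h → absurd (mem'-elim τ h)
      where
      absurd : τ ≡ τ' ⊎ (mem T τ ≡ true × τ ≢ τ) → ⊥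
      absurd (inj₁ p) = τ≢τ' p
      absurd (inj₂ (_ , p)) = p refl
    same : ∀ γ → tarcEq γ τ ≡ false → tarcEq γ τ' ≡ false → mem T γ ≡ mem' γ
    same γ p q rewrite p | q = refl

-- Arcs as intervals on the circle cut open at a vertex

module Arcs {n : ℕ} (3≤n : 3 ≤ n) where
  open Circle 3≤n

  len : Fin (n ∸ 2) → ℕ
  len k = toℕ k ℕ.+ 2

  2≤n : 2 ≤ n
  2≤n = ℕₚ.≤-trans (ℕ.s≤s (ℕ.s≤s ℕ.z≤n)) 3≤n

  len<n : ∀ k → len k < n
  len<n k = subst (len k <_) (ℕₚ.m∸n+n≡m 2≤n) (ℕₚ.+-monoˡ-< 2 (Finₚ.toℕ<n k))

  2≤len : ∀ k → 2 ≤ len k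
  2≤len k = ℕₚ.m≤n+m 2 (toℕ k)

  len-injective : ∀ {k l} → len k ≡ len l → k ≡ l
  len-injective h = Finₚ.toℕ-injective (ℕₚ.+-cancelʳ-≡ 2 _ _ h)

  side : Fin n → ℕ → Var n
  -- A default value, like the one for lengths from n on; `side-view` assumes a length between 1 and
  -- n - 1.
  side u 0 = bd u
  side u 1 = bd u
  side u (suc (suc k)) with k ℕₚ.<? (n ∸ 2)
  ... | yes h = cl (arc u (fromℕ< h))
  ... | no _ = bd u

  data SideView (u : Fin n) (d : ℕ) : Var n → Set where
    boundary : d ≡ 1 → SideView u d (bd u)
    chord : ∀ k → len k ≡ d → SideView u d (cl (arc u k))

  side-view : ∀ u d → 1 ≤ d → d < n → SideView u d (side u d)
  side-view u 1 _ _ = boundary refl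
  side-view u (suc (suc k)) _ d<n with k ℕₚ.<? (n ∸ 2)
  ... | yes h = chord (fromℕ< h) (trans (cong (ℕ._+ 2) (Finₚ.toℕ-fromℕ< h)) (ℕₚ.+-comm k 2))
  ... | no h = ⊥-elim (h (ℕₚ.m+n≤o⇒m≤o∸n (suc k) (subst (_≤ n) (cong suc (ℕₚ.+-comm 2 k)) d<n)))

  side-arc : ∀ u k → side u (len k) ≡ cl (arc u k)
  side-arc u k with side u (len k) | side-view u (len k) (ℕₚ.≤-trans (ℕ.s≤s ℕ.z≤n) (2≤len k)) (len<n k)
  ... | _ | boundary h = ⊥-elim (ℕₚ.<⇒≢ (2≤len k) (sym h))
  ... | _ | chord l h = cong (λ z → cl (arc u z)) (len-injective h)

  module _ (u : Fin n) where

    private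
      at : Fin n → ℕ
      at = dist u

    -- Positions are measured from u. The bound says that the arc does not run past u, and then the
    -- segments it cuts off form an interval of positions.
    segIn-elim : ∀ i k s → at i ℕ.+ len k ≤ n → segIn i k s ≡ true → at i ≤ at s × at s < at i ℕ.+ len k
    segIn-elim i k s p≤ h with ℕₚ.≤-total (at i) (at s)
    ... | inj₁ p≤q = p≤q , subst (_< at i ℕ.+ len k) (trans (cong (λ z → at i ℕ.+ dist z s) (sym (↻-dist u i))) (dist-≤ u (at i) s p≤q)) (ℕₚ.+-monoʳ-< (at i) (<ᵇ-elim h))
    ... | inj₂ q≤p with ℕₚ.m≤n⇒m<n∨m≡n q≤p
    ...   | inj₂ q≡p = ℕₚ.≤-reflexive (sym q≡p) , subst (_< at i ℕ.+ len k) (sym q≡p) (ℕₚ.m<m+n (at i) (ℕₚ.≤-trans (ℕ.s≤s ℕ.z≤n) (2≤len k)))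
    ...   | inj₁ q<p = ⊥-elim (ℕₚ.<⇒≱ (<ᵇ-elim h) (ℕₚ.+-cancelˡ-≤ (at i) _ _ (ℕₚ.≤-trans p≤ (ℕₚ.≤-trans (ℕₚ.m≤m+n n (at s))
              (ℕₚ.≤-reflexive (sym (trans (cong (λ z → at i ℕ.+ dist z s) (sym (↻-dist u i))) (dist-> u (at i) s (dist<n u i) q<p))))))))

    segIn-intro : ∀ i k s → at i ≤ at s → at s < at i ℕ.+ len k → segIn i k s ≡ true
    segIn-intro i k s p≤q q< = <ᵇ-intro (ℕₚ.+-cancelˡ-< (at i) _ _ (subst (_< at i ℕ.+ len k) (sym (trans (cong (λ z → at i ℕ.+ dist z s) (sym (↻-dist u i))) (dist-≤ u (at i) s p≤q))) q<))

    inside-elim : ∀ i k v → at i ℕ.+ len k ≤ n → vtxInside i k v ≡ true → at i < at v × at v < at i ℕ.+ len k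
    inside-elim i k v p≤ h = let (0<d , d<) = ∧-true {0 <ᵇ dist i v} h ; (p≤q , q<) = segIn-elim i k v p≤ d< in
      ℕₚ.≤∧≢⇒< p≤q (λ eq → ℕₚ.<⇒≢ (<ᵇ-elim {0} 0<d) (sym (trans (cong (dist i) (trans (sym (↻-dist u v)) (trans (cong (u ↻_) (sym eq)) (↻-dist u i)))) (dist-self i)))) , q<

    inside-intro : ∀ i k v → at i < at v → at v < at i ℕ.+ len k → vtxInside i k v ≡ true
    inside-intro i k v p<q q< = ∧-intro (<ᵇ-intro {0} (ℕₚ.n≢0⇒n>0 λ eq → ℕₚ.<⇒≢ p<q (cong at (dist≡0 eq)))) (segIn-intro i k v (ℕₚ.<⇒≤ p<q) q<)

    -- An arc compatible with a radius at u does not pass through u.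
    linear : ∀ i k t → compatible (arc i k) (rad t u) ≡ true → at i ℕ.+ len k ≤ n
    linear i k t h with at i ℕ.+ len k ℕₚ.≤? n
    ... | yes p = p
    ... | no ¬p with ℕₚ.m≤n⇒m<n∨m≡n (ℕ.z≤n {at i})
    ...   | inj₂ 0≡ = subst (λ z → z ℕ.+ len k ≤ n) 0≡ (ℕₚ.<⇒≤ (len<n k))
    ...   | inj₁ 0< = ⊥-elim (not-true h (∧-intro (<ᵇ-intro {0} (ℕₚ.n≢0⇒n>0 λ eq → ℕₚ.<⇒≢ 0< (sym (trans (cong at (dist≡0 eq)) (dist-self u))))) (<ᵇ-intro
      (ℕₚ.+-cancelˡ-< (at i) _ _ (subst (_< at i ℕ.+ len k) (sym gap) (ℕₚ.≰⇒> ¬p))))))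
      where
      gap : at i ℕ.+ dist i u ≡ n
      gap = trans (cong (λ z → at i ℕ.+ dist z u) (sym (↻-dist u i))) (trans (dist-> u (at i) u (dist<n u i) (subst (_< at i) (sym (dist-self u)) 0<)) (trans (cong (n ℕ.+_) (dist-self u)) (ℕₚ.+-identityʳ n)))

    noncrossing : ∀ i k j l → at i ℕ.+ len k ≤ n → at j ℕ.+ len l ≤ n → compatible (arc i k) (arc j l) ≡ true →
      at i < at j → at j < at i ℕ.+ len k → at i ℕ.+ len k < at j ℕ.+ len l → ⊥
    noncrossing i k j l p≤ q≤ h i<j j<e e<f with ∨-true {allF (λ s → not (segIn i k s) ∨ segIn j l s)} h
    ... | inj₁ sub with ∨-true {not (segIn i k i)} (allF-elim sub i)
    ...   | inj₁ p = not-true p (segIn-intro i k i ℕₚ.≤-refl (ℕₚ.m<m+n (at i) (ℕₚ.≤-trans (ℕ.s≤s ℕ.z≤n) (2≤len k))))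
    ...   | inj₂ p = ℕₚ.<⇒≱ i<j (proj₁ (segIn-elim j l i q≤ p))
    noncrossing i k j l p≤ q≤ h i<j j<e e<f | inj₂ h' with ∨-true {allF (λ s → not (segIn j l s) ∨ segIn i k s)} h'
    ... | inj₁ sub = absurd (∨-true {not (segIn j l e)} (allF-elim sub e))
      where
      -- The segment just beyond the end of the arc from `i`: cut off by the arc from `j` but not by
      -- that from `i`, so the second region is not contained in the first.
      e = u ↻ (at i ℕ.+ len k)
      at-e : at e ≡ at i ℕ.+ len k
      at-e = dist-↻ u _ (ℕₚ.<-≤-trans e<f q≤)
      absurd : not (segIn j l e) ≡ true ⊎ segIn i k e ≡ true → ⊥
      absurd (inj₁ p) = not-true p (segIn-intro j l e (subst (at j ≤_) (sym at-e) (ℕₚ.<⇒≤ j<e)) (subst (_< at j ℕ.+ len l) (sym at-e) e<f))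
      absurd (inj₂ p) = ℕₚ.<-irrefl at-e (proj₂ (segIn-elim i k e p≤ p))
    ... | inj₂ disj = not-true (allF-elim disj j) (∧-intro (segIn-intro i k j (ℕₚ.<⇒≤ i<j) j<e) (segIn-intro j l j ℕₚ.≤-refl (ℕₚ.m<m+n (at j) (ℕₚ.≤-trans (ℕ.s≤s ℕ.z≤n) (2≤len l)))))

    compatible-intro : ∀ i k j l → at i ℕ.+ len k ≤ n → at j ℕ.+ len l ≤ n →
      (at j ≤ at i × at i ℕ.+ len k ≤ at j ℕ.+ len l) ⊎ (at i ≤ at j × at j ℕ.+ len l ≤ at i ℕ.+ len k) ⊎ at i ℕ.+ len k ≤ at j ⊎ at j ℕ.+ len l ≤ at i →
      compatible (arc i k) (arc j l) ≡ true
    compatible-intro i k j l p≤ q≤ (inj₁ (a , b)) = ∨-introˡ (allF-intro {f = λ s → not (segIn i k s) ∨ segIn j l s} λ s → go s (segIn i k s) refl)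
      where
      go : ∀ s c → segIn i k s ≡ c → not c ∨ segIn j l s ≡ true
      go s false h = refl
      go s true h = let (x , y) = segIn-elim i k s p≤ h in segIn-intro j l s (ℕₚ.≤-trans a x) (ℕₚ.<-≤-trans y b)
    compatible-intro i k j l p≤ q≤ (inj₂ (inj₁ (a , b))) = trans (compatible-sym (arc i k) (arc j l)) (compatible-intro j l i k q≤ p≤ (inj₁ (a , b)))
    compatible-intro i k j l p≤ q≤ (inj₂ (inj₂ d)) = ∨-introʳ (allF (λ s → not (segIn i k s) ∨ segIn j l s)) (∨-introʳ (allF (λ s → not (segIn j l s) ∨ segIn i k s))
      (allF-intro {f = λ s → not (segIn i k s ∧ segIn j l s)} λ s → not-intro {segIn i k s ∧ segIn j l s} λ h → let (x , y) = ∧-true {segIn i k s} h in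
        apart d (segIn-elim i k s p≤ x) (segIn-elim j l s q≤ y)))
      where
      apart : ∀ {s} → at i ℕ.+ len k ≤ at j ⊎ at j ℕ.+ len l ≤ at i → at i ≤ s × s < at i ℕ.+ len k → at j ≤ s × s < at j ℕ.+ len l → ⊥
      apart (inj₁ d) (_ , x) (y , _) = ℕₚ.<⇒≱ x (ℕₚ.≤-trans d y)
      apart (inj₂ d) (y , _) (_ , x) = ℕₚ.<⇒≱ x (ℕₚ.≤-trans d y)

    rad-compatible : ∀ i k t v → at i ℕ.+ len k ≤ n → ¬ (at i < at v × at v < at i ℕ.+ len k) → compatible (arc i k) (rad t v) ≡ true
    rad-compatible i k t v p≤ h = not-intro {vtxInside i k v} (λ q → h (inside-elim i k v p≤ q))

    rad-compatible-elim : ∀ i k t v → compatible (arc i k) (rad t v) ≡ true → ¬ (at i < at v × at v < at i ℕ.+ len k)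
    rad-compatible-elim i k t v h (a , b) = not-true h (inside-intro i k v a b)

-- Two adjacent triangles at the puncture and the flip of their common radius

module Corners {n : ℕ} (3≤n : 3 ≤ n) where
  open Circle 3≤n
  open Arcs 3≤n

  no-inside : ∀ (T : TaggedTriangulation n) x d → 1 ≤ d → d < n → inSeed T (side x d) ≡ true → ∀ s y → mem T (rad s y) ≡ true → 0 < dist x y → dist x y < d → ⊥
  no-inside T x d 1≤d d<n h s y m 0<e e<d with side x d | side-view x d 1≤d d<n
  ... | _ | boundary refl = ℕₚ.<⇒≱ e<d 0<e
  ... | _ | chord k refl = not-true (pairwise T (arc x k) (rad s y) h m) (∧-intro (<ᵇ-intro {0} 0<e) (<ᵇ-intro e<d))

  -- A radius with the other tag would have to share its vertex with both of the given ones.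
  same-tag : ∀ (T : TaggedTriangulation n) t (x y : Fin n) → x ≢ y → mem T (rad t x) ≡ true → mem T (rad t y) ≡ true → ∀ s z → mem T (rad s z) ≡ true → s ≡ t
  same-tag T t x y x≢y mx my s z mz with ∨-true {tagEq s t} (pairwise T (rad s z) (rad t x) mz mx) | ∨-true {tagEq s t} (pairwise T (rad s z) (rad t y) mz my)
  ... | inj₁ p | _ = tagEq-elim p
  ... | _ | inj₁ p = tagEq-elim p
  ... | inj₂ p | inj₂ q = ⊥-elim (x≢y (trans (sym (finEq-elim {a = z} {x} p)) (finEq-elim {a = z} {y} q)))

  -- `d₁ + d₂ = n` is allowed: then c is the vertex u again, and the outer sides of the two
  -- triangles go once around the polygon.
  record Corner (T : TaggedTriangulation n) (t : Tag) (u : Fin n) (d₁ d₂ : ℕ) : Set where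
    field
      1≤d₁ : 1 ≤ d₁
      1≤d₂ : 1 ≤ d₂
      d≤n  : d₁ ℕ.+ d₂ ≤ n
      rad-a : mem T (rad t u) ≡ true
      rad-b : mem T (rad t (u ↻ d₁)) ≡ true
      rad-c : mem T (rad t (u ↻ (d₁ ℕ.+ d₂))) ≡ true
      side-ab : inSeed T (side u d₁) ≡ true
      side-bc : inSeed T (side (u ↻ d₁) d₂) ≡ true

    b c : Fin n
    b = u ↻ d₁
    c = u ↻ (d₁ ℕ.+ d₂)

    d₁<n : d₁ < n
    d₁<n = ℕₚ.<-≤-trans (ℕₚ.m<m+n d₁ 1≤d₂) d≤n

    d₂<n : d₂ < n
    d₂<n = ℕₚ.<-≤-trans (ℕₚ.m<n+m d₂ 1≤d₁) d≤n

    at-b : dist u b ≡ d₁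
    at-b = dist-↻ u d₁ d₁<n

    c≡ : b ↻ d₂ ≡ c
    c≡ = ↻-↻ u d₁ d₂

    b-c : dist b c ≡ d₂
    b-c = trans (cong (dist b) (sym c≡)) (dist-↻ b d₂ d₂<n)

    u≢b : u ≢ b
    u≢b h = ℕₚ.<⇒≢ 1≤d₁ (trans (sym (dist-self u)) (trans (cong (dist u) h) at-b))

    b≢c : b ≢ c
    b≢c h = ℕₚ.<⇒≢ 1≤d₂ (trans (sym (dist-self b)) (trans (cong (dist b) h) b-c))

    between : ∀ s v → mem T (rad s v) ≡ true → 0 < dist u v → dist u v < d₁ ℕ.+ d₂ → dist u v ≡ d₁
    between s v m 0<q q< with ℕₚ.<-cmp (dist u v) d₁
    ... | tri≈ _ h _ = h
    ... | tri< h _ _ = ⊥-elim (no-inside T u d₁ 1≤d₁ d₁<n side-ab s v m 0<q h)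
    ... | tri> _ _ h = ⊥-elim (no-inside T b d₂ 1≤d₂ d₂<n side-bc s v m
        (ℕₚ.+-cancelˡ-< d₁ 0 _ (subst₂ _<_ (sym (ℕₚ.+-identityʳ d₁)) (sym eq) h)) (ℕₚ.+-cancelˡ-< d₁ _ _ (subst (_< d₁ ℕ.+ d₂) (sym eq) q<)))
      where
      eq : d₁ ℕ.+ dist b v ≡ dist u v
      eq = dist-≤ u d₁ v (ℕₚ.<⇒≤ h)

  module Flips {T t u d₁ d₂} (C : Corner T t u d₁ d₂) where
    open Corner C

    private
      τ : TArc n
      τ = rad t b

    at-pos : ∀ v {q} → dist u v ≡ q → u ↻ q ≡ v
    at-pos v refl = ↻-dist u v

    rad-a≢τ : rad t u ≢ τ
    rad-a≢τ h = u≢b (inj h)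
      where
      inj : ∀ {x y : Fin n} → rad t x ≡ rad t y → x ≡ y
      inj refl = refl

    rad-c≢τ : rad t c ≢ τ
    rad-c≢τ h = b≢c (sym (inj h))
      where
      inj : ∀ {x y : Fin n} → rad t x ≡ rad t y → x ≡ y
      inj refl = refl

    -- An arc that crosses the radius at b but none of the others comes from a and goes beyond c.
    crossing : ∀ i k → (∀ y → mem T y ≡ true → y ≢ τ → compatible (arc i k) y ≡ true) → compatible (arc i k) τ ≡ false →
      dist u i ≡ 0 × d₁ ℕ.+ d₂ ≤ dist u i ℕ.+ len k
    crossing i k h ¬τ = p≡0 , q≥
      where
      lin : dist u i ℕ.+ len k ≤ n
      lin = linear u i k t (h (rad t u) rad-a rad-a≢τ)
      ins : dist u i < d₁ × d₁ < dist u i ℕ.+ len k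
      ins = subst (λ z → dist u i < z × z < dist u i ℕ.+ len k) at-b (inside-elim u i k b lin (not-false ¬τ))
        where
        not-false : ∀ {x} → not x ≡ false → x ≡ true
        not-false {true} _ = refl
      p≡0 : dist u i ≡ 0
      p≡0 = go (side u d₁) (side-view u d₁ 1≤d₁ d₁<n) side-ab
        where
        go : ∀ σ → SideView u d₁ σ → inSeed T σ ≡ true → dist u i ≡ 0
        go _ (boundary refl) _ = ℕₚ.n<1⇒n≡0 (proj₁ ins)
        go _ (chord l refl) m with ℕₚ.m≤n⇒m<n∨m≡n (ℕ.z≤n {dist u i})
        ... | inj₂ q = sym q
        ... | inj₁ 0<p = ⊥-elim (noncrossing u u l i k (subst (λ z → z ℕ.+ len l ≤ n) (sym (dist-self u)) (ℕₚ.<⇒≤ (len<n l))) lin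
                (trans (compatible-sym (arc u l) (arc i k)) (h (arc u l) m (λ ())))
                (subst (_< dist u i) (sym (dist-self u)) 0<p)
                (subst (λ z → dist u i < z ℕ.+ len l) (sym (dist-self u)) (proj₁ ins))
                (subst (λ z → z ℕ.+ len l < dist u i ℕ.+ len k) (sym (dist-self u)) (proj₂ ins)))
      q≥ : d₁ ℕ.+ d₂ ≤ dist u i ℕ.+ len k
      q≥ = go (side b d₂) (side-view b d₂ 1≤d₂ d₂<n) side-bc
        where
        go : ∀ σ → SideView b d₂ σ → inSeed T σ ≡ true → d₁ ℕ.+ d₂ ≤ dist u i ℕ.+ len k
        go _ (boundary refl) _ = subst (_≤ dist u i ℕ.+ len k) (ℕₚ.+-comm 1 d₁) (proj₂ ins)
        go _ (chord l refl) m with d₁ ℕ.+ len l ℕₚ.≤? dist u i ℕ.+ len k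
        ... | yes p = p
        ... | no ¬p = ⊥-elim (noncrossing u i k b l lin (subst (λ z → z ℕ.+ len l ≤ n) (sym at-b) d≤n) (h (arc b l) m (λ ()))
                (subst (dist u i <_) (sym at-b) (proj₁ ins)) (subst (_< dist u i ℕ.+ len k) (sym at-b) (proj₂ ins))
                (subst (λ z → dist u i ℕ.+ len k < z ℕ.+ len l) (sym at-b) (ℕₚ.≰⇒> ¬p)))

    τ-incompatible : ∀ i k → dist u i < d₁ → d₁ < dist u i ℕ.+ len k → compatible τ (arc i k) ≡ false
    τ-incompatible i k p q = cong not (inside-intro u i k b (subst (dist u i <_) (sym at-b) p) (subst (_< dist u i ℕ.+ len k) (sym at-b) q))

    flip-arc : ∀ k → len k ≡ d₁ ℕ.+ d₂ → Σ[ T' ∈ TaggedTriangulation n ] Flip T τ T' (arc u k)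
    flip-arc k len-k = replace T τ (arc u k) rad-b
      (τ-incompatible u k (subst (_< d₁) (sym (dist-self u)) 1≤d₁) (subst (λ z → d₁ < z ℕ.+ len k) (sym (dist-self u)) (subst (d₁ <_) (sym len-k) (ℕₚ.m<m+n d₁ 1≤d₂))))
      old new
      where
      k-lin : dist u u ℕ.+ len k ≤ n
      k-lin = subst (λ z → z ℕ.+ len k ≤ n) (sym (dist-self u)) (ℕₚ.<⇒≤ (len<n k))
      d<n : d₁ ℕ.+ d₂ < n
      d<n = subst (_< n) len-k (len<n k)
      at-c : dist u c ≡ d₁ ℕ.+ d₂
      at-c = dist-↻ u _ d<n
      u≢c : u ≢ c
      u≢c h = ℕₚ.<⇒≢ (ℕₚ.<-≤-trans 1≤d₁ (ℕₚ.m≤m+n d₁ d₂)) (trans (sym (dist-self u)) (trans (cong (dist u) h) at-c))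
      old : ∀ x → mem T x ≡ true → x ≢ τ → compatible x (arc u k) ≡ true
      old (rad s v) m ne = rad-compatible u u k s v k-lin λ (p , q) →
        let p' = subst (_< dist u v) (dist-self u) p
            q' = subst (dist u v <_) (trans (cong (ℕ._+ len k) (dist-self u)) len-k) q
        in ne (cong₂ rad (same-tag T t u b u≢b rad-a rad-b s v m) (sym (at-pos v (between s v m p' q'))))
      old (arc i l) m ne = compatible-intro u i l u k lin k-lin (cases (dist u i ℕ.+ len l ℕₚ.≤? d₁ ℕ.+ d₂))
        where
        lin : dist u i ℕ.+ len l ≤ n
        lin = linear u i l t (pairwise T (arc i l) (rad t u) m rad-a)
        cases : Dec (dist u i ℕ.+ len l ≤ d₁ ℕ.+ d₂) → _
        cases (yes p) = inj₁ (subst (_≤ dist u i) (sym (dist-self u)) ℕ.z≤n , subst (λ z → dist u i ℕ.+ len l ≤ z ℕ.+ len k) (sym (dist-self u)) (subst (dist u i ℕ.+ len l ≤_) (sym len-k) p))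
        cases (no ¬p) = inj₂ (inj₂ (inj₂ (subst (λ z → z ℕ.+ len k ≤ dist u i) (sym (dist-self u)) (subst (_≤ dist u i) (sym len-k)
          (ℕₚ.≮⇒≥ λ q → rad-compatible-elim u i l t c (pairwise T (arc i l) (rad t c) m rad-c) (subst (λ z → dist u i < z × z < dist u i ℕ.+ len l) (sym at-c) (q , ℕₚ.≰⇒> ¬p)))))))
      new : ∀ x → (∀ y → mem T y ≡ true → y ≢ τ → compatible x y ≡ true) → compatible x (arc u k) ≡ true → compatible x τ ≡ false → x ≡ arc u k
      new (rad s v) h _ ¬τ = ⊥-elim (u≢c (trans (sym (end u (h (rad t u) rad-a rad-a≢τ))) (end c (h (rad t c) rad-c rad-c≢τ))))
        where
        s≢t : tagEq s t ≡ false
        s≢t = ¬true⇒false λ p → true≢false (trans (sym (∨-introˡ {tagEq s t} p)) ¬τ)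
        end : ∀ z → tagEq s t ∨ finEq v z ≡ true → v ≡ z
        end z p with ∨-true {tagEq s t} p
        ... | inj₁ q = ⊥-elim (true≢false (trans (sym q) s≢t))
        ... | inj₂ q = finEq-elim {a = v} {z} q
      new (arc i l) h _ ¬τ = cong₂ arc i≡u (len-injective (trans (ℕₚ.≤-antisym len≤ len≥) (sym len-k)))
        where
        cr = crossing i l h ¬τ
        i≡u : i ≡ u
        i≡u = sym (dist≡0 (proj₁ cr))
        len≥ : d₁ ℕ.+ d₂ ≤ len l
        len≥ = subst (λ z → d₁ ℕ.+ d₂ ≤ z ℕ.+ len l) (proj₁ cr) (proj₂ cr)
        len≤ : len l ≤ d₁ ℕ.+ d₂
        len≤ = ℕₚ.≮⇒≥ λ q → rad-compatible-elim u i l t c (h (rad t c) rad-c rad-c≢τ)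
          (subst₂ (λ y z → y < z × z < y ℕ.+ len l) (sym (proj₁ cr)) (sym at-c) (ℕₚ.<-≤-trans 1≤d₁ (ℕₚ.m≤m+n d₁ d₂) , q))

    -- The arc of `flip-arc` would now be the loop at u, which is not a tagged arc; the radius at u
    -- with the other tag takes its place.
    flip-rad : d₁ ℕ.+ d₂ ≡ n → Σ[ T' ∈ TaggedTriangulation n ] Flip T τ T' (rad (opposite t) u)
    flip-rad d≡n = replace T τ (rad (opposite t) u) rad-b
      (cong₂ _∨_ (¬true⇒false λ h → opposite-≢ t (sym (tagEq-elim {t} h))) (finEq-≢ (λ h → u≢b (sym h)))) old new
      where
      old : ∀ x → mem T x ≡ true → x ≢ τ → compatible x (rad (opposite t) u) ≡ true
      old (arc i l) m ne = pairwise T (arc i l) (rad t u) m rad-a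
      old (rad s v) m ne with ℕₚ.m≤n⇒m<n∨m≡n (ℕ.z≤n {dist u v})
      ... | inj₂ 0≡ = ∨-introʳ (tagEq s (opposite t)) (subst (λ z → finEq z u ≡ true) (dist≡0 {u} {v} (sym 0≡)) (finEq-refl u))
      ... | inj₁ 0< = ⊥-elim (ne (cong₂ rad (same-tag T t u b u≢b rad-a rad-b s v m) (sym (at-pos v (between s v m 0< (subst (dist u v <_) (sym d≡n) (dist<n u v)))))))
      new : ∀ x → (∀ y → mem T y ≡ true → y ≢ τ → compatible x y ≡ true) → compatible x (rad (opposite t) u) ≡ true → compatible x τ ≡ false → x ≡ rad (opposite t) u
      new (rad s v) h _ ¬τ = cong₂ rad (≢⇒opposite s≢t) (end (∨-true {tagEq s t} (h (rad t u) rad-a rad-a≢τ)))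
        where
        s≢t : s ≢ t
        s≢t refl = true≢false (trans (sym (∨-introˡ (tagEq-refl s))) ¬τ)
        end : tagEq s t ≡ true ⊎ finEq v u ≡ true → v ≡ u
        end (inj₁ p) = ⊥-elim (s≢t (tagEq-elim p))
        end (inj₂ q) = finEq-elim {a = v} {u} q
      new (arc i l) h _ ¬τ = ⊥-elim (ℕₚ.<⇒≱ (len<n l) (subst₂ _≤_ d≡n (cong (ℕ._+ len l) (proj₁ cr)) (proj₂ cr)))
        where
        cr = crossing i l h ¬τ

  sideArcs : Fin n → ℕ → List (TArc n)
  sideArcs u d with side u d
  ... | cl γ = γ ∷ []
  ... | bd _ = []

  sideArcs-⊆ : ∀ T u d → (∀ {x} → x ∈ sideArcs u d → mem T x ≡ true) → inSeed T (side u d) ≡ true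
  sideArcs-⊆ T u d h with side u d
  ... | cl γ = h (here refl)
  ... | bd _ = refl

  corner : ∀ t u d₁ d₂ → 1 ≤ d₁ → 1 ≤ d₂ → d₁ ℕ.+ d₂ ≤ n → Σ[ T ∈ TaggedTriangulation n ] Corner T t u d₁ d₂
  corner t u d₁ d₂ 1≤d₁ 1≤d₂ d≤n = T , record
    { 1≤d₁ = 1≤d₁ ; 1≤d₂ = 1≤d₂ ; d≤n = d≤n
    ; rad-a = in-T (here refl) ; rad-b = in-T (there (here refl)) ; rad-c = in-T (there (there (here refl)))
    ; side-ab = sideArcs-⊆ T u d₁ (λ m → in-T (there (there (there (∈-++⁺ˡ m)))))
    ; side-bc = sideArcs-⊆ T b d₂ (λ m → in-T (there (there (there (∈-++⁺ʳ (sideArcs u d₁) m))))) }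
    where
    b c : Fin n
    b = u ↻ d₁
    c = u ↻ (d₁ ℕ.+ d₂)
    d₁<n : d₁ < n
    d₁<n = ℕₚ.<-≤-trans (ℕₚ.m<m+n d₁ 1≤d₂) d≤n
    d₂<n : d₂ < n
    d₂<n = ℕₚ.<-≤-trans (ℕₚ.m<n+m d₂ 1≤d₁) d≤n
    Y : List (TArc n)
    Y = rad t u ∷ rad t b ∷ rad t c ∷ (sideArcs u d₁ ++ sideArcs b d₂)
    -- Records positions relative to u, so that pairwise compatibility needs a few comparisons of
    -- intervals. The vertex c has position 0 if `d₁ + d₂ = n`.
    data Item : TArc n → Set where
      radius : ∀ v → dist u v ≡ 0 ⊎ dist u v ≡ d₁ ⊎ d₁ ℕ.+ d₂ ≤ dist u v → Item (rad t v)
      chord : ∀ i k → (dist u i ≡ 0 × len k ≡ d₁) ⊎ (dist u i ≡ d₁ × len k ≡ d₂) → Item (arc i k)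
    side-item₁ : ∀ {x} → x ∈ sideArcs u d₁ → Item x
    side-item₁ m with side u d₁ | side-view u d₁ 1≤d₁ d₁<n
    side-item₁ (here refl) | _ | chord k h = chord u k (inj₁ (dist-self u , h))
    side-item₂ : ∀ {x} → x ∈ sideArcs b d₂ → Item x
    side-item₂ m with side b d₂ | side-view b d₂ 1≤d₂ d₂<n
    side-item₂ (here refl) | _ | chord k h = chord b k (inj₂ (dist-↻ u d₁ d₁<n , h))
    c-pos : dist u c ≡ 0 ⊎ dist u c ≡ d₁ ⊎ d₁ ℕ.+ d₂ ≤ dist u c
    c-pos with ℕₚ.m≤n⇒m<n∨m≡n d≤n
    ... | inj₁ d<n = inj₂ (inj₂ (ℕₚ.≤-reflexive (sym (dist-↻ u _ d<n))))
    ... | inj₂ d≡n = inj₁ (trans (cong (λ z → dist u (u ↻ z)) d≡n) (trans (cong (dist u) (↻-n u)) (dist-self u)))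
    item : ∀ {x} → x ∈ Y → Item x
    item (here refl) = radius u (inj₁ (dist-self u))
    item (there (here refl)) = radius b (inj₂ (inj₁ (dist-↻ u d₁ d₁<n)))
    item (there (there (here refl))) = radius c c-pos
    item (there (there (there m))) with ∈-++⁻ (sideArcs u d₁) m
    ... | inj₁ m₁ = side-item₁ m₁
    ... | inj₂ m₂ = side-item₂ m₂
    lin : ∀ i k → (dist u i ≡ 0 × len k ≡ d₁) ⊎ (dist u i ≡ d₁ × len k ≡ d₂) → dist u i ℕ.+ len k ≤ n
    lin i k (inj₁ (p , q)) = subst₂ (λ x y → x ℕ.+ y ≤ n) (sym p) (sym q) (ℕₚ.<⇒≤ d₁<n)
    lin i k (inj₂ (p , q)) = subst₂ (λ x y → x ℕ.+ y ≤ n) (sym p) (sym q) d≤n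
    rad-arc : ∀ i k v → (dist u i ≡ 0 × len k ≡ d₁) ⊎ (dist u i ≡ d₁ × len k ≡ d₂) → dist u v ≡ 0 ⊎ dist u v ≡ d₁ ⊎ d₁ ℕ.+ d₂ ≤ dist u v →
      ¬ (dist u i < dist u v × dist u v < dist u i ℕ.+ len k)
    rad-arc i k v (inj₁ (p , q)) w (x , y) rewrite p | q = go w
      where
      go : dist u v ≡ 0 ⊎ dist u v ≡ d₁ ⊎ d₁ ℕ.+ d₂ ≤ dist u v → ⊥
      go (inj₁ h) = ℕₚ.<⇒≢ x (sym h)
      go (inj₂ (inj₁ h)) = ℕₚ.<⇒≢ y h
      go (inj₂ (inj₂ h)) = ℕₚ.<⇒≱ y (ℕₚ.≤-trans (ℕₚ.m≤m+n d₁ d₂) h)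
    rad-arc i k v (inj₂ (p , q)) w (x , y) rewrite p | q = go w
      where
      go : dist u v ≡ 0 ⊎ dist u v ≡ d₁ ⊎ d₁ ℕ.+ d₂ ≤ dist u v → ⊥
      go (inj₁ h) = ℕₚ.<⇒≱ x (ℕₚ.≤-trans (ℕₚ.≤-reflexive h) ℕ.z≤n)
      go (inj₂ (inj₁ h)) = ℕₚ.<⇒≢ x (sym h)
      go (inj₂ (inj₂ h)) = ℕₚ.<⇒≱ y h
    arc-arc : ∀ i k j l → (dist u i ≡ 0 × len k ≡ d₁) ⊎ (dist u i ≡ d₁ × len k ≡ d₂) → (dist u j ≡ 0 × len l ≡ d₁) ⊎ (dist u j ≡ d₁ × len l ≡ d₂) →
      (dist u j ≤ dist u i × dist u i ℕ.+ len k ≤ dist u j ℕ.+ len l) ⊎ (dist u i ≤ dist u j × dist u j ℕ.+ len l ≤ dist u i ℕ.+ len k) ⊎ dist u i ℕ.+ len k ≤ dist u j ⊎ dist u j ℕ.+ len l ≤ dist u i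
    arc-arc i k j l (inj₁ (p , q)) (inj₁ (p' , q')) rewrite p | q | p' | q' = inj₁ (ℕₚ.≤-refl , ℕₚ.≤-refl)
    arc-arc i k j l (inj₂ (p , q)) (inj₂ (p' , q')) rewrite p | q | p' | q' = inj₁ (ℕₚ.≤-refl , ℕₚ.≤-refl)
    arc-arc i k j l (inj₁ (p , q)) (inj₂ (p' , q')) rewrite p | q | p' | q' = inj₂ (inj₂ (inj₁ ℕₚ.≤-refl))
    arc-arc i k j l (inj₂ (p , q)) (inj₁ (p' , q')) rewrite p | q | p' | q' = inj₂ (inj₂ (inj₂ ℕₚ.≤-refl))
    compat : ∀ {x y} → Item x → Item y → compatible x y ≡ true
    compat (radius v _) (radius w _) = ∨-introˡ (tagEq-refl t)
    compat (radius v h) (chord i k h') = rad-compatible u i k t v (lin i k h') (rad-arc i k v h' h)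
    compat (chord i k h') (radius v h) = rad-compatible u i k t v (lin i k h') (rad-arc i k v h' h)
    compat (chord i k h) (chord j l h') = compatible-intro u i k j l (lin i k h) (lin j l h') (arc-arc i k j l h h')
    T = proj₁ (complete Y (λ p q → compat (item p) (item q)))
    in-T : ∀ {x} → x ∈ Y → mem T x ≡ true
    in-T = proj₂ (complete Y (λ p q → compat (item p) (item q)))

-- The column of the exchange matrix of a radius

sumF-zero : ∀ {m} {f : Fin m → ℤ} → (∀ i → f i ≡ + 0) → sumF f ≡ + 0
sumF-zero {zero} h = refl
sumF-zero {suc m} h = cong₂ ℤ._+_ (h Fz) (sumF-zero (λ i → h (Fs i)))

sumF-single : ∀ {m} {f : Fin m → ℤ} j → (∀ i → i ≢ j → f i ≡ + 0) → sumF f ≡ f j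
sumF-single {suc m} {f} Fz h = trans (cong (ℤ._+_ (f Fz)) (sumF-zero (λ i → h (Fs i) (λ ())))) (ℤₚ.+-identityʳ (f Fz))
sumF-single {suc m} {f} (Fs j) h = trans (cong₂ ℤ._+_ (h Fz (λ ())) (sumF-single j (λ i ne → h (Fs i) (λ eq → ne (Finₚ.suc-injective eq))))) (ℤₚ.+-identityˡ _)

sumF-two : ∀ {m} {f : Fin m → ℤ} j k → j ≢ k → (∀ i → i ≢ j → i ≢ k → f i ≡ + 0) → sumF f ≡ f j ℤ.+ f k
sumF-two {suc m} {f} Fz Fz ne h = ⊥-elim (ne refl)
sumF-two {suc m} {f} Fz (Fs k) ne h = cong (ℤ._+_ (f Fz)) (sumF-single k (λ i i≢k → h (Fs i) (λ ()) (λ eq → i≢k (Finₚ.suc-injective eq))))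
sumF-two {suc m} {f} (Fs j) Fz ne h = trans (cong (ℤ._+_ (f Fz)) (sumF-single j (λ i i≢j → h (Fs i) (λ eq → i≢j (Finₚ.suc-injective eq)) (λ ())))) (ℤₚ.+-comm (f Fz) (f (Fs j)))
sumF-two {suc m} {f} (Fs j) (Fs k) ne h = trans (cong₂ ℤ._+_ (h Fz (λ ()) (λ ())) (sumF-two j k (λ eq → ne (cong Fs eq)) (λ i p q → h (Fs i) (λ eq → p (Finₚ.suc-injective eq)) (λ eq → q (Finₚ.suc-injective eq))))) (ℤₚ.+-identityˡ _)

if-zero : ∀ b {x} → x ≡ + 0 → (if b then x else + 0) ≡ + 0
if-zero true h = h
if-zero false h = refl

if-false : ∀ {b} {x : ℤ} → b ≡ false → (if b then x else + 0) ≡ + 0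
if-false refl = refl

if-true : ∀ {b} {x : ℤ} → b ≡ true → (if b then x else + 0) ≡ x
if-true refl = refl

tri : (p₁ p₂ p₃ q₁ q₂ q₃ : Bool) → ℤ
tri p₁ p₂ p₃ q₁ q₂ q₃ = (ind (p₁ ∧ q₂) ℤ.+ ind (p₂ ∧ q₃) ℤ.+ ind (p₃ ∧ q₁)) ℤ.- (ind (p₂ ∧ q₁) ℤ.+ ind (p₃ ∧ q₂) ℤ.+ ind (p₁ ∧ q₃))

tri-000 : ∀ p₁ p₂ p₃ → tri p₁ p₂ p₃ false false false ≡ + 0
tri-000 true true true = refl
tri-000 true true false = refl
tri-000 true false true = refl
tri-000 true false false = refl
tri-000 false true true = refl
tri-000 false true false = refl
tri-000 false false true = refl
tri-000 false false false = refl

tri-100 : ∀ p₁ p₂ p₃ → tri p₁ p₂ p₃ true false false ≡ ind p₃ ℤ.- ind p₂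
tri-100 true true true = refl
tri-100 true true false = refl
tri-100 true false true = refl
tri-100 true false false = refl
tri-100 false true true = refl
tri-100 false true false = refl
tri-100 false false true = refl
tri-100 false false false = refl

tri-001 : ∀ p₁ p₂ p₃ → tri p₁ p₂ p₃ false false true ≡ ind p₂ ℤ.- ind p₁
tri-001 true true true = refl
tri-001 true true false = refl
tri-001 true false true = refl
tri-001 true false false = refl
tri-001 false true true = refl
tri-001 false true false = refl
tri-001 false false true = refl
tri-001 false false false = refl

module Column {n : ℕ} (3≤n : 3 ≤ n) where
  open Circle 3≤n
  open Arcs 3≤n
  open Corners 3≤n

  sideIn-elim : ∀ T x y → sideIn T x y ≡ true → 1 ≤ dist x y × inSeed T (side x (dist x y)) ≡ true
  sideIn-elim T x y h with ∨-true {dist x y ≡ᵇ 1} h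
  ... | inj₁ p = subst (λ d → 1 ≤ d × inSeed T (side x d) ≡ true) (sym (≡ᵇ-elim p)) (ℕₚ.≤-refl , refl)
  ... | inj₂ p = let (k , q) = anyF-elim {f = λ k → ((toℕ k ℕ.+ 2) ≡ᵇ dist x y) ∧ mem T (arc x k)} p ; (q₁ , q₂) = ∧-true {(toℕ k ℕ.+ 2) ≡ᵇ dist x y} q in
    subst (λ d → 1 ≤ d × inSeed T (side x d) ≡ true) (≡ᵇ-elim {len k} q₁) (ℕₚ.≤-trans (ℕ.s≤s ℕ.z≤n) (2≤len k) , trans (cong (inSeed T) (side-arc x k)) q₂)

  sideIn-intro : ∀ T x y d → 1 ≤ d → d < n → dist x y ≡ d → inSeed T (side x d) ≡ true → sideIn T x y ≡ true
  sideIn-intro T x y d 1≤d d<n eq h with side x d | side-view x d 1≤d d<n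
  ... | _ | boundary refl = ∨-introˡ {dist x y ≡ᵇ 1} (≡ᵇ-intro eq)
  ... | _ | chord k refl = ∨-introʳ (dist x y ≡ᵇ 1) (anyF-intro {f = λ k → ((toℕ k ℕ.+ 2) ≡ᵇ dist x y) ∧ mem T (arc x k)} k (∧-intro (≡ᵇ-intro {len k} (sym eq)) h))

  isS-elim : ∀ x y σ → isS x y σ ≡ true → σ ≡ side x (dist x y)
  isS-elim x y (bd s) h = let (p , q) = ∧-true {finEq s x} h in trans (cong bd (finEq-elim {a = s} {x} p)) (sym (cong (side x) (≡ᵇ-elim {dist x y} q)))
  isS-elim x y (cl (arc i k)) h = let (p , q) = ∧-true {finEq i x} h in
    trans (cong (λ z → cl (arc z k)) (finEq-elim {a = i} {x} p)) (trans (sym (side-arc x k)) (cong (side x) (≡ᵇ-elim {len k} q)))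

  isS-intro : ∀ x y d → 1 ≤ d → d < n → dist x y ≡ d → isS x y (side x d) ≡ true
  isS-intro x y d 1≤d d<n eq with side x d | side-view x d 1≤d d<n
  ... | _ | boundary refl = ∧-intro (finEq-refl x) (≡ᵇ-intro eq)
  ... | _ | chord k refl = ∧-intro (finEq-refl x) (≡ᵇ-intro {len k} (sym eq))

  isR-elim : ∀ t (x : Fin n) σ → isR t x σ ≡ true → σ ≡ cl (rad t x)
  isR-elim t x (cl (rad s y)) h = let (p , q) = ∧-true {tagEq t s} h in cong cl (cong₂ rad (sym (tagEq-elim p)) (sym (finEq-elim {a = x} {y} q)))

  isR-refl : ∀ t (x : Fin n) → isR t x (cl (rad t x)) ≡ true
  isR-refl t x = ∧-intro (tagEq-refl t) (finEq-refl x)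

  isR-≢ : ∀ t (x y : Fin n) → x ≢ y → isR t x (cl (rad t y)) ≡ false
  isR-≢ t x y ne = ¬true⇒false λ h → ne (finEq-elim {a = x} {y} (proj₂ (∧-true {tagEq t t} h)))

  module _ {T t u d₁ d₂} (C : Corner T t u d₁ d₂) where
    open Corner C

    private
      y : Var n
      y = cl (rad t b)

    only-t : ∀ s z → mem T (rad s z) ≡ true → s ≡ t
    only-t = same-tag T t u b u≢b rad-a rad-b

    not-both : ∀ i → mem T (rad plain i) ≡ true → mem T (rad notched i) ≡ true → ⊥
    not-both i p q with trans (only-t plain i p) (sym (only-t notched i q))
    ... | ()

    piT-id : ∀ σ → inSeed T σ ≡ true → piT T σ ≡ σ
    piT-id (bd _) h = refl
    piT-id (cl (arc _ _)) h = refl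
    piT-id (cl (rad notched i)) h = refl
    piT-id (cl (rad plain i)) h with mem T (rad notched i) in eq
    ... | true = ⊥-elim (not-both i h eq)
    ... | false = refl

    -- Of two sides that start at b and end at vertices with radii, the longer one would cut off the
    -- end of the shorter one from the puncture.
    next-radius : ∀ v → mem T (rad t v) ≡ true → sideIn T b v ≡ true → v ≡ c
    next-radius v m s with sideIn-elim T b v s
    ... | 1≤e , side-e with ℕₚ.<-cmp (dist b v) d₂
    ...   | tri≈ _ h _ = trans (sym (↻-dist b v)) (trans (cong (b ↻_) h) c≡)
    ...   | tri< h _ _ = ⊥-elim (no-inside T b d₂ 1≤d₂ d₂<n side-bc t v m 1≤e h)
    ...   | tri> _ _ h = ⊥-elim (no-inside T b (dist b v) 1≤e (dist<n b v) side-e t c rad-c (subst (0 <_) (sym b-c) 1≤d₂) (subst (_< dist b v) (sym b-c) h))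

    previous-radius : ∀ v → mem T (rad t v) ≡ true → sideIn T v b ≡ true → v ≡ u
    previous-radius v m s with sideIn-elim T v b s | v Finₚ.≟ u
    ... | _ | yes p = p
    ... | 1≤e , side-e | no v≢u with ℕₚ.<-cmp (dist v u) (dist v b)
    ...   | tri< h _ _ = ⊥-elim (no-inside T v (dist v b) 1≤e (dist<n v b) side-e t u rad-a (ℕₚ.n≢0⇒n>0 (λ z → v≢u (dist≡0 z))) h)
    ...   | tri≈ _ h _ = ⊥-elim (u≢b (trans (sym (↻-dist v u)) (trans (cong (v ↻_) h) (↻-dist v b))))
    ...   | tri> _ _ h = ⊥-elim (no-inside T u d₁ 1≤d₁ d₁<n side-ab t v m (ℕₚ.n≢0⇒n>0 (λ z → v≢u (sym (dist≡0 z))))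
        (ℕₚ.+-cancelˡ-< (dist v u) _ _ (subst₂ _<_ (sym eq₁) (sym eq₂) (ℕₚ.m<m+n n 1≤e))))
      where
      eq₁ : dist v u ℕ.+ dist u v ≡ n
      eq₁ = trans (cong (λ z → dist v u ℕ.+ dist z v) (sym (↻-dist v u))) (trans (dist-> v (dist v u) v (dist<n v u) (subst (_< dist v u) (sym (dist-self v)) (ℕₚ.n≢0⇒n>0 (λ z → v≢u (dist≡0 z)))))
        (trans (cong (n ℕ.+_) (dist-self v)) (ℕₚ.+-identityʳ n)))
      eq₂ : dist v u ℕ.+ d₁ ≡ n ℕ.+ dist v b
      eq₂ = trans (cong (dist v u ℕ.+_) (sym at-b)) (trans (cong (λ z → dist v u ℕ.+ dist z b) (sym (↻-dist v u))) (dist-> v (dist v u) b (dist<n v u) h))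

    module _ (σ : Var n) where

      sum₁ sum₃ : Var n → ℤ
      sum₁ py = sumF (λ a → sumF (λ b → sumF (λ c →
        if (0 <ᵇ dist a b) ∧ (dist a b <ᵇ dist a c) ∧ sideIn T a b ∧ sideIn T b c ∧ sideIn T a c
        then triB (isS a b) (isS b c) (isS a c) σ py else + 0)))
      sum₃ py = sumF (λ i → sumF (λ j →
        if mem T (rad plain i) ∧ mem T (rad notched i) ∧ not (finEq i j) ∧ sideIn T i j ∧ sideIn T j i
        then triB (isS i j) (isS j i) (isR notched i) σ py else + 0))

      cond : Tag → Fin n → Fin n → Bool
      cond s A C = mem T (rad s A) ∧ mem T (rad s C) ∧ not (finEq A C) ∧ sideIn T A C

      term : Tag → Fin n → Fin n → ℤ
      term s A C = if cond s A C then triB (isR s A) (isS A C) (isR s C) σ y else + 0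

      sum₂ : ℤ
      sum₂ = sumF (λ a → sumF (λ c → term plain a c ℤ.+ term notched a c))

      sum₁≡0 : sum₁ y ≡ + 0
      sum₁≡0 = sumF-zero λ a → sumF-zero λ b → sumF-zero λ c →
        if-zero ((0 <ᵇ dist a b) ∧ (dist a b <ᵇ dist a c) ∧ sideIn T a b ∧ sideIn T b c ∧ sideIn T a c) (tri-000 (isS a b σ) (isS b c σ) (isS a c σ))

      sum₃≡0 : sum₃ y ≡ + 0
      sum₃≡0 = sumF-zero λ i → sumF-zero λ j → if-false {mem T (rad plain i) ∧ mem T (rad notched i) ∧ not (finEq i j) ∧ sideIn T i j ∧ sideIn T j i}
        (¬true⇒false λ h → let (p , q) = ∧-true {mem T (rad plain i)} h in not-both i p (proj₁ (∧-true {mem T (rad notched i)} q)))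

      term-other : ∀ s → s ≢ t → ∀ A C → term s A C ≡ + 0
      term-other s s≢t A C = if-false {cond s A C} (¬true⇒false λ h → s≢t (only-t s A (proj₁ (∧-true {mem T (rad s A)} h))))

      combine-tags : ∀ A C → term plain A C ℤ.+ term notched A C ≡ term t A C
      combine-tags A C = go t refl
        where
        go : ∀ s → s ≡ t → term plain A C ℤ.+ term notched A C ≡ term s A C
        go plain refl = trans (cong (ℤ._+_ (term plain A C)) (term-other notched (λ ()) A C)) (ℤₚ.+-identityʳ _)
        go notched refl = trans (cong (ℤ._+ term notched A C) (term-other plain (λ ()) A C)) (ℤₚ.+-identityˡ _)

      tri-cong : ∀ {p₁ p₂ p₃ q₁ q₃ r₁ r₃} → q₁ ≡ r₁ → q₃ ≡ r₃ → tri p₁ p₂ p₃ q₁ false q₃ ≡ tri p₁ p₂ p₃ r₁ false r₃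
      tri-cong refl refl = refl

      term-elsewhere : ∀ A C → A ≢ b → C ≢ b → term t A C ≡ + 0
      term-elsewhere A C A≢b C≢b = if-zero (cond t A C) (trans (tri-cong {isR t A σ} {isS A C σ} {isR t C σ} (isR-≢ t A b A≢b) (isR-≢ t C b C≢b)) (tri-000 (isR t A σ) (isS A C σ) (isR t C σ)))

      cond-elim : ∀ A C → cond t A C ≡ true → mem T (rad t A) ≡ true × mem T (rad t C) ≡ true × A ≢ C × sideIn T A C ≡ true
      cond-elim A C h = let (p , h₁) = ∧-true {mem T (rad t A)} h ; (q , h₂) = ∧-true {mem T (rad t C)} h₁ ; (r , s) = ∧-true {not (finEq A C)} h₂ in
        p , q , (λ { refl → not-true r (finEq-refl A) }) , s

      cond-intro : ∀ A C → mem T (rad t A) ≡ true → mem T (rad t C) ≡ true → A ≢ C → sideIn T A C ≡ true → cond t A C ≡ true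
      cond-intro A C p q ne s = ∧-intro p (∧-intro q (∧-intro (not-intro {finEq A C} λ h → ne (finEq-elim {a = A} {C} h)) s))

      row-b-zero : ∀ C → C ≢ c → term t b C ≡ + 0
      row-b-zero C C≢c = if-false {cond t b C} (¬true⇒false λ h → let (_ , m , _ , s) = cond-elim b C h in C≢c (next-radius C m s))

      column-b-zero : ∀ A → A ≢ u → term t A b ≡ + 0
      column-b-zero A A≢u = if-false {cond t A b} (¬true⇒false λ h → let (m , _ , _ , s) = cond-elim A b h in A≢u (previous-radius A m s))

      term-bc : term t b c ≡ ind (isR t c σ) ℤ.- ind (isS b c σ)
      term-bc = trans (if-true {cond t b c} (cond-intro b c rad-b rad-c b≢c (sideIn-intro T b c d₂ 1≤d₂ d₂<n b-c side-bc)))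
        (trans (tri-cong {isR t b σ} {isS b c σ} {isR t c σ} (isR-refl t b) (isR-≢ t c b (λ h → b≢c (sym h)))) (tri-100 (isR t b σ) (isS b c σ) (isR t c σ)))

      term-ub : term t u b ≡ ind (isS u b σ) ℤ.- ind (isR t u σ)
      term-ub = trans (if-true {cond t u b} (cond-intro u b rad-a rad-b u≢b (sideIn-intro T u b d₁ 1≤d₁ d₁<n at-b side-ab)))
        (trans (tri-cong {isR t u σ} {isS u b σ} {isR t b σ} (isR-≢ t u b u≢b) (isR-refl t b)) (tri-001 (isR t u σ) (isS u b σ) (isR t b σ)))

      row : ∀ A → A ≢ b → sumF (λ C → term t A C) ≡ term t A b
      row A A≢b = sumF-single b (λ C C≢b → term-elsewhere A C A≢b C≢b)

      sum₂≡ : sum₂ ≡ (ind (isS u b σ) ℤ.- ind (isR t u σ)) ℤ.+ (ind (isR t c σ) ℤ.- ind (isS b c σ))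
      sum₂≡ = trans (sumF-cong (λ A → sumF-cong (λ C → combine-tags A C)))
        (trans (sumF-two u b u≢b (λ A A≢u A≢b → trans (row A A≢b) (column-b-zero A A≢u)))
          (cong₂ ℤ._+_ (trans (row u u≢b) term-ub) (trans (sumF-single c row-b-zero) term-bc)))

    -- A radius is no side of a triangle away from the puncture, and a self-folded triangle would
    -- need both tags at one vertex. There remain the triangles on the two sides of the radius. The
    -- formula includes c = u, where the two terms with radii cancel.
    column : ∀ σ → inSeed T σ ≡ true → bMat T σ (cl (rad t b)) ≡ (ind (isS u b σ) ℤ.- ind (isR t u σ)) ℤ.+ (ind (isR t c σ) ℤ.- ind (isS b c σ))
    column σ h = trans (cong₂ (λ px py → full px py) (piT-id σ h) (piT-id y rad-b))
      (trans (cong₂ ℤ._+_ (cong₂ ℤ._+_ (sum₁≡0 σ) (sum₂≡ σ)) (sum₃≡0 σ)) (trans (ℤₚ.+-identityʳ _) (ℤₚ.+-identityˡ _)))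
      where
      -- The body of `bMat` with `px` and `py` as arguments, so that `piT` can be removed from both.
      full : Var n → Var n → ℤ
      full px py =
        sumF (λ a → sumF (λ b → sumF (λ c →
          if (0 <ᵇ dist a b) ∧ (dist a b <ᵇ dist a c) ∧ sideIn T a b ∧ sideIn T b c ∧ sideIn T a c
          then triB (isS a b) (isS b c) (isS a c) px py else + 0)))
        ℤ.+ sumF (λ a → sumF (λ c →
          (if mem T (rad plain a) ∧ mem T (rad plain c) ∧ not (finEq a c) ∧ sideIn T a c
           then triB (isR plain a) (isS a c) (isR plain c) px py else + 0)
          ℤ.+ (if mem T (rad notched a) ∧ mem T (rad notched c) ∧ not (finEq a c) ∧ sideIn T a c
           then triB (isR notched a) (isS a c) (isR notched c) px py else + 0)))
        ℤ.+ sumF (λ i → sumF (λ j →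
          if mem T (rad plain i) ∧ mem T (rad notched i) ∧ not (finEq i j) ∧ sideIn T i j ∧ sideIn T j i
          then triB (isS i j) (isS j i) (isR notched i) px py else + 0))

-- From the columns of the exchange matrix to exchange relations

Unique-allVar : ∀ n → Unique (allVar n)
Unique-allVar n = Uniqueₚ.++⁺ (Uniqueₚ.map⁺ (λ { refl → refl }) arcs) (Uniqueₚ.map⁺ (λ { refl → refl }) (Uniqueₚ.allFin⁺ n))
  λ (p , q) → let (_ , _ , h) = ∈-map⁻ cl p ; (_ , _ , k) = ∈-map⁻ bd q in cl≢bd (trans (sym h) k)
  where
  cl≢bd : ∀ {γ s} → cl {n} γ ≢ bd s
  cl≢bd ()
  product≡ : ∀ xs → List.cartesianProductWith arc xs (allFinL (n ∸ 2)) ≡ concatMap (λ i → map (arc {n} i) (allFinL (n ∸ 2))) xs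
  product≡ [] = refl
  product≡ (x ∷ xs) = cong (map (arc x) (allFinL (n ∸ 2)) ++_) (product≡ xs)
  radii : Unique (map (rad plain) (allFinL n) ++ map (rad notched) (allFinL n))
  radii = Uniqueₚ.++⁺ (Uniqueₚ.map⁺ (λ { refl → refl }) (Uniqueₚ.allFin⁺ n)) (Uniqueₚ.map⁺ (λ { refl → refl }) (Uniqueₚ.allFin⁺ n))
    λ (p , q) → let (_ , _ , h) = ∈-map⁻ (rad plain) p ; (_ , _ , k) = ∈-map⁻ (rad notched) q in plain≢notched (trans (sym h) k)
    where
    plain≢notched : ∀ {i j : Fin n} → rad plain i ≢ rad notched j
    plain≢notched ()
  arcs : Unique (allTArc n)
  arcs = Uniqueₚ.++⁺ (subst Unique (product≡ (allFinL n)) (Uniqueₚ.cartesianProductWith⁺ arc (λ { refl → refl , refl }) (Uniqueₚ.allFin⁺ n) (Uniqueₚ.allFin⁺ (n ∸ 2)))) radii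
    λ (p , q) → let (_ , _ , _ , _ , h) = ∈-cartesianProductWith⁻ arc (allFinL n) (allFinL (n ∸ 2)) (subst (_ ∈_) (sym (product≡ (allFinL n))) p) in arc≢rad h (∈-++⁻ (map (rad plain) (allFinL n)) q)
    where
    arc≢rad : ∀ {x i k} → x ≡ arc {n} i k → x ∈ map (rad plain) (allFinL n) ⊎ x ∈ map (rad notched) (allFinL n) → ⊥
    arc≢rad refl (inj₁ q) with ∈-map⁻ (rad plain) q
    ... | _ , _ , ()
    arc≢rad refl (inj₂ q) with ∈-map⁻ (rad notched) q
    ... | _ , _ , ()

module Products {n : ℕ} where
  module Rₚ = CommutativeSemiring (LP-semiring n)
  open NatSolver (LP-semiring n) using (solve; _:=_; _:*_)

  prod : List (LP n) → LP n
  prod = foldr _⊗_ 1ᴸ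

  prodL≡prod : ∀ ps → prodL ps ≡ prod ps
  prodL≡prod [] = sym 1ᴸ-def
  prodL≡prod (p ∷ ps) = trans (cong (p *L_) (prodL≡prod ps)) (sym (⊗-def p (prod ps)))

  prod-cong : ∀ {f g : Var n → LP n} xs → (∀ σ → f σ ≈ g σ) → prod (map f xs) ≈ prod (map g xs)
  prod-cong [] h = ≈-refl
  prod-cong (σ ∷ xs) h = Rₚ.*-cong (h σ) (prod-cong xs h)

  prod-⊗ : ∀ (f g : Var n → LP n) xs → prod (map (λ σ → f σ ⊗ g σ) xs) ≈ prod (map f xs) ⊗ prod (map g xs)
  prod-⊗ f g [] = ≈-sym (Rₚ.*-identityˡ 1ᴸ)
  prod-⊗ f g (σ ∷ xs) = ≈-trans (Rₚ.*-congˡ (prod-⊗ f g xs)) (solve 4 (λ a b c d → a :* b :* (c :* d) := a :* c :* (b :* d)) ≈-refl (f σ) (g σ) (prod (map f xs)) (prod (map g xs)))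

  choose : Bool → LP n → LP n
  choose true p = p
  choose false p = 1ᴸ

  prod-none : ∀ (P : Var n → Bool) (g : Var n → LP n) xs → (∀ {σ} → σ ∈ xs → P σ ≡ false) → prod (map (λ σ → choose (P σ) (g σ)) xs) ≈ 1ᴸ
  prod-none P g [] h = ≈-refl
  prod-none P g (σ ∷ xs) h rewrite h (here refl) = ≈-trans (Rₚ.*-identityˡ _) (prod-none P g xs (λ m → h (there m)))

  -- Uniqueness enters because a variable listed twice would have its factor squared.
  prod-select : ∀ (P : Var n → Bool) (g : Var n → LP n) σ₀ xs → Unique xs → σ₀ ∈ xs → P σ₀ ≡ true → (∀ σ → P σ ≡ true → σ ≡ σ₀) →
    prod (map (λ σ → choose (P σ) (g σ)) xs) ≈ g σ₀
  prod-select P g σ₀ (.σ₀ ∷ xs) (u AllPairs.∷ _) (here refl) t only rewrite t = ≈-trans (Rₚ.*-congˡ (prod-none P g xs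
    λ m → ¬true⇒false λ h → All.lookup u m (sym (only _ h)))) (Rₚ.*-identityʳ _)
  prod-select P g σ₀ (σ ∷ xs) (u AllPairs.∷ us) (there m) t only with P σ in eq
  ... | true = ⊥-elim (All.lookup u m (only σ eq))
  ... | false = ≈-trans (Rₚ.*-identityˡ _) (prod-select P g σ₀ xs us m t only)

  powL-0 : ∀ (p : LP n) → powL p 0 ≈ 1ᴸ
  powL-0 p = subst (oneL ≈_) (sym 1ᴸ-def) ≈-refl

  powL-1 : ∀ (p : LP n) → powL p 1 ≈ p
  powL-1 p = subst (_≈ p) (trans (⊗-def p 1ᴸ) (cong (p *L_) 1ᴸ-def)) (Rₚ.*-identityʳ p)

  -- An exponent in an exchange relation is the positive or negative part of a sum of four signed
  -- indicators. It splits into one factor for each indicator because no two of them hold together.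
  data AtMostOne : (p q r s : Bool) → Set where
    none  : AtMostOne false false false false
    one-p : AtMostOne true false false false
    one-q : AtMostOne false true false false
    one-r : AtMostOne false false true false
    one-s : AtMostOne false false false true

  pow-pos : ∀ {p q r s} v {m} → AtMostOne p q r s → m ≡ (ind p ℤ.- ind r) ℤ.+ (ind q ℤ.- ind s) → powL v (posPart m) ≈ choose p v ⊗ choose q v
  pow-pos v none refl = ≈-trans (powL-0 v) (≈-sym (Rₚ.*-identityˡ _))
  pow-pos v one-p refl = ≈-trans (powL-1 v) (≈-sym (Rₚ.*-identityʳ _))
  pow-pos v one-q refl = ≈-trans (powL-1 v) (≈-sym (Rₚ.*-identityˡ _))
  pow-pos v one-r refl = ≈-trans (powL-0 v) (≈-sym (Rₚ.*-identityˡ _))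
  pow-pos v one-s refl = ≈-trans (powL-0 v) (≈-sym (Rₚ.*-identityˡ _))

  pow-neg : ∀ {p q r s} v {m} → AtMostOne p q r s → m ≡ (ind p ℤ.- ind r) ℤ.+ (ind q ℤ.- ind s) → powL v (negPart m) ≈ choose s v ⊗ choose r v
  pow-neg v none refl = ≈-trans (powL-0 v) (≈-sym (Rₚ.*-identityˡ _))
  pow-neg v one-p refl = ≈-trans (powL-0 v) (≈-sym (Rₚ.*-identityʳ _))
  pow-neg v one-q refl = ≈-trans (powL-0 v) (≈-sym (Rₚ.*-identityˡ _))
  pow-neg v one-r refl = ≈-trans (powL-1 v) (≈-sym (Rₚ.*-identityˡ _))
  pow-neg v one-s refl = ≈-trans (powL-1 v) (≈-sym (Rₚ.*-identityʳ _))

  -- The case c = u: the indicator of the one outer radius occurs with both signs, and only the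
  -- sides survive.
  pow-pos′ : ∀ {p r s} v {m} → (p ≡ true → s ≡ true → ⊥) → m ≡ (ind p ℤ.- ind r) ℤ.+ (ind r ℤ.- ind s) → powL v (posPart m) ≈ choose p v
  pow-pos′ {true} {r} {true} v h = ⊥-elim (h refl refl)
  pow-pos′ {true} {true} {false} v h refl = powL-1 v
  pow-pos′ {true} {false} {false} v h refl = powL-1 v
  pow-pos′ {false} {true} {true} v h refl = powL-0 v
  pow-pos′ {false} {true} {false} v h refl = powL-0 v
  pow-pos′ {false} {false} {true} v h refl = powL-0 v
  pow-pos′ {false} {false} {false} v h refl = powL-0 v

  pow-neg′ : ∀ {p r s} v {m} → (p ≡ true → s ≡ true → ⊥) → m ≡ (ind p ℤ.- ind r) ℤ.+ (ind r ℤ.- ind s) → powL v (negPart m) ≈ choose s v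
  pow-neg′ {true} {r} {true} v h = ⊥-elim (h refl refl)
  pow-neg′ {true} {true} {false} v h refl = powL-0 v
  pow-neg′ {true} {false} {false} v h refl = powL-0 v
  pow-neg′ {false} {true} {true} v h refl = powL-1 v
  pow-neg′ {false} {true} {false} v h refl = powL-0 v
  pow-neg′ {false} {false} {true} v h refl = powL-1 v
  pow-neg′ {false} {false} {false} v h refl = powL-0 v

module Relations {n : ℕ} (3≤n : 3 ≤ n) (F : TArc n → LP n)
  (exchange : ∀ T₁ τ₁ T₂ τ₂ → Flip T₁ τ₁ T₂ τ₂ → (F τ₁ *L F τ₂) ≈L exchL T₁ τ₁ F) where
  open Circle 3≤n
  open Arcs 3≤n
  open Corners 3≤n
  open Column 3≤n
  open Products {n}

  val : Var n → LP n
  val = valL F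

  module _ {T t u d₁ d₂} (C : Corner T t u d₁ d₂) where
    open Corner C

    private
      Seed : (ℤ → ℕ) → Var n → LP n
      Seed part σ = if inSeed T σ then powL (val σ) (part (bMat T σ (cl (rad t b)))) else oneL

    exchL≈ : exchL T (rad t b) F ≈ prod (map (Seed posPart) (allVar n)) ⊕ prod (map (Seed negPart) (allVar n))
    exchL≈ = subst (exchL T (rad t b) F ≈_) (trans (cong₂ _+L_ (prodL≡prod (map (Seed posPart) (allVar n))) (prodL≡prod (map (Seed negPart) (allVar n)))) (sym (⊕-def _ _))) ≈-refl

    relation : ∀ T' τ' → Flip T (rad t b) T' τ' → F (rad t b) ⊗ F τ' ≈ prod (map (Seed posPart) (allVar n)) ⊕ prod (map (Seed negPart) (allVar n))
    relation T' τ' flip = ≈-trans (subst (_≈ exchL T (rad t b) F) (sym (⊗-def _ _)) (mk≈ (exchange T (rad t b) T' τ' flip))) exchL≈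

    p-elim : ∀ σ → isS u b σ ≡ true → σ ≡ side u d₁
    p-elim σ h = trans (isS-elim u b σ h) (cong (side u) at-b)

    s-elim : ∀ σ → isS b c σ ≡ true → σ ≡ side b d₂
    s-elim σ h = trans (isS-elim b c σ h) (cong (side b) b-c)

    side≢ : side u d₁ ≢ side b d₂
    side≢ = go _ _ (side-view u d₁ 1≤d₁ d₁<n) (side-view b d₂ 1≤d₂ d₂<n)
      where
      go : ∀ σ τ → SideView u d₁ σ → SideView b d₂ τ → σ ≢ τ
      go _ _ (boundary _) (boundary _) h = u≢b (bd-injective h)
        where
        bd-injective : ∀ {x y : Fin n} → bd x ≡ bd y → x ≡ y
        bd-injective refl = refl
      go _ _ (boundary _) (chord _ _) ()
      go _ _ (chord _ _) (boundary _) ()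
      go _ _ (chord _ _) (chord _ _) h = u≢b (arc-injective h)
        where
        arc-injective : ∀ {x y : Fin n} {k l} → cl (arc x k) ≡ cl (arc y l) → x ≡ y
        arc-injective refl = refl

    side-not-rad : ∀ x d s z → 1 ≤ d → d < n → isR s z (side x d) ≡ false
    side-not-rad x d s z 1≤d d<n with side x d | side-view x d 1≤d d<n
    ... | _ | boundary _ = refl
    ... | _ | chord _ _ = refl

    product : ∀ (P : Var n → Bool) σ₀ → P σ₀ ≡ true → (∀ σ → P σ ≡ true → σ ≡ σ₀) → prod (map (λ σ → choose (P σ) (val σ)) (allVar n)) ≈ val σ₀
    product P σ₀ = prod-select P val σ₀ (allVar n) (Unique-allVar n) (∈-allVar σ₀)

    ab-true : isS u b (side u d₁) ≡ true
    ab-true = isS-intro u b d₁ 1≤d₁ d₁<n at-b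

    bc-true : isS b c (side b d₂) ≡ true
    bc-true = isS-intro b c d₂ 1≤d₂ d₂<n b-c

    -- In `exchL` a variable outside the seed gives the factor 1; the indicators have to agree with
    -- this, and they do because the variables they select belong to the seed.
    outside : ∀ (P : Var n → Bool) σ₀ → inSeed T σ₀ ≡ true → (∀ σ → P σ ≡ true → σ ≡ σ₀) → ∀ σ → inSeed T σ ≡ false → choose (P σ) (val σ) ≈ 1ᴸ
    outside P σ₀ in₀ only σ out with P σ in eq
    ... | false = ≈-refl
    ... | true = ⊥-elim (true≢false (trans (sym in₀) (trans (cong (inSeed T) (sym (only σ eq))) out)))

    one≈ : oneL ≈ 1ᴸ {n}
    one≈ = subst (oneL ≈_) (sym 1ᴸ-def) ≈-refl

    exchange-arc : ∀ k → len k ≡ d₁ ℕ.+ d₂ → val (cl (rad t b)) ⊗ val (cl (arc u k)) ≈ val (side u d₁) ⊗ val (cl (rad t c)) ⊕ val (side b d₂) ⊗ val (cl (rad t u))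
    exchange-arc k len-k = ≈-trans (let (T' , flip) = Flips.flip-arc C k len-k in relation T' (arc u k) flip)
      (Rₚ.+-cong
        (≈-trans (prod-cong (allVar n) pos-term) (≈-trans (prod-⊗ _ _ (allVar n)) (Rₚ.*-cong (product (isS u b) _ ab-true p-elim) (product (isR t c) _ (isR-refl t c) (isR-elim t c)))))
        (≈-trans (prod-cong (allVar n) neg-term) (≈-trans (prod-⊗ _ _ (allVar n)) (Rₚ.*-cong (product (isS b c) _ bc-true s-elim) (product (isR t u) _ (isR-refl t u) (isR-elim t u))))))
      where
      u≢c : u ≢ c
      u≢c h = ℕₚ.<⇒≢ (ℕₚ.<-≤-trans 1≤d₁ (ℕₚ.m≤m+n d₁ d₂)) (trans (sym (dist-self u)) (trans (cong (dist u) h) (dist-↻ u _ (subst (_< n) len-k (len<n k)))))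
      view : ∀ σ → AtMostOne (isS u b σ) (isR t c σ) (isR t u σ) (isS b c σ)
      view σ with isS u b σ in p | isR t c σ in q | isR t u σ in r | isS b c σ in s
      ... | false | false | false | false = none
      ... | true | false | false | false = one-p
      ... | false | true | false | false = one-q
      ... | false | false | true | false = one-r
      ... | false | false | false | true = one-s
      ... | true | true | _ | _ = ⊥-elim (true≢false (trans (sym q) (trans (cong (isR t c) (p-elim σ p)) (side-not-rad u d₁ t c 1≤d₁ d₁<n))))
      ... | true | false | true | _ = ⊥-elim (true≢false (trans (sym r) (trans (cong (isR t u) (p-elim σ p)) (side-not-rad u d₁ t u 1≤d₁ d₁<n))))
      ... | true | false | false | true = ⊥-elim (side≢ (trans (sym (p-elim σ p)) (s-elim σ s)))
      ... | false | true | true | _ = ⊥-elim (true≢false (trans (sym r) (trans (cong (isR t u) (isR-elim t c σ q)) (isR-≢ t u c u≢c))))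
      ... | false | true | false | true = ⊥-elim (true≢false (trans (sym q) (trans (cong (isR t c) (s-elim σ s)) (side-not-rad b d₂ t c 1≤d₂ d₂<n))))
      ... | false | false | true | true = ⊥-elim (true≢false (trans (sym r) (trans (cong (isR t u) (s-elim σ s)) (side-not-rad b d₂ t u 1≤d₂ d₂<n))))
      pos-term : ∀ σ → Seed posPart σ ≈ choose (isS u b σ) (val σ) ⊗ choose (isR t c σ) (val σ)
      pos-term σ with inSeed T σ in eq
      ... | true = pow-pos (val σ) (view σ) (column C σ eq)
      ... | false = ≈-trans one≈ (≈-sym (≈-trans (Rₚ.*-cong (outside (isS u b) _ side-ab p-elim σ eq) (outside (isR t c) _ rad-c (isR-elim t c) σ eq)) (Rₚ.*-identityˡ 1ᴸ)))
      neg-term : ∀ σ → Seed negPart σ ≈ choose (isS b c σ) (val σ) ⊗ choose (isR t u σ) (val σ)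
      neg-term σ with inSeed T σ in eq
      ... | true = pow-neg (val σ) (view σ) (column C σ eq)
      ... | false = ≈-trans one≈ (≈-sym (≈-trans (Rₚ.*-cong (outside (isS b c) _ side-bc s-elim σ eq) (outside (isR t u) _ rad-a (isR-elim t u) σ eq)) (Rₚ.*-identityˡ 1ᴸ)))

    exchange-rad : d₁ ℕ.+ d₂ ≡ n → val (cl (rad t b)) ⊗ val (cl (rad (opposite t) u)) ≈ val (side u d₁) ⊕ val (side b d₂)
    exchange-rad d≡n = ≈-trans (let (T' , flip) = Flips.flip-rad C d≡n in relation T' (rad (opposite t) u) flip)
      (Rₚ.+-cong (≈-trans (prod-cong (allVar n) pos-term) (product (isS u b) _ ab-true p-elim)) (≈-trans (prod-cong (allVar n) neg-term) (product (isS b c) _ bc-true s-elim)))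
      where
      c≡u : c ≡ u
      c≡u = trans (cong (u ↻_) d≡n) (↻-n u)
      disjoint : ∀ σ → isS u b σ ≡ true → isS b c σ ≡ true → ⊥
      disjoint σ p s = side≢ (trans (sym (p-elim σ p)) (s-elim σ s))
      value : ∀ σ → inSeed T σ ≡ true → bMat T σ (cl (rad t b)) ≡ (ind (isS u b σ) ℤ.- ind (isR t u σ)) ℤ.+ (ind (isR t u σ) ℤ.- ind (isS b c σ))
      value σ h = trans (column C σ h) (cong (λ z → (ind (isS u b σ) ℤ.- ind (isR t u σ)) ℤ.+ (ind (isR t z σ) ℤ.- ind (isS b c σ))) c≡u)
      pos-term : ∀ σ → Seed posPart σ ≈ choose (isS u b σ) (val σ)
      pos-term σ with inSeed T σ in eq
      ... | true = pow-pos′ (val σ) (disjoint σ) (value σ eq)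
      ... | false = ≈-trans one≈ (≈-sym (outside (isS u b) _ side-ab p-elim σ eq))
      neg-term : ∀ σ → Seed negPart σ ≈ choose (isS b c σ) (val σ)
      neg-term σ with inSeed T σ in eq
      ... | true = pow-neg′ (val σ) (disjoint σ) (value σ eq)
      ... | false = ≈-trans one≈ (≈-sym (outside (isS b c) _ side-bc s-elim σ eq))

  relation-arc : ∀ t u d₁ d₂ → 1 ≤ d₁ → 1 ≤ d₂ → d₁ ℕ.+ d₂ < n →
    val (cl (rad t (u ↻ d₁))) ⊗ val (side u (d₁ ℕ.+ d₂)) ≈ val (side u d₁) ⊗ val (cl (rad t (u ↻ (d₁ ℕ.+ d₂)))) ⊕ val (side (u ↻ d₁) d₂) ⊗ val (cl (rad t u))
  relation-arc t u d₁ d₂ p q d<n with side u (d₁ ℕ.+ d₂) | side-view u (d₁ ℕ.+ d₂) (ℕₚ.≤-trans p (ℕₚ.m≤m+n d₁ d₂)) d<n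
  ... | _ | boundary h = ⊥-elim (ℕₚ.<⇒≢ (ℕₚ.+-mono-≤ p q) (sym h))
  ... | _ | chord k h = exchange-arc (proj₂ (corner t u d₁ d₂ p q (ℕₚ.<⇒≤ d<n))) k h

  relation-rad : ∀ t u d₁ d₂ → 1 ≤ d₁ → 1 ≤ d₂ → d₁ ℕ.+ d₂ ≡ n →
    val (cl (rad t (u ↻ d₁))) ⊗ val (cl (rad (opposite t) u)) ≈ val (side u d₁) ⊕ val (side (u ↻ d₁) d₂)
  relation-rad t u d₁ d₂ p q d≡n = exchange-rad (proj₂ (corner t u d₁ d₂ p q (ℕₚ.≤-reflexive d≡n))) d≡n

last-true : ∀ (f : ℕ → Bool) lo m → f lo ≡ true →
  Σ[ b ∈ ℕ ] (lo ≤ b × b ≤ lo ℕ.+ m × f b ≡ true × (∀ r → b < r → r ≤ lo ℕ.+ m → f r ≡ false))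
last-true f lo zero h = lo , ℕₚ.≤-refl , ℕₚ.m≤m+n lo 0 , h , λ r p q → ⊥-elim (ℕₚ.<⇒≱ p (subst (r ≤_) (ℕₚ.+-identityʳ lo) q))
last-true f lo (suc m) h with f (lo ℕ.+ suc m) in eq
... | true = lo ℕ.+ suc m , ℕₚ.m≤m+n lo (suc m) , ℕₚ.≤-refl , eq , λ r p q → ⊥-elim (ℕₚ.<⇒≱ p q)
... | false with last-true f lo m h
...   | b , lo≤b , b≤ , fb , none = b , lo≤b , ℕₚ.≤-trans b≤ (ℕₚ.+-monoʳ-≤ lo (ℕₚ.n≤1+n m)) , fb , go
  where
  go : ∀ r → b < r → r ≤ lo ℕ.+ suc m → f r ≡ false
  go r p q with r ℕₚ.≟ lo ℕ.+ suc m
  ... | yes refl = eq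
  ... | no ne = none r p (ℕ.s≤s⁻¹ (subst (suc r ≤_) (ℕₚ.+-suc lo m) (ℕₚ.≤∧≢⇒< q ne)))

varEq-refl : ∀ {n} (v : Var n) → varEq v v ≡ true
varEq-refl (cl γ) = tarcEq-refl γ
varEq-refl (bd s) = finEq-refl s

varEq-elim : ∀ {n} (v w : Var n) → varEq v w ≡ true → v ≡ w
varEq-elim (cl γ) (cl δ) h = cong cl (tarcEq-elim h)
varEq-elim (bd s) (bd r) h = cong bd (finEq-elim {a = s} {r} h)

ind-false : ∀ {b} → ¬ b ≡ true → ind b ≡ + 0
ind-false h = cong ind (¬true⇒false h)

module _ {n : ℕ} where

  search : ∀ (f : TArc n → Bool) → (∀ x → f x ≡ true) ⊎ Σ[ x ∈ TArc n ] f x ≡ false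
  search f with go (allTArc n)
    where
    go : ∀ xs → (∀ {x} → x ∈ xs → f x ≡ true) ⊎ Σ[ x ∈ TArc n ] f x ≡ false
    go [] = inj₁ λ ()
    go (x ∷ xs) with f x in eq | go xs
    ... | false | _ = inj₂ (x , eq)
    ... | true | inj₂ r = inj₂ r
    ... | true | inj₁ h = inj₁ λ { (here refl) → eq ; (there m) → h m }
  ... | inj₁ h = inj₁ λ x → h (∈-allTArc x)
  ... | inj₂ r = inj₂ r

  Sat-shift : ∀ {X : Exp n → Set} m → Sat X → Sat (λ e → X (e ⊞ m))
  Sat-shift m sat N es u h av = sat N (λ i → es i ⊞ m) (u ⊞ m) h (λ v → Avg-+ (av v) (Avg-const (m v)))

-- Existence of a radius in every tagged triangulation

module Radii {n : ℕ} (3≤n : 3 ≤ n) (T : TaggedTriangulation n) where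
  open Circle 3≤n
  open Arcs 3≤n

  Radius : Set
  Radius = Σ[ t ∈ Tag ] Σ[ a ∈ Fin n ] mem T (rad t a) ≡ true

  -- By maximality `T` contains the plain radius at `i` or something incompatible with it, and the
  -- latter is a radius or an arc that separates `i` from the puncture.
  at-vertex : ∀ i → Radius ⊎ Σ[ j ∈ Fin n ] Σ[ l ∈ Fin (n ∸ 2) ] (mem T (arc j l) ≡ true × vtxInside j l i ≡ true)
  at-vertex i with search (λ y → not (mem T y) ∨ compatible (rad plain i) y)
  ... | inj₁ h = inj₁ (plain , i , maximal T (rad plain i) (λ y m → subst (λ z → not z ∨ compatible (rad plain i) y ≡ true) m (h y)))
  ... | inj₂ (y , h) with mem T y in m
  at-vertex i | inj₂ (rad s v , h) | true = inj₁ (s , v , m)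
  at-vertex i | inj₂ (arc j l , h) | true = inj₂ (j , l , m , not-false h)
    where
    not-false : ∀ {x} → not x ≡ false → x ≡ true
    not-false {true} _ = refl
  at-vertex i | inj₂ (y , ()) | false

  -- Both regions contain the segment that starts at `i`, so they are nested; that of the arc from
  -- `j` contains also the segment before `i`, hence is the larger one.
  longer : ∀ i k j l → compatible (arc i k) (arc j l) ≡ true → vtxInside j l i ≡ true → len k < len l
  longer i k j l h ins with ∧-true {0 <ᵇ dist j i} ins
  ... | 0<p′ , p<l′ with dist j i ℕ.+ len k ℕₚ.≤? n
  ...   | yes lin = ℕₚ.≰⇒> λ l≤k → noncrossing j j l i k (subst (λ z → z ℕ.+ len l ≤ n) (sym (dist-self j)) (ℕₚ.<⇒≤ (len<n l))) lin
            (trans (compatible-sym (arc j l) (arc i k)) h) (subst (_< dist j i) (sym (dist-self j)) 0<p) (subst (λ z → dist j i < z ℕ.+ len l) (sym (dist-self j)) p<l)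
            (subst (λ z → z ℕ.+ len l < dist j i ℕ.+ len k) (sym (dist-self j)) (ℕₚ.≤-<-trans l≤k (ℕₚ.m<n+m (len k) 0<p)))
    where
    0<p : 0 < dist j i
    0<p = <ᵇ-elim {0} 0<p′
    p<l : dist j i < len l
    p<l = <ᵇ-elim p<l′
  ...   | no ¬lin = ⊥-elim (cases (∨-true {allF (λ s → not (segIn i k s) ∨ segIn j l s)} h))
    where
    p = dist j i
    0<p : 0 < p
    0<p = <ᵇ-elim {0} 0<p′
    p<l : p < len l
    p<l = <ᵇ-elim p<l′
    n-1 = n ∸ 1
    suc-n-1 : suc n-1 ≡ n
    suc-n-1 = ℕₚ.m+[n∸m]≡n 0<n
    n-1<n : n-1 < n
    n-1<n = ℕₚ.≤-reflexive suc-n-1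
    z : Fin n
    -- The last segment before `j`. If the arc from `i` runs past `j`, it cuts off this segment, and
    -- the arc from `j` does not.
    z = j ↻ n-1
    at-z : dist j z ≡ n-1
    at-z = dist-↻ j n-1 n-1<n
    z∈i : segIn i k z ≡ true
    z∈i = <ᵇ-intro (ℕₚ.+-cancelˡ-< p _ _ (subst (_< p ℕ.+ len k) (sym (trans (trans (cong (λ x → p ℕ.+ dist x z) (sym (↻-dist j i))) (dist-≤ j p z (subst (p ≤_) (sym at-z) (ℕ.s≤s⁻¹ (subst (suc p ≤_) (sym suc-n-1) (dist<n j i)))))) at-z)) (ℕₚ.<-trans n-1<n (ℕₚ.≰⇒> ¬lin))))
    z∉j : ¬ segIn j l z ≡ true
    z∉j q = ℕₚ.<⇒≱ (subst (_< len l) at-z (<ᵇ-elim q)) (ℕ.s≤s⁻¹ (subst (suc (len l) ≤_) (sym suc-n-1) (len<n l)))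
    y : Fin n
    -- The segment before `i`, cut off by the arc from `j` only; so neither region contains the
    -- other, although they meet.
    y = j ↻ (p ∸ 1)
    p-1<n : p ∸ 1 < n
    p-1<n = ℕₚ.≤-<-trans (ℕₚ.m∸n≤m p 1) (dist<n j i)
    at-y : dist j y ≡ p ∸ 1
    at-y = dist-↻ j _ p-1<n
    suc-p-1 : suc (p ∸ 1) ≡ p
    suc-p-1 = ℕₚ.m+[n∸m]≡n 0<p
    y∈j : segIn j l y ≡ true
    y∈j = <ᵇ-intro (subst (_< len l) (sym at-y) (ℕₚ.≤-<-trans (ℕₚ.m∸n≤m p 1) p<l))
    y∉i : ¬ segIn i k y ≡ true
    y∉i q = ℕₚ.<⇒≱ (<ᵇ-elim q) (subst (len k ≤_) (sym i-y) (ℕ.s≤s⁻¹ (subst (suc (len k) ≤_) (sym suc-n-1) (len<n k))))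
      where
      i-y : dist i y ≡ n-1
      i-y = ℕₚ.+-cancelˡ-≡ p _ _ (trans (trans (cong (λ x → p ℕ.+ dist x y) (sym (↻-dist j i))) (dist-> j p y (dist<n j i) (subst (_< p) (sym at-y) (ℕₚ.≤-reflexive suc-p-1))))
        (trans (cong (n ℕ.+_) at-y) (trans (cong (ℕ._+ (p ∸ 1)) (sym suc-n-1)) (trans (sym (ℕₚ.+-suc n-1 (p ∸ 1))) (trans (cong (n-1 ℕ.+_) suc-p-1) (ℕₚ.+-comm n-1 p))))))
    cases : _ → ⊥
    cases (inj₁ sub) with ∨-true {not (segIn i k z)} (allF-elim sub z)
    ... | inj₁ q = not-true q z∈i
    ... | inj₂ q = z∉j q
    cases (inj₂ h′) with ∨-true {allF (λ s → not (segIn j l s) ∨ segIn i k s)} h′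
    ... | inj₁ sub with ∨-true {not (segIn j l y)} (allF-elim sub y)
    ...   | inj₁ q = not-true q y∈j
    ...   | inj₂ q = y∉i q
    cases (inj₂ h′) | inj₂ disj = not-true (allF-elim disj i) (∧-intro {segIn i k i} (<ᵇ-intro (subst (_< len k) (sym (dist-self i)) (ℕₚ.≤-trans (ℕ.s≤s ℕ.z≤n) (2≤len k)))) (<ᵇ-intro p<l))

  -- As long as no radius is found, the starting point of an arc of `T` is enclosed by a longer arc
  -- of `T`; lengths stay below n, so this ends.
  radius-exists : Radius
  radius-exists with at-vertex (fromℕ< 0<n)
  ... | inj₁ r = r
  ... | inj₂ (j , l , m , _) = go n j l m (ℕₚ.m≤n+m n (len l))
    where
    -- the fuel bounds the number of times the arc can get longer
    go : ∀ fuel i k → mem T (arc i k) ≡ true → n ≤ len k ℕ.+ fuel → Radius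
    go zero i k m h = ⊥-elim (ℕₚ.<⇒≱ (len<n k) (subst (n ≤_) (ℕₚ.+-identityʳ (len k)) h))
    go (suc fuel) i k m h with at-vertex i
    ... | inj₁ r = r
    ... | inj₂ (j , l , m′ , ins) = go fuel j l m′ (ℕₚ.≤-trans h (subst (_≤ len l ℕ.+ fuel) (sym (ℕₚ.+-suc (len k) fuel)) (ℕₚ.+-monoˡ-≤ fuel (longer i k j l (pairwise T (arc i k) (arc j l) m m′) ins))))

-- T seen from a radius at a: position p is the vertex a ↻ p (so that n is a again), and n + 1 is the puncture.
module Based {n : ℕ} (3≤n : 3 ≤ n) (T : TaggedTriangulation n) (F : TArc n → LP n) (expansion : ClusterExpansion T F)
  (t : Tag) (a : Fin n) (a∈T : mem T (rad t a) ≡ true) where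
  open Circle 3≤n
  open Arcs 3≤n
  open Relations 3≤n F (proj₂ expansion)
  module Rₛ = CommutativeSemiring (LP-semiring n)
  open NatSolver (LP-semiring n) using (solve; _:=_; _:*_; _:+_)

  t̄ : Tag
  t̄ = opposite t

  private
    at : Fin n → ℕ
    at = dist a

  -- The value at the chord pq: degenerate, to the puncture, the loop at a, or an arc or boundary segment.
  opaque
    select : ∀ {A : Set} → A → A → A → A → ℕ → ℕ → A
    select x y z w p q with p ℕₚ.≟ q | q ℕₚ.≟ suc n | q ℕₚ.≟ p ℕ.+ n
    ... | yes _ | _ | _ = x
    ... | no _ | yes _ | _ = y
    ... | no _ | no _ | yes _ = z
    ... | no _ | no _ | no _ = w

    select-point : ∀ {A : Set} {x y z w : A} p → select x y z w p p ≡ x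
    select-point p with p ℕₚ.≟ p
    ... | yes _ = refl
    ... | no h = ⊥-elim (h refl)

    select-puncture : ∀ {A : Set} {x y z w : A} p → p ≤ n → select x y z w p (suc n) ≡ y
    select-puncture p p≤n with p ℕₚ.≟ suc n | suc n ℕₚ.≟ suc n
    ... | yes refl | _ = ⊥-elim (ℕₚ.<-irrefl refl p≤n)
    ... | no _ | yes _ = refl
    ... | no _ | no h = ⊥-elim (h refl)

    select-loop : ∀ {A : Set} {x y z w : A} → select x y z w 0 n ≡ z
    select-loop with 0 ℕₚ.≟ n | n ℕₚ.≟ suc n | n ℕₚ.≟ n
    ... | yes h | _ | _ = ⊥-elim (ℕₚ.<⇒≢ 0<n h)
    ... | no _ | yes h | _ = ⊥-elim (ℕₚ.<⇒≢ (ℕₚ.n<1+n n) h)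
    ... | no _ | no _ | yes _ = refl
    ... | no _ | no _ | no h = ⊥-elim (h refl)

    select-regular : ∀ {A : Set} {x y z w : A} p q → Reg n p q → select x y z w p q ≡ w
    select-regular p q (p<q , q≤n , q<p+n) with p ℕₚ.≟ q | q ℕₚ.≟ suc n | q ℕₚ.≟ p ℕ.+ n
    ... | yes h | _ | _ = ⊥-elim (ℕₚ.<⇒≢ p<q h)
    ... | no _ | yes refl | _ = ⊥-elim (ℕₚ.<-irrefl refl q≤n)
    ... | no _ | no _ | yes h = ⊥-elim (ℕₚ.<⇒≢ q<p+n h)
    ... | no _ | no _ | no _ = refl

  data ChordView : ℕ → ℕ → Set where
    puncture : ∀ p → p ≤ n → ChordView p (suc n)
    loop     : ChordView 0 n
    regular  : ∀ {p q} → Reg n p q → ChordView p q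

  chord-view : ∀ p q → p < q → q ≤ suc n → ChordView p q
  chord-view p q p<q q≤ with ℕₚ.m≤n⇒m<n∨m≡n q≤
  ... | inj₂ refl = puncture p (ℕ.s≤s⁻¹ p<q)
  ... | inj₁ q<1+n with q ℕₚ.<? p ℕ.+ n
  ...   | yes h = regular (p<q , ℕ.s≤s⁻¹ q<1+n , h)
  ...   | no h = irregular p (ℕₚ.≮⇒≥ h) (ℕ.s≤s⁻¹ q<1+n)
    where
    irregular : ∀ p → p ℕ.+ n ≤ q → q ≤ n → ChordView p q
    irregular zero h k = subst (ChordView 0) (ℕₚ.≤-antisym h k) loop
    irregular (suc p) h k = ⊥-elim (ℕₚ.<⇒≱ (ℕₚ.m<n+m n (ℕ.s≤s ℕ.z≤n)) (ℕₚ.≤-trans h k))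

  var : ℕ → ℕ → Var n
  var p q = side (a ↻ p) (q ∸ p)

  ι : Var n → Exp n
  ι v w = ind (varEq v w)

  -- With the product of the two radii at `a` as the value of the loop, `relation-rad`, multiplied
  -- by the radius at `a`, becomes the instance of `ptolemy-R` for the chord from 0 to n.
  Λ : ℕ → ℕ → LP n
  Λ p q = select 0ᴸ (val (cl (rad t (a ↻ p)))) (val (cl (rad t a)) ⊗ val (cl (rad t̄ a))) (val (var p q)) p q

  ℓ : ℕ → ℕ → Exp n
  ℓ p q = select 0ᵉ (ι (cl (rad t (a ↻ p)))) (ι (cl (rad t a)) ⊞ ι (cl (rad t̄ a))) (ι (var p q)) p q

  -- The chords of the triangulation after the cut. The loop is one of them exactly if `T` contains
  -- both radii at `a`, the case of a self-folded triangle.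
  E : ℕ → ℕ → Bool
  E p q = select false (mem T (rad t (a ↻ p))) (mem T (rad t̄ a)) (inSeed T (var p q)) p q

  Reg-bounds : ∀ {p q} → Reg n p q → p < n × 1 ≤ q ∸ p × q ∸ p < n
  Reg-bounds {p} {q} (p<q , q≤n , q<p+n) = ℕₚ.<-≤-trans p<q q≤n , ℕₚ.m<n⇒0<n∸m p<q , ℕₚ.+-cancelˡ-< p _ _ (subst (_< p ℕ.+ n) (sym (ℕₚ.m+[n∸m]≡n (ℕₚ.<⇒≤ p<q))) q<p+n)

  var-view : ∀ {p q} → Reg n p q → SideView (a ↻ p) (q ∸ p) (var p q)
  var-view {p} {q} reg = let (_ , x , y) = Reg-bounds reg in side-view (a ↻ p) (q ∸ p) x y

  side-not-radius : ∀ {u d σ} s v → SideView u d σ → varEq (cl (rad s v)) σ ≡ true → ⊥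
  side-not-radius s v (boundary _) ()
  side-not-radius s v (chord _ _) ()

  side-injective : ∀ {u d σ u′ d′ σ′} → SideView u d σ → SideView u′ d′ σ′ → σ ≡ σ′ → u ≡ u′ × d ≡ d′
  side-injective (boundary p) (boundary q) refl = refl , trans p (sym q)
  side-injective (chord _ p) (chord _ q) refl = refl , trans (sym p) q
  side-injective (boundary _) (chord _ _) ()
  side-injective (chord _ _) (boundary _) ()

  ℓ-self : ∀ p q → Reg n p q → ℓ p q (var p q) ≡ + 1
  ℓ-self p q reg = trans (cong (λ e → e (var p q)) (select-regular {z = ι (cl (rad t a)) ⊞ ι (cl (rad t̄ a))} p q reg)) (cong ind (varEq-refl (var p q)))

  ℓ-other : ∀ p q → Reg n p q → ∀ p' q' → p' < q' → q' ≤ suc n → ¬ (p' ≡ p × q' ≡ q) → ℓ p' q' (var p q) ≡ + 0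
  ℓ-other p q reg p' q' p'<q' q'≤ ne with chord-view p' q' p'<q' q'≤
  ... | puncture _ p'≤n = trans (cong (λ e → e (var p q)) (select-puncture {x = 0ᵉ} p' p'≤n)) (ind-false (side-not-radius t _ (var-view reg)))
  ... | loop = trans (cong (λ e → e (var p q)) (select-loop {x = 0ᵉ})) (cong₂ ℤ._+_ (ind-false (side-not-radius t a (var-view reg))) (ind-false (side-not-radius t̄ a (var-view reg))))
  ... | regular reg' = trans (cong (λ e → e (var p q)) (select-regular {x = 0ᵉ} p' q' reg')) (ind-false λ h →
      let (i , j) = side-injective (var-view reg') (var-view reg) (varEq-elim (var p' q') (var p q) h)
          p'≡p = ↻-injective a p' p (proj₁ (Reg-bounds reg')) (proj₁ (Reg-bounds reg)) i
      in ne (p'≡p , trans (sym (ℕₚ.m+[n∸m]≡n (ℕₚ.<⇒≤ p'<q'))) (trans (cong₂ ℕ._+_ p'≡p j) (ℕₚ.m+[n∸m]≡n (ℕₚ.<⇒≤ (proj₁ reg))))))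

  Λ-refl : ∀ p → Λ p p ≈ 0ᴸ
  Λ-refl p = subst (_≈ 0ᴸ) (sym (select-point {x = 0ᴸ} p)) ≈-refl

  Λ-R : ∀ p → p ≤ n → Λ p (suc n) ≡ val (cl (rad t (a ↻ p)))
  Λ-R p p≤n = select-puncture {x = 0ᴸ} p p≤n

  Λ-loop : Λ 0 n ≡ val (cl (rad t a)) ⊗ val (cl (rad t̄ a))
  Λ-loop = select-loop {x = 0ᴸ}

  Λ-regular : ∀ p q → Reg n p q → Λ p q ≡ val (var p q)
  Λ-regular p q reg = select-regular {x = 0ᴸ} p q reg

  val-label : ∀ σ → inSeed T σ ≡ true → val σ ≈ 𝕩 (ι σ)
  val-label (cl γ) h = subst (F γ ≈_) (sym (𝕩-def (ι (cl γ)))) (mk≈ (proj₁ expansion γ h))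
  val-label (bd s) h = subst (varL (bd s) ≈_) (sym (𝕩-def (ι (bd s)))) ≈-refl

  E-label : ∀ p q → p < q → q ≤ suc n → E p q ≡ true → Λ p q ≈ 𝕩 (ℓ p q)
  E-label p q p<q q≤ h with chord-view p q p<q q≤
  ... | puncture _ p≤n = subst₂ (λ x y → x ≈ 𝕩 y) (sym (Λ-R p p≤n)) (sym (select-puncture {x = 0ᵉ} p p≤n)) (val-label _ (trans (sym (select-puncture {x = false} p p≤n)) h))
  ... | loop = subst₂ (λ x y → x ≈ 𝕩 y) (sym Λ-loop) (sym (select-loop {x = 0ᵉ})) (≈-trans (Rₛ.*-cong (val-label (cl (rad t a)) a∈T) (val-label (cl (rad t̄ a)) (trans (sym (select-loop {x = false})) h))) (𝕩-⊗ _ _))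
  ... | regular reg = subst₂ (λ x y → x ≈ 𝕩 y) (sym (Λ-regular p q reg)) (sym (select-regular {x = 0ᵉ} p q reg)) (val-label (var p q) (trans (sym (select-regular {x = false} p q reg)) h))

  ptolemy-R : ∀ p b c → p < b → b < c → c ≤ n → Λ b (suc n) ⊗ Λ p c ≈ Λ p b ⊗ Λ c (suc n) ⊕ Λ b c ⊗ Λ p (suc n)
  ptolemy-R p b c p<b b<c c≤n with chord-view p c (ℕₚ.<-trans p<b b<c) (ℕₚ.m≤n⇒m≤1+n c≤n)
  ... | puncture _ _ = ⊥-elim (ℕₚ.<-irrefl refl c≤n)
  ... | regular reg = subst₂ _≈_ (sym (cong₂ _⊗_ (trans (Λ-R b b≤n) (cong (λ z → val (cl (rad t z))) (sym at-b))) (trans (Λ-regular p c reg) (cong (λ d → val (side (a ↻ p) d)) (sym d₁+d₂)))))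
      (sym (cong₂ _⊕_ (cong₂ _⊗_ (Λ-regular p b reg₁) (trans (Λ-R c c≤n) (cong (λ z → val (cl (rad t z))) (sym at-c))))
        (cong₂ _⊗_ (trans (Λ-regular b c reg₂) (cong (λ z → val (side z d₂)) (sym at-b))) (Λ-R p p≤n))))
      (relation-arc t (a ↻ p) d₁ d₂ (ℕₚ.m<n⇒0<n∸m p<b) (ℕₚ.m<n⇒0<n∸m b<c) (subst (_< n) (sym d₁+d₂) (proj₂ (proj₂ (Reg-bounds reg)))))
    where
    b≤n = ℕₚ.≤-trans (ℕₚ.<⇒≤ b<c) c≤n
    p≤n = ℕₚ.≤-trans (ℕₚ.<⇒≤ p<b) b≤n
    d₁ = b ∸ p
    d₂ = c ∸ b
    p+d₁ : p ℕ.+ d₁ ≡ b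
    p+d₁ = ℕₚ.m+[n∸m]≡n (ℕₚ.<⇒≤ p<b)
    p+d : p ℕ.+ (d₁ ℕ.+ d₂) ≡ c
    p+d = trans (sym (ℕₚ.+-assoc p d₁ d₂)) (trans (cong (ℕ._+ d₂) p+d₁) (ℕₚ.m+[n∸m]≡n (ℕₚ.<⇒≤ b<c)))
    d₁+d₂ : d₁ ℕ.+ d₂ ≡ c ∸ p
    d₁+d₂ = ℕₚ.+-cancelˡ-≡ p _ _ (trans p+d (sym (ℕₚ.m+[n∸m]≡n (ℕₚ.<⇒≤ (ℕₚ.<-trans p<b b<c)))))
    at-b : (a ↻ p) ↻ d₁ ≡ a ↻ b
    at-b = trans (↻-↻ a p d₁) (cong (a ↻_) p+d₁)
    at-c : (a ↻ p) ↻ (d₁ ℕ.+ d₂) ≡ a ↻ c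
    at-c = trans (↻-↻ a p _) (cong (a ↻_) p+d)
    reg₁ : Reg n p b
    reg₁ = p<b , b≤n , ℕₚ.<-trans b<c (proj₂ (proj₂ reg))
    reg₂ : Reg n b c
    reg₂ = b<c , c≤n , ℕₚ.<-trans (proj₂ (proj₂ reg)) (ℕₚ.+-monoˡ-< n p<b)
  ... | loop = subst₂ _≈_ (sym (cong₂ _⊗_ (Λ-R b b≤n) Λ-loop))
      (sym (cong₂ _⊕_ (cong₂ _⊗_ (trans (Λ-regular 0 b reg₁) (cong (λ z → val (side z b)) (↻-0 a))) (trans (Λ-R n ℕₚ.≤-refl) (cong (λ z → val (cl (rad t z))) (↻-n a))))
        (cong₂ _⊗_ (Λ-regular b n reg₂) (trans (Λ-R 0 ℕ.z≤n) (cong (λ z → val (cl (rad t z))) (↻-0 a))))))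
      (≈-trans (solve 3 (λ x y z → x :* (y :* z) := (x :* z) :* y) ≈-refl (val (cl (rad t (a ↻ b)))) (val (cl (rad t a))) (val (cl (rad t̄ a))))
      (≈-trans (Rₛ.*-congʳ (relation-rad t a b (n ∸ b) p<b (ℕₚ.m<n⇒0<n∸m b<c) (ℕₚ.m+[n∸m]≡n b≤n))) (Rₛ.distribʳ _ _ _)))
    where
    b≤n = ℕₚ.<⇒≤ b<c
    reg₁ : Reg n 0 b
    reg₁ = p<b , b≤n , b<c
    reg₂ : Reg n b n
    reg₂ = b<c , ℕₚ.≤-refl , ℕₚ.m<n+m n p<b

  at-↻ : ∀ p → p < n → at (a ↻ p) ≡ p
  at-↻ = dist-↻ a

  regular-chord : ∀ {p q} → Reg n p q → suc p < q → E p q ≡ true → Σ[ k ∈ Fin (n ∸ 2) ] (mem T (arc (a ↻ p) k) ≡ true × at (a ↻ p) ≡ p × p ℕ.+ len k ≡ q)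
  regular-chord {p} {q} reg sp<q h = go (var p q) (var-view reg) (trans (sym (select-regular {x = false} p q reg)) h)
    where
    go : ∀ σ → SideView (a ↻ p) (q ∸ p) σ → inSeed T σ ≡ true → Σ[ k ∈ Fin (n ∸ 2) ] (mem T (arc (a ↻ p) k) ≡ true × at (a ↻ p) ≡ p × p ℕ.+ len k ≡ q)
    go _ (boundary d≡1) _ = ⊥-elim (ℕₚ.<⇒≢ sp<q (trans (ℕₚ.+-comm 1 p) (trans (cong (p ℕ.+_) (sym d≡1)) (ℕₚ.m+[n∸m]≡n (ℕₚ.<⇒≤ (proj₁ reg))))))
    go _ (chord k len≡) m = k , m , at-↻ p (proj₁ (Reg-bounds reg)) , trans (cong (p ℕ.+_) len≡) (ℕₚ.m+[n∸m]≡n (ℕₚ.<⇒≤ (proj₁ reg)))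

  arc-linear : ∀ i k → mem T (arc i k) ≡ true → at i ℕ.+ len k ≤ n
  arc-linear i k m = linear a i k t (pairwise T (arc i k) (rad t a) m a∈T)

  arc-E : ∀ i k → mem T (arc i k) ≡ true → at i < at i ℕ.+ len k × at i ℕ.+ len k ≤ suc n × E (at i) (at i ℕ.+ len k) ≡ true
  arc-E i k m = i<e , ℕₚ.m≤n⇒m≤1+n (arc-linear i k m) , trans (select-regular {x = false} _ _ reg) (trans (cong (inSeed T) (trans (cong₂ side (↻-dist a i) (ℕₚ.m+n∸m≡n (at i) (len k))) (side-arc i k))) m)
    where
    i<e : at i < at i ℕ.+ len k
    i<e = ℕₚ.m<m+n (at i) (ℕₚ.≤-trans (ℕ.s≤s ℕ.z≤n) (2≤len k))
    reg : Reg n (at i) (at i ℕ.+ len k)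
    reg = i<e , arc-linear i k m , ℕₚ.+-monoʳ-< (at i) (len<n k)

  rad-E : ∀ v → mem T (rad t v) ≡ true → E (at v) (suc n) ≡ true
  rad-E v m = trans (select-puncture {x = false} (at v) (ℕₚ.<⇒≤ (dist<n a v))) (trans (cong (λ z → mem T (rad t z)) (↻-dist a v)) m)

  other-tag : ∀ s v → s ≢ t → mem T (rad s v) ≡ true → s ≡ t̄ × v ≡ a
  other-tag s v s≢t m with ∨-true {tagEq s t} (pairwise T (rad s v) (rad t a) m a∈T)
  ... | inj₁ p = ⊥-elim (s≢t (tagEq-elim p))
  ... | inj₂ q = ≢⇒opposite s≢t , finEq-elim {a = v} {a} q

  tag-cases : ∀ s → s ≡ t ⊎ s ≢ t
  tag-cases s with tagEq s t in eq
  ... | true = inj₁ (tagEq-elim eq)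
  ... | false = inj₂ λ { refl → true≢false (trans (sym (tagEq-refl s)) eq) }

  E-noncrossing : ∀ p q r s → s ≤ suc n → E p q ≡ true → E r s ≡ true → p < r → r < q → q < s → ⊥
  E-noncrossing p q r s s≤ e f p<r r<q q<s with chord-view p q (ℕₚ.<-trans p<r r<q) (ℕₚ.≤-trans (ℕₚ.<⇒≤ q<s) s≤)
  ... | puncture _ _ = ℕₚ.<⇒≱ q<s s≤
  ... | loop with ℕₚ.≤-antisym s≤ q<s
  ...   | refl = ℕₚ.<⇒≢ p<r (trans (sym (dist-self a)) (trans (cong at (sym v≡a)) (at-↻ r r<q)))
    where
    v≡a : a ↻ r ≡ a
    v≡a with ∨-true {tagEq t t̄} (pairwise T (rad t (a ↻ r)) (rad t̄ a) (trans (sym (select-puncture {x = false} r (ℕₚ.<⇒≤ r<q))) f) (trans (sym (select-loop {x = false})) e))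
    ... | inj₁ h = ⊥-elim (opposite-≢ t (sym (tagEq-elim h)))
    ... | inj₂ h = finEq-elim {a = a ↻ r} {a} h
  E-noncrossing p q r s s≤ e f p<r r<q q<s | regular reg with regular-chord reg (ℕₚ.≤-<-trans p<r r<q) e | chord-view r s (ℕₚ.<-trans r<q q<s) s≤
  ... | k , m , at-p , e≡ | puncture _ r≤n = rad-compatible-elim a (a ↻ p) k t (a ↻ r)
      (pairwise T (arc (a ↻ p) k) (rad t (a ↻ r)) m (trans (sym (select-puncture {x = false} r r≤n)) f))
      (subst₂ (λ x y → x < y × y < x ℕ.+ len k) (sym at-p) (sym (at-↻ r (ℕₚ.<-≤-trans r<q (proj₁ (proj₂ reg))))) (p<r , subst (r <_) (sym e≡) r<q))
  ... | k , m , at-p , e≡ | loop = ℕₚ.<⇒≱ p<r ℕ.z≤n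
  ... | k , m , at-p , e≡ | regular reg' with regular-chord reg' (ℕₚ.≤-<-trans r<q q<s) f
  ...   | l , m' , at-r , f≡ = noncrossing a (a ↻ p) k (a ↻ r) l (arc-linear (a ↻ p) k m) (arc-linear (a ↻ r) l m') (pairwise T (arc (a ↻ p) k) (arc (a ↻ r) l) m m')
      (subst₂ _<_ (sym at-p) (sym at-r) p<r)
      (subst₂ (λ x y → x < y ℕ.+ len k) (sym at-r) (sym at-p) (subst (r <_) (sym e≡) r<q))
      (subst₂ (λ x y → x ℕ.+ len k < y ℕ.+ len l) (sym at-p) (sym at-r) (subst₂ _<_ (sym e≡) (sym f≡) q<s))

  -- With `E-noncrossing` this makes `E` a triangulation of the polygon. Reading the radius of tag
  -- `t̄` at `a` as the loop is consistent: its ends interleave with those of the radii of tag `t`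
  -- at other vertices, and these are the radii of tag `t` with which it is incompatible.
  E-maximal : ∀ p q → p < q → q ≤ suc n →
    (∀ r s → r < s → s ≤ suc n → E r s ≡ true → ¬ (p < r × r < q × q < s) × ¬ (r < p × p < s × s < q)) → E p q ≡ true
  E-maximal p q p<q q≤ nc with chord-view p q p<q q≤
  ... | puncture _ p≤n = trans (select-puncture {x = false} p p≤n) (maximal T (rad t (a ↻ p)) compat)
    where
    compat : ∀ y → mem T y ≡ true → compatible (rad t (a ↻ p)) y ≡ true
    compat (rad s v) m with tag-cases s
    ... | inj₁ refl = ∨-introˡ (tagEq-refl t)
    ... | inj₂ s≢t with other-tag s v s≢t m
    ...   | refl , refl = ∨-introʳ (tagEq t t̄) (subst (λ z → finEq z a ≡ true) (sym p≡a) (finEq-refl a))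
      where
      p≡a : a ↻ p ≡ a
      p≡a with ℕₚ.m≤n⇒m<n∨m≡n p≤n | ℕₚ.m≤n⇒m<n∨m≡n (ℕ.z≤n {p})
      ... | inj₂ refl | _ = ↻-n a
      ... | _ | inj₂ refl = ↻-0 a
      ... | inj₁ p<n | inj₁ 0<p = ⊥-elim (proj₂ (nc 0 n 0<n (ℕₚ.n≤1+n n) (trans (select-loop {x = false}) m)) (0<p , p<n , ℕₚ.n<1+n n))
    compat (arc i k) m = rad-compatible a i k t (a ↻ p) (arc-linear i k m) not-inside
      where
      not-inside : ¬ (at i < at (a ↻ p) × at (a ↻ p) < at i ℕ.+ len k)
      not-inside (x , y) with ℕₚ.m≤n⇒m<n∨m≡n p≤n
      ... | inj₂ refl = ℕₚ.<⇒≱ x (subst (_≤ at i) (sym (trans (cong at (↻-n a)) (dist-self a))) ℕ.z≤n)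
      ... | inj₁ p<n = let (i<e , e≤ , e) = arc-E i k m in proj₂ (nc _ _ i<e e≤ e) (subst (at i <_) (at-↻ p p<n) x , subst (_< at i ℕ.+ len k) (at-↻ p p<n) y , ℕ.s≤s (arc-linear i k m))
  ... | loop = trans (select-loop {x = false}) (maximal T (rad t̄ a) compat)
    where
    compat : ∀ y → mem T y ≡ true → compatible (rad t̄ a) y ≡ true
    compat (arc i k) m = pairwise T (rad t a) (arc i k) a∈T m
    compat (rad s v) m with tag-cases s
    ... | inj₂ s≢t with other-tag s v s≢t m
    ...   | refl , _ = ∨-introˡ (tagEq-refl t̄)
    compat (rad s v) m | inj₁ refl with ℕₚ.m≤n⇒m<n∨m≡n (ℕ.z≤n {at v})
    ... | inj₂ 0≡ = ∨-introʳ (tagEq t̄ t) (subst (λ z → finEq a z ≡ true) (dist≡0 {a} {v} (sym 0≡)) (finEq-refl a))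
    ... | inj₁ 0< = ⊥-elim (proj₁ (nc (at v) (suc n) (ℕₚ.m≤n⇒m≤1+n (dist<n a v)) ℕₚ.≤-refl (rad-E v m)) (0< , dist<n a v , ℕₚ.n<1+n n))
  ... | regular reg = trans (select-regular {x = false} p q reg) (go (var p q) (var-view reg))
    where
    go : ∀ σ → SideView (a ↻ p) (q ∸ p) σ → inSeed T σ ≡ true
    go _ (boundary _) = refl
    go _ (chord k len≡) = maximal T (arc (a ↻ p) k) compat
      where
      at-p : at (a ↻ p) ≡ p
      at-p = at-↻ p (proj₁ (Reg-bounds reg))
      e≡ : at (a ↻ p) ℕ.+ len k ≡ q
      e≡ = trans (cong₂ ℕ._+_ at-p len≡) (ℕₚ.m+[n∸m]≡n (ℕₚ.<⇒≤ p<q))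
      lin : at (a ↻ p) ℕ.+ len k ≤ n
      lin = subst (_≤ n) (sym e≡) (proj₁ (proj₂ reg))
      compat : ∀ y → mem T y ≡ true → compatible (arc (a ↻ p) k) y ≡ true
      compat (rad s v) m = rad-compatible a (a ↻ p) k s v lin λ (x , y) → not-inside (subst (_< at v) at-p x) (subst (at v <_) e≡ y) (tag-cases s)
        where
        not-inside : p < at v → at v < q → s ≡ t ⊎ s ≢ t → ⊥
        not-inside x y (inj₁ refl) = proj₁ (nc (at v) (suc n) (ℕₚ.m≤n⇒m≤1+n (dist<n a v)) ℕₚ.≤-refl (rad-E v m)) (x , y , ℕ.s≤s (proj₁ (proj₂ reg)))
        not-inside x y (inj₂ s≢t) with other-tag s v s≢t m
        ... | _ , refl = ℕₚ.<⇒≱ x (subst (_≤ p) (sym (dist-self a)) ℕ.z≤n)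
      compat (arc j l) m = compatible-intro a (a ↻ p) k j l lin (arc-linear j l m) (subst₂ Cases (sym at-p) (sym e≡) cases)
        where
        r s : ℕ
        r = at j
        s = at j ℕ.+ len l
        Cases : ℕ → ℕ → Set
        Cases p q = (r ≤ p × q ≤ s) ⊎ (p ≤ r × s ≤ q) ⊎ q ≤ r ⊎ s ≤ p
        no-cross : ¬ (p < r × r < q × q < s) × ¬ (r < p × p < s × s < q)
        no-cross = let (x , y , z) = arc-E j l m in nc r s x y z
        cases : Cases p q
        cases with q ℕₚ.≤? r | s ℕₚ.≤? p
        ... | yes h | _ = inj₂ (inj₂ (inj₁ h))
        ... | no _ | yes h = inj₂ (inj₂ (inj₂ h))
        ... | no q≰r | no s≰p with ℕₚ.<-cmp p r
        ...   | tri< p<r _ _ = inj₂ (inj₁ (ℕₚ.<⇒≤ p<r , ℕₚ.≮⇒≥ λ h → proj₁ no-cross (p<r , ℕₚ.≰⇒> q≰r , h)))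
        ...   | tri> _ _ r<p = inj₁ (ℕₚ.<⇒≤ r<p , ℕₚ.≮⇒≥ λ h → proj₂ no-cross (r<p , ℕₚ.≰⇒> s≰p , h))
        ...   | tri≈ _ refl _ with ℕₚ.≤-total q s
        ...     | inj₁ h = inj₁ (ℕₚ.≤-refl , h)
        ...     | inj₂ h = inj₂ (inj₁ (ℕₚ.≤-refl , h))

  E-edge : ∀ p → suc p ≤ n → E p (suc p) ≡ true
  E-edge p p<n = trans (select-regular {x = false} p (suc p) (ℕₚ.n<1+n p , p<n , subst (_< p ℕ.+ n) (ℕₚ.+-comm p 1) (ℕₚ.+-monoʳ-< p (ℕₚ.≤-trans (ℕ.s≤s (ℕ.s≤s ℕ.z≤n)) 3≤n))))
    (cong (λ d → inSeed T (side (a ↻ p) d)) (ℕₚ.m+n∸n≡m 1 p))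

  -- The apex of the triangle on pq is the last vertex before q joined to p.
  E-apex : ∀ p q → suc p < q → q ≤ suc n → E p q ≡ true → Σ[ b ∈ ℕ ] (p < b × b < q × E p b ≡ true × E b q ≡ true)
  -- The search runs from p + 1, which is joined to p by a boundary segment, up to q - 1.
  E-apex p q sp<q q≤ e with last-true (E p) (suc p) (q ∸ suc (suc p)) (E-edge p (ℕ.s≤s⁻¹ (ℕₚ.≤-trans sp<q q≤)))
  ... | b , p<b , b≤ , pb , none = b , p<b , b<q , pb , E-maximal b q b<q q≤ λ r s r<s s≤ rs →
      (λ (b<r , r<q , q<s) → E-noncrossing p q r s s≤ e rs (ℕₚ.<-trans p<b b<r) r<q q<s) ,
      (λ (r<b , b<s , s<q) → left r s s≤ rs r<b b<s s<q (ℕₚ.<-cmp r p))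
    where
    end : suc (suc p ℕ.+ (q ∸ suc (suc p))) ≡ q
    end = ℕₚ.m+[n∸m]≡n sp<q
    b<q : b < q
    b<q = subst (suc b ≤_) end (ℕ.s≤s b≤)
    left : ∀ r s → s ≤ suc n → E r s ≡ true → r < b → b < s → s < q → _ → ⊥
    left r s s≤ rs r<b b<s s<q (tri< r<p _ _) = E-noncrossing r s p q q≤ rs e r<p (ℕₚ.<-trans p<b b<s) s<q
    left r s s≤ rs r<b b<s s<q (tri≈ _ refl _) = true≢false (trans (sym rs) (none s b<s (ℕ.s≤s⁻¹ (subst (suc s ≤_) (sym end) s<q))))
    left r s s≤ rs r<b b<s s<q (tri> _ _ p<r) = E-noncrossing p b r s s≤ pb rs p<r r<b b<s

  open Expansion ℓ var ℓ-self ℓ-other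
  open Ptolemy ℓ var ℓ-self ℓ-other Λ Λ-refl ptolemy-R

  opaque
    triangulate : ∀ fuel p q → q ≤ p ℕ.+ fuel → p < q → q ≤ suc n → E p q ≡ true → Σ[ τ ∈ Tree p q ] Labelled τ
    triangulate zero p q h p<q = ⊥-elim (ℕₚ.<⇒≱ p<q (subst (q ≤_) (ℕₚ.+-identityʳ p) h))
    triangulate (suc fuel) p q h p<q q≤ e with ℕₚ.m≤n⇒m<n∨m≡n p<q
    ... | inj₂ refl = leaf , E-label p q p<q q≤ e
    ... | inj₁ sp<q with E-apex p q sp<q q≤ e
    ...   | b , p<b , b<q , pb , bq =
      let (l , hl) = triangulate fuel p b (ℕ.s≤s⁻¹ (subst (suc b ≤_) (ℕₚ.+-suc p fuel) (ℕₚ.≤-trans b<q h))) p<b (ℕₚ.≤-trans (ℕₚ.<⇒≤ b<q) q≤) pb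
          (r , hr) = triangulate fuel b q (ℕₚ.≤-trans h (subst (_≤ b ℕ.+ fuel) (sym (ℕₚ.+-suc p fuel)) (ℕₚ.+-monoˡ-≤ fuel p<b))) b<q q≤ bq
      in node l r , E-label p q p<q q≤ e , hl , hr

  root-E : E 0 (suc n) ≡ true
  root-E = trans (select-puncture {x = false} 0 ℕ.z≤n) (trans (cong (λ z → mem T (rad t z)) (↻-0 a)) a∈T)

  opaque
    root : Σ[ q ∈ ℕ ] Σ[ t₁ ∈ Tree 0 q ] Σ[ t₂ ∈ Tree q (suc n) ] (Labelled t₁ × Labelled t₂ × E q (suc n) ≡ true)
    root with E-apex 0 (suc n) (ℕ.s≤s 0<n) ℕₚ.≤-refl root-E
    ... | q , 0<q , q<1+n , e , f =
      let (t₁ , h₁) = triangulate q 0 q ℕₚ.≤-refl 0<q (ℕₚ.<⇒≤ q<1+n) e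
          (t₂ , h₂) = triangulate (suc n) q (suc n) (ℕₚ.m≤n+m (suc n) q) q<1+n ℕₚ.≤-refl f
      in q , t₁ , t₂ , h₁ , h₂ , f

  q : ℕ
  q = proj₁ root
  t₁ : Tree 0 q
  t₁ = proj₁ (proj₂ root)
  t₂ : Tree q (suc n)
  t₂ = proj₁ (proj₂ (proj₂ root))
  h₁ : Labelled t₁
  h₁ = proj₁ (proj₂ (proj₂ (proj₂ root)))
  h₂ : Labelled t₂
  h₂ = proj₁ (proj₂ (proj₂ (proj₂ (proj₂ root))))

  q≤n : q ≤ n
  q≤n = ℕ.s≤s⁻¹ (Tree-< t₂)

  R0 : Λ 0 (suc n) ≈ 𝕩 (ℓ 0 (suc n))
  R0 = E-label 0 (suc n) (ℕ.s≤s ℕ.z≤n) ℕₚ.≤-refl root-E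

  whole : Labelled (node t₁ t₂)
  whole = R0 , h₁ , h₂

  pos-R : ∀ v → v ≤ n → Pos (R v)
  pos-R v v≤n = Positive⇒Pos (Positive-R (node t₁ t₂) whole refl v ℕ.z≤n v≤n)

  chord-saturated : ∀ p r → p < r → r ≤ suc n → Σ[ X ∈ (Exp n → Set) ] (Rep (Λ p r) X × Sat X)
  chord-saturated p r p<r r≤ = let (loc , h , k) = locate2 (node t₁ t₂) p r ℕ.z≤n p<r r≤ in
    𝒳 loc , subst₂ (λ x y → Rep (Λ x y) (𝒳 loc)) h k (Rep-Λ pos-R loc whole ℕₚ.≤-refl) , 𝒳-sat loc ℕₚ.≤-refl

  opaque
    -- For q = n there is no chord from q to n, and the value `Λ n n` is 0, so the empty set is the
    -- right one. Otherwise the chord lies in the polygon of `t₂`, which has no regular chord ending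
    -- at or before q.
    rest : Σ[ G ∈ (Exp n → Set) ] (Rep (Λ q n) G × Sat G × (∀ {g} → G g → ∀ p p' → Reg n p p' → p' ≤ q → g (var p p') ≡ + 0) × (q ≡ n → ∀ {g} → ¬ G g))
    rest with ℕₚ.m≤n⇒m<n∨m≡n q≤n
    ... | inj₂ q≡n = (λ _ → ⊥) , Rep-≈ (subst (λ z → Λ q z ≈ 0ᴸ) q≡n (Λ-refl q)) Rep-0ᴸ , (λ N es u h av → h Fz) , (λ ()) , (λ _ ())
    ... | inj₁ q<n = let (loc , h , k) = locate2 t₂ q n ℕₚ.≤-refl q<n (ℕₚ.n≤1+n n) in
      𝒳 loc , subst₂ (λ x y → Rep (Λ x y) (𝒳 loc)) h k (Rep-Λ pos-R loc h₂ ℕₚ.≤-refl) , 𝒳-sat loc ℕₚ.≤-refl ,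
      (λ x p p' reg p'≤q → 𝒳-supported loc ℕₚ.≤-refl x p p' reg (λ (q≤p , _) → ℕₚ.<⇒≱ (proj₁ reg) (ℕₚ.≤-trans p'≤q q≤p))) ,
      (λ q≡n → ⊥-elim (ℕₚ.<⇒≢ q<n q≡n))

  G : Exp n → Set
  G = proj₁ rest
  repG : Rep (Λ q n) G
  repG = proj₁ (proj₂ rest)

  Rn : R n ≈ R 0
  Rn = subst₂ _≈_ (sym (trans (Λ-R n ℕₚ.≤-refl) (cong (λ z → val (cl (rad t z))) (↻-n a)))) (sym (trans (Λ-R 0 ℕ.z≤n) (cong (λ z → val (cl (rad t z))) (↻-0 a)))) ≈-refl

  module Punctured = AroundPuncture pos-R t₁ h₁ q≤n R0 (label t₂ h₂) Rn G repG

  inner₁ : Inner 0 q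
  inner₁ = ℕₚ.m≤n⇒m≤1+n q≤n , inj₂ q≤n

  around-saturated : ∀ k 𝒢 𝒜 → Averages 0 q 𝒢 → Averages 0 q 𝒜 → Supported 0 q 𝒢 → Supported 0 q 𝒜 → (∀ {z ρ e} → 𝒢 z ρ e → 𝒜 z ρ e) →
    Sat (Around.𝒲 q (Tree-< t₁) q≤n k 𝒢 𝒜 G)
  around-saturated k 𝒢 𝒜 a₁ a₂ s₁ s₂ sub = Around.Around-Sat q (Tree-< t₁) q≤n k 𝒢 𝒜 G a₁ a₂ s₁ s₂ (proj₁ (proj₂ (proj₂ rest))) (proj₁ (proj₂ (proj₂ (proj₂ rest)))) (proj₂ (proj₂ (proj₂ (proj₂ rest)))) sub

  -- The relation used comes from a corner based at v, in which the radius at `a` is flipped; hence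
  -- `R 0`, a monomial, stands on the left.
  notched-saturated : ∀ v → 0 < v → v < q → Saturated (F (rad t̄ (a ↻ v)))
  notched-saturated v 0<v v<q with locate t₁ v ℕ.z≤n (ℕₚ.<⇒≤ v<q)
  ... | x , refl = Sat⇒Saturated (Punctured.Rep-notched x (F (rad t̄ (a ↻ v))) relation₀)
      (around-saturated (+ 1) (Z x) (Z x) (Z-averages x inner₁) (Z-averages x inner₁) (Z-supported x (proj₁ inner₁)) (Z-supported x (proj₁ inner₁)) (λ z → z))
    where
    v<n : v < n
    v<n = ℕₚ.<-≤-trans v<q q≤n
    turn : (a ↻ v) ↻ (n ∸ v) ≡ a
    turn = trans (↻-↻ a v (n ∸ v)) (trans (cong (a ↻_) (ℕₚ.m+[n∸m]≡n (ℕₚ.<⇒≤ v<n))) (↻-n a))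
    relation₀ : R 0 ⊗ F (rad t̄ (a ↻ v)) ≈ Λ v n ⊕ Λ 0 v
    relation₀ = subst₂ _≈_ (cong (_⊗ F (rad t̄ (a ↻ v))) (trans (cong (λ z → val (cl (rad t z))) (trans turn (sym (↻-0 a)))) (sym (Λ-R 0 ℕ.z≤n))))
      (cong₂ _⊕_ (sym (Λ-regular v n (v<n , ℕₚ.≤-refl , ℕₚ.m<n+m n 0<v))) (trans (cong (λ z → val (side z v)) (trans turn (sym (↻-0 a)))) (sym (Λ-regular 0 v (0<v , ℕₚ.<⇒≤ v<n , v<n)))))
      (relation-rad t (a ↻ v) (n ∸ v) v (ℕₚ.m<n⇒0<n∸m v<n) 0<v (ℕₚ.m∸n+n≡m (ℕₚ.<⇒≤ v<n)))

  -- The arc passes `a` and ends at position `v ℕ.+ len k ∸ n`, which is less than v; so both ends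
  -- lie in the polygon of `t₁`. It is obtained by flipping the radius at `a` in a corner based at
  -- v.
  wrap-saturated : ∀ v k → v < q → n < v ℕ.+ len k → Saturated (F (arc (a ↻ v) k))
  wrap-saturated v k v<q n< with locate2 t₁ (v ℕ.+ len k ∸ n) v ℕ.z≤n w<v (ℕₚ.<⇒≤ v<q)
    where
    w<v : v ℕ.+ len k ∸ n < v
    w<v = ℕₚ.+-cancelʳ-< n _ _ (subst (_< v ℕ.+ n) (sym (ℕₚ.m∸n+n≡m (ℕₚ.<⇒≤ n<))) (ℕₚ.+-monoʳ-< v (len<n k)))
  ... | loc , fst≡ , refl = Sat⇒Saturated (Punctured.Rep-wrap loc (F (arc (a ↻ v) k)) relation₀)
      (around-saturated (+ 2) (Q true loc) (Q false loc) (Q-averages true loc inner₁) (Q-averages false loc inner₁) (Q-supported true loc (proj₁ inner₁)) (Q-supported false loc (proj₁ inner₁)) (Q-relax true loc))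
    where
    w : ℕ
    w = v ℕ.+ len k ∸ n
    w+n : w ℕ.+ n ≡ v ℕ.+ len k
    w+n = ℕₚ.m∸n+n≡m (ℕₚ.<⇒≤ n<)
    v<n : v < n
    v<n = ℕₚ.<-≤-trans v<q q≤n
    0<w : 0 < w
    0<w = ℕₚ.m<n⇒0<n∸m n<
    w<n : w < n
    w<n = ℕₚ.+-cancelʳ-< n _ _ (subst (_< n ℕ.+ n) (sym w+n) (ℕₚ.+-mono-< v<n (len<n k)))
    0<v : 0 < v
    0<v = ℕₚ.n≢0⇒n>0 λ v≡0 → ℕₚ.<⇒≱ n< (subst (λ z → z ℕ.+ len k ≤ n) (sym v≡0) (ℕₚ.<⇒≤ (len<n k)))
    turn : (a ↻ v) ↻ (n ∸ v) ≡ a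
    turn = trans (↻-↻ a v (n ∸ v)) (trans (cong (a ↻_) (ℕₚ.m+[n∸m]≡n (ℕₚ.<⇒≤ v<n))) (↻-n a))
    len≡ : n ∸ v ℕ.+ w ≡ len k
    len≡ = ℕₚ.+-cancelˡ-≡ v _ _ (trans (sym (ℕₚ.+-assoc v (n ∸ v) w)) (trans (cong (ℕ._+ w) (ℕₚ.m+[n∸m]≡n (ℕₚ.<⇒≤ v<n))) (trans (ℕₚ.+-comm n w) w+n)))
    end : (a ↻ v) ↻ (n ∸ v ℕ.+ w) ≡ a ↻ w
    end = trans (sym (↻-↻ (a ↻ v) (n ∸ v) w)) (cong (_↻ w) turn)
    relation₁ : R 0 ⊗ F (arc (a ↻ v) k) ≈ Λ v n ⊗ R w ⊕ Λ 0 w ⊗ R v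
    relation₁ = subst₂ _≈_
      (cong₂ _⊗_ (trans (cong (λ z → val (cl (rad t z))) (trans turn (sym (↻-0 a)))) (sym (Λ-R 0 ℕ.z≤n))) (trans (cong (λ d → val (side (a ↻ v) d)) len≡) (cong val (side-arc (a ↻ v) k))))
      (cong₂ _⊕_ (cong₂ _⊗_ (sym (Λ-regular v n (v<n , ℕₚ.≤-refl , ℕₚ.m<n+m n 0<v))) (trans (cong (λ z → val (cl (rad t z))) end) (sym (Λ-R w (ℕₚ.<⇒≤ w<n)))))
        (cong₂ _⊗_ (trans (cong (λ z → val (side z w)) (trans turn (sym (↻-0 a)))) (sym (Λ-regular 0 w (0<w , ℕₚ.<⇒≤ w<n , w<n)))) (sym (Λ-R v (ℕₚ.<⇒≤ v<n)))))
      (relation-arc t (a ↻ v) (n ∸ v) w (ℕₚ.m<n⇒0<n∸m v<n) 0<w (subst (_< n) (sym len≡) (len<n k)))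
    relation₀ : R 0 ⊗ F (arc (a ↻ v) k) ≈ Λ v n ⊗ R (pos (fst2 loc)) ⊕ Λ 0 (pos (fst2 loc)) ⊗ R v
    relation₀ = subst (λ z → R 0 ⊗ F (arc (a ↻ v) k) ≈ Λ v n ⊗ R z ⊕ Λ 0 z ⊗ R v) (sym fst≡) relation₁

  q-radius : q < n → mem T (rad t (a ↻ q)) ≡ true
  q-radius q<n = trans (sym (select-puncture {x = false} q q≤n)) (proj₂ (proj₂ (proj₂ (proj₂ (proj₂ root)))))

  -- The triangle at the puncture next to the base has its third vertex at position q, which carries
  -- a radius unless q = n. Without radii at the positions from 1 to v, the vertex v lies before q,
  -- as the formulas around the puncture require.
  saturated : ∀ v → v < n → (∀ r → 0 < r → r ≤ v → mem T (rad t (a ↻ r)) ≡ false) →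
    (∀ s → Saturated (F (rad s (a ↻ v)))) × (∀ k → Saturated (F (arc (a ↻ v) k)))
  saturated v v<n no-radii = radii , arcs
    where
    v<q : v < q
    v<q = ℕₚ.≰⇒> λ q≤v → true≢false (trans (sym (q-radius (ℕₚ.≤-<-trans q≤v v<n))) (no-radii q (Tree-< t₁) q≤v))
    radii : ∀ s → Saturated (F (rad s (a ↻ v)))
    radii s with tag-cases s
    ... | inj₁ refl = let (X , rep , sat) = chord-saturated v (suc n) (ℕₚ.m≤n⇒m≤1+n v<n) ℕₚ.≤-refl in Sat⇒Saturated (subst (λ p → Rep p X) (Λ-R v (ℕₚ.<⇒≤ v<n)) rep) sat
    ... | inj₂ s≢t with ≢⇒opposite s≢t | ℕₚ.m≤n⇒m<n∨m≡n (ℕ.z≤n {v})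
    ...   | refl | inj₁ 0<v = notched-saturated v 0<v v<q
    -- At the base itself the other radius is the loop divided by the radius of tag `t`, which is a
    -- variable of the seed.
    ...   | refl | inj₂ refl = subst (λ z → Saturated (F (rad t̄ z))) (sym (↻-0 a))
      (let (X , rep , sat) = chord-saturated 0 n 0<n (ℕₚ.n≤1+n n) in
        Sat⇒Saturated (Rep-÷ (ι (cl (rad t a))) (≈-trans (Rₛ.*-congʳ (≈-sym (val-label (cl (rad t a)) a∈T))) (subst (val (cl (rad t a)) ⊗ F (rad t̄ a) ≈_) (sym Λ-loop) ≈-refl)) rep)
          (Sat-shift (ι (cl (rad t a))) sat))
    arcs : ∀ k → Saturated (F (arc (a ↻ v) k))
    arcs k with v ℕ.+ len k ℕₚ.≤? n
    ... | no h = wrap-saturated v k v<q (ℕₚ.≰⇒> h)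
    ... | yes h = let (X , rep , sat) = chord-saturated v (v ℕ.+ len k) v<e (ℕₚ.m≤n⇒m≤1+n h) in
        Sat⇒Saturated (subst (λ p → Rep p X) (trans (Λ-regular v _ (v<e , h , ℕₚ.+-monoʳ-< v (len<n k))) (cong val (trans (cong (side (a ↻ v)) (ℕₚ.m+n∸m≡n v (len k))) (side-arc (a ↻ v) k)))) rep) sat
      where
      v<e : v < v ℕ.+ len k
      v<e = ℕₚ.m<m+n v (ℕₚ.≤-trans (ℕ.s≤s ℕ.z≤n) (2≤len k))

theorem5p10 : (n : ℕ) → 3 ≤ n → (T : TaggedTriangulation n) → (F : TArc n → LP n)
    → ClusterExpansion T F → (γ : TArc n) → Saturated (F γ)
theorem5p10 n 3≤n T F expansion = λ { (rad s v) → proj₁ (at-vertex v) s ; (arc i k) → proj₂ (at-vertex i) k }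
  where
  open Circle 3≤n
  radius : Radii.Radius 3≤n T
  radius = Radii.radius-exists 3≤n T
  t : Tag
  t = proj₁ radius
  a₀ : Fin n
  a₀ = proj₁ (proj₂ radius)
  Goal : Fin n → Set
  Goal v = (∀ s → Saturated (F (rad s v))) × (∀ k → Saturated (F (arc v k)))
  -- Seen from the last radius before v, there is no radius between the base and v.
  at-vertex : ∀ v → Goal v
  at-vertex v = from-last (last-true is-radius 0 (dist a₀ v) (subst (λ z → mem T (rad t z) ≡ true) (sym (↻-0 a₀)) (proj₂ (proj₂ radius))))
    where
    is-radius : ℕ → Bool
    is-radius p = mem T (rad t (a₀ ↻ p))
    from-last : Σ[ b ∈ ℕ ] (0 ≤ b × b ≤ dist a₀ v × is-radius b ≡ true × (∀ r → b < r → r ≤ dist a₀ v → is-radius r ≡ false)) → Goal v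
    from-last (b , _ , b≤ , b∈T , none) = subst Goal v≡ (Based.saturated 3≤n T F expansion t (a₀ ↻ b) b∈T e e<n λ r 0<r r≤e →
        trans (cong (λ z → mem T (rad t z)) (↻-↻ a₀ b r)) (none (b ℕ.+ r) (ℕₚ.m<m+n b 0<r) (subst (b ℕ.+ r ≤_) b+e (ℕₚ.+-monoʳ-≤ b r≤e))))
      where
      e : ℕ
      e = dist a₀ v ∸ b
      b+e : b ℕ.+ e ≡ dist a₀ v
      b+e = ℕₚ.m+[n∸m]≡n b≤
      e<n : e < n
      e<n = ℕₚ.≤-<-trans (ℕₚ.m∸n≤m (dist a₀ v) b) (dist<n a₀ v)
      v≡ : (a₀ ↻ b) ↻ e ≡ v
      v≡ = trans (↻-↻ a₀ b e) (trans (cong (a₀ ↻_) b+e) (↻-dist a₀ v))
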